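{- For every positive integer $\ell$ there is an integer $d_\ell$ such that every (simple) eulerian graph $G$ with minimum degree at least $d_\ell$ admits an $\ell$-step self-avoiding eulerian tour.
   Context: Graphs are simple and undirected unless said otherwise. A graph is eulerian if it is connected and every vertex has even degree, i.e. it has an eulerian tour (a closed walk using every edge exactly once). Given an eulerian tour $\mathcal{E}$ of a graph, a segment of length $\ell$ of $\mathcal{E}$ is a walk $e_1e_2\dots e_\ell$ in which each $e_i,e_{i+1}$ are consecutive edges of $\mathcal{E}$ (consecutiveness taken cyclically along the closed tour). The tour $\mathcal{E}$ is $\ell$-step self-avoiding if every segment of length at most $\ell$ of $\mathcal{E}$ is a path (has no repeated vertex). -}

module Defs where

open import Data.Bool using (Bool; true; false)
open import Data.Nat using (ℕ; zero; suc; _+_; _≤_; _<_)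
open import Data.Nat.DivMod using (_%_; m%n<n)
open import Data.Nat.Divisibility using (_∣_)
open import Data.Fin using (Fin; toℕ; fromℕ<)
open import Data.List using (List; length; filterᵇ; allFin)
open import Data.Product using (Σ; ∃; _×_; _,_)
open import Data.Sum using (_⊎_)
open import Relation.Binary.PropositionalEquality using (_≡_)
open import Relation.Nullary using (¬_)

record Graph (n : ℕ) : Set where
  field
    adj   : Fin n → Fin n → Bool
    sym   : ∀ a b → adj a b ≡ adj b a
    irrefl : ∀ a → adj a a ≡ false

module _ {n : ℕ} (G : Graph n) where
  open Graph G

  Adj : Fin n → Fin n → Set
  Adj a b = adj a b ≡ true

  degree : Fin n → ℕ
  degree v = length (filterᵇ (adj v) (allFin n))

  data Reach : Fin n → Fin n → Set where
    here : ∀ {a} → Reach a a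
    step : ∀ {a b c} → Adj a b → Reach b c → Reach a c

  Connected : Set
  Connected = ∀ a b → Reach a b

  Eulerian : Set
  Eulerian = Connected × (∀ v → 2 ∣ degree v)

  MinDegreeAtLeast : ℕ → Set
  MinDegreeAtLeast d = ∀ v → d ≤ degree v

  HasNoEdges : Set
  HasNoEdges = ∀ a b → ¬ Adj a b

pos : (k : ℕ) → ℕ → Fin (suc k)
pos k j = fromℕ< (m%n<n j (suc k))

-- A nonempty closed walk with m = suc k edges is given by its vertex
-- sequence v₀,…,v_{m-1}; edge number i joins v_i and v_{(i+1) mod m}.
module _ {n : ℕ} (G : Graph n) {k : ℕ} (v : Fin (suc k) → Fin n) where

  vtx : ℕ → Fin n
  vtx j = v (pos k j)

  EdgeIs : Fin (suc k) → Fin n → Fin n → Set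
  EdgeIs i a b = (vtx (toℕ i) ≡ a × vtx (suc (toℕ i)) ≡ b)
               ⊎ (vtx (toℕ i) ≡ b × vtx (suc (toℕ i)) ≡ a)

  IsEulerianTour : Set
  IsEulerianTour =
      (∀ (i : Fin (suc k)) → Adj G (vtx (toℕ i)) (vtx (suc (toℕ i))))
    × (∀ a b → Adj G a b → ∃ λ i → EdgeIs i a b)
    × (∀ a b i j → EdgeIs i a b → EdgeIs j a b → i ≡ j)

  SegmentIsPath : ℕ → ℕ → Set
  SegmentIsPath i len =
    ∀ s t → s ≤ len → t ≤ len → vtx (i + s) ≡ vtx (i + t) → s ≡ t

  SelfAvoiding : ℕ → Set
  SelfAvoiding ℓ = ∀ (i : ℕ) len → len ≤ ℓ → SegmentIsPath i len

-- G admits an ℓ-step self-avoiding eulerian tour.  If G has no edges the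
-- only eulerian tour is the trivial closed walk with no edges, whose only
-- segment has length 0 and is trivially a path.
HasSelfAvoidingEulerianTour : {n : ℕ} → Graph n → ℕ → Set
HasSelfAvoidingEulerianTour {n} G ℓ =
    HasNoEdges G
  ⊎ Σ ℕ (λ k → Σ (Fin (suc k) → Fin n) (λ v →
      IsEulerianTour G v × SelfAvoiding G v ℓ))

{-# OPTIONS --safe #-}
module Submission where

-- The edges of G are glued into a "path graph" H on the same vertices: every edge of H is a path
-- of G and the paths partition E(G).  The ends of paths at a vertex are divided into groups of
-- bounded size, and H is kept such that, for every group and every vertex p off the group, only
-- few paths of the group pass through p.
--
-- A stage lengthens paths.  Orient H as an eulerian digraph that is balanced in every group, and
-- fix a spanning arborescence; it uses at most one arc into each vertex, so a constant proportion
-- of every group may be changed without disconnecting H.  A part of these arcs is joined in pairs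
-- at their heads.  For each group there are many disjoint conflict-free perfect matchings, and the
-- local lemma (in a counting form, with bounded dependencies because groups are bounded) picks one
-- for each group such that conflicts stay few.  Iterating, the short paths become a negligible
-- proportion at every vertex while H stays connected.
--
-- Finally take an eulerian tour of H.  Reversing a segment between two visits of the same vertex
-- changes two transitions and keeps the tour connected; as almost all paths at a vertex are long
-- and avoid a given short list of vertices, bad transitions can be removed one after the other.

open import Defs
open import Data.Nat using (ℕ; _≤_)
open import Data.Product using (Σ)
open import Data.Bool using (Bool; true; false)
open import Data.Empty using (⊥; ⊥-elim)
open import Data.Fin using (Fin; zero; suc; toℕ; fromℕ<)
import Data.Fin.Properties as FinP
open import Data.List using (List; []; _∷_; _++_; map; concatMap; length; allFin; filter; filterᵇ; reverse; lookup; tabulate; take)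
open import Data.List.Membership.Propositional using (_∈_; find)
open import Data.List.Membership.Propositional.Properties using (∈-∃++; ∈-++⁺ˡ; ∈-++⁺ʳ; ∈-++⁻; ∈-allFin; ∈-map⁺; ∈-map⁻; ∈-lookup; ∈-concatMap⁺)
open import Data.List.Properties using (length-map; length-tabulate; length-++; ++-assoc; ++-identityʳ; tabulate-lookup; map-tabulate; ∷-injective; ∷ʳ-injective; unfold-reverse; reverse-++)
open import Data.List.Relation.Binary.Permutation.Propositional using (_↭_; ↭-sym; ↭-trans; ↭-refl; ↭-reflexive; prep; swap)
import Data.List.Relation.Binary.Permutation.Propositional as Perm
open import Data.List.Relation.Binary.Permutation.Propositional.Properties using (shift; ++-comm; ++⁺ˡ; ++⁺ʳ; map⁺; All-resp-↭; ↭-reverse; ∷↭∷ʳ; ↭-length)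
open import Data.List.Relation.Unary.All using (All; []; _∷_)
import Data.List.Relation.Unary.All as All
import Data.List.Relation.Unary.All.Properties as AllP
open import Data.List.Relation.Unary.AllPairs using ([]; _∷_)
open import Data.List.Relation.Unary.Any using (here; there)
import Data.List.Relation.Unary.Any as Any
open import Data.List.Relation.Unary.Any.Properties using (lookup-index)
open import Data.List.Relation.Unary.Unique.Propositional using (Unique)
open import Data.List.Relation.Unary.Unique.Propositional.Properties using (allFin⁺)
open import Data.Maybe using (Maybe; just; nothing)
open import Data.Nat using (zero; suc; _+_; _*_; _∸_; _^_; _<_; z≤n; s≤s; NonZero; >-nonZero; _≟_; _≤?_; _<?_)
open import Data.Nat.DivMod using (_%_; m%n<n; m<n⇒m%n≡m; n%n≡0; [m+n]%n≡m%n; %-distribˡ-+)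
open import Data.Nat.Divisibility using (_∣_; divides; ∣m+n∣m⇒∣n; m∣m*n)
open import Data.Nat.Properties hiding (_≟_)
open import Data.Nat.Tactic.RingSolver using (solve-∀)
open import Data.Product using (∃; _×_; _,_; proj₁; proj₂)
import Data.Product.Properties as ProdP
open import Data.Sum using (_⊎_; inj₁; inj₂)
import Data.Sum.Properties as SumP
open import Data.Unit using (⊤; tt)
import Data.Unit.Properties as UnitP
open import Data.Vec using (Vec; []; _∷_; _[_]≔_) renaming (lookup to vlookup)
open import Data.Vec.Properties using (lookup∘update′)
open import Function using (_∘_; id; case_of_)
open import Relation.Binary.Definitions using (DecidableEquality; tri<; tri≈; tri>)
open import Relation.Binary.PropositionalEquality using (_≡_; _≢_; refl; sym; trans; cong; cong₂; subst; subst₂; module ≡-Reasoning)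
open import Relation.Nullary using (¬_; Dec; yes; no)

-- Joining at heads has a purpose: an arc has one head, so it takes part in at most one join, and a
-- stage at most doubles interior lengths, plus one. The danger is that the vertices of a partner
-- become new conflicts for the group of the tail. The parameters look circular: the number `r` of
-- hits to be tolerated depends on the group size, the conflict bound `M` grows by the factor
-- `1 + r` per stage, and groups must stay much larger than `M`. The way out is that the number of
-- stages depends on `ℓ` alone, and that group sizes are exponential in a parameter `w` in which
-- `r`, and hence `M`, is only polynomial. Progress is measured by levels: an end of level `i`
-- belongs to a path with at least `i` interior vertices. A stage treats one level and changes only
-- a constant proportion of each of its groups, so a level is emptied, up to a negligible rest, by a
-- phase of many stages before the next level is treated.

private variable
  A B : Set

-- Finite sums


-- Certificates for linear arithmetic: the hypotheses are combined with suitable multipliers into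
-- one `l ≤ r`, the slack left over is `z`, and what remains is a polynomial identity for the ring
-- solver.
≤-of-slack : ∀ {l r g h} z → l ≤ r → g + r + z ≡ h + l → g ≤ h
≤-of-slack {l} {r} {g} {h} z l≤r eq = +-cancelʳ-≤ r g h (begin
  g + r       ≤⟨ m≤m+n (g + r) z ⟩
  g + r + z   ≡⟨ eq ⟩
  h + l       ≤⟨ +-monoʳ-≤ h l≤r ⟩
  h + r       ∎)
  where open ≤-Reasoning

∑ : (A → ℕ) → List A → ℕ
∑ f []       = 0
∑ f (x ∷ xs) = f x + ∑ f xs

ind : {P : Set} → Dec P → ℕ
ind (yes _) = 1
ind (no _)  = 0

sg : ℕ → ℕ
sg zero    = 0
sg (suc _) = 1

sg≤ : ∀ n → sg n ≤ n
sg≤ zero    = z≤n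
sg≤ (suc n) = s≤s z≤n

ind≤1 : {P : Set} (d : Dec P) → ind d ≤ 1
ind≤1 (yes _) = ≤-refl
ind≤1 (no _)  = z≤n

ind-yes : {P : Set} (d : Dec P) → P → ind d ≡ 1
ind-yes (yes _) p = refl
ind-yes (no ¬p) p = ⊥-elim (¬p p)

ind-no : {P : Set} (d : Dec P) → ¬ P → ind d ≡ 0
ind-no (yes p) ¬p = ⊥-elim (¬p p)
ind-no (no _)  ¬p = refl

ind-pos : {P : Set} (d : Dec P) → 0 < ind d → P
ind-pos (yes p) _ = p
ind-pos (no _) ()

ind-cong : {P Q : Set} (d : Dec P) (e : Dec Q) → (P → Q) → (Q → P) → ind d ≡ ind e
ind-cong (yes p) e f g = sym (ind-yes e (f p))
ind-cong (no ¬p) e f g = sym (ind-no e (¬p ∘ g))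

*-pos : ∀ a b → 0 < a * b → 0 < a × 0 < b
*-pos zero    b       ()
*-pos (suc a) zero    lt = ⊥-elim (<-irrefl refl (subst (0 <_) (*-zeroʳ (suc a)) lt))
*-pos (suc a) (suc b) _  = s≤s z≤n , s≤s z≤n

+-pos : ∀ a b → 0 < a + b → 0 < a ⊎ 0 < b
+-pos zero    b lt = inj₂ lt
+-pos (suc a) b _  = inj₁ (s≤s z≤n)

≤0⇒≡0 : ∀ {n} → n ≤ 0 → n ≡ 0
≤0⇒≡0 z≤n = refl

¬pos⇒≡0 : ∀ n → ¬ (0 < n) → n ≡ 0
¬pos⇒≡0 zero    _ = refl
¬pos⇒≡0 (suc n) h = ⊥-elim (h (s≤s z≤n))

∑-++ : (f : A → ℕ) (xs ys : List A) → ∑ f (xs ++ ys) ≡ ∑ f xs + ∑ f ys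
∑-++ f []       ys = refl
∑-++ f (x ∷ xs) ys = trans (cong (f x +_) (∑-++ f xs ys)) (sym (+-assoc (f x) _ _))

∑-cong : {f g : A → ℕ} → (∀ x → f x ≡ g x) → ∀ xs → ∑ f xs ≡ ∑ g xs
∑-cong h []       = refl
∑-cong h (x ∷ xs) = cong₂ _+_ (h x) (∑-cong h xs)

∑-cong-All : {f g : A → ℕ} {xs : List A} → All (λ x → f x ≡ g x) xs → ∑ f xs ≡ ∑ g xs
∑-cong-All []       = refl
∑-cong-All (h ∷ hs) = cong₂ _+_ h (∑-cong-All hs)

∑-mono-All : {f g : A → ℕ} {xs : List A} → All (λ x → f x ≤ g x) xs → ∑ f xs ≤ ∑ g xs
∑-mono-All []       = z≤n
∑-mono-All (h ∷ hs) = +-mono-≤ h (∑-mono-All hs)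

∑-mono : {f g : A → ℕ} → (∀ x → f x ≤ g x) → ∀ xs → ∑ f xs ≤ ∑ g xs
∑-mono h []       = z≤n
∑-mono h (x ∷ xs) = +-mono-≤ (h x) (∑-mono h xs)

∑-zero : (xs : List A) → ∑ (λ _ → 0) xs ≡ 0
∑-zero []       = refl
∑-zero (x ∷ xs) = ∑-zero xs

∑-zero-All : {f : A → ℕ} {xs : List A} → All (λ x → f x ≡ 0) xs → ∑ f xs ≡ 0
∑-zero-All {xs = xs} hs = trans (∑-cong-All hs) (∑-zero xs)

∑-const : ∀ c (xs : List A) → ∑ (λ _ → c) xs ≡ length xs * c
∑-const c []       = refl
∑-const c (x ∷ xs) = cong (c +_) (∑-const c xs)

∑-≤-length : {f : A → ℕ} {xs : List A} {c : ℕ} → All (λ x → f x ≤ c) xs → ∑ f xs ≤ length xs * c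
∑-≤-length {xs = xs} hs = ≤-trans (∑-mono-All hs) (≤-reflexive (∑-const _ xs))

∑-+ : (f g : A → ℕ) (xs : List A) → ∑ (λ x → f x + g x) xs ≡ ∑ f xs + ∑ g xs
∑-+ f g []       = refl
∑-+ f g (x ∷ xs) rewrite ∑-+ f g xs = interchange (f x) (g x) (∑ f xs) (∑ g xs)
  where
  interchange : ∀ a b c d → a + b + (c + d) ≡ a + c + (b + d)
  interchange = solve-∀

∑-*ˡ : ∀ c (f : A → ℕ) (xs : List A) → ∑ (λ x → c * f x) xs ≡ c * ∑ f xs
∑-*ˡ c f []       = sym (*-zeroʳ c)
∑-*ˡ c f (x ∷ xs) = trans (cong (c * f x +_) (∑-*ˡ c f xs)) (sym (*-distribˡ-+ c (f x) _))

∑-*ʳ : ∀ c (f : A → ℕ) (xs : List A) → ∑ (λ x → f x * c) xs ≡ ∑ f xs * c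
∑-*ʳ c f xs = trans (∑-cong (λ x → *-comm (f x) c) xs) (trans (∑-*ˡ c f xs) (*-comm c _))

∑-swap : (f : A → B → ℕ) (xs : List A) (ys : List B) →
         ∑ (λ x → ∑ (f x) ys) xs ≡ ∑ (λ y → ∑ (λ x → f x y) xs) ys
∑-swap f []       ys = sym (∑-zero ys)
∑-swap f (x ∷ xs) ys = trans (cong (∑ (f x) ys +_) (∑-swap f xs ys)) (sym (∑-+ (f x) _ ys))

∑-map : (f : B → ℕ) (g : A → B) (xs : List A) → ∑ f (map g xs) ≡ ∑ (f ∘ g) xs
∑-map f g []       = refl
∑-map f g (x ∷ xs) = cong (f (g x) +_) (∑-map f g xs)

∑-concatMap : (f : B → ℕ) (g : A → List B) (xs : List A) → ∑ f (concatMap g xs) ≡ ∑ (λ x → ∑ f (g x)) xs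
∑-concatMap f g []       = refl
∑-concatMap f g (x ∷ xs) = trans (∑-++ f (g x) _) (cong (∑ f (g x) +_) (∑-concatMap f g xs))

∑-↭ : (f : A → ℕ) {xs ys : List A} → xs ↭ ys → ∑ f xs ≡ ∑ f ys
∑-↭ f Perm.refl          = refl
∑-↭ f (Perm.prep x p)    = cong (f x +_) (∑-↭ f p)
∑-↭ f (Perm.swap x y p)  = trans (cong (λ z → f x + (f y + z)) (∑-↭ f p)) (exchange (f x) (f y) _)
  where
  exchange : ∀ a b c → a + (b + c) ≡ b + (a + c)
  exchange = solve-∀
∑-↭ f (Perm.trans p q)   = trans (∑-↭ f p) (∑-↭ f q)

∑-∈ : (f : A → ℕ) {x : A} {xs : List A} → x ∈ xs → f x ≤ ∑ f xs
∑-∈ f (here refl) = m≤m+n _ _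
∑-∈ f (there p)   = ≤-trans (∑-∈ f p) (m≤n+m _ _)

∑-<-find : (f g : A → ℕ) (xs : List A) → ∑ f xs < ∑ g xs → ∃ λ x → x ∈ xs × f x < g x
∑-<-find f g [] ()
∑-<-find f g (x ∷ xs) lt with f x <? g x
... | yes p = x , here refl , p
... | no ¬p with ∑-<-find f g xs (+-cancelˡ-< (g x) _ _ (<-≤-trans (s≤s (+-monoˡ-≤ _ (≮⇒≥ ¬p))) lt))
...   | y , y∈ , q = y , there y∈ , q

∑-pos-find : (f : A → ℕ) (xs : List A) → 0 < ∑ f xs → ∃ λ x → x ∈ xs × 0 < f x
∑-pos-find f xs lt = ∑-<-find (λ _ → 0) f xs (subst (_< ∑ f xs) (sym (∑-zero xs)) lt)

∑-zero⁻ : (f : A → ℕ) {xs : List A} → ∑ f xs ≡ 0 → All (λ x → f x ≡ 0) xs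
∑-zero⁻ f {[]}     h = []
∑-zero⁻ f {x ∷ xs} h = m+n≡0⇒m≡0 (f x) h ∷ ∑-zero⁻ f (m+n≡0⇒n≡0 (f x) h)

∑-ones : (xs : List A) → ∑ (λ _ → 1) xs ≡ length xs
∑-ones xs = trans (∑-const 1 xs) (*-identityʳ _)

∑-product : (f : A → ℕ) (g : B → ℕ) (xs : List A) (ys : List B) →
            ∑ (λ x → ∑ (λ y → f x * g y) ys) xs ≡ ∑ f xs * ∑ g ys
∑-product f g xs ys = trans (∑-cong (λ x → ∑-*ˡ (f x) g ys) xs) (∑-*ʳ (∑ g ys) f xs)

∑-filter-split : {P : A → Set} (P? : ∀ x → Dec (P x)) (f : A → ℕ) (xs : List A) →
                 ∑ f (filter P? xs) ≡ ∑ (λ x → ind (P? x) * f x) xs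
∑-filter-split P? f [] = refl
∑-filter-split P? f (x ∷ xs) with P? x
... | yes _ = cong₂ _+_ (sym (+-identityʳ (f x))) (∑-filter-split P? f xs)
... | no _  = ∑-filter-split P? f xs

partition-↭ : {P : A → Set} (P? : ∀ x → Dec (P x)) (xs : List A) →
              Σ (List A) λ ys → Σ (List A) λ zs → xs ↭ ys ++ zs × All P ys × All (¬_ ∘ P) zs
partition-↭ P? [] = [] , [] , ↭-refl , [] , []
partition-↭ P? (x ∷ xs) with P? x | partition-↭ P? xs
... | yes p | ys , zs , perm , py , pz = x ∷ ys , zs , prep x perm , p ∷ py , pz
... | no ¬p | ys , zs , perm , py , pz = ys , x ∷ zs , ↭-trans (prep x perm) (↭-sym (shift x ys zs)) , py , ¬p ∷ pz

module Distinct {L : Set} (_≟_ : DecidableEquality L) where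

  eq : L → L → ℕ
  eq a b = ind (a ≟ b)

  eq-refl : ∀ a → eq a a ≡ 1
  eq-refl a = ind-yes (a ≟ a) refl

  eq-sym : ∀ a b → eq a b ≡ eq b a
  eq-sym a b = ind-cong (a ≟ b) (b ≟ a) sym sym

  distinct : List L → List L
  distinct [] = []
  distinct (x ∷ xs) with ∑ (λ a → eq a x) (distinct xs)
  ... | zero  = x ∷ distinct xs
  ... | suc _ = distinct xs

  distinct-≤1 : ∀ xs l → ∑ (λ a → eq a l) (distinct xs) ≤ 1
  distinct-≤1 [] l = z≤n
  distinct-≤1 (x ∷ xs) l with ∑ (λ a → eq a x) (distinct xs) in e
  ... | suc _ = distinct-≤1 xs l
  ... | zero with x ≟ l
  ...   | yes refl = s≤s (≤-reflexive e)
  ...   | no _     = distinct-≤1 xs l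

  distinct-≥1 : ∀ xs {l} → l ∈ xs → 1 ≤ ∑ (λ a → eq a l) (distinct xs)
  distinct-≥1 (x ∷ xs) l∈ with ∑ (λ a → eq a x) (distinct xs) in e
  distinct-≥1 (x ∷ xs) (here refl) | suc _ rewrite e = s≤s z≤n
  distinct-≥1 (x ∷ xs) (there l∈)  | suc _ = distinct-≥1 xs l∈
  distinct-≥1 (x ∷ xs) (here refl) | zero = ≤-trans (≤-reflexive (sym (eq-refl x))) (m≤m+n _ _)
  distinct-≥1 (x ∷ xs) (there l∈)  | zero = ≤-trans (distinct-≥1 xs l∈) (m≤n+m _ _)

  distinct-≡1 : ∀ xs {l} → l ∈ xs → ∑ (λ a → eq a l) (distinct xs) ≡ 1
  distinct-≡1 xs l∈ = ≤-antisym (distinct-≤1 xs _) (distinct-≥1 xs l∈)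

  eq-* : ∀ (f : L → ℕ) a b → eq a b * f a ≡ eq a b * f b
  eq-* f a b with a ≟ b
  ... | yes refl = refl
  ... | no _     = refl

  -- Sum the hypothesis over the labels that occur in `X`: every `x` is then counted exactly once
  -- and every `y` at most once. In this way bounds for single groups become bounds for whole
  -- vertices.
  fibrewise-ratio : (p q : ℕ) (X : List A) (ℓX : A → L) (wX : A → ℕ)
                    (Y : List B) (ℓY : B → L) (wY : B → ℕ) →
                    (∀ a → p * ∑ (λ x → eq a (ℓX x) * wX x) X ≤ q * ∑ (λ y → eq a (ℓY y) * wY y) Y) →
                    p * ∑ wX X ≤ q * ∑ wY Y
  fibrewise-ratio p q X ℓX wX Y ℓY wY h = begin
    p * ∑ wX X                                                  ≡⟨ cong (p *_) (sym lhs) ⟩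
    p * ∑ (λ a → ∑ (λ x → eq a (ℓX x) * wX x) X) Λ              ≡⟨ sym (∑-*ˡ p _ Λ) ⟩
    ∑ (λ a → p * ∑ (λ x → eq a (ℓX x) * wX x) X) Λ              ≤⟨ ∑-mono h Λ ⟩
    ∑ (λ a → q * ∑ (λ y → eq a (ℓY y) * wY y) Y) Λ              ≡⟨ ∑-*ˡ q _ Λ ⟩
    q * ∑ (λ a → ∑ (λ y → eq a (ℓY y) * wY y) Y) Λ              ≤⟨ *-monoʳ-≤ q rhs ⟩
    q * ∑ wY Y                                                  ∎
    where
    open ≤-Reasoning
    Λ = distinct (map ℓX X)
    lhs : ∑ (λ a → ∑ (λ x → eq a (ℓX x) * wX x) X) Λ ≡ ∑ wX X
    lhs = trans (∑-swap _ Λ X) (∑-cong-All (All.tabulate (λ {x} x∈ →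
      trans (∑-*ʳ (wX x) _ Λ) (trans (cong (_* wX x) (distinct-≡1 (map ℓX X) (∈-map⁺ ℓX x∈))) (*-identityˡ _)))))
    rhs : ∑ (λ a → ∑ (λ y → eq a (ℓY y) * wY y) Y) Λ ≤ ∑ wY Y
    rhs = ≤-trans (≤-reflexive (∑-swap _ Λ Y)) (∑-mono (λ y →
      ≤-trans (≤-reflexive (∑-*ʳ (wY y) _ Λ)) (≤-trans (*-monoˡ-≤ (wY y) (distinct-≤1 (map ℓX X) (ℓY y))) (≤-reflexive (*-identityˡ _)))) Y)

∑-allFin-suc : ∀ {n} (f : Fin (suc n) → ℕ) → ∑ f (allFin (suc n)) ≡ f zero + ∑ (f ∘ suc) (allFin n)
∑-allFin-suc {n} f = cong (f zero +_) (trans (cong (∑ f) (tab n suc)) (∑-map f suc (allFin n)))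
  where
  tab : ∀ k (g : Fin k → Fin (suc n)) → tabulate g ≡ map g (allFin k)
  tab k g = sym (map-tabulate id g)

∑-eq-Fin : ∀ {n} (q : Fin n) → ∑ (λ p → ind (p FinP.≟ q)) (allFin n) ≡ 1
∑-eq-Fin {suc n} zero = trans (∑-allFin-suc {n} (λ p → ind (p FinP.≟ zero))) (cong suc (∑-zero (allFin n)))
∑-eq-Fin {suc n} (suc q) = trans (∑-allFin-suc {n} (λ p → ind (p FinP.≟ suc q)))
  (trans (∑-cong (λ p → ind-cong (suc p FinP.≟ suc q) (p FinP.≟ q) FinP.suc-injective (cong suc)) (allFin n)) (∑-eq-Fin q))

-- Counting form of the local lemma

binom : ℕ → ℕ → ℕ
binom n       zero    = 1
binom zero    (suc r) = 0
binom (suc n) (suc r) = binom n r + binom n (suc r)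

binom-monoˡ : ∀ {n k} r → n ≤ k → binom n r ≤ binom k r
binom-monoˡ zero    _         = ≤-refl
binom-monoˡ (suc r) z≤n       = z≤n
binom-monoˡ (suc r) (s≤s n≤k) = +-mono-≤ (binom-monoˡ r n≤k) (binom-monoˡ (suc r) n≤k)

fact : ℕ → ℕ
fact zero    = 1
fact (suc n) = suc n * fact n

private
  bernoulli : ∀ n r → n ^ suc r + suc r * n ^ r ≤ suc n ^ suc r
  bernoulli n zero    = ≤-reflexive (lemma n)
    where
    lemma : ∀ n → n * 1 + 1 ≡ suc n * 1
    lemma = solve-∀
  bernoulli n (suc r) = ≤-of-slack (suc r * n ^ r) (*-monoʳ-≤ (suc n) (bernoulli n r)) (lemma n r (n ^ r) (suc n ^ suc r))
    where
    lemma : ∀ n r x y → n * (n * x) + suc (suc r) * (n * x) + suc n * y + suc r * x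
                      ≡ suc n * y + suc n * (n * x + suc r * x)
    lemma = solve-∀

-- Induction along Pascal's rule; the step is Bernoulli's inequality, that is, the first two terms
-- in the expansion of `suc n ^ suc r`.
fact*binom≤ : ∀ n r → fact r * binom n r ≤ n ^ r
fact*binom≤ n       zero    = ≤-refl
fact*binom≤ zero    (suc r) = ≤-reflexive (*-zeroʳ (fact (suc r)))
fact*binom≤ (suc n) (suc r) = begin
  suc r * fact r * (binom n r + binom n (suc r))             ≡⟨ lemma r (fact r) (binom n r) (binom n (suc r)) ⟩
  suc r * (fact r * binom n r) + suc r * fact r * binom n (suc r) ≤⟨ +-mono-≤ (*-monoʳ-≤ (suc r) (fact*binom≤ n r)) (fact*binom≤ n (suc r)) ⟩
  suc r * n ^ r + n ^ suc r                                  ≡⟨ +-comm (suc r * n ^ r) _ ⟩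
  n ^ suc r + suc r * n ^ r                                  ≤⟨ bernoulli n r ⟩
  suc n ^ suc r                                              ∎
  where
  open ≤-Reasoning
  lemma : ∀ r f a b → suc r * f * (a + b) ≡ suc r * (f * a) + suc r * f * b
  lemma = solve-∀

∑-Unique≤ : ∀ {V} (f : Fin V → ℕ) {S : List (Fin V)} → Unique S → ∑ f S ≤ ∑ f (allFin V)
∑-Unique≤ {V} f {S} uniq = begin
  ∑ f S                                                  ≡⟨ ∑-cong (λ q → sym (point q)) S ⟩
  ∑ (λ q → ∑ (λ p → eq p q * f p) (allFin V)) S          ≡⟨ ∑-swap _ S (allFin V) ⟩
  ∑ (λ p → ∑ (λ q → eq p q * f p) S) (allFin V)          ≤⟨ ∑-mono (λ p → ≤-trans (≤-reflexive (∑-*ʳ (f p) _ S)) (*-monoˡ-≤ (f p) (once p uniq))) (allFin V) ⟩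
  ∑ (λ p → 1 * f p) (allFin V)                           ≡⟨ ∑-cong (λ p → *-identityˡ (f p)) (allFin V) ⟩
  ∑ f (allFin V)                                         ∎
  where
  open ≤-Reasoning
  open Distinct (FinP._≟_ {V})
  point : ∀ q → ∑ (λ p → eq p q * f p) (allFin V) ≡ f q
  point q = trans (∑-cong (λ p → eq-* f p q) (allFin V)) (trans (∑-*ʳ (f q) _ (allFin V)) (trans (cong (_* f q) (∑-eq-Fin q)) (*-identityˡ _)))
  absent : ∀ p {S} → All (p ≢_) S → ∑ (λ q → eq p q) S ≡ 0
  absent p h = ∑-zero-All (All.map (λ {q} p≢q → ind-no (p FinP.≟ q) p≢q) h)
  once : ∀ p {S} → Unique S → ∑ (λ q → eq p q) S ≤ 1
  once p {[]}    []       = z≤n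
  once p {q ∷ S} (h ∷ hs) with p FinP.≟ q
  ... | yes refl = s≤s (≤-reflexive (absent p h))
  ... | no _     = once p hs

module _ {m : ℕ} where

  -- An expectation over uniform independent choices, not divided by the number `m ^ V` of
  -- assignments, so that probabilities become counts.
  𝔼 : ∀ V → (Vec (Fin m) V → ℕ) → ℕ
  𝔼 zero    f = f []
  𝔼 (suc V) f = ∑ (λ o → 𝔼 V (λ v → f (o ∷ v))) (allFin m)

  𝔼-mono : ∀ V {f g : Vec (Fin m) V → ℕ} → (∀ v → f v ≤ g v) → 𝔼 V f ≤ 𝔼 V g
  𝔼-mono zero    h = h []
  𝔼-mono (suc V) h = ∑-mono (λ o → 𝔼-mono V (λ v → h (o ∷ v))) (allFin m)

  𝔼-cong : ∀ V {f g : Vec (Fin m) V → ℕ} → (∀ v → f v ≡ g v) → 𝔼 V f ≡ 𝔼 V g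
  𝔼-cong zero    h = h []
  𝔼-cong (suc V) h = ∑-cong (λ o → 𝔼-cong V (λ v → h (o ∷ v))) (allFin m)

  𝔼-+ : ∀ V (f g : Vec (Fin m) V → ℕ) → 𝔼 V (λ v → f v + g v) ≡ 𝔼 V f + 𝔼 V g
  𝔼-+ zero    f g = refl
  𝔼-+ (suc V) f g = trans (∑-cong (λ o → 𝔼-+ V _ _) (allFin m)) (∑-+ _ _ (allFin m))

  𝔼-zero : ∀ V → 𝔼 V (λ _ → 0) ≡ 0
  𝔼-zero zero    = refl
  𝔼-zero (suc V) = trans (∑-cong (λ _ → 𝔼-zero V) (allFin m)) (∑-zero (allFin m))

  𝔼-∑ : ∀ V {C : Set} (f : C → Vec (Fin m) V → ℕ) (cs : List C) → 𝔼 V (λ v → ∑ (λ c → f c v) cs) ≡ ∑ (λ c → 𝔼 V (f c)) cs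
  𝔼-∑ V f []       = 𝔼-zero V
  𝔼-∑ V f (c ∷ cs) = trans (𝔼-+ V (f c) _) (cong (𝔼 V (f c) +_) (𝔼-∑ V f cs))

  𝔼-find : ∀ V (f : Vec (Fin m) V → ℕ) → 0 < 𝔼 V f → ∃ λ v → 0 < f v
  𝔼-find zero    f lt = [] , lt
  𝔼-find (suc V) f lt with ∑-pos-find _ (allFin m) lt
  ... | o , _ , lt' with 𝔼-find V _ lt'
  ...   | v , q = o ∷ v , q

  length-allFin : length (allFin m) ≡ m
  length-allFin = length-tabulate (λ (i : Fin m) → i)

  𝔼-one-pos : ∀ V → 0 < m → 0 < 𝔼 V (λ _ → 1)
  𝔼-one-pos zero    _   = s≤s z≤n
  𝔼-one-pos (suc V) m>0 = ≤-trans (*-mono-≤ m>0 (𝔼-one-pos V m>0))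
    (≤-reflexive (sym (trans (∑-const _ (allFin m)) (cong (_* 𝔼 V (λ _ → 1)) length-allFin))))

  -- Independence of the coordinate `h` from a function that ignores it; the factor `m` clears the
  -- denominator of the mean of `g`.
  𝔼-indep : ∀ {V} (h : Fin V) (g : Fin m → ℕ) (X : Vec (Fin m) V → ℕ) → (∀ v o → X (v [ h ]≔ o) ≡ X v) →
            m * 𝔼 V (λ v → g (vlookup v h) * X v) ≡ ∑ g (allFin m) * 𝔼 V X
  𝔼-indep {suc V} zero g X inv = begin
    m * ∑ (λ o → 𝔼 V (λ v → g o * X (o ∷ v))) (allFin m)     ≡⟨ cong (m *_) (∑-cong (λ o → 𝔼-scale (g o) (λ v → X (o ∷ v))) (allFin m)) ⟩
    m * ∑ (λ o → g o * e o) (allFin m)                        ≡⟨ cong (_* ∑ (λ o → g o * e o) (allFin m)) (sym length-allFin) ⟩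
    length (allFin m) * ∑ (λ o → g o * e o) (allFin m)        ≡⟨ sym (∑-const _ (allFin m)) ⟩
    -- By invariance `e` is constant, so the dummy index that stands for the factor `m` may take
    -- over its argument, and the double sum factors.
    ∑ (λ o' → ∑ (λ o → g o * e o) (allFin m)) (allFin m)      ≡⟨ ∑-cong (λ o' → ∑-cong (λ o → cong (g o *_) (𝔼-cong V (λ v → trans (sym (inv (o ∷ v) o')) refl))) (allFin m)) (allFin m) ⟩
    ∑ (λ o' → ∑ (λ o → g o * e o') (allFin m)) (allFin m)     ≡⟨ ∑-swap _ (allFin m) (allFin m) ⟩
    ∑ (λ o → ∑ (λ o' → g o * e o') (allFin m)) (allFin m)     ≡⟨ ∑-product g e (allFin m) (allFin m) ⟩
    ∑ g (allFin m) * ∑ e (allFin m)                           ∎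
    where
    open ≡-Reasoning
    e : Fin m → ℕ
    e o = 𝔼 V (λ v → X (o ∷ v))
    𝔼-scale : ∀ {V} c (f : Vec (Fin m) V → ℕ) → 𝔼 V (λ v → c * f v) ≡ c * 𝔼 V f
    𝔼-scale {zero}  c f = refl
    𝔼-scale {suc V} c f = trans (∑-cong (λ o → 𝔼-scale c (λ v → f (o ∷ v))) (allFin m)) (∑-*ˡ c (λ o → 𝔼 V (λ v → f (o ∷ v))) (allFin m))
  𝔼-indep {suc V} (suc h) g X inv = begin
    m * ∑ (λ o → 𝔼 V (λ v → g (vlookup v h) * X (o ∷ v))) (allFin m)     ≡⟨ sym (∑-*ˡ m _ (allFin m)) ⟩
    ∑ (λ o → m * 𝔼 V (λ v → g (vlookup v h) * X (o ∷ v))) (allFin m)     ≡⟨ ∑-cong (λ o → 𝔼-indep h g (λ v → X (o ∷ v)) (λ v o' → inv (o ∷ v) o')) (allFin m) ⟩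
    ∑ (λ o → ∑ g (allFin m) * 𝔼 V (λ v → X (o ∷ v))) (allFin m)          ≡⟨ ∑-*ˡ (∑ g (allFin m)) (λ o → 𝔼 V (λ v → X (o ∷ v))) (allFin m) ⟩
    ∑ g (allFin m) * ∑ (λ o → 𝔼 V (λ v → X (o ∷ v))) (allFin m)          ∎
    where open ≡-Reasoning

-- One of `m` options is chosen for each of `V` variables, and option `o` of `h` hits `c` if
-- `ν c h o` is positive. No constraint shall be hit by more than `r` variables. In place of
-- conditional probabilities the number of fine assignments is followed while the variables enter
-- one at a time, as in Rosenfeld's counting argument: a new variable destroys at most half of them.
module LocalLemma {C : Set} (m V r B K D : ℕ) (m>0 : 0 < m) (cs : List C)
  (ν : C → Fin V → Fin m → ℕ) (σ : C → Fin V → ℕ)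
  (optionBound : ∀ c h → ∑ (ν c h) (allFin m) ≤ B)
  (support : ∀ c h o → σ c h ≡ 0 → ν c h o ≡ 0)
  (supportBound : ∀ c → ∑ (σ c) (allFin V) ≤ K)
  (constraintBound : ∀ h o → ∑ (λ c → ν c h o) cs ≤ D)
  (numeric : 2 * (D * (binom K r * (2 * B) ^ r)) ≤ m ^ r)
  where

  private
    Asg : Set
    Asg = Vec (Fin m) V

    hit : C → Fin V → Asg → ℕ
    hit c h v = sg (ν c h (vlookup v h))

    cnt : C → List (Fin V) → Asg → ℕ
    cnt c S v = ∑ (λ h → hit c h v) S

    Fine : List (Fin V) → Asg → Set
    Fine S v = All (λ c → cnt c S v ≤ r) cs

    fine? : ∀ S v → Dec (Fine S v)
    fine? S v = All.all? (λ c → cnt c S v ≤? r) cs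

    gd : List (Fin V) → Asg → ℕ
    gd S v = ind (fine? S v)

    -- The number of ways to single out ρ hit variables Y of S such that v is fine on Z ++ (S ∖ Y).
    X : C → List (Fin V) → List (Fin V) → ℕ → Asg → ℕ
    X c Z S       zero    v = gd (Z ++ S) v
    X c Z []      (suc ρ) v = 0
    X c Z (h ∷ S) (suc ρ) v = X c (h ∷ Z) S (suc ρ) v + hit c h v * X c Z S ρ v

    gd-↭ : ∀ {S S'} v → S ↭ S' → gd S v ≡ gd S' v
    gd-↭ {S} {S'} v p = ind-cong (fine? S v) (fine? S' v)
      (All.map (λ {c} → subst (_≤ r) (∑-↭ (λ h → hit c h v) p)))
      (All.map (λ {c} → subst (_≤ r) (sym (∑-↭ (λ h → hit c h v) p))))

    cnt-indep : ∀ c S v h o → All (h ≢_) S → cnt c S (v [ h ]≔ o) ≡ cnt c S v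
    cnt-indep c S v h o ne = ∑-cong-All (All.map (λ {h'} h≢h' → cong (λ x → sg (ν c h' x)) (lookup∘update′ (λ e → h≢h' (sym e)) v o)) ne)

    gd-indep : ∀ S v h o → All (h ≢_) S → gd S (v [ h ]≔ o) ≡ gd S v
    gd-indep S v h o ne = ind-cong (fine? S (v [ h ]≔ o)) (fine? S v)
      (All.map (λ {c} → subst (_≤ r) (cnt-indep c S v h o ne)))
      (All.map (λ {c} → subst (_≤ r) (sym (cnt-indep c S v h o ne))))

    X-indep : ∀ c Z S ρ v h o → All (h ≢_) (Z ++ S) → X c Z S ρ (v [ h ]≔ o) ≡ X c Z S ρ v
    X-indep c Z S       zero    v h o ne = gd-indep (Z ++ S) v h o ne
    X-indep c Z []      (suc ρ) v h o ne = refl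
    X-indep c Z (x ∷ S) (suc ρ) v h o ne with All-resp-↭ (shift x Z S) ne
    ... | h≢x ∷ ne' = cong₂ _+_ (X-indep c (x ∷ Z) S (suc ρ) v h o (h≢x ∷ ne'))
      (cong₂ _*_ (cong (λ w → sg (ν c x w)) (lookup∘update′ (λ e → h≢x (sym e)) v o)) (X-indep c Z S ρ v h o ne'))

    X-lower : ∀ c Z S ρ v → Fine (Z ++ S) v → ρ ≤ cnt c S v → 1 ≤ X c Z S ρ v
    X-lower c Z S       zero    v fine _ = ≤-reflexive (sym (ind-yes (fine? (Z ++ S) v) fine))
    X-lower c Z []      (suc ρ) v fine ()
    X-lower c Z (h ∷ S) (suc ρ) v fine ρ≤ with ν c h (vlookup v h)
    ... | zero  = ≤-trans (X-lower c (h ∷ Z) S (suc ρ) v fine' ρ≤) (m≤m+n _ _)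
      where
      fine' : Fine (h ∷ Z ++ S) v
      fine' = All.map (λ {c'} → subst (_≤ r) (∑-↭ (λ x → hit c' x v) (shift h Z S))) fine
    ... | suc _ = ≤-trans (≤-trans (X-lower c Z S ρ v fine' (≤-pred ρ≤)) (≤-reflexive (sym (+-identityʳ _)))) (m≤n+m _ (X c (h ∷ Z) S (suc ρ) v))
      where
      fine' : Fine (Z ++ S) v
      fine' = All.map (λ {c'} le → ≤-trans (m≤n+m _ _) (≤-trans (≤-reflexive (sym (∑-↭ (λ x → hit c' x v) (shift h Z S)))) le)) fine

    Halving : List (Fin V) → Fin V → Set
    Halving S y = Unique (y ∷ S) → 𝔼 V (gd S) ≤ 2 * 𝔼 V (gd (y ∷ S))

    unique-↭ : ∀ {S S' : List (Fin V)} → S ↭ S' → Unique S → Unique S'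
    unique-↭ Perm.refl         uq                    = uq
    unique-↭ (Perm.prep x p)   (h ∷ uq)              = All-resp-↭ p h ∷ unique-↭ p uq
    unique-↭ (Perm.swap x y p) ((x≢y ∷ hx) ∷ hy ∷ uq) = ((x≢y ∘ sym) ∷ All-resp-↭ p hy) ∷ All-resp-↭ p hx ∷ unique-↭ p uq
    unique-↭ (Perm.trans p q)  uq                    = unique-↭ q (unique-↭ p uq)

    u : C → List (Fin V) → ℕ
    u c S = ∑ (λ h → sg (σ c h)) S

    -- A variable that is singled out no longer enters the fineness condition, so by independence
    -- its being hit costs the factor `B / m`; putting it back into the condition costs a factor 2,
    -- by halving. The selections are counted by `binom`, because variables outside the support of
    -- `c` are never hit.
    X-upper : ∀ N → (∀ S y → length S < N → Halving S y) →
              ∀ c Z S ρ → Unique (Z ++ S) → length (Z ++ S) ≤ N →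
              m ^ ρ * 𝔼 V (X c Z S ρ) ≤ binom (u c S) ρ * (2 * B) ^ ρ * 𝔼 V (gd (Z ++ S))
    X-upper N hf c Z S       zero    uq len = ≤-refl
    X-upper N hf c Z []      (suc ρ) uq len = ≤-trans (≤-reflexive (trans (cong (m ^ suc ρ *_) (𝔼-zero V)) (*-zeroʳ (m ^ suc ρ)))) z≤n
    X-upper N hf c Z (h ∷ S) (suc ρ) uq len = goal
      where
      open ≤-Reasoning
      uq' : Unique (h ∷ Z ++ S)
      uq' = unique-↭ (shift h Z S) uq
      len' : length (h ∷ Z ++ S) ≤ N
      len' = subst (_≤ N) (↭-length (shift h Z S)) len
      G = 𝔼 V (gd (h ∷ Z ++ S))
      G≡ : 𝔼 V (gd (Z ++ h ∷ S)) ≡ G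
      G≡ = 𝔼-cong V (λ v → gd-↭ v (shift h Z S))
      without : m ^ suc ρ * 𝔼 V (X c (h ∷ Z) S (suc ρ)) ≤ binom (u c S) (suc ρ) * (2 * B) ^ suc ρ * G
      without = X-upper N hf c (h ∷ Z) S (suc ρ) uq' len'
      uq″ : Unique (Z ++ S)
      uq″ = case uq' of λ { (_ ∷ q) → q }
      h∉ : All (h ≢_) (Z ++ S)
      h∉ = case uq' of λ { (q ∷ _) → q }
      withh : m * 𝔼 V (λ v → hit c h v * X c Z S ρ v) ≤ B * 𝔼 V (X c Z S ρ)
      withh = begin
        m * 𝔼 V (λ v → hit c h v * X c Z S ρ v) ≡⟨ 𝔼-indep h (λ o → sg (ν c h o)) (X c Z S ρ) (λ v o → X-indep c Z S ρ v h o h∉) ⟩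
        ∑ (λ o → sg (ν c h o)) (allFin m) * 𝔼 V (X c Z S ρ) ≤⟨ *-monoˡ-≤ _ (≤-trans (∑-mono (λ o → sg≤ (ν c h o)) (allFin m)) (optionBound c h)) ⟩
        B * 𝔼 V (X c Z S ρ) ∎
      split : 𝔼 V (X c Z (h ∷ S) (suc ρ)) ≡ 𝔼 V (X c (h ∷ Z) S (suc ρ)) + 𝔼 V (λ v → hit c h v * X c Z S ρ v)
      split = 𝔼-+ V (X c (h ∷ Z) S (suc ρ)) (λ v → hit c h v * X c Z S ρ v)
      rest : m ^ ρ * 𝔼 V (X c Z S ρ) ≤ binom (u c S) ρ * (2 * B) ^ ρ * (2 * G)
      rest = ≤-trans (X-upper N hf c Z S ρ uq″ (≤-trans (n≤1+n _) len')) (*-monoʳ-≤ (binom (u c S) ρ * (2 * B) ^ ρ) (hf (Z ++ S) h len' uq'))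
      second : m ^ suc ρ * 𝔼 V (λ v → hit c h v * X c Z S ρ v) ≤ binom (u c S) ρ * (2 * B) ^ suc ρ * G
      second = begin
        m * m ^ ρ * 𝔼 V (λ v → hit c h v * X c Z S ρ v)   ≡⟨ l1 m (m ^ ρ) _ ⟩
        m ^ ρ * (m * 𝔼 V (λ v → hit c h v * X c Z S ρ v)) ≤⟨ *-monoʳ-≤ (m ^ ρ) withh ⟩
        m ^ ρ * (B * 𝔼 V (X c Z S ρ))                     ≡⟨ l2 (m ^ ρ) B _ ⟩
        B * (m ^ ρ * 𝔼 V (X c Z S ρ))                     ≤⟨ *-monoʳ-≤ B rest ⟩
        B * (binom (u c S) ρ * (2 * B) ^ ρ * (2 * G))     ≡⟨ l3 B (binom (u c S) ρ) ((2 * B) ^ ρ) G ⟩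
        binom (u c S) ρ * (2 * B * (2 * B) ^ ρ) * G       ∎
        where
        l1 : ∀ a b c → a * b * c ≡ b * (a * c)
        l1 = solve-∀
        l2 : ∀ a b c → a * (b * c) ≡ b * (a * c)
        l2 = solve-∀
        l3 : ∀ a b c d → a * (b * c * (2 * d)) ≡ b * (2 * a * c) * d
        l3 = solve-∀
      goal : m ^ suc ρ * 𝔼 V (X c Z (h ∷ S) (suc ρ)) ≤ binom (u c (h ∷ S)) (suc ρ) * (2 * B) ^ suc ρ * 𝔼 V (gd (Z ++ h ∷ S))
      goal rewrite G≡ | split with σ c h in eσ
      ... | suc _ = begin
        m ^ suc ρ * (𝔼 V (X c (h ∷ Z) S (suc ρ)) + 𝔼 V (λ v → hit c h v * X c Z S ρ v)) ≡⟨ *-distribˡ-+ (m ^ suc ρ) _ _ ⟩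
        m ^ suc ρ * 𝔼 V (X c (h ∷ Z) S (suc ρ)) + m ^ suc ρ * 𝔼 V (λ v → hit c h v * X c Z S ρ v) ≤⟨ +-mono-≤ without second ⟩
        binom (u c S) (suc ρ) * (2 * B) ^ suc ρ * G + binom (u c S) ρ * (2 * B) ^ suc ρ * G ≡⟨ pascal (binom (u c S) ρ) (binom (u c S) (suc ρ)) ((2 * B) ^ suc ρ) G ⟩
        (binom (u c S) ρ + binom (u c S) (suc ρ)) * (2 * B) ^ suc ρ * G ∎
        where
        pascal : ∀ a b c d → b * c * d + a * c * d ≡ (a + b) * c * d
        pascal = solve-∀
      ... | zero = begin
        m ^ suc ρ * (𝔼 V (X c (h ∷ Z) S (suc ρ)) + 𝔼 V (λ v → hit c h v * X c Z S ρ v)) ≡⟨ cong (λ z → m ^ suc ρ * (𝔼 V (X c (h ∷ Z) S (suc ρ)) + z)) vanish ⟩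
        m ^ suc ρ * (𝔼 V (X c (h ∷ Z) S (suc ρ)) + 0) ≡⟨ cong (m ^ suc ρ *_) (+-identityʳ _) ⟩
        m ^ suc ρ * 𝔼 V (X c (h ∷ Z) S (suc ρ)) ≤⟨ without ⟩
        binom (u c S) (suc ρ) * (2 * B) ^ suc ρ * G ∎
        where
        vanish : 𝔼 V (λ v → hit c h v * X c Z S ρ v) ≡ 0
        vanish = trans (𝔼-cong V (λ v → cong (λ z → sg z * X c Z S ρ v) (support c h (vlookup v h) eσ))) (𝔼-zero V)

    -- If adding `y` spoils fineness, then some `c` is hit at `y` and has `r` hits in `S` already,
    -- and these can be singled out.
    fine-split : ∀ S y v → gd S v ≤ gd (y ∷ S) v + ∑ (λ c → hit c y v * X c [] S r v) cs
    fine-split S y v with fine? S v | fine? (y ∷ S) v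
    ... | no _     | _     = z≤n
    ... | yes _    | yes _ = s≤s z≤n
    ... | yes fine | no ¬f with find (AllP.¬All⇒Any¬ (λ c → cnt c (y ∷ S) v ≤? r) cs ¬f)
    ...   | c , c∈ , ¬le with ν c y (vlookup v y) in eν
    ...     | zero  = ⊥-elim (¬le (All.lookup fine c∈))
    ...     | suc _ = ≤-trans one (∑-∈ (λ c → hit c y v * X c [] S r v) c∈)
      where
      one : 1 ≤ hit c y v * X c [] S r v
      one rewrite eν = ≤-trans (X-lower c [] S r v fine (≤-pred (≰⇒> ¬le))) (≤-reflexive (sym (+-identityʳ _)))

    Q : ℕ
    Q = binom K r * (2 * B) ^ r

    halving-step : ∀ N → (∀ S y → length S < N → Halving S y) → ∀ S y → length S ≤ N → Halving S y
    halving-step N hf S y len uq = final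
      where
      open ≤-Reasoning
      G = 𝔼 V (gd S)
      y∉ : All (y ≢_) S
      y∉ = case uq of λ { (q ∷ _) → q }
      uqS : Unique S
      uqS = case uq of λ { (_ ∷ q) → q }
      bad : ℕ
      bad = ∑ (λ c → 𝔼 V (λ v → hit c y v * X c [] S r v)) cs
      G≤ : G ≤ 𝔼 V (gd (y ∷ S)) + bad
      G≤ = begin
        G ≤⟨ 𝔼-mono V (fine-split S y) ⟩
        𝔼 V (λ v → gd (y ∷ S) v + ∑ (λ c → hit c y v * X c [] S r v) cs) ≡⟨ 𝔼-+ V (gd (y ∷ S)) _ ⟩
        𝔼 V (gd (y ∷ S)) + 𝔼 V (λ v → ∑ (λ c → hit c y v * X c [] S r v) cs) ≡⟨ cong (𝔼 V (gd (y ∷ S)) +_) (𝔼-∑ V (λ c v → hit c y v * X c [] S r v) cs) ⟩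
        𝔼 V (gd (y ∷ S)) + bad ∎
      one : ∀ c → m * m ^ r * 𝔼 V (λ v → hit c y v * X c [] S r v) ≤ ∑ (ν c y) (allFin m) * (Q * G)
      one c = begin
        m * m ^ r * 𝔼 V (λ v → hit c y v * X c [] S r v) ≡⟨ l1 m (m ^ r) _ ⟩
        m ^ r * (m * 𝔼 V (λ v → hit c y v * X c [] S r v)) ≡⟨ cong (m ^ r *_) (𝔼-indep y (λ o → sg (ν c y o)) (X c [] S r) (λ v o → X-indep c [] S r v y o y∉)) ⟩
        m ^ r * (∑ (λ o → sg (ν c y o)) (allFin m) * 𝔼 V (X c [] S r)) ≡⟨ l2 (m ^ r) (∑ (λ o → sg (ν c y o)) (allFin m)) (𝔼 V (X c [] S r)) ⟩
        ∑ (λ o → sg (ν c y o)) (allFin m) * (m ^ r * 𝔼 V (X c [] S r)) ≤⟨ *-mono-≤ (∑-mono (λ o → sg≤ (ν c y o)) (allFin m)) (X-upper N hf c [] S r uqS len) ⟩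
        ∑ (ν c y) (allFin m) * (binom (u c S) r * (2 * B) ^ r * G) ≤⟨ *-monoʳ-≤ (∑ (ν c y) (allFin m)) (*-monoˡ-≤ G (*-monoˡ-≤ ((2 * B) ^ r) (binom-monoˡ r uK))) ⟩
        ∑ (ν c y) (allFin m) * (Q * G) ∎
        where
        l1 : ∀ a b c → a * b * c ≡ b * (a * c)
        l1 = solve-∀
        l2 : ∀ a b c → a * (b * c) ≡ b * (a * c)
        l2 = solve-∀
        uK : u c S ≤ K
        uK = ≤-trans (∑-mono (λ h → sg≤ (σ c h)) S) (≤-trans (∑-Unique≤ (σ c) uqS) (supportBound c))
      all-c : m * (m ^ r * bad) ≤ m * (D * (Q * G))
      all-c = begin
        m * (m ^ r * bad) ≡⟨ sym (*-assoc m (m ^ r) bad) ⟩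
        m * m ^ r * bad   ≡⟨ sym (∑-*ˡ (m * m ^ r) _ cs) ⟩
        ∑ (λ c → m * m ^ r * 𝔼 V (λ v → hit c y v * X c [] S r v)) cs ≤⟨ ∑-mono one cs ⟩
        ∑ (λ c → ∑ (ν c y) (allFin m) * (Q * G)) cs ≡⟨ ∑-*ʳ (Q * G) _ cs ⟩
        ∑ (λ c → ∑ (ν c y) (allFin m)) cs * (Q * G) ≡⟨ cong (_* (Q * G)) (∑-swap (λ c o → ν c y o) cs (allFin m)) ⟩
        ∑ (λ o → ∑ (λ c → ν c y o) cs) (allFin m) * (Q * G) ≤⟨ *-monoˡ-≤ (Q * G) (∑-≤-length {xs = allFin m} (All.tabulate (λ {o} _ → constraintBound y o))) ⟩
        length (allFin m) * D * (Q * G) ≡⟨ cong (λ z → z * D * (Q * G)) (length-allFin {m}) ⟩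
        m * D * (Q * G) ≡⟨ *-assoc m D (Q * G) ⟩
        m * (D * (Q * G)) ∎
      instance
        m-nonZero : NonZero m
        m-nonZero = >-nonZero m>0
      -- Summing over `c` replaces the hits at `y` by at most `D` for each of the `m` options;
      -- `numeric` is exactly what then bounds the loss by one half.
      2bad≤G : 2 * bad ≤ G
      2bad≤G = *-cancelˡ-≤ (m ^ r) {{m^n≢0 m r}} (begin
        m ^ r * (2 * bad)     ≡⟨ l1 (m ^ r) bad ⟩
        2 * (m ^ r * bad)     ≤⟨ *-monoʳ-≤ 2 (*-cancelˡ-≤ m all-c) ⟩
        2 * (D * (Q * G))     ≡⟨ l2 D Q G ⟩
        2 * (D * Q) * G       ≤⟨ *-monoˡ-≤ G numeric ⟩
        m ^ r * G             ∎)
        where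
        l1 : ∀ a b → a * (2 * b) ≡ 2 * (a * b)
        l1 = solve-∀
        l2 : ∀ a b c → 2 * (a * (b * c)) ≡ 2 * (a * b) * c
        l2 = solve-∀
      final : G ≤ 2 * 𝔼 V (gd (y ∷ S))
      final = ≤-of-slack 0 (+-mono-≤ (*-monoʳ-≤ 2 G≤) 2bad≤G) (lemma G (𝔼 V (gd (y ∷ S))) bad)
        where
        lemma : ∀ G H b → G + (2 * (H + b) + G) + 0 ≡ 2 * H + (2 * G + 2 * b)
        lemma = solve-∀

    halving : ∀ N S y → length S ≤ N → Halving S y
    halving zero    = halving-step zero (λ S y ())
    halving (suc N) = halving-step (suc N) (λ S y lt → halving N S y (≤-pred lt))

    positive : ∀ S → Unique S → 0 < 𝔼 V (gd S)
    positive [] _ = ≤-trans (𝔼-one-pos V m>0) (𝔼-mono V (λ v → ≤-reflexive (sym (ind-yes (fine? [] v) (All.tabulate (λ _ → z≤n))))))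
    positive (y ∷ S) (h ∷ uq) = proj₂ (*-pos 2 _ (≤-trans (positive S uq) (halving (length S) S y ≤-refl (h ∷ uq))))

  local-lemma : ∃ λ (α : Fin V → Fin m) → All (λ c → ∑ (λ h → sg (ν c h (α h))) (allFin V) ≤ r) cs
  local-lemma with 𝔼-find V (gd (allFin V)) (positive (allFin V) (allFin⁺ V))
  ... | v , pos = vlookup v , ind-pos (fine? (allFin V) v) pos

-- Disjoint conflict-free perfect matchings

flat : List (A × A) → List A
flat []             = []
flat ((x , y) ∷ ps) = x ∷ y ∷ flat ps

flat-↭ : {ps qs : List (A × A)} → ps ↭ qs → flat ps ↭ flat qs
flat-↭ Perm.refl = ↭-refl
flat-↭ (Perm.prep (x , y) p) = prep x (prep y (flat-↭ p))
flat-↭ (Perm.swap (x , y) (x' , y') p) = ↭-trans (prep x (prep y (prep x' (prep y' (flat-↭ p))))) (++⁺ʳ _ (++-comm (x ∷ y ∷ []) (x' ∷ y' ∷ [])))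
flat-↭ (Perm.trans p q) = ↭-trans (flat-↭ p) (flat-↭ q)

∑-flat : (f : A → ℕ) (ps : List (A × A)) → ∑ f (flat ps) ≡ ∑ (λ p → f (proj₁ p) + f (proj₂ p)) ps
∑-flat f []             = refl
∑-flat f ((x , y) ∷ ps) = trans (cong (λ z → f x + (f y + z)) (∑-flat f ps)) (sym (+-assoc (f x) (f y) _))

length-flat : (ps : List (A × A)) → length (flat ps) ≡ 2 * length ps
length-flat []             = refl
length-flat ((x , y) ∷ ps) = trans (cong (λ z → suc (suc z)) (length-flat ps)) (lemma (length ps))
  where
  lemma : ∀ n → suc (suc (2 * n)) ≡ 2 * suc n
  lemma = solve-∀

pairUp : ∀ κ (xs : List A) → length xs ≡ 2 * κ → Σ (List (A × A)) λ ps → flat ps ≡ xs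
pairUp zero    [] _ = [] , refl
pairUp (suc κ) (x ∷ y ∷ xs) e with pairUp κ xs (suc-injective (suc-injective (trans e (cong suc (+-suc κ (κ + 0))))))
... | ps , q = (x , y) ∷ ps , cong (λ z → x ∷ y ∷ z) q
pairUp (suc κ) (x ∷ []) e with trans e (cong suc (+-suc κ (κ + 0)))
... | ()

extract : {x : A} {xs : List A} → x ∈ xs → Σ (List A) λ ys → xs ↭ x ∷ ys
extract x∈ with ∈-∃++ x∈
... | us , vs , refl = us ++ vs , shift _ us vs

module _ {A : Set} (b : A → A → ℕ) (β : ℕ) where

  private
    conflicts : List (A × A) → ℕ
    conflicts = ∑ (λ p → sg (b (proj₁ p) (proj₂ p)))

    Bounded : List A → Set
    Bounded xs = All (λ x → ∑ (b x) xs ≤ β) xs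

    bounded-↭ : ∀ {xs ys} → xs ↭ ys → Bounded xs → Bounded ys
    bounded-↭ p h = All-resp-↭ p (All.map (λ {x} → subst (_≤ β) (∑-↭ (b x) p)) h)

    sg≡0 : ∀ {n} → sg n ≡ 0 → n ≡ 0
    sg≡0 {zero} _ = refl

  -- A conflicting pair (x , y) is removed by exchanging with a pair (c , d) such that neither (x , c) nor (y , d) conflicts.
  repair : ∀ N ps → conflicts ps ≤ N → Bounded (flat ps) → suc (2 * β) < length ps →
           Σ (List (A × A)) λ ps' → flat ps' ↭ flat ps × All (λ p → b (proj₁ p) (proj₂ p) ≡ 0) ps'
  repair zero ps le _ _ = ps , ↭-refl , All.map sg≡0 (∑-zero⁻ _ (≤0⇒≡0 le))
  repair (suc N) ps le bd long with 0 <? conflicts ps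
  ... | no ¬p = ps , ↭-refl , All.map sg≡0 (∑-zero⁻ _ (¬pos⇒≡0 _ ¬p))
  ... | yes p with ∑-pos-find (λ q → sg (b (proj₁ q) (proj₂ q))) ps p
  ...   | (x , y) , xy∈ , xy>0 with extract xy∈
  ...     | qs , ps↭ with ∑-<-find (λ q → b x (proj₁ q) + b y (proj₂ q)) (λ _ → 1) qs few
    where
    bd' : Bounded (x ∷ y ∷ flat qs)
    bd' = bounded-↭ (flat-↭ ps↭) bd
    bx : ∑ (b x) (flat qs) ≤ β
    bx = ≤-trans (≤-trans (m≤n+m _ (b x y)) (m≤n+m _ (b x x))) (All.head bd')
    by : ∑ (b y) (flat qs) ≤ β
    by = ≤-trans (≤-trans (m≤n+m _ (b y y)) (m≤n+m _ (b y x))) (All.head (All.tail bd'))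
    fst≤ : ∀ (f : A → ℕ) → ∑ (λ q → f (proj₁ q)) qs ≤ ∑ f (flat qs)
    fst≤ f = ≤-trans (∑-mono (λ q → m≤m+n (f (proj₁ q)) (f (proj₂ q))) qs) (≤-reflexive (sym (∑-flat f qs)))
    snd≤ : ∀ (f : A → ℕ) → ∑ (λ q → f (proj₂ q)) qs ≤ ∑ f (flat qs)
    snd≤ f = ≤-trans (∑-mono (λ q → m≤n+m (f (proj₂ q)) (f (proj₁ q))) qs) (≤-reflexive (sym (∑-flat f qs)))
    open ≤-Reasoning
    few : ∑ (λ q → b x (proj₁ q) + b y (proj₂ q)) qs < ∑ (λ _ → 1) qs
    few = begin-strict
      ∑ (λ q → b x (proj₁ q) + b y (proj₂ q)) qs ≡⟨ ∑-+ (λ q → b x (proj₁ q)) (λ q → b y (proj₂ q)) qs ⟩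
      ∑ (λ q → b x (proj₁ q)) qs + ∑ (λ q → b y (proj₂ q)) qs ≤⟨ +-mono-≤ (≤-trans (fst≤ (b x)) bx) (≤-trans (snd≤ (b y)) by) ⟩
      β + β ≡⟨ cong (β +_) (sym (+-identityʳ β)) ⟩
      2 * β <⟨ ≤-pred (subst (suc (2 * β) <_) (↭-length ps↭) long) ⟩
      length qs ≡⟨ sym (∑-ones qs) ⟩
      ∑ (λ _ → 1) qs ∎
  ...       | (c , d) , cd∈ , cd<1 with extract cd∈
  ...         | rs , qs↭ with repair N ((x , c) ∷ (y , d) ∷ rs) fewer (bounded-↭ (↭-trans (flat-↭ ps↭) perm) bd) (subst (suc (2 * β) <_) (trans (↭-length ps↭) (cong suc (↭-length qs↭))) long)
    where
    bxc : b x c ≡ 0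
    bxc = m+n≡0⇒m≡0 (b x c) (≤0⇒≡0 (≤-pred cd<1))
    byd : b y d ≡ 0
    byd = m+n≡0⇒n≡0 (b x c) (≤0⇒≡0 (≤-pred cd<1))
    perm : x ∷ y ∷ flat qs ↭ x ∷ c ∷ y ∷ d ∷ flat rs
    perm = prep x (↭-trans (prep y (flat-↭ qs↭)) (swap y c ↭-refl))
    open ≤-Reasoning
    -- The two new pairs are free of conflict and `(x , y)` was not, so the count drops whatever the
    -- status of `(c , d)`.
    fewer : conflicts ((x , c) ∷ (y , d) ∷ rs) ≤ N
    fewer rewrite bxc | byd = ≤-pred (begin
      suc (conflicts rs)        ≤⟨ +-mono-≤ xy>0 (m≤n+m (conflicts rs) (sg (b c d))) ⟩
      sg (b x y) + (sg (b c d) + conflicts rs) ≡⟨ cong (sg (b x y) +_) (sym (∑-↭ _ qs↭)) ⟩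
      sg (b x y) + conflicts qs ≡⟨ sym (∑-↭ _ ps↭) ⟩
      conflicts ps              ≤⟨ le ⟩
      suc N                     ∎)
  ...           | ps' , perm' , free = ps' , ↭-trans perm' (↭-sym (↭-trans (flat-↭ ps↭) (prep x (↭-trans (prep y (flat-↭ qs↭)) (swap y c ↭-refl))))) , free

private
  zer : ℕ → ℕ
  zer zero    = 1
  zer (suc _) = 0

module _ {k κ β : ℕ} (even : k ≡ 2 * κ) (long : suc (2 * β) < κ) where
  open Distinct (FinP._≟_ {k})

  private
    I : List (Fin k)
    I = allFin k

    used : List (Fin k × Fin k) → Fin k → Fin k → ℕ
    used μ i j = ∑ (λ p → eq i (proj₁ p) * eq j (proj₂ p) + eq i (proj₂ p) * eq j (proj₁ p)) μ

    used-sym : ∀ μ i j → used μ i j ≡ used μ j i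
    used-sym μ i j = ∑-cong (λ p → lemma (eq i (proj₁ p)) (eq j (proj₂ p)) (eq i (proj₂ p)) (eq j (proj₁ p))) μ
      where
      lemma : ∀ a b c d → a * b + c * d ≡ d * c + b * a
      lemma = solve-∀

    row : ∀ i → ∑ (λ j → eq j i) I ≡ 1
    row i = ∑-eq-Fin i

    used-total : ∀ μ (w : Fin k → Fin k → ℕ) →
                 ∑ (λ i → ∑ (λ j → used μ i j * w i j) I) I ≡ ∑ (λ p → w (proj₁ p) (proj₂ p) + w (proj₂ p) (proj₁ p)) μ
    used-total μ w = begin
      ∑ (λ i → ∑ (λ j → used μ i j * w i j) I) I
        ≡⟨ ∑-cong (λ i → trans (∑-cong (λ j → sym (∑-*ʳ (w i j) _ μ)) I) (∑-swap _ I μ)) I ⟩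
      ∑ (λ i → ∑ (λ p → ∑ (λ j → (eq i (proj₁ p) * eq j (proj₂ p) + eq i (proj₂ p) * eq j (proj₁ p)) * w i j) I) μ) I
        ≡⟨ ∑-swap _ I μ ⟩
      ∑ (λ p → ∑ (λ i → ∑ (λ j → (eq i (proj₁ p) * eq j (proj₂ p) + eq i (proj₂ p) * eq j (proj₁ p)) * w i j) I) I) μ
        ≡⟨ ∑-cong (λ p → pick p) μ ⟩
      ∑ (λ p → w (proj₁ p) (proj₂ p) + w (proj₂ p) (proj₁ p)) μ ∎
      where
      open ≡-Reasoning
      point : ∀ (f : Fin k → ℕ) i → ∑ (λ j → eq j i * f j) I ≡ f i
      point f i = trans (∑-cong (λ j → eq-* f j i) I) (trans (∑-*ʳ (f i) _ I) (trans (cong (_* f i) (row i)) (*-identityˡ _)))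
      one : ∀ x y → ∑ (λ i → ∑ (λ j → eq i x * eq j y * w i j) I) I ≡ w x y
      one x y = trans (∑-cong (λ i → trans (∑-cong (λ j → *-assoc (eq i x) (eq j y) (w i j)) I) (trans (∑-*ˡ (eq i x) _ I) (cong (eq i x *_) (point (w i) y)))) I) (point (λ i → w i y) x)
      pick : ∀ p → ∑ (λ i → ∑ (λ j → (eq i (proj₁ p) * eq j (proj₂ p) + eq i (proj₂ p) * eq j (proj₁ p)) * w i j) I) I
                 ≡ w (proj₁ p) (proj₂ p) + w (proj₂ p) (proj₁ p)
      pick (x , y) = begin
        ∑ (λ i → ∑ (λ j → (eq i x * eq j y + eq i y * eq j x) * w i j) I) I
          ≡⟨ ∑-cong (λ i → trans (∑-cong (λ j → *-distribʳ-+ (w i j) (eq i x * eq j y) (eq i y * eq j x)) I) (∑-+ _ _ I)) I ⟩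
        ∑ (λ i → ∑ (λ j → eq i x * eq j y * w i j) I + ∑ (λ j → eq i y * eq j x * w i j) I) I
          ≡⟨ ∑-+ _ _ I ⟩
        ∑ (λ i → ∑ (λ j → eq i x * eq j y * w i j) I) I + ∑ (λ i → ∑ (λ j → eq i y * eq j x * w i j) I) I
          ≡⟨ cong₂ _+_ (one x y) (one y x) ⟩
        w x y + w y x ∎

    used-row : ∀ μ → flat μ ↭ I → ∀ i → ∑ (used μ i) I ≡ 1
    used-row μ perm i = begin
      ∑ (used μ i) I ≡⟨ ∑-swap _ I μ ⟩
      ∑ (λ p → ∑ (λ j → eq i (proj₁ p) * eq j (proj₂ p) + eq i (proj₂ p) * eq j (proj₁ p)) I) μ ≡⟨ ∑-cong inner μ ⟩
      ∑ (λ p → eq i (proj₁ p) + eq i (proj₂ p)) μ ≡⟨ sym (∑-flat (eq i) μ) ⟩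
      ∑ (eq i) (flat μ) ≡⟨ ∑-↭ (eq i) perm ⟩
      ∑ (eq i) I ≡⟨ trans (∑-cong (eq-sym i) I) (row i) ⟩
      1 ∎
      where
      open ≡-Reasoning
      inner : ∀ p → ∑ (λ j → eq i (proj₁ p) * eq j (proj₂ p) + eq i (proj₂ p) * eq j (proj₁ p)) I ≡ eq i (proj₁ p) + eq i (proj₂ p)
      inner (x , y) = trans (∑-+ _ _ I) (cong₂ _+_
        (trans (∑-*ˡ (eq i x) _ I) (trans (cong (eq i x *_) (row y)) (*-identityʳ (eq i x))))
        (trans (∑-*ˡ (eq i y) _ I) (trans (cong (eq i y *_) (row x)) (*-identityʳ (eq i y)))))

  -- Pairs used by one matching are declared conflicts for the later ones, which forces
  -- disjointness. A matching adds exactly one conflict to each row, and so the budget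
  -- `∑ (b i) I + t ≤ β` is preserved. Disjointness is stated as it is applied: no weight summed
  -- over all the matchings exceeds its sum over all free ordered pairs.
  indexMatchings : ∀ t (b : Fin k → Fin k → ℕ) → (∀ i j → b i j ≡ b j i) → (∀ i → ∑ (b i) I + t ≤ β) →
    Σ (Fin t → List (Fin k × Fin k)) λ f →
      (∀ o → flat (f o) ↭ I) × (∀ o → All (λ p → b (proj₁ p) (proj₂ p) ≡ 0) (f o)) ×
      (∀ (w : Fin k → Fin k → ℕ) → ∑ (λ o → ∑ (λ p → w (proj₁ p) (proj₂ p) + w (proj₂ p) (proj₁ p)) (f o)) (allFin t)
                                  ≤ ∑ (λ i → ∑ (λ j → zer (b i j) * w i j) I) I)
  indexMatchings zero    b _ _ = (λ ()) , (λ ()) , (λ ()) , (λ w → z≤n)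
  indexMatchings (suc t) b b-sym bound with pairUp κ I (trans (length-tabulate (λ (i : Fin k) → i)) even)
  ... | ps , flat-ps with repair b β _ ps ≤-refl
          (subst (λ xs → All (λ x → ∑ (b x) xs ≤ β) xs) (sym flat-ps) (All.tabulate (λ {i} _ → ≤-trans (m≤m+n _ (suc t)) (bound i))))
          (subst (suc (2 * β) <_) (sym len) long)
    where
    len : length ps ≡ κ
    len = *-cancelˡ-≡ _ _ 2 (trans (sym (length-flat ps)) (trans (cong length flat-ps) (trans (length-tabulate (λ (i : Fin k) → i)) even)))
  ...   | μ , flat-μ , free with indexMatchings t (λ i j → b i j + used μ i j)
            (λ i j → cong₂ _+_ (b-sym i j) (used-sym μ i j)) bound'
    where
    μ↭ : flat μ ↭ I
    μ↭ = subst (flat μ ↭_) flat-ps flat-μ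
    bound' : ∀ i → ∑ (λ j → b i j + used μ i j) I + t ≤ β
    bound' i = ≤-trans (≤-reflexive (trans (cong (_+ t) (trans (∑-+ (b i) (used μ i) I) (cong (∑ (b i) I +_) (used-row μ μ↭ i)))) (+-assoc (∑ (b i) I) 1 t))) (bound i)
  ...     | f , f↭ , f-free , f-w = g , g↭ , g-free , g-w
    where
    μ↭ : flat μ ↭ I
    μ↭ = subst (flat μ ↭_) flat-ps flat-μ
    g : Fin (suc t) → List (Fin k × Fin k)
    g zero    = μ
    g (suc o) = f o
    g↭ : ∀ o → flat (g o) ↭ I
    g↭ zero    = μ↭
    g↭ (suc o) = f↭ o
    g-free : ∀ o → All (λ p → b (proj₁ p) (proj₂ p) ≡ 0) (g o)
    g-free zero    = free
    g-free (suc o) = All.map (λ {p} e → m+n≡0⇒m≡0 (b (proj₁ p) (proj₂ p)) e) (f-free o)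
    used⇒free : ∀ i j → 0 < used μ i j → b i j ≡ 0
    used⇒free i j pos with ∑-pos-find (λ p → eq i (proj₁ p) * eq j (proj₂ p) + eq i (proj₂ p) * eq j (proj₁ p)) μ pos
    ... | (x , y) , xy∈ , q with +-pos (eq i x * eq j y) _ q
    ...   | inj₁ q₁ with ind-pos (i FinP.≟ x) (proj₁ (*-pos (eq i x) _ q₁)) | ind-pos (j FinP.≟ y) (proj₂ (*-pos (eq i x) _ q₁))
    ...     | refl | refl = All.lookup free xy∈
    used⇒free i j pos | (x , y) , xy∈ , q | inj₂ q₂ with ind-pos (i FinP.≟ y) (proj₁ (*-pos (eq i y) _ q₂)) | ind-pos (j FinP.≟ x) (proj₂ (*-pos (eq i y) _ q₂))
    ...     | refl | refl = trans (b-sym i j) (All.lookup free xy∈)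
    used≤1 : ∀ i j → used μ i j ≤ 1
    used≤1 i j = ≤-trans (∑-∈ (used μ i) (∈-allFin j)) (≤-reflexive (used-row μ μ↭ i))
    -- The new matching uses a pair at most once and only if it is free, and a used pair is not free
    -- for the remaining matchings.
    pointwise : ∀ i j → used μ i j + zer (b i j + used μ i j) ≤ zer (b i j)
    pointwise i j with used μ i j | used≤1 i j | used⇒free i j
    ... | zero        | _ | _  = ≤-reflexive (cong zer (+-identityʳ (b i j)))
    ... | suc zero    | _ | fr rewrite fr (s≤s z≤n) = ≤-refl
    ... | suc (suc _) | s≤s () | _
    open ≤-Reasoning
    g-w : ∀ (w : Fin k → Fin k → ℕ) → ∑ (λ o → ∑ (λ p → w (proj₁ p) (proj₂ p) + w (proj₂ p) (proj₁ p)) (g o)) (allFin (suc t))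
                                  ≤ ∑ (λ i → ∑ (λ j → zer (b i j) * w i j) I) I
    g-w w = begin
      ∑ (λ o → ∑ ww (g o)) (allFin (suc t)) ≡⟨ ∑-allFin-suc (λ o → ∑ ww (g o)) ⟩
      ∑ ww μ + ∑ (λ o → ∑ ww (f o)) (allFin t) ≤⟨ +-mono-≤ (≤-reflexive (sym (used-total μ w))) (f-w w) ⟩
      ∑ (λ i → ∑ (λ j → used μ i j * w i j) I) I + ∑ (λ i → ∑ (λ j → zer (b i j + used μ i j) * w i j) I) I ≡⟨ sym (∑-+ _ _ I) ⟩
      ∑ (λ i → ∑ (λ j → used μ i j * w i j) I + ∑ (λ j → zer (b i j + used μ i j) * w i j) I) I ≡⟨ ∑-cong (λ i → sym (∑-+ _ _ I)) I ⟩
      ∑ (λ i → ∑ (λ j → used μ i j * w i j + zer (b i j + used μ i j) * w i j) I) I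
        ≤⟨ ∑-mono (λ i → ∑-mono (λ j → ≤-trans (≤-reflexive (sym (*-distribʳ-+ (w i j) (used μ i j) _))) (*-monoˡ-≤ (w i j) (pointwise i j))) I) I ⟩
      ∑ (λ i → ∑ (λ j → zer (b i j) * w i j) I) I ∎
      where
      ww : Fin k × Fin k → ℕ
      ww p = w (proj₁ p) (proj₂ p) + w (proj₂ p) (proj₁ p)

map² : (A → B) → A × A → B × B
map² g (x , y) = g x , g y

flat-map : (g : A → B) (ps : List (A × A)) → flat (map (map² g) ps) ≡ map g (flat ps)
flat-map g []             = refl
flat-map g ((x , y) ∷ ps) = cong (λ z → g x ∷ g y ∷ z) (flat-map g ps)

∑-lookup : (f : A → ℕ) (J : List A) → ∑ (λ i → f (lookup J i)) (allFin (length J)) ≡ ∑ f J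
∑-lookup f J = trans (sym (∑-map f (lookup J) (allFin (length J)))) (cong (∑ f) (trans (map-tabulate id (lookup J)) (tabulate-lookup J)))

-- Positions of `J` are matched instead of entries, because entries may repeat and `A` has no
-- decidable equality. The budget `c + m` provides for the `c` given conflicts and for one more per
-- matching.
disjointMatchings : (m c κ : ℕ) (cf : A → A → ℕ) (J : List A) → (∀ x y → cf x y ≡ cf y x) →
  length J ≡ 2 * κ → (∀ {x} → x ∈ J → ∑ (cf x) J ≤ c) → suc (2 * (c + m)) < κ →
  Σ (Fin m → List (A × A)) λ f →
    (∀ o → flat (f o) ↭ J) × (∀ o → All (λ p → cf (proj₁ p) (proj₂ p) ≡ 0) (f o)) ×
    (∀ (w : A → A → ℕ) → ∑ (λ o → ∑ (λ p → w (proj₁ p) (proj₂ p) + w (proj₂ p) (proj₁ p)) (f o)) (allFin m)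
                        ≤ ∑ (λ x → ∑ (w x) J) J)
disjointMatchings m c κ cf J cf-sym even bound long
  with indexMatchings even long m (λ i j → cf (lookup J i) (lookup J j)) (λ i j → cf-sym _ _)
         (λ i → +-monoˡ-≤ m (≤-trans (≤-reflexive (∑-lookup (cf (lookup J i)) J)) (bound (∈-lookup i))))
... | f , f↭ , f-free , f-w = (λ o → map (map² (lookup J)) (f o)) ,
  (λ o → subst₂ _↭_ (sym (flat-map (lookup J) (f o))) (trans (map-tabulate id (lookup J)) (tabulate-lookup J)) (map⁺ (lookup J) (f↭ o))) ,
  (λ o → AllP.map⁺ (f-free o)) ,
  λ w → begin
    ∑ (λ o → ∑ (λ p → w (proj₁ p) (proj₂ p) + w (proj₂ p) (proj₁ p)) (map (map² (lookup J)) (f o))) (allFin m)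
      ≡⟨ ∑-cong (λ o → ∑-map _ (map² (lookup J)) (f o)) (allFin m) ⟩
    ∑ (λ o → ∑ (λ p → w (lookup J (proj₁ p)) (lookup J (proj₂ p)) + w (lookup J (proj₂ p)) (lookup J (proj₁ p))) (f o)) (allFin m)
      ≤⟨ f-w (λ i j → w (lookup J i) (lookup J j)) ⟩
    ∑ (λ i → ∑ (λ j → zer (cf (lookup J i) (lookup J j)) * w (lookup J i) (lookup J j)) (allFin (length J))) (allFin (length J))
      ≤⟨ ∑-mono (λ i → ∑-mono (λ j → zer* (cf (lookup J i) (lookup J j)) (w (lookup J i) (lookup J j))) (allFin (length J))) (allFin (length J)) ⟩
    ∑ (λ i → ∑ (λ j → w (lookup J i) (lookup J j)) (allFin (length J))) (allFin (length J))
      ≡⟨ ∑-cong (λ i → ∑-lookup (w (lookup J i)) J) (allFin (length J)) ⟩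
    ∑ (λ i → ∑ (w (lookup J i)) J) (allFin (length J))
      ≡⟨ ∑-lookup (λ x → ∑ (w x) J) J ⟩
    ∑ (λ x → ∑ (w x) J) J ∎
  where
  open ≤-Reasoning
  zer* : ∀ n x → zer n * x ≤ x
  zer* zero    x = ≤-reflexive (*-identityˡ x)
  zer* (suc n) x = z≤n

-- Balanced orientations

Near : ℕ → ℕ → Set
Near a b = a ≤ suc b × b ≤ suc a

private
  near-of-ends : ∀ {o i x y} → o + y ≡ i + x → x + y ≤ 1 → Near o i
  near-of-ends {o} {i} {x} {y} e le = ≤-of-slack (y + y) (+-mono-≤ (≤-reflexive e) le) (l₁ o i x y) , ≤-of-slack (x + x) (+-mono-≤ (≤-reflexive (sym e)) le) (l₂ o i x y)
    where
    l₁ : ∀ o i x y → o + (i + x + 1) + (y + y) ≡ suc i + (o + y + (x + y))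
    l₁ = solve-∀
    l₂ : ∀ o i x y → i + (o + y + 1) + (x + x) ≡ suc o + (i + x + (x + y))
    l₂ = solve-∀

-- Trails are glued at coinciding end labels until all end labels are different.  A trail is
-- recorded by its two ends and by the edges it traverses forwards and backwards.
module Trails {E X : Set} (_≟_ : DecidableEquality X) (α β : E → X) where
  open Distinct _≟_

  outward inward : List E → List E → (X → ℕ) → ℕ
  outward F B φ = ∑ (φ ∘ α) F + ∑ (φ ∘ β) B
  inward  F B φ = ∑ (φ ∘ β) F + ∑ (φ ∘ α) B

  record Trail : Set where
    constructor mkTrail
    field
      x y : X
      fw bw : List E
      -- The order of the edges is forgotten. What remains of a trail is that every potential `φ`
      -- telescopes along it; balance at a label is the case in which `φ` is the indicator of that
      -- label.
      telescope : ∀ φ → outward fw bw φ + φ y ≡ inward fw bw φ + φ x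
  open Trail public

  size : (E → ℕ) → Trail → ℕ
  size w t = ∑ w (fw t) + ∑ w (bw t)

  single : E → Trail
  single e = mkTrail (α e) (β e) (e ∷ []) [] (λ φ → lemma (φ (α e)) (φ (β e)))
    where
    lemma : ∀ a b → a + 0 + 0 + b ≡ b + 0 + 0 + a
    lemma = solve-∀

  flipTrail : Trail → Trail
  flipTrail t = mkTrail (y t) (x t) (bw t) (fw t) λ φ →
    trans (cong (_+ φ (x t)) (+-comm (∑ (φ ∘ α) (bw t)) _)) (trans (sym (telescope t φ)) (cong (_+ φ (y t)) (+-comm (∑ (φ ∘ α) (fw t)) _)))

  glue : (s t : Trail) → y s ≡ x t → Trail
  glue s t e = mkTrail (x s) (y t) (fw s ++ fw t) (bw s ++ bw t) tel
    where
    tel : ∀ φ → outward (fw s ++ fw t) (bw s ++ bw t) φ + φ (y t) ≡ inward (fw s ++ fw t) (bw s ++ bw t) φ + φ (x s)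
    tel φ rewrite ∑-++ (φ ∘ α) (fw s) (fw t) | ∑-++ (φ ∘ β) (bw s) (bw t) | ∑-++ (φ ∘ β) (fw s) (fw t) | ∑-++ (φ ∘ α) (bw s) (bw t) =
      +-cancelʳ-≡ (φ (y s)) _ _ (trans (l₁ (∑ (φ ∘ α) (fw s)) (∑ (φ ∘ α) (fw t)) (∑ (φ ∘ β) (bw s)) (∑ (φ ∘ β) (bw t)) (φ (y t)) (φ (y s)))
        (trans (cong₂ _+_ (telescope s φ) (trans (telescope t φ) (cong (λ z → inward (fw t) (bw t) φ + φ z) (sym e))))
          (l₂ (∑ (φ ∘ β) (fw s)) (∑ (φ ∘ β) (fw t)) (∑ (φ ∘ α) (bw s)) (∑ (φ ∘ α) (bw t)) (φ (x s)) (φ (y s)))))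
      where
      l₁ : ∀ a b c d e f → a + b + (c + d) + e + f ≡ a + c + f + (b + d + e)
      l₁ = solve-∀
      l₂ : ∀ a b c d e f → a + c + e + (b + d + f) ≡ a + b + (c + d) + e + f
      l₂ = solve-∀

  size-glue : ∀ w s t e → size w (glue s t e) ≡ size w s + size w t
  size-glue w s t _ rewrite ∑-++ w (fw s) (fw t) | ∑-++ w (bw s) (bw t) =
    lemma (∑ w (fw s)) (∑ w (fw t)) (∑ w (bw s)) (∑ w (bw t))
    where
    lemma : ∀ a b c d → a + b + (c + d) ≡ a + c + (b + d)
    lemma = solve-∀

  ends : X → Trail → ℕ
  ends z t = eq z (x t) + eq z (y t)

  Settled : List Trail → Set
  Settled S = ∀ z → ∑ (ends z) S ≤ 1

  -- The edges treated so far are given only by their sums `w₀`. As `total` holds for every weight,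
  -- it says that the trails together use precisely this multiset of edges.
  record Settlement (w₀ : (E → ℕ) → ℕ) : Set where
    field
      open-trails : List Trail
      settled : Settled open-trails
      closed-fw closed-bw : List E
      closed-balance : ∀ φ → outward closed-fw closed-bw φ ≡ inward closed-fw closed-bw φ
      total : ∀ w → ∑ (size w) open-trails + (∑ w closed-fw + ∑ w closed-bw) ≡ w₀ w
  open Settlement public

  private
    settled-tail : ∀ {t S S'} → S ↭ t ∷ S' → Settled S → Settled S'
    settled-tail {t} p h z = ≤-trans (m≤n+m _ (ends z t)) (≤-trans (≤-reflexive (sym (∑-↭ (ends z) p))) (h z))

    settled-cons : ∀ t S → x t ≢ y t → ∑ (ends (x t)) S ≡ 0 → ∑ (ends (y t)) S ≡ 0 → Settled S → Settled (t ∷ S)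
    settled-cons t S ne ex ey h z with z ≟ x t | z ≟ y t
    ... | yes refl | yes e    = ⊥-elim (ne e)
    ... | yes refl | no _     = s≤s (≤-reflexive ex)
    ... | no _     | yes refl = s≤s (≤-reflexive ey)
    ... | no _     | no _     = h z

    resettle : ∀ {w₁ w₂ : (E → ℕ) → ℕ} → (∀ w → w₁ w ≡ w₂ w) → Settlement w₁ → Settlement w₂
    resettle h s = record { Settlement s ; total = λ w → trans (total s w) (h w) }

    attach : (t s : Trail) → ends (y t) s ≡ 0 ⊎ Σ Trail λ u → ∀ w → size w u ≡ size w t + size w s
    attach t s with y t ≟ x s | y t ≟ y s
    ... | yes e | _     = inj₂ (glue t s e , λ w → size-glue w t s e)
    ... | no _  | yes e = inj₂ (glue t (flipTrail s) e , λ w → trans (size-glue w t (flipTrail s) e) (cong (size w t +_) (+-comm (∑ w (bw s)) _)))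
    ... | no _  | no _  = inj₁ refl

  -- The trail is glued at its end `y`, or else at `x`, until it closes or both its ends are new
  -- labels. Each gluing uses up an open trail, so `k` bounds the recursion.
  insert : ∀ k (S : List Trail) (t : Trail) → length S ≤ k → Settled S → Settlement (λ w → size w t + ∑ (size w) S)
  insert k S t len h with x t ≟ y t
  insert k S t len h | yes e = record
    { open-trails = S ; settled = h ; closed-fw = fw t ; closed-bw = bw t
    ; closed-balance = λ φ → +-cancelʳ-≡ (φ (y t)) _ _ (trans (telescope t φ) (cong (λ z → inward (fw t) (bw t) φ + φ z) e))
    ; total = λ w → +-comm (∑ (size w) S) (size w t) }
  insert k S t len h | no ne with 0 <? ∑ (ends (y t)) S | 0 <? ∑ (ends (x t)) S
  insert k S t len h | no ne | no p | no q = record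
    { open-trails = t ∷ S ; settled = settled-cons t S ne (¬pos⇒≡0 _ q) (¬pos⇒≡0 _ p) h ; closed-fw = [] ; closed-bw = []
    ; closed-balance = λ φ → refl ; total = λ w → +-identityʳ _ }
  insert k S t len h | no ne | yes p | _ with ∑-pos-find (ends (y t)) S p
  ... | s , s∈ , s>0 with extract s∈ | attach t s
  ...   | S' , perm | inj₁ z = ⊥-elim (<-irrefl (sym z) s>0)
  insert zero S t len h | no ne | yes p | _ | s , s∈ , s>0 | S' , perm | inj₂ (u , su) with subst (_≤ 0) (↭-length perm) len
  ... | ()
  insert (suc k) S t len h | no ne | yes p | _ | s , s∈ , s>0 | S' , perm | inj₂ (u , su) =
    resettle (λ w → trans (cong (_+ ∑ (size w) S') (su w)) (trans (+-assoc (size w t) _ _) (cong (size w t +_) (sym (∑-↭ (size w) perm)))))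
      (insert k S' u (≤-pred (subst (_≤ suc k) (↭-length perm) len)) (settled-tail perm h))
  insert k S t len h | no ne | no _ | yes p with ∑-pos-find (ends (x t)) S p
  ... | s , s∈ , s>0 with extract s∈ | attach (flipTrail t) s
  ...   | S' , perm | inj₁ z = ⊥-elim (<-irrefl (sym z) s>0)
  insert zero S t len h | no ne | no _ | yes p | s , s∈ , s>0 | S' , perm | inj₂ (u , su) with subst (_≤ 0) (↭-length perm) len
  ... | ()
  insert (suc k) S t len h | no ne | no _ | yes p | s , s∈ , s>0 | S' , perm | inj₂ (u , su) =
    resettle (λ w → trans (cong (_+ ∑ (size w) S') (trans (su w) (cong (_+ size w s) (+-comm (∑ w (bw t)) _)))) (trans (+-assoc (size w t) _ _) (cong (size w t +_) (sym (∑-↭ (size w) perm)))))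
      (insert k S' u (≤-pred (subst (_≤ suc k) (↭-length perm) len)) (settled-tail perm h))

  settle : (es : List E) → Settlement (λ w → ∑ w es)
  settle [] = record { open-trails = [] ; settled = λ _ → z≤n ; closed-fw = [] ; closed-bw = [] ; closed-balance = λ _ → refl ; total = λ _ → refl }
  settle (e ∷ es) = record
    { open-trails = open-trails s' ; settled = settled s'
    ; closed-fw = closed-fw s' ++ closed-fw s ; closed-bw = closed-bw s' ++ closed-bw s
    ; closed-balance = bal ; total = tot }
    where
    s = settle es
    s' = insert _ (open-trails s) (single e) ≤-refl (settled s)
    bal : ∀ φ → outward (closed-fw s' ++ closed-fw s) (closed-bw s' ++ closed-bw s) φ ≡ inward (closed-fw s' ++ closed-fw s) (closed-bw s' ++ closed-bw s) φ
    bal φ rewrite ∑-++ (φ ∘ α) (closed-fw s') (closed-fw s) | ∑-++ (φ ∘ β) (closed-bw s') (closed-bw s)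
                | ∑-++ (φ ∘ β) (closed-fw s') (closed-fw s) | ∑-++ (φ ∘ α) (closed-bw s') (closed-bw s) =
      trans (l (∑ (φ ∘ α) (closed-fw s')) _ _ _) (trans (cong₂ _+_ (closed-balance s' φ) (closed-balance s φ)) (l (∑ (φ ∘ β) (closed-fw s')) _ _ _))
      where
      l : ∀ a b c d → a + b + (c + d) ≡ a + c + (b + d)
      l = solve-∀
    tot : ∀ w → ∑ (size w) (open-trails s') + (∑ w (closed-fw s' ++ closed-fw s) + ∑ w (closed-bw s' ++ closed-bw s)) ≡ w e + ∑ w es
    tot w rewrite ∑-++ w (closed-fw s') (closed-fw s) | ∑-++ w (closed-bw s') (closed-bw s) =
      trans (l (∑ (size w) (open-trails s')) (∑ w (closed-fw s')) (∑ w (closed-fw s)) (∑ w (closed-bw s')) _)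
        (trans (cong (_+ (∑ w (closed-fw s) + ∑ w (closed-bw s))) (total s' w)) (trans (l' (w e) (∑ (size w) (open-trails s)) (∑ w (closed-fw s)) (∑ w (closed-bw s))) (cong (w e +_) (total s w))))
      where
      l : ∀ a b c d e → a + (b + c + (d + e)) ≡ a + (b + d) + (c + e)
      l = solve-∀
      l' : ∀ a b c d → a + 0 + 0 + b + (c + d) ≡ a + (b + (c + d))
      l' = solve-∀

  -- An open trail is unbalanced only at its two ends, and in a settled list a label is an end at
  -- most once.
  settlement-balance : ∀ {w₀} (s : Settlement w₀) z →
    Near (∑ (λ t → outward (fw t) (bw t) (eq z)) (open-trails s)) (∑ (λ t → inward (fw t) (bw t) (eq z)) (open-trails s))
  settlement-balance s z = near-of-ends (trans (sym (∑-+ _ _ (open-trails s))) (trans (∑-cong (λ t → telescope t (eq z)) (open-trails s)) (∑-+ _ _ (open-trails s))))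
    (≤-trans (≤-reflexive (sym (∑-+ _ _ (open-trails s)))) (settled s z))

-- The edges in `back` are to be reversed. Both tiers matter: labels (`fine`), so that about half of
-- every group points each way, and vertices (`coarse`), so that even degrees turn near balance into
-- an eulerian digraph.
record Direction {E X Y : Set} (α β : E → X) (γ : X → Y) (eqX : X → X → ℕ) (eqY : Y → Y → ℕ) (es : List E) : Set where
  field
    forw back : List E
    total : ∀ w → ∑ w forw + ∑ w back ≡ ∑ w es
    forw⊆ : ∀ {e} → e ∈ forw → e ∈ es
    back⊆ : ∀ {e} → e ∈ back → e ∈ es
    fine : ∀ z → Near (∑ (eqX z ∘ α) forw + ∑ (eqX z ∘ β) back) (∑ (eqX z ∘ β) forw + ∑ (eqX z ∘ α) back)
    coarse : ∀ u → Near (∑ (eqY u ∘ γ ∘ α) forw + ∑ (eqY u ∘ γ ∘ β) back) (∑ (eqY u ∘ γ ∘ β) forw + ∑ (eqY u ∘ γ ∘ α) back)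

-- First glue at equal labels, then glue the remaining trails at labels with equal image under γ.
module TwoTier {E X Y : Set} (_≟X_ : DecidableEquality X) (_≟Y_ : DecidableEquality Y) (γ : X → Y) (α β : E → X) (es : List E) where
  module T₁ = Trails _≟X_ α β
  S₁ = T₁.settle es
  module T₂ = Trails {T₁.Trail} _≟Y_ (γ ∘ T₁.x) (γ ∘ T₁.y)
  S₂ = T₂.settle (T₁.open-trails S₁)
  eqX = Distinct.eq _≟X_
  eqY = Distinct.eq _≟Y_

  up down : List T₁.Trail
  up   = T₂.closed-fw S₂ ++ concatMap T₂.fw (T₂.open-trails S₂)
  down = T₂.closed-bw S₂ ++ concatMap T₂.bw (T₂.open-trails S₂)

  ∑-up : ∀ w → ∑ w up ≡ ∑ w (T₂.closed-fw S₂) + ∑ (λ t → ∑ w (T₂.fw t)) (T₂.open-trails S₂)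
  ∑-up w = trans (∑-++ w (T₂.closed-fw S₂) _) (cong (∑ w (T₂.closed-fw S₂) +_) (∑-concatMap w T₂.fw (T₂.open-trails S₂)))

  ∑-down : ∀ w → ∑ w down ≡ ∑ w (T₂.closed-bw S₂) + ∑ (λ t → ∑ w (T₂.bw t)) (T₂.open-trails S₂)
  ∑-down w = trans (∑-++ w (T₂.closed-bw S₂) _) (cong (∑ w (T₂.closed-bw S₂) +_) (∑-concatMap w T₂.bw (T₂.open-trails S₂)))

  ∑-updown : ∀ w → ∑ w up + ∑ w down ≡ ∑ w (T₁.open-trails S₁)
  ∑-updown w = trans (cong₂ _+_ (∑-up w) (∑-down w)) (trans (l (∑ w (T₂.closed-fw S₂)) (∑ (λ t → ∑ w (T₂.fw t)) (T₂.open-trails S₂)) (∑ w (T₂.closed-bw S₂)) (∑ (λ t → ∑ w (T₂.bw t)) (T₂.open-trails S₂)))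
    (trans (cong (_+ (∑ w (T₂.closed-fw S₂) + ∑ w (T₂.closed-bw S₂))) (sym (∑-+ (λ t → ∑ w (T₂.fw t)) (λ t → ∑ w (T₂.bw t)) (T₂.open-trails S₂)))) (T₂.total S₂ w)))
    where
    l : ∀ a b c d → a + b + (c + d) ≡ b + d + (a + c)
    l = solve-∀

  forw back : List E
  forw = T₁.closed-fw S₁ ++ (concatMap T₁.fw up ++ concatMap T₁.bw down)
  back = T₁.closed-bw S₁ ++ (concatMap T₁.bw up ++ concatMap T₁.fw down)

  ∑-forw : ∀ w → ∑ w forw ≡ ∑ w (T₁.closed-fw S₁) + (∑ (λ t → ∑ w (T₁.fw t)) up + ∑ (λ t → ∑ w (T₁.bw t)) down)
  ∑-forw w = trans (∑-++ w (T₁.closed-fw S₁) _) (cong (∑ w (T₁.closed-fw S₁) +_)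
    (trans (∑-++ w (concatMap T₁.fw up) _) (cong₂ _+_ (∑-concatMap w T₁.fw up) (∑-concatMap w T₁.bw down))))

  ∑-back : ∀ w → ∑ w back ≡ ∑ w (T₁.closed-bw S₁) + (∑ (λ t → ∑ w (T₁.bw t)) up + ∑ (λ t → ∑ w (T₁.fw t)) down)
  ∑-back w = trans (∑-++ w (T₁.closed-bw S₁) _) (cong (∑ w (T₁.closed-bw S₁) +_)
    (trans (∑-++ w (concatMap T₁.bw up) _) (cong₂ _+_ (∑-concatMap w T₁.bw up) (∑-concatMap w T₁.fw down))))

  total : ∀ w → ∑ w forw + ∑ w back ≡ ∑ w es
  total w = trans (cong₂ _+_ (∑-forw w) (∑-back w)) (trans (l (∑ w (T₁.closed-fw S₁)) (∑ (λ t → ∑ w (T₁.fw t)) up) (∑ (λ t → ∑ w (T₁.bw t)) down) (∑ w (T₁.closed-bw S₁)) (∑ (λ t → ∑ w (T₁.bw t)) up) (∑ (λ t → ∑ w (T₁.fw t)) down))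
    (trans (cong₂ (λ a b → a + b + (∑ w (T₁.closed-fw S₁) + ∑ w (T₁.closed-bw S₁)))
      (sym (∑-+ (λ t → ∑ w (T₁.fw t)) (λ t → ∑ w (T₁.bw t)) up)) (sym (∑-+ (λ t → ∑ w (T₁.fw t)) (λ t → ∑ w (T₁.bw t)) down)))
    (trans (cong (_+ (∑ w (T₁.closed-fw S₁) + ∑ w (T₁.closed-bw S₁))) (∑-updown (T₁.size w))) (T₁.total S₁ w))))
    where
    l : ∀ a b c d e f → a + (b + c) + (d + (e + f)) ≡ b + e + (f + c) + (a + d)
    l = solve-∀

  outφ inφ : (X → ℕ) → ℕ
  outφ φ = ∑ (φ ∘ α) forw + ∑ (φ ∘ β) back
  inφ  φ = ∑ (φ ∘ β) forw + ∑ (φ ∘ α) back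

  balance : ∀ φ → outφ φ + (∑ (φ ∘ T₁.y) up + ∑ (φ ∘ T₁.x) down) ≡ inφ φ + (∑ (φ ∘ T₁.x) up + ∑ (φ ∘ T₁.y) down)
  balance φ = trans (cong (_+ (∑ (φ ∘ T₁.y) up + ∑ (φ ∘ T₁.x) down)) (cong₂ _+_ (∑-forw (φ ∘ α)) (∑-back (φ ∘ β))))
    (trans (l (∑ (φ ∘ α) (T₁.closed-fw S₁)) (fu α) (bd α) (∑ (φ ∘ β) (T₁.closed-bw S₁)) (bu β) (fd β) (∑ (φ ∘ T₁.y) up) (∑ (φ ∘ T₁.x) down))
    (trans (cong₂ _+_ (T₁.closed-balance S₁ φ) (cong₂ _+_ upward downward))
    (trans (sym (l (∑ (φ ∘ β) (T₁.closed-fw S₁)) (fu β) (bd β) (∑ (φ ∘ α) (T₁.closed-bw S₁)) (bu α) (fd α) (∑ (φ ∘ T₁.x) up) (∑ (φ ∘ T₁.y) down)))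
    (sym (cong (_+ (∑ (φ ∘ T₁.x) up + ∑ (φ ∘ T₁.y) down)) (cong₂ _+_ (∑-forw (φ ∘ β)) (∑-back (φ ∘ α))))))))
    where
    fu bu fd bd : (E → X) → ℕ
    fu ε = ∑ (λ t → ∑ (φ ∘ ε) (T₁.fw t)) up
    bu ε = ∑ (λ t → ∑ (φ ∘ ε) (T₁.bw t)) up
    fd ε = ∑ (λ t → ∑ (φ ∘ ε) (T₁.fw t)) down
    bd ε = ∑ (λ t → ∑ (φ ∘ ε) (T₁.bw t)) down
    l : ∀ a b c d e f g h → a + (b + c) + (d + (e + f)) + (g + h) ≡ a + d + (b + e + g + (f + c + h))
    l = solve-∀
    three : ∀ (f g h : T₁.Trail → ℕ) ts → ∑ (λ t → f t + g t + h t) ts ≡ ∑ f ts + ∑ g ts + ∑ h ts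
    three f g h ts = trans (∑-+ (λ t → f t + g t) h ts) (cong (_+ ∑ h ts) (∑-+ f g ts))
    fc bc : (E → X) → T₁.Trail → ℕ
    fc ε t = ∑ (φ ∘ ε) (T₁.fw t)
    bc ε t = ∑ (φ ∘ ε) (T₁.bw t)
    upward : fu α + bu β + ∑ (φ ∘ T₁.y) up ≡ fu β + bu α + ∑ (φ ∘ T₁.x) up
    upward = trans (sym (three (fc α) (bc β) (φ ∘ T₁.y) up)) (trans (∑-cong (λ t → T₁.telescope t φ) up) (three (fc β) (bc α) (φ ∘ T₁.x) up))
    downward : fd β + bd α + ∑ (φ ∘ T₁.x) down ≡ fd α + bd β + ∑ (φ ∘ T₁.y) down
    downward = trans (sym (three (fc β) (bc α) (φ ∘ T₁.x) down)) (trans (∑-cong (λ t → sym (T₁.telescope t φ)) down) (three (fc α) (bc β) (φ ∘ T₁.y) down))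

  fine : ∀ z → Near (outφ (eqX z)) (inφ (eqX z))
  fine z = near-of-ends (balance (eqX z)) (≤-trans (≤-reflexive (trans (l (∑ (eqX z ∘ T₁.x) up) (∑ (eqX z ∘ T₁.y) down) (∑ (eqX z ∘ T₁.y) up) (∑ (eqX z ∘ T₁.x) down))
      (trans (cong₂ _+_ (sym (∑-+ (eqX z ∘ T₁.x) (eqX z ∘ T₁.y) up)) (sym (∑-+ (eqX z ∘ T₁.x) (eqX z ∘ T₁.y) down)))
      (∑-updown (T₁.ends z))))) (T₁.settled S₁ z))
    where
    l : ∀ a b c d → a + b + (c + d) ≡ a + c + (d + b)
    l = solve-∀

  -- Potentials telescope along the trails of the first tier, so only their ends count at `u`; the
  -- trails of the second tier balance these ends up to one.
  coarse : ∀ u → Near (outφ (eqY u ∘ γ)) (inφ (eqY u ∘ γ))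
  coarse u = near-shift (balance (eqY u ∘ γ)) ends-near
    where
    φ = eqY u ∘ γ
    ends-near : Near (∑ (φ ∘ T₁.x) up + ∑ (φ ∘ T₁.y) down) (∑ (φ ∘ T₁.y) up + ∑ (φ ∘ T₁.x) down)
    ends-near = subst₂ Near
      (sym (trans (cong₂ _+_ (∑-up (φ ∘ T₁.x)) (∑-down (φ ∘ T₁.y))) (trans (l (cf T₁.x) (fo T₁.x) (cb T₁.y) (bo T₁.y)) (cong₂ _+_ (T₂.closed-balance S₂ (eqY u)) (sym (∑-+ (λ t → ∑ (φ ∘ T₁.x) (T₂.fw t)) (λ t → ∑ (φ ∘ T₁.y) (T₂.bw t)) (T₂.open-trails S₂)))))))
      (sym (trans (cong₂ _+_ (∑-up (φ ∘ T₁.y)) (∑-down (φ ∘ T₁.x))) (trans (l (cf T₁.y) (fo T₁.y) (cb T₁.x) (bo T₁.x)) (cong (cf T₁.y + cb T₁.x +_) (sym (∑-+ (λ t → ∑ (φ ∘ T₁.y) (T₂.fw t)) (λ t → ∑ (φ ∘ T₁.x) (T₂.bw t)) (T₂.open-trails S₂)))))))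
      (near-+ (cf T₁.y + cb T₁.x) (T₂.settlement-balance S₂ u))
      where
      cf cb fo bo : (T₁.Trail → X) → ℕ
      cf ε = ∑ (φ ∘ ε) (T₂.closed-fw S₂)
      cb ε = ∑ (φ ∘ ε) (T₂.closed-bw S₂)
      fo ε = ∑ (λ t → ∑ (φ ∘ ε) (T₂.fw t)) (T₂.open-trails S₂)
      bo ε = ∑ (λ t → ∑ (φ ∘ ε) (T₂.bw t)) (T₂.open-trails S₂)
      l : ∀ a b c d → a + b + (c + d) ≡ a + c + (b + d)
      l = solve-∀
      near-+ : ∀ c {a b} → Near a b → Near (c + a) (c + b)
      near-+ c (p , q) = ≤-trans (+-monoʳ-≤ c p) (≤-reflexive (+-suc c _)) , ≤-trans (+-monoʳ-≤ c q) (≤-reflexive (+-suc c _))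
    near-shift : ∀ {o i p q} → o + q ≡ i + p → Near p q → Near o i
    near-shift {o} {i} {p} {q} e (h₁ , h₂) =
      ≤-of-slack 0 (+-mono-≤ (≤-reflexive e) h₁) (k₁ o i p q) , ≤-of-slack 0 (+-mono-≤ (≤-reflexive (sym e)) h₂) (k₂ o i p q)
      where
      k₁ : ∀ o i p q → o + (i + p + suc q) + 0 ≡ suc i + (o + q + p)
      k₁ = solve-∀
      k₂ : ∀ o i p q → i + (o + q + suc p) + 0 ≡ suc o + (i + p + q)
      k₂ = solve-∀

module _ {E X Y : Set} (_≟X_ : DecidableEquality X) (_≟Y_ : DecidableEquality Y) (γ : X → Y) (α β : E → X) where

  -- Without decidable equality on `E`, membership cannot be read off from identities between sums.
  -- Positions in `es` are directed instead, and every position looks up to a member.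
  direct : (es : List E) → Direction α β γ (Distinct.eq _≟X_) (Distinct.eq _≟Y_) es
  direct es = record
    { forw = map (lookup es) Co.forw ; back = map (lookup es) Co.back
    ; total = λ w → trans (cong₂ _+_ (∑-map w (lookup es) Co.forw) (∑-map w (lookup es) Co.back)) (trans (Co.total (w ∘ lookup es)) (∑-lookup w es))
    ; forw⊆ = sub Co.forw ; back⊆ = sub Co.back
    ; fine = λ z → subst₂ Near (two (Co.eqX z ∘ α) (Co.eqX z ∘ β)) (two (Co.eqX z ∘ β) (Co.eqX z ∘ α)) (Co.fine z)
    ; coarse = λ u → subst₂ Near (two (Co.eqY u ∘ γ ∘ α) (Co.eqY u ∘ γ ∘ β)) (two (Co.eqY u ∘ γ ∘ β) (Co.eqY u ∘ γ ∘ α)) (Co.coarse u) }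
    where
    module Co = TwoTier _≟X_ _≟Y_ γ (α ∘ lookup es) (β ∘ lookup es) (allFin (length es))
    sub : ∀ is {e} → e ∈ map (lookup es) is → e ∈ es
    sub is e∈ with ∈-map⁻ (lookup es) e∈
    ... | i , _ , refl = ∈-lookup i
    two : ∀ (f g : E → ℕ) → ∑ (f ∘ lookup es) Co.forw + ∑ (g ∘ lookup es) Co.back ≡ ∑ f (map (lookup es) Co.forw) + ∑ g (map (lookup es) Co.back)
    two f g = cong₂ _+_ (sym (∑-map f (lookup es) Co.forw)) (sym (∑-map g (lookup es) Co.back))

-- Spanning arborescences of balanced digraphs

bit : Bool → ℕ
bit true  = 1
bit false = 0

bit-injective : ∀ {a b} → bit a ≡ bit b → a ≡ b
bit-injective {true}  {true}  _ = refl
bit-injective {false} {false} _ = refl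

bit≤1 : ∀ b → bit b ≤ 1
bit≤1 true  = ≤-refl
bit≤1 false = z≤n

∑-≤-tight : (f g : A → ℕ) (xs : List A) → All (λ x → f x ≤ g x) xs → ∑ f xs ≡ ∑ g xs → All (λ x → f x ≡ g x) xs
∑-≤-tight f g []       []       _ = []
∑-≤-tight f g (x ∷ xs) (h ∷ hs) e = fx≡gx ∷ ∑-≤-tight f g xs hs (+-cancelˡ-≡ (f x) _ _ (trans e (cong (_+ ∑ g xs) (sym fx≡gx))))
  where
  fx≡gx : f x ≡ g x
  fx≡gx = ≤-antisym h (+-cancelʳ-≤ (∑ g xs) (g x) (f x) (≤-trans (≤-reflexive (sym e)) (+-monoʳ-≤ (f x) (∑-mono-All hs))))

eqV : ∀ {n} → Fin n → Fin n → ℕ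
eqV x y = ind (x FinP.≟ y)

eqV-refl : ∀ {n} (x : Fin n) → eqV x x ≡ 1
eqV-refl x = ind-yes (x FinP.≟ x) refl

eqV-sym : ∀ {n} (x y : Fin n) → eqV x y ≡ eqV y x
eqV-sym x y = ind-cong (x FinP.≟ y) (y FinP.≟ x) sym sym

∑-point : ∀ {n} (f : Fin n → ℕ) q → ∑ (λ p → eqV p q * f p) (allFin n) ≡ f q
∑-point {n} f q = trans (∑-cong (λ p → Distinct.eq-* FinP._≟_ f p q) (allFin n))
  (trans (∑-*ʳ (f q) (λ p → eqV p q) (allFin n)) (trans (cong (_* f q) (∑-eq-Fin q)) (*-identityˡ _)))

∑-by-vertex : ∀ {n} {E : Set} (s : E → Fin n) (f : Fin n → ℕ) (H : List E) →
              ∑ (λ e → f (s e)) H ≡ ∑ (λ y → f y * ∑ (λ e → eqV y (s e)) H) (allFin n)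
∑-by-vertex {n} s f H = begin
  ∑ (λ e → f (s e)) H                                    ≡⟨ ∑-cong (λ e → sym (∑-point f (s e))) H ⟩
  ∑ (λ e → ∑ (λ y → eqV y (s e) * f y) (allFin n)) H      ≡⟨ ∑-swap _ H (allFin n) ⟩
  ∑ (λ y → ∑ (λ e → eqV y (s e) * f y) H) (allFin n)      ≡⟨ ∑-cong (λ y → trans (∑-*ʳ (f y) (λ e → eqV y (s e)) H) (*-comm _ (f y))) (allFin n) ⟩
  ∑ (λ y → f y * ∑ (λ e → eqV y (s e)) H) (allFin n)      ∎
  where open ≡-Reasoning

Closed : ∀ {n} {E : Set} → (E → Fin n) → (E → Fin n) → List E → (Fin n → Bool) → Set
Closed s t H R = All (λ e → R (s e) ≡ R (t e)) H

-- Connectedness is expressed by the absence of nontrivial cuts.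
Joined : ∀ {n} {E : Set} → (E → Fin n) → (E → Fin n) → List E → Set
Joined s t H = ∀ R → Closed s t H R → ∀ x y → R x ≡ R y

module Arborescence {n : ℕ} {E : Set} (s t : E → Fin n) (H : List E) (joined : Joined s t H)
  (balanced : ∀ y → ∑ (λ e → eqV y (s e)) H ≡ ∑ (λ e → eqV y (t e)) H) (root : Fin n) where

  private
    cross : (Fin n → Bool) → E → ℕ
    cross R e = bit (R (s e)) ∸ bit (R (t e))

    cross⇒ : ∀ a b → 0 < bit a ∸ bit b → a ≡ true × b ≡ false
    cross⇒ true  false _ = refl , refl
    cross⇒ true  true  ()
    cross⇒ false true  ()
    cross⇒ false false ()

    record Grown : Set where
      field
        reached   : Fin n → Bool
        tree rest : List E
        perm      : H ↭ tree ++ rest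
        -- Stronger than the bound 1 that is wanted in the end: no tree arc enters an unreached
        -- vertex, so `grow` may add one.
        heads     : ∀ y → ∑ (λ e → eqV y (t e)) tree ≤ bit (reached y)
        linked    : ∀ Q → Closed s t tree Q → ∀ y → reached y ≡ true → Q y ≡ Q root
    open Grown

    missing : Grown → ℕ
    missing g = ∑ (λ y → 1 ∸ bit (reached g y)) (allFin n)

    start : Grown
    start = record { reached = λ y → eqᵇ y ; tree = [] ; rest = H ; perm = ↭-refl ; heads = λ _ → z≤n
                   ; linked = λ Q _ y e → cong Q (eqᵇ-sound y e) }
      where
      eqᵇ : Fin n → Bool
      eqᵇ y with y FinP.≟ root
      ... | yes _ = true
      ... | no _  = false
      eqᵇ-sound : ∀ y → eqᵇ y ≡ true → y ≡ root
      eqᵇ-sound y e with y FinP.≟ root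
      eqᵇ-sound y e  | yes p = p
      eqᵇ-sound y () | no _

    root-reached : reached start root ≡ true
    root-reached with root FinP.≟ root
    ... | yes _ = refl
    ... | no ¬p = ⊥-elim (¬p refl)

    grow : (g : Grown) → ∀ {e rest'} → rest g ↭ e ∷ rest' → reached g (s e) ≡ true → reached g (t e) ≡ false →
           Σ Grown λ g' → missing g' < missing g × (∀ y → reached g y ≡ true → reached g' y ≡ true)
    grow g {e} {rest'} p rs rt = g' , fewer , R⊆
      where
      R' : Fin n → Bool
      R' y with y FinP.≟ t e
      ... | yes _ = true
      ... | no _  = reached g y
      R⊆ : ∀ y → reached g y ≡ true → R' y ≡ true
      R⊆ y h with y FinP.≟ t e
      ... | yes _ = refl
      ... | no _  = h
      hd : ∀ y → ∑ (λ e → eqV y (t e)) (e ∷ tree g) ≤ bit (R' y)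
      hd y with y FinP.≟ t e
      ... | yes refl = s≤s (≤-trans (heads g y) (≤-reflexive (cong bit rt)))
      ... | no _     = heads g y
      lk : ∀ Q → Closed s t (e ∷ tree g) Q → ∀ y → R' y ≡ true → Q y ≡ Q root
      lk Q (q ∷ qs) y h with y FinP.≟ t e
      ... | yes refl = trans (sym q) (linked g Q qs (s e) rs)
      ... | no _     = linked g Q qs y h
      g' : Grown
      g' = record { reached = R' ; tree = e ∷ tree g ; rest = rest'
                  ; perm = ↭-trans (perm g) (↭-trans (++⁺ˡ (tree g) p) (shift e (tree g) rest')) ; heads = hd ; linked = lk }
      newcomer : ∀ y → eqV y (t e) + (1 ∸ bit (R' y)) ≤ 1 ∸ bit (reached g y)
      newcomer y with y FinP.≟ t e
      ... | yes refl rewrite rt = ≤-refl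
      ... | no _ = ≤-refl
      fewer : missing g' < missing g
      fewer = ≤-trans (≤-reflexive (sym (trans (∑-+ (λ y → eqV y (t e)) (λ y → 1 ∸ bit (R' y)) (allFin n)) (cong (_+ missing g') (∑-eq-Fin (t e))))))
                (∑-mono newcomer (allFin n))

    -- If no arc leaves the reached set, then `bit ∘ R` at the source is at most its value at the
    -- target for every arc. Balance makes the sums of both sides equal, hence equality holds
    -- termwise: no arc enters either, and `R` is a trivial cut.
    stuck⇒all : (g : Grown) → ∑ (cross (reached g)) (rest g) ≡ 0 → reached g root ≡ true → ∀ y → reached g y ≡ true
    stuck⇒all g none r y = trans (joined (reached g) closed y root) r
      where
      R = reached g
      tree-cross : All (λ e → bit (R (s e)) ≤ bit (R (t e))) (tree g)
      tree-cross = All.tabulate (λ {e} e∈ → ≤-trans (bit≤1 (R (s e)))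
        (≤-trans (≤-trans (≤-reflexive (sym (eqV-refl (t e)))) (∑-∈ (λ f → eqV (t e) (t f)) e∈)) (heads g (t e))))
      rest-cross : All (λ e → bit (R (s e)) ≤ bit (R (t e))) (rest g)
      rest-cross = All.map (λ {e} → m∸n≡0⇒m≤n) (∑-zero⁻ (cross R) none)
      closed : Closed s t H R
      closed = All.map bit-injective (∑-≤-tight (λ e → bit (R (s e))) (λ e → bit (R (t e))) H
        (All-resp-↭ (↭-sym (perm g)) (AllP.++⁺ tree-cross rest-cross))
        (trans (∑-by-vertex s (bit ∘ R) H) (trans (∑-cong (λ y → cong (bit (R y) *_) (balanced y)) (allFin n)) (sym (∑-by-vertex t (bit ∘ R) H)))))

    spread : ∀ k (g : Grown) → missing g ≤ k → reached g root ≡ true → Σ Grown λ g' → ∀ y → reached g' y ≡ true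
    spread k g le r with 0 <? ∑ (cross (reached g)) (rest g)
    ... | no ¬p = g , stuck⇒all g (¬pos⇒≡0 _ ¬p) r
    ... | yes p with ∑-pos-find (cross (reached g)) (rest g) p
    ...   | e , e∈ , c with extract e∈ | cross⇒ (reached g (s e)) (reached g (t e)) c
    ...     | rest' , q | rs , rt with grow g q rs rt
    spread zero    g le r | yes p | e , e∈ , c | rest' , q | rs , rt | g' , lt , R⊆ = ⊥-elim (<-irrefl refl (<-≤-trans (≤-<-trans z≤n lt) le))
    spread (suc k) g le r | yes p | e , e∈ , c | rest' , q | rs , rt | g' , lt , R⊆ = spread k g' (≤-pred (≤-trans lt le)) (R⊆ root r)

  arborescence : Σ (List E) λ tree → Σ (List E) λ rest →
    H ↭ tree ++ rest × (∀ y → ∑ (λ e → eqV y (t e)) tree ≤ 1) × Joined s t tree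
  arborescence with spread _ start ≤-refl root-reached
  ... | g , all = tree g , rest g , perm g , (λ y → ≤-trans (heads g y) (bit≤1 _)) ,
    λ Q c x y → trans (linked g Q c x (all x)) (sym (linked g Q c y (all y)))

-- Path graphs

module _ {n : ℕ} where

  mult : Fin n → List (Fin n) → ℕ
  mult p = ∑ (eqV p)

  inter : List (Fin n) → List (Fin n) → ℕ
  inter xs ys = ∑ (λ p → mult p ys) xs

  inter-sym : ∀ xs ys → inter xs ys ≡ inter ys xs
  inter-sym xs ys = trans (∑-swap eqV xs ys) (∑-cong (λ q → ∑-cong (λ p → eqV-sym p q) xs) ys)

  mult-∈ : ∀ {p xs} → p ∈ xs → 1 ≤ mult p xs
  mult-∈ {p} {xs} p∈ = ≤-trans (≤-reflexive (sym (eqV-refl p))) (∑-∈ (eqV p) p∈)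

  mult-pos : ∀ {p} xs → 0 < mult p xs → p ∈ xs
  mult-pos {p} xs pos with ∑-pos-find (eqV p) xs pos
  ... | q , q∈ , h with ind-pos (p FinP.≟ q) h
  ...   | refl = q∈

  mult-reverse : ∀ p xs → mult p (reverse xs) ≡ mult p xs
  mult-reverse p xs = ∑-↭ (eqV p) (↭-reverse xs)

  inter-zero : ∀ {p} xs ys → inter xs ys ≡ 0 → 0 < mult p xs → mult p ys ≡ 0
  inter-zero xs ys e pos = All.lookup (∑-zero⁻ (λ p → mult p ys) e) (mult-pos xs pos)

  ∑-mult : ∀ xs → ∑ (λ p → mult p xs) (allFin n) ≡ length xs
  ∑-mult xs = trans (∑-swap eqV (allFin n) xs) (trans (∑-cong ∑-eq-Fin xs) (∑-ones xs))

  stepWeight : Fin n → Fin n → Fin n → Fin n → ℕ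
  stepWeight x y a b = eqV x a * eqV y b + eqV x b * eqV y a

  -- Counts how often a vertex sequence traverses the edge between `x` and `y`, in either direction.
  -- Equality of this count with the adjacency bit expresses both that paths partition the edges and
  -- that a closed walk is an eulerian tour.
  occ : Fin n → Fin n → List (Fin n) → ℕ
  occ x y []          = 0
  occ x y (a ∷ [])    = 0
  occ x y (a ∷ b ∷ r) = stepWeight x y a b + occ x y (b ∷ r)

  occ-split : ∀ x y xs a ys → occ x y (xs ++ a ∷ ys) ≡ occ x y (xs ++ a ∷ []) + occ x y (a ∷ ys)
  occ-split x y []           a ys = refl
  occ-split x y (b ∷ [])     a ys = cong (_+ occ x y (a ∷ ys)) (sym (+-identityʳ (stepWeight x y b a)))
  occ-split x y (b ∷ c ∷ xs) a ys = trans (cong (stepWeight x y b c +_) (occ-split x y (c ∷ xs) a ys)) (sym (+-assoc (stepWeight x y b c) _ _))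

  occ-reverse : ∀ x y xs → occ x y (reverse xs) ≡ occ x y xs
  occ-reverse x y []           = refl
  occ-reverse x y (a ∷ [])     = refl
  occ-reverse x y (a ∷ b ∷ xs) = begin
    occ x y (reverse (a ∷ b ∷ xs))        ≡⟨ cong (occ x y) (trans (unfold-reverse a (b ∷ xs)) (trans (cong (_++ a ∷ []) (unfold-reverse b xs)) (++-assoc (reverse xs) _ _))) ⟩
    occ x y (reverse xs ++ b ∷ a ∷ [])    ≡⟨ occ-split x y (reverse xs) b (a ∷ []) ⟩
    occ x y (reverse xs ++ b ∷ []) + (stepWeight x y b a + 0) ≡⟨ cong₂ _+_ (trans (cong (occ x y) (sym (unfold-reverse b xs))) (occ-reverse x y (b ∷ xs))) (trans (+-identityʳ _) (+-comm (eqV x b * eqV y a) _)) ⟩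
    occ x y (b ∷ xs) + stepWeight x y a b ≡⟨ +-comm (occ x y (b ∷ xs)) _ ⟩
    occ x y (a ∷ b ∷ xs)                  ∎
    where open ≡-Reasoning

-- A label names a group of path ends at the vertex `vOf`. Its level `lev` will be a lower bound for
-- the number of interior vertices of the paths in the group. The type of labels changes with every
-- stage.
record Labels (n : ℕ) : Set₁ where
  field
    Lab  : Set
    _≟L_ : DecidableEquality Lab
    vOf  : Lab → Fin n
    lev  : Lab → ℕ

-- After a stage the label inj₁ a carries the kept ends of the old group a, and inj₂ a the
-- ends of a whose paths were prolonged.
raise : ∀ {n} → Labels n → Labels n
raise Λ = record
  { Lab = Lab ⊎ Lab ; _≟L_ = SumP.≡-dec _≟L_ _≟L_
  ; vOf = λ { (inj₁ a) → vOf a ; (inj₂ a) → vOf a }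
  ; lev = λ { (inj₁ a) → lev a ; (inj₂ a) → suc (lev a) } }
  where open Labels Λ

module PathGraph {n : ℕ} (Λ : Labels n) where
  open Labels Λ public
  open Distinct _≟L_ public using () renaming (eq to eqL; eq-refl to eqL-refl; eq-sym to eqL-sym)

  record Edge : Set where
    constructor mkEdge
    field
      l₀  : Lab
      int : List (Fin n)
      l₁  : Lab
  open Edge public

  src tgt : Edge → Fin n
  src e = vOf (l₀ e)
  tgt e = vOf (l₁ e)

  front verts : Edge → List (Fin n)
  front e = src e ∷ int e
  verts e = front e ++ tgt e ∷ []

  flip : Edge → Edge
  flip (mkEdge a i b) = mkEdge b (reverse i) a

  endL : Lab → Edge → ℕ
  endL a e = eqL a (l₀ e) + eqL a (l₁ e)

  endV : Fin n → Edge → ℕ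
  endV y e = eqV y (src e) + eqV y (tgt e)

  record Valid (L : ℕ) (e : Edge) : Set where
    field
      simple    : ∀ p → mult p (verts e) ≤ 1
      sameLevel : lev (l₀ e) ≡ lev (l₁ e)
      levelLow  : lev (l₀ e) ≤ length (int e)
      short     : length (int e) ≤ L
  open Valid public

  record Good (adj : Fin n → Fin n → ℕ) (L M lo hi : ℕ) (H : List Edge) : Set where
    field
      valid     : All (Valid L) H
      joined    : Joined src tgt H
      even      : ∀ y → 2 ∣ ∑ (endV y) H
      covers    : ∀ x y → ∑ (λ e → occ x y (verts e)) H ≡ adj x y
      conflict  : ∀ a p → p ≢ vOf a → ∑ (λ e → endL a e * mult p (verts e)) H ≤ M
      groupHigh : ∀ a → ∑ (endL a) H ≤ hi
      -- Many labels of the type are borne by no end, so the lower bound can be asked of nonempty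
      -- groups only.
      groupLow  : ∀ a → 0 < ∑ (endL a) H → lo ≤ ∑ (endL a) H
  open Good public

  mult-verts : ∀ p e → mult p (verts e) ≡ mult p (front e) + eqV p (tgt e)
  mult-verts p e = trans (∑-++ (eqV p) (front e) _) (cong (mult p (front e) +_) (+-identityʳ _))

  mult-front≤ : ∀ p e → mult p (front e) ≤ mult p (verts e)
  mult-front≤ p e = ≤-trans (m≤m+n _ _) (≤-reflexive (sym (mult-verts p e)))

  tgt∉front : ∀ {L e} → Valid L e → mult (tgt e) (front e) ≡ 0
  tgt∉front {e = e} v = ≤0⇒≡0 (≤-pred (≤-trans (≤-reflexive (trans (+-comm 1 _) (trans (cong (mult (tgt e) (front e) +_) (sym (eqV-refl (tgt e)))) (sym (mult-verts (tgt e) e))))) (simple v (tgt e))))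

  src≢tgt : ∀ {L e} → Valid L e → src e ≢ tgt e
  src≢tgt {e = e} v h = <-irrefl (sym (tgt∉front v)) (subst (λ z → 1 ≤ mult z (front e)) h (mult-∈ {p = src e} {xs = front e} (here refl)))

  verts-flip : ∀ e → verts (flip e) ≡ reverse (verts e)
  verts-flip (mkEdge a i b) = sym (trans (unfold-reverse (vOf a) (i ++ vOf b ∷ [])) (cong (_++ vOf a ∷ []) (reverse-++ i (vOf b ∷ []))))

  mult-flip : ∀ p e → mult p (verts (flip e)) ≡ mult p (verts e)
  mult-flip p e = trans (cong (mult p) (verts-flip e)) (mult-reverse p (verts e))

  occ-flip : ∀ x y e → occ x y (verts (flip e)) ≡ occ x y (verts e)
  occ-flip x y e = trans (cong (occ x y) (verts-flip e)) (occ-reverse x y (verts e))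

  endL-flip : ∀ a e → endL a (flip e) ≡ endL a e
  endL-flip a e = +-comm (eqL a (l₁ e)) _

  endV-flip : ∀ y e → endV y (flip e) ≡ endV y e
  endV-flip y e = +-comm (eqV y (tgt e)) _

  length-reverse' : ∀ (xs : List (Fin n)) → length (reverse xs) ≡ length xs
  length-reverse' xs = ↭-length (↭-reverse xs)

  valid-flip : ∀ {L e} → Valid L e → Valid L (flip e)
  valid-flip {L} {e} v = record
    { simple = λ p → ≤-trans (≤-reflexive (mult-flip p e)) (simple v p)
    ; sameLevel = sym (sameLevel v)
    ; levelLow = ≤-trans (≤-reflexive (sym (sameLevel v))) (≤-trans (levelLow v) (≤-reflexive (sym (length-reverse' (int e)))))
    ; short = ≤-trans (≤-reflexive (length-reverse' (int e))) (short v) }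

  record Oriented (H : List Edge) : Set where
    field
      arcs    : List Edge
      origin  : ∀ {e} → e ∈ arcs → e ∈ H ⊎ (∃ λ e' → e' ∈ H × e ≡ flip e')
      flipSum : ∀ (w : Edge → ℕ) → (∀ e → w (flip e) ≡ w e) → ∑ w arcs ≡ ∑ w H
      labelBalance  : ∀ a → Near (∑ (λ e → eqL a (l₀ e)) arcs) (∑ (λ e → eqL a (l₁ e)) arcs)
      vertexBalance : ∀ y → Near (∑ (λ e → eqV y (src e)) arcs) (∑ (λ e → eqV y (tgt e)) arcs)

  balance : ∀ H → Oriented H
  balance H = record
    { arcs = D.forw ++ map flip D.back
    ; origin = orig
    ; flipSum = λ w inv → trans (∑-arcs w) (trans (cong (∑ w D.forw +_) (∑-cong inv D.back)) (D.total w))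
    ; labelBalance = λ a → subst₂ Near (sym (∑-arcs (λ e → eqL a (l₀ e)))) (sym (∑-arcs (λ e → eqL a (l₁ e)))) (D.fine a)
    ; vertexBalance = λ y → subst₂ Near (sym (∑-arcs (λ e → eqV y (src e)))) (sym (∑-arcs (λ e → eqV y (tgt e)))) (D.coarse y) }
    where
    module D = Direction (direct _≟L_ FinP._≟_ vOf l₀ l₁ H)
    ∑-arcs : ∀ w → ∑ w (D.forw ++ map flip D.back) ≡ ∑ w D.forw + ∑ (w ∘ flip) D.back
    ∑-arcs w = trans (∑-++ w D.forw _) (cong (∑ w D.forw +_) (∑-map w flip D.back))
    orig : ∀ {e} → e ∈ D.forw ++ map flip D.back → e ∈ H ⊎ (∃ λ e' → e' ∈ H × e ≡ flip e')
    orig e∈ with ∈-++⁻ D.forw e∈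
    ... | inj₁ h = inj₁ (D.forw⊆ h)
    ... | inj₂ h with ∈-map⁻ flip h
    ...   | e' , h' , refl = inj₂ (e' , D.back⊆ h' , refl)

  abstract
    orient : ∀ H → Oriented H
    orient = balance

  oriented-valid : ∀ {L H} (o : Oriented H) → All (Valid L) H → All (Valid L) (Oriented.arcs o)
  oriented-valid o v = All.tabulate (λ e∈ → case Oriented.origin o e∈ of λ
    { (inj₁ h) → All.lookup v h ; (inj₂ (e' , h , refl)) → valid-flip (All.lookup v h) })

  -- Indegree and outdegree differ by at most one and have an even sum.
  oriented-eulerian : ∀ {H} (o : Oriented H) → (∀ y → 2 ∣ ∑ (endV y) H) →
    ∀ y → ∑ (λ e → eqV y (src e)) (Oriented.arcs o) ≡ ∑ (λ e → eqV y (tgt e)) (Oriented.arcs o)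
  oriented-eulerian {H} o ev y = near-even (Oriented.vertexBalance o y)
    (subst (2 ∣_) (trans (sym (Oriented.flipSum o (endV y) (endV-flip y))) (∑-+ (λ e → eqV y (src e)) (λ e → eqV y (tgt e)) (Oriented.arcs o))) (ev y))
    where
    odd : ∀ b → ¬ (2 ∣ suc (b + b))
    odd b (divides q e) = parity b q (trans e (trans (*-comm q 2) (cong (q +_) (+-identityʳ q))))
      where
      parity : ∀ b q → suc (b + b) ≢ q + q
      parity zero    (suc zero)    ()
      parity zero    (suc (suc q)) ()
      parity (suc b) (suc q) e = parity b q (suc-injective (suc-injective (trans (cong suc (cong suc (sym (+-suc b b)))) (trans e (cong suc (+-suc q q))))))
    near-even : ∀ {a b} → Near a b → 2 ∣ a + b → a ≡ b
    near-even {a} {b} (p , q) d with <-cmp a b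
    ... | tri≈ _ e _ = e
    ... | tri< lt _ _ = ⊥-elim (odd a (subst (2 ∣_) (trans (cong (a +_) (≤-antisym q lt)) (+-suc a a)) d))
    ... | tri> _ _ gt = ⊥-elim (odd b (subst (2 ∣_) (cong (_+ b) (≤-antisym p gt)) d))

  -- Being separated by `R` is a weight invariant under `flip`, so `flipSum` carries its vanishing
  -- from the arcs back to `H`.
  oriented-joined : ∀ {H} (o : Oriented H) → Joined src tgt H → Joined src tgt (Oriented.arcs o)
  oriented-joined {H} o jn R c = jn R (All.map (λ {e} → bits {e}) (∑-zero⁻ differ (trans (sym (Oriented.flipSum o differ differ-flip)) (∑-zero-All (All.map (λ {e} → bits' {e}) c)))))
    where
    differ : Edge → ℕ
    differ e = (bit (R (src e)) ∸ bit (R (tgt e))) + (bit (R (tgt e)) ∸ bit (R (src e)))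
    differ-flip : ∀ e → differ (flip e) ≡ differ e
    differ-flip e = +-comm (bit (R (tgt e)) ∸ bit (R (src e))) _
    bits : ∀ {e} → differ e ≡ 0 → R (src e) ≡ R (tgt e)
    bits {e} h = bit-injective (≤-antisym (m∸n≡0⇒m≤n (m+n≡0⇒m≡0 _ h)) (m∸n≡0⇒m≤n (m+n≡0⇒n≡0 (bit (R (src e)) ∸ bit (R (tgt e))) h)))
    bits' : ∀ {e} → R (src e) ≡ R (tgt e) → differ e ≡ 0
    bits' {e} h rewrite h | n∸n≡0 (bit (R (tgt e))) = refl

  atLevel : ℕ → Fin n → Lab → ℕ
  atLevel i y a = ind (lev a ≟ i) * eqV y (vOf a)

  levelEnds : ℕ → Fin n → List Edge → ℕ
  levelEnds i y H = ∑ (λ e → atLevel i y (l₀ e) + atLevel i y (l₁ e)) H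

  endLabels : List Edge → List Lab
  endLabels = concatMap (λ e → l₀ e ∷ l₁ e ∷ [])

  ∑-endLabels : ∀ φ H → ∑ φ (endLabels H) ≡ ∑ (λ e → φ (l₀ e) + φ (l₁ e)) H
  ∑-endLabels φ H = trans (∑-concatMap φ _ H) (∑-cong (λ e → cong (φ (l₀ e) +_) (+-identityʳ _)) H)

-- Choosing the edges to be joined

-- The arcs in `U` are to be joined at `l₁`. Of `k` ends in a group about half are heads, of which
-- the tree takes at most one; a fresh orientation of the rest leaves half of it on each side, and a
-- last halving selects `U`. This yields about `k / 8` from below, and the last two halvings give
-- about `k / 4` from above. The terms `9` and `3` collect the roundings.
record Selection {n : ℕ} (Λ : Labels n) (L j : ℕ) (H : List (PathGraph.Edge Λ)) : Set where
  open PathGraph Λ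
  field
    U Keep     : List Edge
    U-valid    : All (Valid L) U
    U-level    : All (λ e → lev (l₀ e) ≡ j) U
    Keep-valid : All (Valid L) Keep
    splits     : ∀ w → (∀ e → w (flip e) ≡ w e) → ∑ w Keep + ∑ w U ≡ ∑ w H
    Keep-joined : Joined src tgt Keep
    tails-low  : ∀ a → lev a ≡ j → ∑ (endL a) H ≤ 8 * ∑ (λ e → eqL a (l₀ e)) U + 9
    heads-low  : ∀ a → lev a ≡ j → ∑ (endL a) H ≤ 8 * ∑ (λ e → eqL a (l₁ e)) U + 9
    tails-high : ∀ a → 4 * ∑ (λ e → eqL a (l₀ e)) U ≤ ∑ (endL a) H + 3
    heads-high : ∀ a → 4 * ∑ (λ e → eqL a (l₁ e)) U ≤ ∑ (endL a) H + 3

private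
  low-chain : ∀ {k i₁ o₁ it ia sa o₂ i₂ u b} → i₁ + o₁ ≡ k → o₁ ≤ suc i₁ → i₁ ≡ it + ia → it ≤ 1 → ia ≤ sa →
              o₂ + i₂ ≡ sa → i₂ ≤ suc o₂ → u + b ≡ o₂ → b ≤ suc u → k ≤ 8 * u + 9
  low-chain {i₁ = i₁} {o₁} {it} {ia} {_} {_} {i₂} {u} {b} refl h₁ refl h₂ h₃ refl h₄ refl h₅ =
    ≤-of-slack 0 (+-mono-≤ h₁ (+-mono-≤ (*-monoʳ-≤ 2 h₂) (+-mono-≤ (*-monoʳ-≤ 2 h₃) (+-mono-≤ (*-monoʳ-≤ 2 h₄) (*-monoʳ-≤ 4 h₅))))) (lemma it ia o₁ u b i₂)
    where
    lemma : ∀ it ia o₁ u b i₂ →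
      it + ia + o₁ + (suc (it + ia) + (2 * 1 + (2 * (u + b + i₂) + (2 * suc (u + b) + 4 * suc u)))) + 0
      ≡ 8 * u + 9 + (o₁ + (2 * it + (2 * ia + (2 * i₂ + 4 * b))))
    lemma = solve-∀

  high-chain : ∀ {k sa o₂ i₂ u b} → sa ≤ k → o₂ + i₂ ≡ sa → o₂ ≤ suc i₂ → u + b ≡ o₂ → u ≤ suc b → 4 * u ≤ k + 3
  high-chain {k} {_} {_} {i₂} {u} {b} h₁ refl h₂ refl h₃ = ≤-of-slack 0 (+-mono-≤ h₁ (+-mono-≤ h₂ (*-monoʳ-≤ 2 h₃))) (lemma k u b i₂)
    where
    lemma : ∀ k u b i₂ → 4 * u + (k + (suc i₂ + 2 * suc b)) + 0 ≡ k + 3 + (u + b + i₂ + (u + b + 2 * u))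
    lemma = solve-∀

select : ∀ {n} (Λ : Labels n) (root : Fin n) (j : ℕ) {adj L M lo hi H} → PathGraph.Good Λ adj L M lo hi H → Selection Λ L j H
select {n} Λ root j {adj} {L} {M} {lo} {hi} {H} good
  with PathGraph.orient Λ H
... | O₁ with Arborescence.arborescence src₀ tgt₀ (PathGraph.Oriented.arcs O₁)
               (PathGraph.oriented-joined Λ O₁ (PathGraph.Good.joined good)) (PathGraph.oriented-eulerian Λ O₁ (PathGraph.Good.even good)) root
  where
  src₀ = PathGraph.src Λ
  tgt₀ = PathGraph.tgt Λ
... | tree , rest , perm , tree-heads , tree-joined
  with partition-↭ (λ e → Labels.lev Λ (PathGraph.l₀ e) ≟ j) rest
... | act , inact , rest↭ , act-level , inact-level
  -- The tree has few heads in a group but possibly most of its tails, so only heads are known to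
  -- survive its removal. A new orientation of the remaining active paths gives both kinds their
  -- share.
  with PathGraph.orient Λ act
-- Tails and heads receive separate copies of the labels. Orienting this bipartite graph splits the
-- arcs into `forw` and `back` so that the tails and the heads of every group are both halved; since
-- `back` is kept, no group is used up.
... | O₂ with direct (SumP.≡-dec (Labels._≟L_ Λ) (Labels._≟L_ Λ)) UnitP._≟_ (λ _ → tt) (λ e → inj₁ (PathGraph.l₀ e)) (λ e → inj₂ (PathGraph.l₁ e)) (PathGraph.Oriented.arcs O₂)
... | D = record
  { U = U ; Keep = Keep
  ; U-valid = All.tabulate (λ e∈ → All.lookup A₂-valid (D.forw⊆ e∈))
  ; U-level = All.tabulate (λ e∈ → All.lookup A₂-level (D.forw⊆ e∈))
  ; Keep-valid = AllP.++⁺ tree-valid (AllP.++⁺ inact-valid (All.tabulate (λ e∈ → All.lookup A₂-valid (D.back⊆ e∈))))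
  ; splits = splits
  ; Keep-joined = λ R c → tree-joined R (AllP.++⁻ˡ tree c)
  ; tails-low = tails-low ; heads-low = heads-low
  ; tails-high = λ a → high-chain (act≤ a) (A₂-size a) (proj₁ (O₂.labelBalance a)) (U-tails a) (proj₁ (near-tails a))
  ; heads-high = λ a → high-chain (act≤ a) (trans (+-comm (∑ (λ e → eqL a (l₁ e)) A₂) _) (A₂-size a)) (proj₂ (O₂.labelBalance a)) (U-heads a) (proj₁ (near-heads a)) }
  where
  open PathGraph Λ
  module O₁ = Oriented O₁
  module O₂ = Oriented O₂
  module D = Direction D
  A₁ = O₁.arcs
  A₂ = O₂.arcs
  U = D.forw
  Keep = tree ++ (inact ++ D.back)
  A₁-valid : All (Valid L) (tree ++ rest)
  A₁-valid = All-resp-↭ perm (oriented-valid O₁ (Good.valid good))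
  tree-valid = AllP.++⁻ˡ tree A₁-valid
  rest-valid = All-resp-↭ rest↭ (AllP.++⁻ʳ tree A₁-valid)
  act-valid = AllP.++⁻ˡ act rest-valid
  inact-valid = AllP.++⁻ʳ act rest-valid
  A₂-valid = oriented-valid O₂ act-valid
  A₂-level : All (λ e → lev (l₀ e) ≡ j) A₂
  A₂-level = All.tabulate (λ e∈ → case O₂.origin e∈ of λ
    { (inj₁ h) → All.lookup act-level h
    ; (inj₂ (e' , h , refl)) → trans (sym (sameLevel (All.lookup act-valid h))) (All.lookup act-level h) })
  ∑-A₁ : ∀ w → ∑ w A₁ ≡ ∑ w tree + (∑ w act + ∑ w inact)
  ∑-A₁ w = trans (∑-↭ w perm) (trans (∑-++ w tree rest) (cong (∑ w tree +_) (trans (∑-↭ w rest↭) (∑-++ w act inact))))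
  splits : ∀ w → (∀ e → w (flip e) ≡ w e) → ∑ w Keep + ∑ w U ≡ ∑ w H
  splits w inv = begin
    ∑ w (tree ++ (inact ++ D.back)) + ∑ w U           ≡⟨ cong (_+ ∑ w U) (trans (∑-++ w tree _) (cong (∑ w tree +_) (∑-++ w inact D.back))) ⟩
    ∑ w tree + (∑ w inact + ∑ w D.back) + ∑ w U        ≡⟨ l (∑ w tree) (∑ w inact) (∑ w D.back) (∑ w U) ⟩
    ∑ w tree + (∑ w U + ∑ w D.back + ∑ w inact)        ≡⟨ cong (λ z → ∑ w tree + (z + ∑ w inact)) (trans (D.total w) (O₂.flipSum w inv)) ⟩
    ∑ w tree + (∑ w act + ∑ w inact)                   ≡⟨ sym (∑-A₁ w) ⟩
    ∑ w A₁                                             ≡⟨ O₁.flipSum w inv ⟩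
    ∑ w H                                              ∎
    where
    open ≡-Reasoning
    l : ∀ a b c d → a + (b + c) + d ≡ a + (d + c + b)
    l = solve-∀
  A₁-size : ∀ a → ∑ (λ e → eqL a (l₀ e)) A₁ + ∑ (λ e → eqL a (l₁ e)) A₁ ≡ ∑ (endL a) H
  A₁-size a = trans (sym (∑-+ _ _ A₁)) (O₁.flipSum (endL a) (endL-flip a))
  A₂-size : ∀ a → ∑ (λ e → eqL a (l₀ e)) A₂ + ∑ (λ e → eqL a (l₁ e)) A₂ ≡ ∑ (endL a) act
  A₂-size a = trans (sym (∑-+ _ _ A₂)) (O₂.flipSum (endL a) (endL-flip a))
  act≤ : ∀ a → ∑ (endL a) act ≤ ∑ (endL a) H
  act≤ a = ≤-trans (≤-trans (m≤m+n _ (∑ (endL a) inact)) (m≤n+m _ (∑ (endL a) tree))) (≤-reflexive (trans (sym (∑-A₁ (endL a))) (O₁.flipSum (endL a) (endL-flip a))))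
  eqS = Distinct.eq (SumP.≡-dec _≟L_ _≟L_)
  same₁ : ∀ a b → eqS (inj₁ a) (inj₁ b) ≡ eqL a b
  same₁ a b = ind-cong (SumP.≡-dec _≟L_ _≟L_ (inj₁ a) (inj₁ b)) (a ≟L b) SumP.inj₁-injective (cong inj₁)
  same₂ : ∀ a b → eqS (inj₂ a) (inj₂ b) ≡ eqL a b
  same₂ a b = ind-cong (SumP.≡-dec _≟L_ _≟L_ (inj₂ a) (inj₂ b)) (a ≟L b) SumP.inj₂-injective (cong inj₂)
  near-tails : ∀ a → Near (∑ (λ e → eqL a (l₀ e)) U) (∑ (λ e → eqL a (l₀ e)) D.back)
  near-tails a = subst₂ Near
    (trans (cong₂ _+_ (∑-cong (λ e → same₁ a (l₀ e)) U) (∑-zero D.back)) (+-identityʳ _))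
    (cong₂ _+_ (∑-zero U) (∑-cong (λ e → same₁ a (l₀ e)) D.back)) (D.fine (inj₁ a))
  near-heads : ∀ a → Near (∑ (λ e → eqL a (l₁ e)) U) (∑ (λ e → eqL a (l₁ e)) D.back)
  near-heads a = (λ h → proj₂ h , proj₁ h) (subst₂ Near
    (cong₂ _+_ (∑-zero U) (∑-cong (λ e → same₂ a (l₁ e)) D.back))
    (trans (cong₂ _+_ (∑-cong (λ e → same₂ a (l₁ e)) U) (∑-zero D.back)) (+-identityʳ _)) (D.fine (inj₂ a)))
  U-tails : ∀ a → ∑ (λ e → eqL a (l₀ e)) U + ∑ (λ e → eqL a (l₀ e)) D.back ≡ ∑ (λ e → eqL a (l₀ e)) A₂
  U-tails a = D.total _
  U-heads : ∀ a → ∑ (λ e → eqL a (l₁ e)) U + ∑ (λ e → eqL a (l₁ e)) D.back ≡ ∑ (λ e → eqL a (l₁ e)) A₂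
  U-heads a = D.total _
  eqL≤eqV : ∀ a b → eqL a b ≤ eqV (vOf a) (vOf b)
  eqL≤eqV a b with a ≟L b
  ... | yes refl = ≤-reflexive (sym (eqV-refl (vOf a)))
  ... | no _     = z≤n
  tree-in : ∀ a → ∑ (λ e → eqL a (l₁ e)) tree ≤ 1
  tree-in a = ≤-trans (∑-mono (λ e → eqL≤eqV a (l₁ e)) tree) (tree-heads (vOf a))
  inact-in : ∀ a → lev a ≡ j → ∑ (λ e → eqL a (l₁ e)) inact ≡ 0
  inact-in a la = ∑-zero-All (All.tabulate (λ {e} e∈ → ind-no (a ≟L l₁ e) (λ h → All.lookup inact-level e∈
    (trans (sameLevel (All.lookup inact-valid e∈)) (trans (cong lev (sym h)) la)))))
  act-in : ∀ a → lev a ≡ j → ∑ (λ e → eqL a (l₁ e)) A₁ ≡ ∑ (λ e → eqL a (l₁ e)) tree + ∑ (λ e → eqL a (l₁ e)) act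
  act-in a la = trans (∑-A₁ _) (cong (∑ (λ e → eqL a (l₁ e)) tree +_) (trans (cong (∑ (λ e → eqL a (l₁ e)) act +_) (inact-in a la)) (+-identityʳ _)))
  act-in≤ : ∀ a → ∑ (λ e → eqL a (l₁ e)) act ≤ ∑ (endL a) act
  act-in≤ a = ∑-mono (λ e → m≤n+m (eqL a (l₁ e)) (eqL a (l₀ e))) act
  A₁-size' : ∀ a → ∑ (λ e → eqL a (l₁ e)) A₁ + ∑ (λ e → eqL a (l₀ e)) A₁ ≡ ∑ (endL a) H
  A₁-size' a = trans (+-comm (∑ (λ e → eqL a (l₁ e)) A₁) _) (A₁-size a)
  tails-low : ∀ a → lev a ≡ j → ∑ (endL a) H ≤ 8 * ∑ (λ e → eqL a (l₀ e)) U + 9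
  tails-low a la = low-chain (A₁-size' a) (proj₁ (O₁.labelBalance a)) (act-in a la) (tree-in a) (act-in≤ a) (A₂-size a) (proj₂ (O₂.labelBalance a)) (U-tails a) (proj₂ (near-tails a))
  heads-low : ∀ a → lev a ≡ j → ∑ (endL a) H ≤ 8 * ∑ (λ e → eqL a (l₁ e)) U + 9
  heads-low a la = low-chain (A₁-size' a) (proj₁ (O₁.labelBalance a)) (act-in a la) (tree-in a) (act-in≤ a)
    (trans (+-comm (∑ (λ e → eqL a (l₁ e)) A₂) _) (A₂-size a)) (proj₁ (O₂.labelBalance a)) (U-heads a) (proj₂ (near-heads a))

-- One stage: joining pairs of equally labelled edge ends

private
  -- Makes the size of a group even. An arc that is matched with the padding `nothing` stays
  -- unjoined.
  pad : {A : Set} → ℕ → List (Maybe A)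
  pad zero          = []
  pad (suc zero)    = nothing ∷ []
  pad (suc (suc k)) = pad k

  pad-even : ∀ {A : Set} k → Σ ℕ λ κ → k + length (pad {A} k) ≡ 2 * κ
  pad-even zero          = 0 , refl
  pad-even (suc zero)    = 1 , refl
  pad-even {A} (suc (suc k)) with pad-even {A} k
  ... | κ , e = suc κ , trans (cong (λ z → suc (suc z)) e) (lemma κ)
    where
    lemma : ∀ κ → suc (suc (2 * κ)) ≡ 2 * suc κ
    lemma = solve-∀

  pad-length : ∀ {A : Set} k → length (pad {A} k) ≤ 1
  pad-length zero          = z≤n
  pad-length (suc zero)    = ≤-refl
  pad-length (suc (suc k)) = pad-length k

  pad-nothing : ∀ {A : Set} (P : Maybe A → Set) → P nothing → ∀ k → All P (pad k)
  pad-nothing P h zero          = []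
  pad-nothing P h (suc zero)    = h ∷ []
  pad-nothing P h (suc (suc k)) = pad-nothing P h k

  flat-All : ∀ {A : Set} {P : A → Set} (ps : List (A × A)) → All P (flat ps) → All (λ p → P (proj₁ p) × P (proj₂ p)) ps
  flat-All []             []            = []
  flat-All ((x , y) ∷ ps) (hx ∷ hy ∷ h) = (hx , hy) ∷ flat-All ps h

  -- A group of at least `lo` ends supplies about `lo / 8` heads and half as many pairs; the factor
  -- 100 leaves a wide margin over the `32 * x` that the matchings ask for.
  matching-room : ∀ {lo k κ x z} → 100 * (x + z + 1) ≤ lo → lo ≤ 8 * k + 9 → k ≤ 2 * κ → suc (2 * x) < κ
  matching-room {lo} {k} {κ} {x} {z} h₁ h₂ h₃ = *-cancelˡ-≤ 16 (≤-of-slack (68 * x + 59 + 100 * z) (+-mono-≤ h₁ (+-mono-≤ h₂ (*-monoʳ-≤ 8 h₃))) (lemma lo k κ x z))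
    where
    lemma : ∀ lo k κ x z → 16 * suc (suc (2 * x)) + (lo + (8 * k + 9 + 8 * (2 * κ))) + (68 * x + 59 + 100 * z)
                         ≡ 16 * κ + (100 * (x + z + 1) + (lo + 8 * k))
    lemma = solve-∀

-- Here `m` is the number of candidate matchings per head group, `r` the number of head groups that
-- may hit a constraint, and `j` the level whose paths are joined. The bound `room` makes groups
-- large enough for the matchings and absorbs all additive errors; `numeric` is the condition of the
-- local lemma.
module Stage {n : ℕ} (Λ : Labels n) {adj : Fin n → Fin n → ℕ} {L M lo hi m r j : ℕ} {H : List (PathGraph.Edge Λ)}
  (good : PathGraph.Good Λ adj L M lo hi H) (sel : Selection Λ L j H)
  (M≥1 : 1 ≤ M) (m>0 : 0 < m)
  (room : 100 * (suc L * M + m + r * M + 1) ≤ lo)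
  (numeric : 2 * ((suc hi * suc L) * (binom hi r * (2 * (M * M)) ^ r)) ≤ m ^ r)
  where

  open PathGraph Λ
  open Selection sel
  private module N = PathGraph (raise Λ)

  -- Candidate matchings in the head groups

  private
    hs : List Lab
    hs = Distinct.distinct _≟L_ (map l₁ U)

    V : ℕ
    V = length hs

    head : Fin V → Lab
    head = lookup hs

    I : Fin V → List Edge
    I i = filter (λ e → head i ≟L l₁ e) U

    ∑-I : ∀ i w → ∑ w (I i) ≡ ∑ (λ e → eqL (head i) (l₁ e) * w e) U
    ∑-I i w = ∑-filter-split (λ e → head i ≟L l₁ e) w U

    ∑-I≤ : ∀ i w → ∑ w (I i) ≤ ∑ w U
    ∑-I≤ i w = ≤-trans (≤-reflexive (∑-I i w)) (∑-mono (λ e → ≤-trans (*-monoˡ-≤ (w e) (ind≤1 (head i ≟L l₁ e))) (≤-reflexive (*-identityˡ _))) U)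

    ∑-heads : ∀ (f : Lab → ℕ) → ∑ (λ i → f (head i)) (allFin V) ≡ ∑ f hs
    ∑-heads f = ∑-lookup f hs

    ∑-II : ∀ w → ∑ (λ i → ∑ w (I i)) (allFin V) ≡ ∑ w U
    ∑-II w = begin
      ∑ (λ i → ∑ w (I i)) (allFin V)                          ≡⟨ ∑-cong (λ i → ∑-I i w) (allFin V) ⟩
      ∑ (λ i → ∑ (λ e → eqL (head i) (l₁ e) * w e) U) (allFin V) ≡⟨ ∑-heads (λ h → ∑ (λ e → eqL h (l₁ e) * w e) U) ⟩
      ∑ (λ h → ∑ (λ e → eqL h (l₁ e) * w e) U) hs              ≡⟨ ∑-swap _ hs U ⟩
      ∑ (λ e → ∑ (λ h → eqL h (l₁ e) * w e) hs) U              ≡⟨ ∑-cong-All (All.tabulate (λ {e} e∈ → trans (∑-*ʳ (w e) (λ h → eqL h (l₁ e)) hs)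
                                                                    (trans (cong (_* w e) (Distinct.distinct-≡1 _≟L_ (map l₁ U) (∈-map⁺ l₁ e∈))) (*-identityˡ _)))) ⟩
      ∑ w U                                                    ∎
      where open ≡-Reasoning

    I-head : ∀ i → All (λ e → head i ≡ l₁ e) (I i)
    I-head i = AllP.all-filter (λ e → head i ≟L l₁ e) U

    I-valid : ∀ i → All (Valid L) (I i)
    I-valid i = AllP.filter⁺ (λ e → head i ≟L l₁ e) U-valid

    I-level : ∀ i → All (λ e → lev (l₀ e) ≡ j) (I i)
    I-level i = AllP.filter⁺ (λ e → head i ≟L l₁ e) U-level

    U≤H : ∀ w → (∀ e → w (flip e) ≡ w e) → ∑ w U ≤ ∑ w H
    U≤H w inv = ≤-trans (m≤n+m _ (∑ w Keep)) (≤-reflexive (splits w inv))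

    confWeight : Lab → Fin n → Edge → ℕ
    confWeight a p e = endL a e * mult p (verts e)

    confWeight-flip : ∀ a p e → confWeight a p (flip e) ≡ confWeight a p e
    confWeight-flip a p e = cong₂ _*_ (endL-flip a e) (mult-flip p e)

    -- At the vertex of the group itself `conflict` says nothing, but no front passes there because
    -- paths are simple.
    starts≤M : ∀ i p → ∑ (λ f → mult p (front f)) (I i) ≤ M
    starts≤M i p with p FinP.≟ vOf (head i)
    ... | yes refl = ≤-trans (≤-reflexive (∑-zero-All (All.zipWith (λ { {f} (h , v) → trans (cong (λ z → mult (vOf z) (front f)) h) (tgt∉front v) }) (I-head i , I-valid i)))) z≤n
    ... | no p≢ = begin
      ∑ (λ f → mult p (front f)) (I i)                      ≡⟨ ∑-I i _ ⟩
      ∑ (λ f → eqL (head i) (l₁ f) * mult p (front f)) U    ≤⟨ ∑-mono (λ f → *-mono-≤ (m≤n+m (eqL (head i) (l₁ f)) (eqL (head i) (l₀ f))) (mult-front≤ p f)) U ⟩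
      ∑ (confWeight (head i) p) U                           ≤⟨ U≤H _ (confWeight-flip (head i) p) ⟩
      ∑ (confWeight (head i) p) H                           ≤⟨ conflict good (head i) p p≢ ⟩
      M                                                     ∎
      where open ≤-Reasoning

    -- A path from group `a` into head group `i` is a conflict of `a` with the vertex of `head i`.
    -- The two vertices cannot coincide, since the ends of a path are distinct.
    tails≤M : ∀ i a → ∑ (λ e → eqL a (l₀ e)) (I i) ≤ M
    tails≤M i a with vOf (head i) FinP.≟ vOf a
    ... | yes q = ≤-trans (≤-reflexive (∑-zero-All (All.zipWith (λ { {e} (h , v) → ind-no (a ≟L l₀ e) (λ a≡ → src≢tgt v (trans (sym (cong vOf a≡)) (trans (sym q) (cong vOf h)))) }) (I-head i , I-valid i)))) z≤n
    ... | no q = begin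
      ∑ (λ e → eqL a (l₀ e)) (I i)            ≤⟨ ∑-mono-All (All.map (λ {e} h → le e h) (I-head i)) ⟩
      ∑ (confWeight a (vOf (head i))) (I i)   ≤⟨ ∑-I≤ i _ ⟩
      ∑ (confWeight a (vOf (head i))) U       ≤⟨ U≤H _ (confWeight-flip a (vOf (head i))) ⟩
      ∑ (confWeight a (vOf (head i))) H       ≤⟨ conflict good a (vOf (head i)) q ⟩
      M                                       ∎
      where
      open ≤-Reasoning
      le : ∀ e → head i ≡ l₁ e → eqL a (l₀ e) ≤ confWeight a (vOf (head i)) e
      le e h = ≤-trans (≤-reflexive (sym (*-identityʳ _))) (*-mono-≤ (m≤m+n (eqL a (l₀ e)) (eqL a (l₁ e)))
        (subst (λ z → 1 ≤ mult (vOf z) (verts e)) (sym h) (mult-∈ {p = tgt e} {xs = verts e} (∈-++⁺ʳ (front e) (here refl)))))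

    J : Fin V → List (Maybe Edge)
    J i = map just (I i) ++ pad (length (I i))

    ∑-J : ∀ i g → ∑ g (J i) ≡ ∑ (g ∘ just) (I i) + ∑ g (pad (length (I i)))
    ∑-J i g = trans (∑-++ g (map just (I i)) _) (cong (_+ ∑ g (pad (length (I i)))) (∑-map g just (I i)))

    ∑-J₀ : ∀ i g → g nothing ≡ 0 → ∑ g (J i) ≡ ∑ (g ∘ just) (I i)
    ∑-J₀ i g g0 = trans (∑-J i g) (trans (cong (∑ (g ∘ just) (I i) +_) (∑-zero-All (pad-nothing (λ x → g x ≡ 0) g0 (length (I i))))) (+-identityʳ _))

    -- Two arcs with a common head form a path when joined precisely if their fronts are disjoint.
    cf : Maybe Edge → Maybe Edge → ℕ
    cf (just e) (just f) = inter (front e) (front f)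
    cf (just _) nothing  = 0
    cf nothing  _        = 0

    cf-sym : ∀ x y → cf x y ≡ cf y x
    cf-sym (just e) (just f) = inter-sym (front e) (front f)
    cf-sym (just _) nothing  = refl
    cf-sym nothing  (just _) = refl
    cf-sym nothing  nothing  = refl

    OkM : Fin V → Maybe Edge → Set
    OkM i nothing  = ⊤
    OkM i (just e) = Valid L e × head i ≡ l₁ e × lev (l₀ e) ≡ j

    J-ok : ∀ i → All (OkM i) (J i)
    J-ok i = AllP.++⁺ (AllP.map⁺ (All.zipWith (λ { (v , h , l) → v , h , l }) (I-valid i , All.zipWith (λ { (h , l) → h , l }) (I-head i , I-level i))))
      (pad-nothing (OkM i) tt (length (I i)))

    cf-bound : ∀ i {x} → x ∈ J i → ∑ (cf x) (J i) ≤ suc L * M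
    cf-bound i {nothing} x∈ = ≤-trans (≤-reflexive (∑-zero (J i))) z≤n
    cf-bound i {just e}  x∈ = begin
      ∑ (cf (just e)) (J i)                                             ≡⟨ ∑-J₀ i (cf (just e)) refl ⟩
      ∑ (λ f → inter (front e) (front f)) (I i)                         ≡⟨ ∑-swap _ (I i) (front e) ⟩
      ∑ (λ p → ∑ (λ f → mult p (front f)) (I i)) (front e)              ≤⟨ ∑-≤-length {xs = front e} (All.tabulate (λ {p} _ → starts≤M i p)) ⟩
      length (front e) * M                                              ≤⟨ *-monoˡ-≤ M (s≤s (short (proj₁ (All.lookup (J-ok i) x∈)))) ⟩
      suc L * M                                                         ∎
      where open ≤-Reasoning

    length-I : ∀ i → length (I i) ≡ ∑ (λ e → eqL (head i) (l₁ e)) U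
    length-I i = trans (sym (∑-ones (I i))) (trans (∑-I i (λ _ → 1)) (∑-cong (λ e → *-identityʳ _) U))

    heads≤size : ∀ a → ∑ (λ e → eqL a (l₁ e)) U ≤ ∑ (endL a) H
    heads≤size a = ≤-trans (∑-mono (λ e → m≤n+m (eqL a (l₁ e)) (eqL a (l₀ e))) U) (U≤H (endL a) (endL-flip a))

    tails≤size : ∀ a → ∑ (λ e → eqL a (l₀ e)) U ≤ ∑ (endL a) H
    tails≤size a = ≤-trans (∑-mono (λ e → m≤m+n (eqL a (l₀ e)) (eqL a (l₁ e))) U) (U≤H (endL a) (endL-flip a))

    ∈-distinct⁻ : ∀ xs {l : Lab} → l ∈ Distinct.distinct _≟L_ xs → l ∈ xs
    ∈-distinct⁻ (x ∷ xs) l∈ with ∑ (λ a → eqL a x) (Distinct.distinct _≟L_ xs)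
    ∈-distinct⁻ (x ∷ xs) l∈         | suc _ = there (∈-distinct⁻ xs l∈)
    ∈-distinct⁻ (x ∷ xs) (here p)   | zero  = here p
    ∈-distinct⁻ (x ∷ xs) (there l∈) | zero  = there (∈-distinct⁻ xs l∈)

    I-long : ∀ i → lo ≤ 8 * length (I i) + 9
    I-long i with ∈-map⁻ l₁ (∈-distinct⁻ (map l₁ U) (∈-lookup {xs = hs} i))
    ... | e , e∈ , h = ≤-trans (groupLow good (head i) present)
          (subst (λ z → ∑ (endL (head i)) H ≤ 8 * z + 9) (sym (length-I i)) (heads-low (head i) level))
      where
      level : lev (head i) ≡ j
      level = trans (cong lev h) (trans (sym (sameLevel (All.lookup U-valid e∈))) (All.lookup U-level e∈))
      present : 0 < ∑ (endL (head i)) H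
      present = ≤-trans (≤-trans (≤-reflexive (sym (ind-yes (head i ≟L l₁ e) h))) (∑-∈ (λ f → eqL (head i) (l₁ f)) e∈)) (heads≤size (head i))

    length-J : ∀ i → length (J i) ≡ length (I i) + length (pad {Edge} (length (I i)))
    length-J i = trans (length-++ (map just (I i))) (cong (_+ length (pad {Edge} (length (I i)))) (length-map just (I i)))

    abstract
      matchData : ∀ i → Σ (Fin m → List (Maybe Edge × Maybe Edge)) λ f →
        (∀ o → flat (f o) ↭ J i) × (∀ o → All (λ p → cf (proj₁ p) (proj₂ p) ≡ 0) (f o)) ×
        (∀ (w : Maybe Edge → Maybe Edge → ℕ) → ∑ (λ o → ∑ (λ p → w (proj₁ p) (proj₂ p) + w (proj₂ p) (proj₁ p)) (f o)) (allFin m)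
                          ≤ ∑ (λ x → ∑ (w x) (J i)) (J i))
      matchData i with pad-even {Edge} (length (I i))
      ... | κ , e = disjointMatchings m (suc L * M) κ cf (J i) cf-sym (trans (length-J i) e) (cf-bound i)
              (matching-room {x = suc L * M + m} {z = r * M} room (I-long i) (≤-trans (m≤m+n (length (I i)) _) (≤-reflexive e)))

    match : (i : Fin V) → Fin m → List (Maybe Edge × Maybe Edge)
    match i = proj₁ (matchData i)

    match↭ : ∀ i o → flat (match i o) ↭ J i
    match↭ i = proj₁ (proj₂ (matchData i))

    PairOk : Fin V → Maybe Edge × Maybe Edge → Set
    PairOk i p = (OkM i (proj₁ p) × OkM i (proj₂ p)) × cf (proj₁ p) (proj₂ p) ≡ 0

    match-ok : ∀ i o → All (PairOk i) (match i o)
    match-ok i o = All.zipWith id (flat-All (match i o) (All-resp-↭ (↭-sym (match↭ i o)) (J-ok i)) , proj₁ (proj₂ (proj₂ (matchData i))) o)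

    ∑-match : ∀ i o g → ∑ (λ p → g (proj₁ p) + g (proj₂ p)) (match i o) ≡ ∑ g (J i)
    ∑-match i o g = trans (sym (∑-flat g (match i o))) (∑-↭ g (match↭ i o))

    -- Constraints and the application of the local lemma

    tl : Lab → Maybe Edge → ℕ
    tl a nothing  = 0
    tl a (just e) = eqL a (l₀ e)

    -- The place `just p` is met by a partner through `p`, the place `nothing` by the padding. So
    -- the constraint `(a , just p)` counts new conflicts of `a` with `p`, and `(a , nothing)`
    -- counts ends of `a` whose paths fail to be prolonged.
    mi : Maybe (Fin n) → Maybe Edge → ℕ
    mi nothing  nothing  = 1
    mi nothing  (just _) = 0
    mi (just p) nothing  = 0
    mi (just p) (just f) = mult p (front f)

    Cn : Set
    Cn = Lab × Maybe (Fin n)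

    ω : Cn → Maybe Edge → Maybe Edge → ℕ
    ω c x y = tl (proj₁ c) x * mi (proj₂ c) y

    ωs : Cn → Maybe Edge × Maybe Edge → ℕ
    ωs c p = ω c (proj₁ p) (proj₂ p) + ω c (proj₂ p) (proj₁ p)

    ν : Cn → Fin V → Fin m → ℕ
    ν c i o = ∑ (ωs c) (match i o)

    σ : Cn → Fin V → ℕ
    σ c i = ∑ (λ e → eqL (proj₁ c) (l₀ e)) (I i)

    ∑-tl : ∀ a i → ∑ (tl a) (J i) ≡ ∑ (λ e → eqL a (l₀ e)) (I i)
    ∑-tl a i = ∑-J₀ i (tl a) refl

    ∑-mi≤ : ∀ p i → ∑ (mi p) (J i) ≤ M
    ∑-mi≤ (just p) i = ≤-trans (≤-reflexive (∑-J₀ i (mi (just p)) refl)) (starts≤M i p)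
    ∑-mi≤ nothing  i = ≤-trans (≤-reflexive (trans (∑-J i (mi nothing)) (cong (_+ ∑ (mi nothing) (pad (length (I i)))) (∑-zero (I i)))))
      (≤-trans (∑-≤-length (pad-nothing (λ x → mi nothing x ≤ 1) ≤-refl (length (I i)))) (≤-trans (≤-reflexive (*-identityʳ _)) (≤-trans (pad-length (length (I i))) M≥1)))

    -- Disjoint matchings use every ordered pair at most once altogether, and over all ordered pairs
    -- the weight `ω` factors into tails and partners.
    total-ν : ∀ c i → ∑ (ν c i) (allFin m) ≤ ∑ (λ e → eqL (proj₁ c) (l₀ e)) (I i) * ∑ (mi (proj₂ c)) (J i)
    total-ν c i = ≤-trans (proj₂ (proj₂ (proj₂ (matchData i))) (ω c))
      (≤-reflexive (trans (∑-product (tl (proj₁ c)) (mi (proj₂ c)) (J i) (J i)) (cong (_* ∑ (mi (proj₂ c)) (J i)) (∑-tl (proj₁ c) i))))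

    option-bound : ∀ c i → ∑ (ν c i) (allFin m) ≤ M * M
    option-bound c i = ≤-trans (total-ν c i) (*-mono-≤ (tails≤M i (proj₁ c)) (∑-mi≤ (proj₂ c) i))

    supported : ∀ c i o → σ c i ≡ 0 → ν c i o ≡ 0
    supported c i o z = ≤0⇒≡0 (≤-trans (∑-∈ (ν c i) (∈-allFin o)) (≤-trans (total-ν c i) (≤-reflexive (cong (_* ∑ (mi (proj₂ c)) (J i)) z))))

    support-bound : ∀ c → ∑ (σ c) (allFin V) ≤ hi
    support-bound c = ≤-trans (≤-reflexive (∑-II _)) (≤-trans (tails≤size (proj₁ c)) (groupHigh good (proj₁ c)))

    labs : List Lab
    labs = Distinct.distinct _≟L_ (map l₀ U)

    places : List (Maybe (Fin n))
    places = nothing ∷ map just (allFin n)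

    cs : List Cn
    cs = concatMap (λ a → map (a ,_) places) labs

    ∑-cs : ∀ (f : Cn → ℕ) → ∑ f cs ≡ ∑ (λ a → ∑ (λ p → f (a , p)) places) labs
    ∑-cs f = trans (∑-concatMap f (λ a → map (a ,_) places) labs) (∑-cong (λ a → ∑-map f (a ,_) places) labs)

    labs-tl : ∀ x → ∑ (λ a → tl a x) labs ≤ 1
    labs-tl nothing  = ≤-trans (≤-reflexive (∑-zero labs)) z≤n
    labs-tl (just e) = Distinct.distinct-≤1 _≟L_ (map l₀ U) (l₀ e)

    places-mi : ∀ {i} y → OkM i y → ∑ (λ p → mi p y) places ≤ suc L
    places-mi nothing  _ = ≤-trans (≤-reflexive (cong suc (trans (∑-map (λ p → mi p nothing) just (allFin n)) (∑-zero (allFin n))))) (s≤s z≤n)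
    places-mi (just f) (v , _) = ≤-trans (≤-reflexive (trans (∑-map (λ p → mi p (just f)) just (allFin n)) (∑-mult (front f)))) (s≤s (short v))

    half-bound : ∀ {i} x y → OkM i y → ∑ (λ a → ∑ (λ p → ω (a , p) x y) places) labs ≤ suc L
    half-bound x y ok = ≤-trans (≤-reflexive (∑-product (λ a → tl a x) (λ p → mi p y) labs places))
      (≤-trans (*-mono-≤ (labs-tl x) (places-mi y ok)) (≤-reflexive (*-identityˡ _)))

    -- A matched pair concerns at most `suc L` constraints for either choice of the tail: the tail
    -- fixes the label, and the place is a vertex on the front of the partner or the padding.
    constraint-bound : ∀ i o → ∑ (λ c → ν c i o) cs ≤ suc hi * suc L
    constraint-bound i o = begin
      ∑ (λ c → ∑ (ωs c) (match i o)) cs                          ≡⟨ ∑-swap ωs cs (match i o) ⟩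
      ∑ (λ p → ∑ (λ c → ωs c p) cs) (match i o)                  ≤⟨ ∑-mono-All (All.map (λ {p} ok → each p ok) (match-ok i o)) ⟩
      ∑ (λ p → suc L + suc L) (match i o)                        ≡⟨ ∑-match i o (λ _ → suc L) ⟩
      ∑ (λ _ → suc L) (J i)                                      ≡⟨ ∑-const (suc L) (J i) ⟩
      length (J i) * suc L                                       ≤⟨ *-monoˡ-≤ (suc L) J≤ ⟩
      suc hi * suc L                                             ∎
      where
      open ≤-Reasoning
      J≤ : length (J i) ≤ suc hi
      J≤ = ≤-trans (≤-reflexive (length-J i)) (≤-trans (+-mono-≤ (≤-trans (≤-reflexive (length-I i)) (≤-trans (heads≤size (head i)) (groupHigh good (head i)))) (pad-length {Edge} (length (I i)))) (≤-reflexive (+-comm hi 1)))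
      each : ∀ p → PairOk i p → ∑ (λ c → ωs c p) cs ≤ suc L + suc L
      each (x , y) ((ox , oy) , _) = ≤-trans (≤-reflexive (trans (∑-+ (λ c → ω c x y) (λ c → ω c y x) cs) (cong₂ _+_ (∑-cs (λ c → ω c x y)) (∑-cs (λ c → ω c y x)))))
        (+-mono-≤ (half-bound x y oy) (half-bound y x ox))

    abstract
      chosen : ∃ λ (α : Fin V → Fin m) → All (λ c → ∑ (λ i → sg (ν c i (α i))) (allFin V) ≤ r) cs
      chosen = LocalLemma.local-lemma m V r (M * M) hi (suc hi * suc L) m>0 cs ν σ option-bound supported support-bound constraint-bound numeric

    α : Fin V → Fin m
    α = proj₁ chosen

    -- The list `cs` has only labels that occur as tails in `U`. For any other label the support is
    -- empty and nothing hits.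
    few-hits : ∀ c → ∑ (λ i → sg (ν c i (α i))) (allFin V) ≤ r
    few-hits (a , p) with 0 <? ∑ (λ e → eqL a (l₀ e)) U
    ... | yes pos with ∑-pos-find (λ e → eqL a (l₀ e)) U pos
    ...   | e , e∈ , q with ind-pos (a ≟L l₀ e) q
    ...     | refl with ∑-pos-find (λ b → eqL b (l₀ e)) labs (Distinct.distinct-≥1 _≟L_ (map l₀ U) (∈-map⁺ l₀ e∈))
    ...       | b , b∈ , q' with ind-pos (b ≟L l₀ e) q'
    ...         | refl = All.lookup (proj₂ chosen) (∈-concatMap⁺ (λ a → map (a ,_) places) (Any.map (λ { refl → ∈-map⁺ (l₀ e ,_) (place p) }) b∈))
      where
      place : ∀ p → p ∈ places
      place nothing  = here refl
      place (just p) = there (∈-map⁺ just (∈-allFin p))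
    few-hits (a , p) | no ¬pos = ≤-trans (≤-reflexive (trans (∑-cong (λ i → cong sg (supported (a , p) i (α i) (empty i))) (allFin V)) (∑-zero (allFin V)))) z≤n
      where
      empty : ∀ i → σ (a , p) i ≡ 0
      empty i = ≤0⇒≡0 (≤-trans (∑-I≤ i _) (≤-reflexive (¬pos⇒≡0 _ ¬pos)))

    pr : Fin V → List (Maybe Edge × Maybe Edge)
    pr i = match i (α i)

    pr-ok : ∀ i → All (PairOk i) (pr i)
    pr-ok i = match-ok i (α i)

    mi≤1 : ∀ {i} p y → OkM i y → mi p y ≤ 1
    mi≤1 nothing  nothing  _ = ≤-refl
    mi≤1 nothing  (just _) _ = z≤n
    mi≤1 (just p) nothing  _ = z≤n
    mi≤1 (just p) (just f) (v , _) = ≤-trans (mult-front≤ p f) (simple v p)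

    hits : Cn → ℕ
    hits c = ∑ (λ i → ν c i (α i)) (allFin V)

    -- At most `r` groups hit `c`. One of them contributes no more than its arcs with tail in the
    -- label of `c`, because an arc has a single partner and a partner meets a place at most once.
    hits≤ : ∀ c → hits c ≤ r * M
    hits≤ c = ≤-trans (∑-mono one (allFin V)) (≤-trans (≤-reflexive (∑-*ʳ M (λ i → sg (ν c i (α i))) (allFin V))) (*-monoˡ-≤ M (few-hits c)))
      where
      ν≤M : ∀ i → ν c i (α i) ≤ M
      ν≤M i = ≤-trans (∑-mono-All (All.map (λ { {x , y} ((ox , oy) , _) → +-mono-≤
                (≤-trans (*-monoʳ-≤ (tl (proj₁ c) x) (mi≤1 (proj₂ c) y oy)) (≤-reflexive (*-identityʳ (tl (proj₁ c) x))))
                (≤-trans (*-monoʳ-≤ (tl (proj₁ c) y) (mi≤1 (proj₂ c) x ox)) (≤-reflexive (*-identityʳ (tl (proj₁ c) y)))) }) (pr-ok i)))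
              (≤-trans (≤-reflexive (trans (∑-match i (α i) (tl (proj₁ c))) (∑-tl (proj₁ c) i))) (tails≤M i (proj₁ c)))
      sg-scale : ∀ k → k ≤ M → k ≤ sg k * M
      sg-scale zero    _ = z≤n
      sg-scale (suc k) h = ≤-trans h (≤-reflexive (sym (*-identityˡ M)))
      one : ∀ i → ν c i (α i) ≤ sg (ν c i (α i)) * M
      one i = sg-scale _ (ν≤M i)

  -- The path graph after the stage

  keep : Edge → N.Edge
  keep e = N.mkEdge (inj₁ (l₀ e)) (int e) (inj₁ (l₁ e))

  join : Edge → Edge → N.Edge
  join e f = N.mkEdge (inj₂ (l₀ e)) (int e ++ tgt e ∷ reverse (int f)) (inj₂ (l₀ f))

  private
    out : Maybe Edge × Maybe Edge → List N.Edge
    out (just e  , just f)  = join e f ∷ []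
    out (just e  , nothing) = keep e ∷ []
    out (nothing , just f)  = keep f ∷ []
    out (nothing , nothing) = []

  H' : List N.Edge
  H' = map keep Keep ++ concatMap (λ i → concatMap out (pr i)) (allFin V)

  private
    new : (N.Edge → ℕ) → ℕ
    new w = ∑ (λ i → ∑ (λ p → ∑ w (out p)) (pr i)) (allFin V)

    ∑-H' : ∀ w → ∑ w H' ≡ ∑ (w ∘ keep) Keep + new w
    ∑-H' w = trans (∑-++ w (map keep Keep) _) (cong₂ _+_ (∑-map w keep Keep)
      (trans (∑-concatMap w (λ i → concatMap out (pr i)) (allFin V)) (∑-cong (λ i → ∑-concatMap w out (pr i)) (allFin V))))

    ext : (Edge → ℕ) → Maybe Edge → ℕ
    ext g nothing  = 0
    ext g (just e) = g e

    ∑-pairs : ∀ g → ∑ (λ i → ∑ (λ p → ext g (proj₁ p) + ext g (proj₂ p)) (pr i)) (allFin V) ≡ ∑ g U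
    ∑-pairs g = trans (∑-cong (λ i → trans (∑-match i (α i) (ext g)) (∑-J₀ i (ext g) refl)) (allFin V)) (∑-II g)

    new-cong : ∀ {w : N.Edge → ℕ} (f : Maybe Edge × Maybe Edge → ℕ) → (∀ {i} p → PairOk i p → ∑ w (out p) ≡ f p) →
               new w ≡ ∑ (λ i → ∑ f (pr i)) (allFin V)
    new-cong f h = ∑-cong (λ i → ∑-cong-All (All.map (λ {p} ok → h p ok) (pr-ok i))) (allFin V)

    new-mono : ∀ {w : N.Edge → ℕ} (f : Maybe Edge × Maybe Edge → ℕ) → (∀ {i} p → PairOk i p → ∑ w (out p) ≤ f p) →
               new w ≤ ∑ (λ i → ∑ f (pr i)) (allFin V)
    new-mono f h = ∑-mono (λ i → ∑-mono-All (All.map (λ {p} ok → h p ok) (pr-ok i))) (allFin V)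

    ∑∑-+ : ∀ (f g : Maybe Edge × Maybe Edge → ℕ) →
           ∑ (λ i → ∑ (λ p → f p + g p) (pr i)) (allFin V) ≡ ∑ (λ i → ∑ f (pr i)) (allFin V) + ∑ (λ i → ∑ g (pr i)) (allFin V)
    ∑∑-+ f g = trans (∑-cong (λ i → ∑-+ f g (pr i)) (allFin V)) (∑-+ _ _ (allFin V))

    exts : (Edge → ℕ) → Maybe Edge × Maybe Edge → ℕ
    exts g p = ext g (proj₁ p) + ext g (proj₂ p)

    eq₁ : ∀ a b → N.eqL (inj₁ a) (inj₁ b) ≡ eqL a b
    eq₁ a b = ind-cong (SumP.≡-dec _≟L_ _≟L_ (inj₁ a) (inj₁ b)) (a ≟L b) SumP.inj₁-injective (cong inj₁)

    eq₂ : ∀ a b → N.eqL (inj₂ a) (inj₂ b) ≡ eqL a b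
    eq₂ a b = ind-cong (SumP.≡-dec _≟L_ _≟L_ (inj₂ a) (inj₂ b)) (a ≟L b) SumP.inj₂-injective (cong inj₂)

    endL-keep : ∀ a e → N.endL (inj₁ a) (keep e) ≡ endL a e
    endL-keep a e = cong₂ _+_ (eq₁ a (l₀ e)) (eq₁ a (l₁ e))

    endL-join : ∀ a e f → N.endL (inj₂ a) (join e f) ≡ eqL a (l₀ e) + eqL a (l₀ f)
    endL-join a e f = cong₂ _+_ (eq₂ a (l₀ e)) (eq₂ a (l₀ f))

    kept : Lab → ℕ
    kept a = ∑ (endL a) Keep

    kept≡ : ∀ a → ∑ (λ e → N.endL (inj₁ a) (keep e)) Keep ≡ kept a
    kept≡ a = ∑-cong (endL-keep a) Keep

    -- A tail of `a` in `U` either bears the raised label afterwards or was matched with padding,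
    -- which `hits (a , nothing)` counts.
    upSize : ∀ a → ∑ (N.endL (inj₂ a)) H' + hits (a , nothing) ≡ ∑ (λ e → eqL a (l₀ e)) U
    upSize a = begin
      ∑ (N.endL (inj₂ a)) H' + hits (a , nothing)                    ≡⟨ cong (_+ hits (a , nothing)) (trans (∑-H' (N.endL (inj₂ a))) (cong (_+ new (N.endL (inj₂ a))) (∑-zero Keep))) ⟩
      new (N.endL (inj₂ a)) + hits (a , nothing)                     ≡⟨ sym (∑∑-+ (λ p → ∑ (N.endL (inj₂ a)) (out p)) (ωs (a , nothing))) ⟩
      ∑ (λ i → ∑ (λ p → ∑ (N.endL (inj₂ a)) (out p) + ωs (a , nothing) p) (pr i)) (allFin V) ≡⟨ ∑-cong (λ i → ∑-cong point (pr i)) (allFin V) ⟩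
      ∑ (λ i → ∑ (exts (λ e → eqL a (l₀ e))) (pr i)) (allFin V)      ≡⟨ ∑-pairs (λ e → eqL a (l₀ e)) ⟩
      ∑ (λ e → eqL a (l₀ e)) U                                       ∎
      where
      open ≡-Reasoning
      k₁ : ∀ x y → x + y + 0 + (x * 0 + y * 0) ≡ x + y
      k₁ = solve-∀
      k₂ : ∀ x → x * 1 + 0 ≡ x + 0
      k₂ = solve-∀
      k₃ : ∀ x → x * 1 ≡ x
      k₃ = solve-∀
      point : ∀ p → ∑ (N.endL (inj₂ a)) (out p) + ωs (a , nothing) p ≡ exts (λ e → eqL a (l₀ e)) p
      point (just e  , just f)  = trans (cong (λ z → z + 0 + (eqL a (l₀ e) * 0 + eqL a (l₀ f) * 0)) (endL-join a e f)) (k₁ (eqL a (l₀ e)) (eqL a (l₀ f)))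
      point (just e  , nothing) = k₂ (eqL a (l₀ e))
      point (nothing , just f)  = k₃ (eqL a (l₀ f))
      point (nothing , nothing) = refl

    keptSize : ∀ a → ∑ (N.endL (inj₁ a)) H' ≡ kept a + new (N.endL (inj₁ a))
    keptSize a = trans (∑-H' (N.endL (inj₁ a))) (cong (_+ new (N.endL (inj₁ a))) (kept≡ a))

    ∑-UK : ∀ a → kept a + ∑ (endL a) U ≡ ∑ (endL a) H
    ∑-UK a = splits (endL a) (endL-flip a)

    new-endL₁ : ∀ a {i} p → PairOk i p → ∑ (N.endL (inj₁ a)) (out p) ≤ exts (endL a) p
    new-endL₁ a (just e  , just f)  _ = z≤n
    new-endL₁ a (just e  , nothing) _ = ≤-reflexive (cong (_+ 0) (endL-keep a e))
    new-endL₁ a (nothing , just f)  _ = ≤-reflexive (trans (+-identityʳ _) (endL-keep a f))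
    new-endL₁ a (nothing , nothing) _ = z≤n

    size₁≤ : ∀ a → ∑ (N.endL (inj₁ a)) H' ≤ ∑ (endL a) H
    size₁≤ a = ≤-trans (≤-reflexive (keptSize a)) (≤-trans (+-monoʳ-≤ (kept a) (≤-trans (new-mono (exts (endL a)) (λ {i} → new-endL₁ a {i})) (≤-reflexive (∑-pairs (endL a))))) (≤-reflexive (∑-UK a)))

    -- The arcs of `U` that return unjoined are those matched with padding: at most `r * M` with
    -- tail in `a`, by the bound on hits, and at most one with head in `a`, because each matching
    -- has at most one padding.
    size₁-upper : ∀ a → ∑ (N.endL (inj₁ a)) H' ≤ kept a + (r * M + 1)
    size₁-upper a = ≤-trans (≤-reflexive (keptSize a)) (+-monoʳ-≤ (kept a) (begin
      new (N.endL (inj₁ a))                                                        ≤⟨ ∑-mono (λ i → ∑-mono-All (All.map (λ {p} ok → point i p ok) (pr-ok i))) (allFin V) ⟩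
      ∑ (λ i → ∑ (λ p → ωs (a , nothing) p + eqL a (head i) * (mi nothing (proj₁ p) + mi nothing (proj₂ p))) (pr i)) (allFin V)
                                                                                   ≡⟨ trans (∑-cong (λ i → ∑-+ (ωs (a , nothing)) _ (pr i)) (allFin V)) (∑-+ _ _ (allFin V)) ⟩
      hits (a , nothing) + ∑ (λ i → ∑ (λ p → eqL a (head i) * (mi nothing (proj₁ p) + mi nothing (proj₂ p))) (pr i)) (allFin V)
                                                                                   ≤⟨ +-mono-≤ (hits≤ (a , nothing)) (∑-mono heads (allFin V)) ⟩
      r * M + ∑ (λ i → eqL a (head i)) (allFin V)                                  ≡⟨ cong (r * M +_) (trans (∑-heads (eqL a)) (∑-cong (eqL-sym a) hs)) ⟩
      r * M + ∑ (λ h → eqL h a) hs                                                 ≤⟨ +-monoʳ-≤ (r * M) (Distinct.distinct-≤1 _≟L_ (map l₁ U) a) ⟩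
      r * M + 1                                                                    ∎))
      where
      open ≤-Reasoning
      k₂ : ∀ x y → x + y + 0 ≡ x * 1 + 0 + y * (0 + 1)
      k₂ = solve-∀
      k₃ : ∀ x y → x + y + 0 ≡ x * 1 + y * (1 + 0)
      k₃ = solve-∀
      point : ∀ i p → PairOk i p → ∑ (N.endL (inj₁ a)) (out p) ≤ ωs (a , nothing) p + eqL a (head i) * (mi nothing (proj₁ p) + mi nothing (proj₂ p))
      point i (just e  , just f)  _ = z≤n
      point i (just e  , nothing) (((_ , h , _) , _) , _) = ≤-reflexive (trans (cong (_+ 0) (trans (endL-keep a e) (cong (λ z → eqL a (l₀ e) + eqL a z) (sym h)))) (k₂ (eqL a (l₀ e)) (eqL a (head i))))
      point i (nothing , just f)  ((_ , (_ , h , _)) , _) = ≤-reflexive (trans (cong (_+ 0) (trans (endL-keep a f) (cong (λ z → eqL a (l₀ f) + eqL a z) (sym h)))) (k₃ (eqL a (l₀ f)) (eqL a (head i))))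
      point i (nothing , nothing) _ = z≤n
      heads : ∀ i → ∑ (λ p → eqL a (head i) * (mi nothing (proj₁ p) + mi nothing (proj₂ p))) (pr i) ≤ eqL a (head i)
      heads i = ≤-trans (≤-reflexive (trans (∑-*ˡ (eqL a (head i)) _ (pr i)) (cong (eqL a (head i) *_)
          (trans (∑-match i (α i) (mi nothing)) (trans (∑-J i (mi nothing)) (cong (_+ ∑ (mi nothing) (pad (length (I i)))) (∑-zero (I i))))))))
        (≤-trans (*-monoʳ-≤ (eqL a (head i)) (≤-trans (∑-≤-length (pad-nothing (λ x → mi nothing x ≤ 1) ≤-refl (length (I i)))) (≤-trans (≤-reflexive (*-identityʳ _)) (pad-length {Edge} (length (I i))))))
          (≤-reflexive (*-identityʳ (eqL a (head i)))))

    mult-join : ∀ p e f → mult p (N.verts (join e f)) ≡ mult p (verts e) + mult p (front f)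
    mult-join p e f = begin
      eqV p (src e) + mult p ((int e ++ tgt e ∷ reverse (int f)) ++ src f ∷ [])   ≡⟨ cong (eqV p (src e) +_) (trans (∑-++ (eqV p) (int e ++ tgt e ∷ reverse (int f)) _) (cong (_+ (eqV p (src f) + 0)) (∑-++ (eqV p) (int e) _))) ⟩
      eqV p (src e) + (mult p (int e) + (eqV p (tgt e) + mult p (reverse (int f))) + (eqV p (src f) + 0)) ≡⟨ cong (λ z → eqV p (src e) + (mult p (int e) + (eqV p (tgt e) + z) + (eqV p (src f) + 0))) (mult-reverse p (int f)) ⟩
      eqV p (src e) + (mult p (int e) + (eqV p (tgt e) + mult p (int f)) + (eqV p (src f) + 0)) ≡⟨ l (eqV p (src e)) (mult p (int e)) (eqV p (tgt e)) (mult p (int f)) (eqV p (src f)) ⟩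
      mult p (front e) + eqV p (tgt e) + mult p (front f)                                        ≡⟨ cong (_+ mult p (front f)) (sym (mult-verts p e)) ⟩
      mult p (verts e) + mult p (front f)                                                        ∎
      where
      open ≡-Reasoning
      l : ∀ a b c d e → a + (b + (c + d) + (e + 0)) ≡ a + b + c + (e + d)
      l = solve-∀

    same-tgt : ∀ {i e f} → OkM i (just e) → OkM i (just f) → tgt e ≡ tgt f
    same-tgt (_ , h , _) (_ , h' , _) = cong vOf (trans (sym h) h')

    mult-join' : ∀ p {i} e f → OkM i (just e) → OkM i (just f) → mult p (N.verts (join e f)) ≡ mult p (verts f) + mult p (front e)
    mult-join' p {i} e f oe of' = trans (mult-join p e f) (trans (cong (_+ mult p (front f)) (mult-verts p e))
      (trans (cong (λ z → mult p (front e) + eqV p z + mult p (front f)) (same-tgt {i} {e} {f} oe of'))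
      (trans (l (mult p (front e)) (eqV p (tgt f)) (mult p (front f))) (cong (_+ mult p (front e)) (sym (mult-verts p f))))))
      where
      l : ∀ a b c → a + b + c ≡ c + b + a
      l = solve-∀

    verts-join : ∀ e f → N.verts (join e f) ≡ front e ++ tgt e ∷ (reverse (int f) ++ src f ∷ [])
    verts-join e f = cong (src e ∷_) (++-assoc (int e) (tgt e ∷ reverse (int f)) (src f ∷ []))

    occ-join : ∀ x y {i} e f → OkM i (just e) → OkM i (just f) → occ x y (N.verts (join e f)) ≡ occ x y (verts e) + occ x y (verts f)
    occ-join x y {i} e f oe of' = trans (cong (occ x y) (verts-join e f)) (trans (occ-split x y (front e) (tgt e) _)
      (cong (occ x y (verts e) +_) (trans (cong (λ z → occ x y (z ∷ reverse (int f) ++ src f ∷ [])) (same-tgt {i} {e} {f} oe of')) (occ-flip x y f))))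

    valid-keep : ∀ {e} → Valid L e → N.Valid (suc (2 * L)) (keep e)
    valid-keep v = record { simple = simple v ; sameLevel = sameLevel v ; levelLow = levelLow v ; short = ≤-trans (short v) (≤-trans (m≤m+n L (L + 0)) (n≤1+n _)) }

    valid-join : ∀ {i} e f → OkM i (just e) → OkM i (just f) → inter (front e) (front f) ≡ 0 → N.Valid (suc (2 * L)) (join e f)
    valid-join {i} e f oe@(ve , _ , le) of'@(vf , _ , lf) no-conflict = record
      { simple = sim
      ; sameLevel = cong suc (trans le (sym lf))
      -- The common head becomes an interior vertex, and this pays for the raised level.
      ; levelLow = ≤-trans (s≤s (levelLow ve)) (≤-trans (s≤s (m≤m+n (length (int e)) (length (int f)))) (≤-reflexive (sym len)))
      ; short = ≤-trans (≤-reflexive len) (s≤s (≤-trans (+-mono-≤ (short ve) (short vf)) (≤-reflexive (cong (L +_) (sym (+-identityʳ L)))))) }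
      where
      len : length (int e ++ tgt e ∷ reverse (int f)) ≡ suc (length (int e) + length (int f))
      len = trans (length-++ (int e)) (trans (+-suc (length (int e)) _) (cong (λ z → suc (length (int e) + z)) (length-reverse' (int f))))
      sim : ∀ p → mult p (N.verts (join e f)) ≤ 1
      sim p with 0 <? mult p (front e)
      ... | yes pos = ≤-trans (≤-reflexive (trans (mult-join p e f) (trans (cong (mult p (verts e) +_) (inter-zero (front e) (front f) no-conflict pos)) (+-identityʳ _)))) (simple ve p)
      ... | no ¬pos = ≤-trans (≤-reflexive (trans (mult-join' p {i} e f oe of') (trans (cong (mult p (verts f) +_) (¬pos⇒≡0 _ ¬pos)) (+-identityʳ _)))) (simple vf p)

    out-valid : ∀ {i} p → PairOk i p → All (N.Valid (suc (2 * L))) (out p)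
    out-valid {i} (just e  , just f)  ((oe , of') , c) = valid-join {i} e f oe of' c ∷ []
    out-valid (just e  , nothing) (((v , _) , _) , _) = valid-keep v ∷ []
    out-valid (nothing , just f)  ((_ , (v , _)) , _) = valid-keep v ∷ []
    out-valid (nothing , nothing) _                   = []

    valid' : All (N.Valid (suc (2 * L))) H'
    valid' = AllP.++⁺ (AllP.map⁺ (All.map valid-keep Keep-valid))
      (AllP.concat⁺ (AllP.map⁺ (All.tabulate {xs = allFin V} (λ {i} _ → AllP.concat⁺ (AllP.map⁺ (All.map (λ {p} → out-valid {i} p) (pr-ok i)))))))

    joined' : Joined N.src N.tgt H'
    joined' R c = Keep-joined R (AllP.map⁻ (AllP.++⁻ˡ (map keep Keep) c))

    -- A join removes two path ends and both lie at the joint, so each vertex loses an even number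
    -- of ends.
    even' : ∀ y → 2 ∣ ∑ (N.endV y) H'
    even' y = ∣m+n∣m⇒∣n (subst (2 ∣_) (sym total) (even good y)) (m∣m*n joint)
      where
      joints : Maybe Edge × Maybe Edge → ℕ
      joints (just e  , just f)  = eqV y (tgt e)
      joints (just e  , nothing) = 0
      joints (nothing , just f)  = 0
      joints (nothing , nothing) = 0
      joint : ℕ
      joint = ∑ (λ i → ∑ joints (pr i)) (allFin V)
      point : ∀ {i} p → PairOk i p → 2 * joints p + ∑ (N.endV y) (out p) ≡ exts (endV y) p
      point {i} (just e , just f) ((oe , of') , _) = trans (k (eqV y (tgt e)) (eqV y (src e)) (eqV y (src f))) (cong (λ z → eqV y (src e) + eqV y (tgt e) + (eqV y (src f) + eqV y z)) (same-tgt {i} {e} {f} oe of'))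
        where
        k : ∀ t a b → 2 * t + (a + b + 0) ≡ a + t + (b + t)
        k = solve-∀
      point (just e  , nothing) _ = refl
      point (nothing , just f)  _ = +-identityʳ (endV y f)
      point (nothing , nothing) _ = refl
      total : 2 * joint + ∑ (N.endV y) H' ≡ ∑ (endV y) H
      total = begin
        2 * joint + ∑ (N.endV y) H'                               ≡⟨ cong (2 * joint +_) (∑-H' (N.endV y)) ⟩
        2 * joint + (∑ (endV y) Keep + new (N.endV y))            ≡⟨ k (2 * joint) (∑ (endV y) Keep) (new (N.endV y)) ⟩
        ∑ (endV y) Keep + (2 * joint + new (N.endV y))            ≡⟨ cong (λ z → ∑ (endV y) Keep + (z + new (N.endV y))) (trans (sym (∑-*ˡ 2 _ (allFin V))) (∑-cong (λ i → sym (∑-*ˡ 2 joints (pr i))) (allFin V))) ⟩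
        ∑ (endV y) Keep + (∑ (λ i → ∑ (λ p → 2 * joints p) (pr i)) (allFin V) + new (N.endV y)) ≡⟨ cong (∑ (endV y) Keep +_) (sym (∑∑-+ (λ p → 2 * joints p) (λ p → ∑ (N.endV y) (out p)))) ⟩
        ∑ (endV y) Keep + ∑ (λ i → ∑ (λ p → 2 * joints p + ∑ (N.endV y) (out p)) (pr i)) (allFin V) ≡⟨ cong (∑ (endV y) Keep +_) (trans (∑-cong (λ i → ∑-cong-All (All.map (λ {p} ok → point {i} p ok) (pr-ok i))) (allFin V)) (∑-pairs (endV y))) ⟩
        ∑ (endV y) Keep + ∑ (endV y) U                            ≡⟨ splits (endV y) (endV-flip y) ⟩
        ∑ (endV y) H                                              ∎
        where
        open ≡-Reasoning
        k : ∀ a b c → a + (b + c) ≡ b + (a + c)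
        k = solve-∀

    covers' : ∀ x y → ∑ (λ e → occ x y (N.verts e)) H' ≡ adj x y
    covers' x y = begin
      ∑ (λ e → occ x y (N.verts e)) H'                             ≡⟨ ∑-H' (λ e → occ x y (N.verts e)) ⟩
      ∑ w Keep + new (λ e → occ x y (N.verts e))                   ≡⟨ cong (∑ w Keep +_) (trans (new-cong (exts w) (λ {i} → point {i})) (∑-pairs w)) ⟩
      ∑ w Keep + ∑ w U                                             ≡⟨ splits w (occ-flip x y) ⟩
      ∑ w H                                                        ≡⟨ covers good x y ⟩
      adj x y                                                      ∎
      where
      open ≡-Reasoning
      w : Edge → ℕ
      w e = occ x y (verts e)
      point : ∀ {i} p → PairOk i p → ∑ (λ e → occ x y (N.verts e)) (out p) ≡ exts w p
      point {i} (just e , just f) ((oe , of') , _) = trans (+-identityʳ _) (occ-join x y {i} e f oe of')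
      point (just e  , nothing) _ = refl
      point (nothing , just f)  _ = +-identityʳ _
      point (nothing , nothing) _ = refl

    -- For a raised label, a joined path meets `p` on its own old part, which is an old conflict, or
    -- on the front of the partner, which is a hit of `(a , just p)`. Kept labels gain no conflicts.
    conflict' : ∀ a p → p ≢ Labels.vOf (raise Λ) a → ∑ (λ e → N.endL a e * mult p (N.verts e)) H' ≤ M + r * M
    conflict' (inj₁ a) p p≢ = begin
      ∑ w' H'                          ≡⟨ ∑-H' w' ⟩
      ∑ (w' ∘ keep) Keep + new w'      ≤⟨ +-mono-≤ (≤-reflexive (∑-cong (λ e → cong (_* mult p (verts e)) (endL-keep a e)) Keep)) (≤-trans (new-mono (exts w) (λ {i} → point {i})) (≤-reflexive (∑-pairs w))) ⟩
      ∑ w Keep + ∑ w U                 ≡⟨ splits w (confWeight-flip a p) ⟩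
      ∑ w H                            ≤⟨ conflict good a p p≢ ⟩
      M                                ≤⟨ m≤m+n M _ ⟩
      M + r * M                        ∎
      where
      open ≤-Reasoning
      w = confWeight a p
      w' : N.Edge → ℕ
      w' e = N.endL (inj₁ a) e * mult p (N.verts e)
      point : ∀ {i} q → PairOk i q → ∑ w' (out q) ≤ exts w q
      point (just e  , just f)  _ = z≤n
      point (just e  , nothing) _ = ≤-reflexive (cong (λ z → z * mult p (verts e) + 0) (endL-keep a e))
      point (nothing , just f)  _ = ≤-reflexive (trans (+-identityʳ _) (cong (_* mult p (verts f)) (endL-keep a f)))
      point (nothing , nothing) _ = z≤n
    conflict' (inj₂ a) p p≢ = begin
      ∑ w' H'                                       ≡⟨ trans (∑-H' w') (cong (_+ new w') (∑-zero Keep)) ⟩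
      new w'                                        ≤⟨ new-mono (λ q → exts w q + ωs (a , just p) q) (λ {i} → point {i}) ⟩
      ∑ (λ i → ∑ (λ q → exts w q + ωs (a , just p) q) (pr i)) (allFin V) ≡⟨ ∑∑-+ (exts w) (ωs (a , just p)) ⟩
      ∑ (λ i → ∑ (exts w) (pr i)) (allFin V) + hits (a , just p)         ≤⟨ +-mono-≤ (≤-trans (≤-reflexive (∑-pairs w)) (≤-trans (U≤H w (confWeight-flip a p)) (conflict good a p p≢))) (hits≤ (a , just p)) ⟩
      M + r * M                                     ∎
      where
      open ≤-Reasoning
      w = confWeight a p
      w' : N.Edge → ℕ
      w' e = N.endL (inj₂ a) e * mult p (N.verts e)
      k : ∀ a b me mf fe ff → a * (me + ff) + b * (mf + fe) ≡ a * me + b * mf + (a * ff + b * fe)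
      k = solve-∀
      point : ∀ {i} q → PairOk i q → ∑ w' (out q) ≤ exts w q + ωs (a , just p) q
      point {i} (just e , just f) ((oe , of') , _) = begin
        N.endL (inj₂ a) (join e f) * mult p (N.verts (join e f)) + 0   ≡⟨ trans (+-identityʳ _) (trans (cong (_* mult p (N.verts (join e f))) (endL-join a e f)) (*-distribʳ-+ (mult p (N.verts (join e f))) (eqL a (l₀ e)) (eqL a (l₀ f)))) ⟩
        eqL a (l₀ e) * mult p (N.verts (join e f)) + eqL a (l₀ f) * mult p (N.verts (join e f)) ≡⟨ cong₂ (λ s t → eqL a (l₀ e) * s + eqL a (l₀ f) * t) (mult-join p e f) (mult-join' p {i} e f oe of') ⟩
        eqL a (l₀ e) * (mult p (verts e) + mult p (front f)) + eqL a (l₀ f) * (mult p (verts f) + mult p (front e)) ≡⟨ k (eqL a (l₀ e)) (eqL a (l₀ f)) (mult p (verts e)) (mult p (verts f)) (mult p (front e)) (mult p (front f)) ⟩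
        eqL a (l₀ e) * mult p (verts e) + eqL a (l₀ f) * mult p (verts f) + (eqL a (l₀ e) * mult p (front f) + eqL a (l₀ f) * mult p (front e)) ≤⟨ +-monoˡ-≤ _ (+-mono-≤ (*-monoˡ-≤ (mult p (verts e)) (m≤m+n (eqL a (l₀ e)) (eqL a (l₁ e)))) (*-monoˡ-≤ (mult p (verts f)) (m≤m+n (eqL a (l₀ f)) (eqL a (l₁ f))))) ⟩
        exts w (just e , just f) + ωs (a , just p) (just e , just f) ∎
      point (just e  , nothing) _ = z≤n
      point (nothing , just f)  _ = z≤n
      point (nothing , nothing) _ = z≤n

    -- Sizes of groups and levels after the stage

    endL-U : ∀ a → ∑ (endL a) U ≡ ∑ (λ e → eqL a (l₀ e)) U + ∑ (λ e → eqL a (l₁ e)) U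
    endL-U a = ∑-+ (λ e → eqL a (l₀ e)) (λ e → eqL a (l₁ e)) U

    inactive-U : ∀ a → lev a ≢ j → ∑ (endL a) U ≡ 0
    inactive-U a la = ∑-zero-All (All.zipWith (λ { {e} (v , l) → cong₂ _+_
      (ind-no (a ≟L l₀ e) (λ h → la (trans (cong lev h) l)))
      (ind-no (a ≟L l₁ e) (λ h → la (trans (cong lev h) (trans (sym (sameLevel v)) l)))) }) (U-valid , U-level))

    inactive₁ : ∀ a → lev a ≢ j → ∑ (endL a) H ≤ ∑ (N.endL (inj₁ a)) H'
    inactive₁ a la = ≤-trans (≤-reflexive (trans (sym (∑-UK a)) (trans (cong (kept a +_) (inactive-U a la)) (+-identityʳ _)))) (≤-trans (m≤m+n (kept a) _) (≤-reflexive (sym (keptSize a))))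

    size₂≤ : ∀ a → ∑ (N.endL (inj₂ a)) H' ≤ ∑ (λ e → eqL a (l₀ e)) U
    size₂≤ a = ≤-trans (m≤m+n _ (hits (a , nothing))) (≤-reflexive (upSize a))

    inactive₂ : ∀ a → lev a ≢ j → ∑ (N.endL (inj₂ a)) H' ≡ 0
    inactive₂ a la = ≤0⇒≡0 (≤-trans (size₂≤ a) (≤-trans (∑-mono (λ e → m≤m+n (eqL a (l₀ e)) (eqL a (l₁ e))) U) (≤-reflexive (inactive-U a la))))

    large : ∀ a → 0 < ∑ (endL a) H → 100 * (r * M + 1) ≤ ∑ (endL a) H
    large a pos = ≤-trans (*-monoʳ-≤ 100 (≤-trans (m≤n+m (r * M + 1) (suc L * M + m)) (≤-reflexive (sym (+-assoc (suc L * M + m) (r * M) 1))))) (≤-trans room (groupLow good a pos))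

    -- Since `k` is at least `100 * (ρ + 1)`, rounding and the `ρ` unjoined tails cost at most half
    -- of the `k / 8` selected tails.
    up-arith : ∀ {k u s h ρ} → k ≤ 8 * u + 9 → s + h ≡ u → h ≤ ρ → 100 * (ρ + 1) ≤ k → k ≤ 16 * s
    up-arith {k} {_} {s} {h} {ρ} h₁ refl h₂ h₃ = ≤-of-slack (82 + 84 * ρ) (+-mono-≤ (*-monoʳ-≤ 2 h₁) (+-mono-≤ (*-monoʳ-≤ 16 h₂) h₃)) (l k s h ρ)
      where
      l : ∀ k s h ρ → k + (2 * (8 * (s + h) + 9) + (16 * ρ + k)) + (82 + 84 * ρ) ≡ 16 * s + (2 * k + (16 * h + 100 * (ρ + 1)))
      l = solve-∀

    -- Tails and heads in `U` amount to about `k / 4` and at most `ρ + 1` ends come back, so an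
    -- eighth of the group is surely lost.
    shrink-arith : ∀ {k u v kp s ρ} → k ≤ 8 * u + 9 → k ≤ 8 * v + 9 → kp + (u + v) ≡ k → s ≤ kp + (ρ + 1) → 100 * (ρ + 1) ≤ k → 8 * s ≤ 7 * k
    shrink-arith {_} {u} {v} {kp} {s} {ρ} h₁ h₂ refl h₄ h₅ = ≤-of-slack (74 + 92 * ρ) (+-mono-≤ h₁ (+-mono-≤ h₂ (+-mono-≤ (*-monoʳ-≤ 8 h₄) h₅))) (l u v kp s ρ)
      where
      l : ∀ u v kp s ρ → 8 * s + (8 * u + 9 + (8 * v + 9 + (8 * (kp + (ρ + 1)) + (kp + (u + v))))) + (74 + 92 * ρ)
        ≡ 7 * (kp + (u + v)) + (kp + (u + v) + (kp + (u + v) + (8 * s + 100 * (ρ + 1))))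
      l = solve-∀

    -- Tails and heads in `U` amount to at most about `k / 2`; the weaker sixteenth is chosen to
    -- agree with the bound for raised groups.
    keep-arith : ∀ {k u v kp s ρ} → 4 * u ≤ k + 3 → 4 * v ≤ k + 3 → kp + (u + v) ≡ k → kp ≤ s → 100 * (ρ + 1) ≤ k → k ≤ 16 * s
    keep-arith {_} {u} {v} {kp} {s} {ρ} h₁ h₂ refl h₄ h₅ = ≤-of-slack (6 * kp + 6 * u + 6 * v + 76 + 100 * ρ) (+-mono-≤ (*-monoʳ-≤ 4 h₁) (+-mono-≤ (*-monoʳ-≤ 4 h₂) (+-mono-≤ (*-monoʳ-≤ 16 h₄) h₅))) (l u v kp s ρ)
      where
      l : ∀ u v kp s ρ → kp + (u + v) + (4 * (kp + (u + v) + 3) + (4 * (kp + (u + v) + 3) + (16 * s + (kp + (u + v))))) + (6 * kp + 6 * u + 6 * v + 76 + 100 * ρ)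
        ≡ 16 * s + (4 * (4 * u) + (4 * (4 * v) + (16 * kp + 100 * (ρ + 1))))
      l = solve-∀

    kp-split : ∀ a → kept a + (∑ (λ e → eqL a (l₀ e)) U + ∑ (λ e → eqL a (l₁ e)) U) ≡ ∑ (endL a) H
    kp-split a = trans (cong (kept a +_) (sym (endL-U a))) (∑-UK a)

    grow-label : ∀ a → lev a ≡ j → ∑ (endL a) H ≤ 16 * ∑ (N.endL (inj₂ a)) H'
    grow-label a la with 0 <? ∑ (endL a) H
    ... | yes pos = up-arith {u = ∑ (λ e → eqL a (l₀ e)) U} {ρ = r * M} (tails-low a la) (upSize a) (hits≤ (a , nothing)) (large a pos)
    ... | no ¬pos = ≤-trans (≤-reflexive (¬pos⇒≡0 _ ¬pos)) z≤n

    shrink-label : ∀ a → lev a ≡ j → 8 * ∑ (N.endL (inj₁ a)) H' ≤ 7 * ∑ (endL a) H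
    shrink-label a la with 0 <? ∑ (endL a) H
    ... | yes pos = shrink-arith {u = ∑ (λ e → eqL a (l₀ e)) U} {v = ∑ (λ e → eqL a (l₁ e)) U} {kp = kept a} {ρ = r * M} (tails-low a la) (heads-low a la) (kp-split a) (size₁-upper a) (large a pos)
    ... | no ¬pos = ≤-trans (*-monoʳ-≤ 8 (≤-trans (size₁≤ a) (≤-reflexive (¬pos⇒≡0 _ ¬pos)))) z≤n

    kept-label : ∀ a → 0 < ∑ (endL a) H → ∑ (endL a) H ≤ 16 * ∑ (N.endL (inj₁ a)) H'
    kept-label a pos = keep-arith {u = ∑ (λ e → eqL a (l₀ e)) U} {v = ∑ (λ e → eqL a (l₁ e)) U} {kp = kept a} {ρ = r * M} (tails-high a) (heads-high a) (kp-split a) (≤-trans (m≤m+n (kept a) _) (≤-reflexive (sym (keptSize a)))) (large a pos)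

  stage-good : ∀ {lo'} → 16 * lo' ≤ lo → N.Good adj (suc (2 * L)) (M + r * M) lo' hi H'
  stage-good {lo'} lo'≤ = record
    { valid = valid' ; joined = joined' ; even = even' ; covers = covers' ; conflict = conflict'
    ; groupHigh = λ { (inj₁ a) → ≤-trans (size₁≤ a) (groupHigh good a) ; (inj₂ a) → ≤-trans (size₂≤ a) (≤-trans (tails≤size a) (groupHigh good a)) }
    ; groupLow = low }
    where
    low : ∀ a → 0 < ∑ (N.endL a) H' → lo' ≤ ∑ (N.endL a) H'
    low (inj₁ a) pos = *-cancelˡ-≤ 16 (≤-trans lo'≤ (≤-trans (groupLow good a pos') (kept-label a pos')))
      where
      pos' : 0 < ∑ (endL a) H
      pos' = ≤-trans pos (size₁≤ a)
    low (inj₂ a) pos with lev a ≟ j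
    ... | no la  = ⊥-elim (<-irrefl (sym (inactive₂ a la)) pos)
    ... | yes la = *-cancelˡ-≤ 16 (≤-trans lo'≤ (≤-trans (groupLow good a (≤-trans pos (≤-trans (size₂≤ a) (tails≤size a)))) (grow-label a la)))

  private
    collapse : Lab ⊎ Lab → Lab
    collapse (inj₁ a) = a
    collapse (inj₂ a) = a

    fibre : ∀ (φ : Lab ⊎ Lab → ℕ) a → ∑ (λ x → eqL a (collapse x) * φ x) (N.endLabels H')
            ≡ φ (inj₁ a) * ∑ (N.endL (inj₁ a)) H' + φ (inj₂ a) * ∑ (N.endL (inj₂ a)) H'
    fibre φ a = begin
      ∑ (λ x → eqL a (collapse x) * φ x) (N.endLabels H')                              ≡⟨ ∑-cong point (N.endLabels H') ⟩
      ∑ (λ x → φ (inj₁ a) * N.eqL (inj₁ a) x + φ (inj₂ a) * N.eqL (inj₂ a) x) (N.endLabels H') ≡⟨ ∑-+ _ _ (N.endLabels H') ⟩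
      ∑ (λ x → φ (inj₁ a) * N.eqL (inj₁ a) x) (N.endLabels H') + ∑ (λ x → φ (inj₂ a) * N.eqL (inj₂ a) x) (N.endLabels H')
        ≡⟨ cong₂ _+_ (trans (∑-*ˡ (φ (inj₁ a)) _ (N.endLabels H')) (cong (φ (inj₁ a) *_) (N.∑-endLabels (N.eqL (inj₁ a)) H')))
                     (trans (∑-*ˡ (φ (inj₂ a)) _ (N.endLabels H')) (cong (φ (inj₂ a) *_) (N.∑-endLabels (N.eqL (inj₂ a)) H'))) ⟩
      φ (inj₁ a) * ∑ (N.endL (inj₁ a)) H' + φ (inj₂ a) * ∑ (N.endL (inj₂ a)) H' ∎
      where
      open ≡-Reasoning
      point : ∀ x → eqL a (collapse x) * φ x ≡ φ (inj₁ a) * N.eqL (inj₁ a) x + φ (inj₂ a) * N.eqL (inj₂ a) x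
      point (inj₁ b) rewrite eq₁ a b | *-zeroʳ (φ (inj₂ a)) | +-identityʳ (φ (inj₁ a) * eqL a b) with a ≟L b
      ... | yes refl = *-comm 1 (φ (inj₁ a))
      ... | no _     = sym (*-zeroʳ (φ (inj₁ a)))
      point (inj₂ b) rewrite eq₂ a b | *-zeroʳ (φ (inj₁ a)) with a ≟L b
      ... | yes refl = *-comm 1 (φ (inj₂ a))
      ... | no _     = sym (*-zeroʳ (φ (inj₂ a)))

    fibre₀ : ∀ (φ : Lab → ℕ) a → ∑ (λ x → eqL a x * φ x) (endLabels H) ≡ φ a * ∑ (endL a) H
    fibre₀ φ a = trans (∑-cong point (endLabels H)) (trans (∑-*ˡ (φ a) _ (endLabels H)) (cong (φ a *_) (∑-endLabels (eqL a) H)))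
      where
      point : ∀ x → eqL a x * φ x ≡ φ a * eqL a x
      point x with a ≟L x
      ... | yes refl = *-comm 1 (φ a)
      ... | no _     = sym (*-zeroʳ (φ a))

    old→new : ∀ p q y i i' → (∀ a → p * (atLevel i y a * ∑ (endL a) H) ≤ q * (N.atLevel i' y (inj₁ a) * ∑ (N.endL (inj₁ a)) H' + N.atLevel i' y (inj₂ a) * ∑ (N.endL (inj₂ a)) H')) →
              p * levelEnds i y H ≤ q * N.levelEnds i' y H'
    old→new p q y i i' h = subst₂ _≤_ (cong (p *_) (∑-endLabels (atLevel i y) H)) (cong (q *_) (N.∑-endLabels (N.atLevel i' y) H'))
      (Distinct.fibrewise-ratio _≟L_ p q (endLabels H) id (atLevel i y) (N.endLabels H') collapse (N.atLevel i' y)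
        (λ a → subst₂ _≤_ (cong (p *_) (sym (fibre₀ (atLevel i y) a))) (cong (q *_) (sym (fibre (N.atLevel i' y) a))) (h a)))

    new→old : ∀ p q y i → (∀ a → p * (N.atLevel i y (inj₁ a) * ∑ (N.endL (inj₁ a)) H' + N.atLevel i y (inj₂ a) * ∑ (N.endL (inj₂ a)) H') ≤ q * (atLevel i y a * ∑ (endL a) H)) →
              p * N.levelEnds i y H' ≤ q * levelEnds i y H
    new→old p q y i h = subst₂ _≤_ (cong (p *_) (N.∑-endLabels (N.atLevel i y) H')) (cong (q *_) (∑-endLabels (atLevel i y) H))
      (Distinct.fibrewise-ratio _≟L_ p q (N.endLabels H') collapse (N.atLevel i y) (endLabels H) id (atLevel i y)
        (λ a → subst₂ _≤_ (cong (p *_) (sym (fibre (N.atLevel i y) a))) (cong (q *_) (sym (fibre₀ (atLevel i y) a))) (h a)))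

    -- Raised labels are in use only for groups of level `j`, and they then have level `suc j`.
    no-up : ∀ y i a → i ≢ suc j → N.atLevel i y (inj₂ a) * ∑ (N.endL (inj₂ a)) H' ≡ 0
    no-up y i a i≢ with lev a ≟ j
    ... | no la  = trans (cong (N.atLevel i y (inj₂ a) *_) (inactive₂ a la)) (*-zeroʳ (N.atLevel i y (inj₂ a)))
    ... | yes la = cong (λ z → z * eqV y (vOf a) * ∑ (N.endL (inj₂ a)) H') (ind-no (suc (lev a) ≟ i) (λ h → i≢ (trans (sym h) (cong suc la))))

  level-shrink : ∀ y → 8 * N.levelEnds j y H' ≤ 7 * levelEnds j y H
  level-shrink y = new→old 8 7 y j λ a → subst (_≤ 7 * (atLevel j y a * ∑ (endL a) H))
    (cong (8 *_) (sym (trans (cong (atLevel j y a * ∑ (N.endL (inj₁ a)) H' +_) (no-up y j a (λ h → 1+n≢n (sym h)))) (+-identityʳ _)))) (each a)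
    where
    each : ∀ a → 8 * (atLevel j y a * ∑ (N.endL (inj₁ a)) H') ≤ 7 * (atLevel j y a * ∑ (endL a) H)
    each a with lev a ≟ j
    ... | no _ = z≤n
    ... | yes la = subst₂ _≤_ (k 8 (1 * eqV y (vOf a)) _) (k 7 (1 * eqV y (vOf a)) _) (*-monoʳ-≤ (1 * eqV y (vOf a)) (shrink-label a la))
      where
      k : ∀ c x z → x * (c * z) ≡ c * (x * z)
      k = solve-∀

  level-down : ∀ y i → i ≢ suc j → N.levelEnds i y H' ≤ levelEnds i y H
  level-down y i i≢ = subst₂ _≤_ (*-identityˡ _) (*-identityˡ _) (new→old 1 1 y i λ a → subst₂ _≤_
    (sym (trans (*-identityˡ _) (trans (cong (atLevel i y a * ∑ (N.endL (inj₁ a)) H' +_) (no-up y i a i≢)) (+-identityʳ _)))) (sym (*-identityˡ _))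
    (*-monoʳ-≤ (atLevel i y a) (size₁≤ a)))

  level-mono : ∀ y → levelEnds (suc j) y H ≤ N.levelEnds (suc j) y H'
  level-mono y = subst₂ _≤_ (*-identityˡ _) (*-identityˡ _) (old→new 1 1 y (suc j) (suc j) λ a →
    subst₂ _≤_ (sym (*-identityˡ _)) (sym (*-identityˡ _)) (≤-trans (each a) (m≤m+n _ _)))
    where
    each : ∀ a → atLevel (suc j) y a * ∑ (endL a) H ≤ atLevel (suc j) y a * ∑ (N.endL (inj₁ a)) H'
    each a with lev a ≟ suc j
    ... | no _ = z≤n
    ... | yes la = *-monoʳ-≤ (1 * eqV y (vOf a)) (inactive₁ a (λ h → 1+n≢n (trans (sym la) h)))

  level-grow : ∀ y → levelEnds j y H ≤ 16 * N.levelEnds (suc j) y H'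
  level-grow y = subst (_≤ 16 * N.levelEnds (suc j) y H') (*-identityˡ _) (old→new 1 16 y j (suc j) λ a →
    ≤-trans (≤-reflexive (*-identityˡ _)) (≤-trans (each a) (*-monoʳ-≤ 16 (m≤n+m _ (N.atLevel (suc j) y (inj₁ a) * ∑ (N.endL (inj₁ a)) H')))))
    where
    each : ∀ a → atLevel j y a * ∑ (endL a) H ≤ 16 * (N.atLevel (suc j) y (inj₂ a) * ∑ (N.endL (inj₂ a)) H')
    each a with lev a ≟ j
    ... | no _ = z≤n
    ... | yes la rewrite ind-yes (suc (lev a) ≟ suc j) (cong suc la) =
      subst (1 * eqV y (vOf a) * ∑ (endL a) H ≤_) (k (1 * eqV y (vOf a)) (∑ (N.endL (inj₂ a)) H')) (*-monoʳ-≤ (1 * eqV y (vOf a)) (grow-label a la))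
      where
      k : ∀ x z → x * (16 * z) ≡ 16 * (x * z)
      k = solve-∀

-- Eulerian tours of balanced joined digraphs

module Chains {n : ℕ} {E : Set} (s t : E → Fin n) where

  data Chain : Fin n → List E → Fin n → Set where
    []  : ∀ {x} → Chain x [] x
    link : ∀ {x y es} e → s e ≡ x → Chain (t e) es y → Chain x (e ∷ es) y

  chain-++ : ∀ {x y z us vs} → Chain x us y → Chain y vs z → Chain x (us ++ vs) z
  chain-++ []      d = d
  chain-++ (link e h c) d = link e h (chain-++ c d)

  chain-split : ∀ {x z} us {vs} → Chain x (us ++ vs) z → ∃ λ y → Chain x us y × Chain y vs z
  chain-split []       c       = _ , [] , c
  chain-split (e ∷ us) (link _ h c) with chain-split us c
  ... | y , p , q = y , link e h p , q

  chain-rotate : ∀ {x} us {vs} → Chain x (us ++ vs) x → ∃ λ y → Chain y (vs ++ us) y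
  chain-rotate us c with chain-split us c
  ... | y , p , q = y , chain-++ q p

  chain-balance : ∀ {x y ds} z → Chain x ds y → ∑ (λ e → eqV z (s e)) ds + eqV z y ≡ ∑ (λ e → eqV z (t e)) ds + eqV z x
  chain-balance z []      = refl
  chain-balance z (link {es = es} e refl c) = trans (+-assoc (eqV z (s e)) _ _) (trans (cong (eqV z (s e) +_) (chain-balance z c))
    (l (eqV z (s e)) (∑ (λ e → eqV z (t e)) es) (eqV z (t e))))
    where
    l : ∀ a b c → a + (b + c) ≡ c + b + a
    l = solve-∀

module EulerTour {n k : ℕ} (s t : Fin k → Fin n)
  (balanced : ∀ z → ∑ (λ e → eqV z (s e)) (allFin k) ≡ ∑ (λ e → eqV z (t e)) (allFin k))
  (joined : ∀ (R : Fin n → Bool) → (∀ e → R (s e) ≡ R (t e)) → ∀ x y → R x ≡ R y)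
  where
  open Chains s t

  private
    record Walk : Set where
      constructor walk
      field
        x y   : Fin n
        e₁    : Fin k
        rest  : List (Fin k)
        chain : Chain x (e₁ ∷ rest) y
    open Walk

    edges : Walk → List (Fin k)
    edges w = e₁ w ∷ rest w

    weight : (Fin k → ℕ) → Walk → ℕ
    weight f w = ∑ f (edges w)

    Balanced : List Walk → Set
    Balanced ws = ∀ z → ∑ (λ w → eqV z (x w)) ws ≡ ∑ (λ w → eqV z (y w)) ws

    Complete : List Walk → Set
    Complete ws = ∀ f → ∑ (weight f) ws ≡ ∑ f (allFin k)

    Tour : Set
    Tour = ∃ λ x → Σ (List (Fin k)) λ ds → Chain x ds x × (∀ f → ∑ f ds ≡ ∑ f (allFin k))

    touches : Walk → Fin n → Bool
    touches w v with 0 <? ∑ (λ e → eqV v (s e)) (edges w)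
    ... | yes _ = true
    ... | no _  = false

    touches-sound : ∀ w v → touches w v ≡ true → ∃ λ e → e ∈ edges w × s e ≡ v
    touches-sound w v h with 0 <? ∑ (λ e → eqV v (s e)) (edges w)
    touches-sound w v h  | yes p with ∑-pos-find (λ e → eqV v (s e)) (edges w) p
    ... | e , e∈ , q = e , e∈ , sym (ind-pos (v FinP.≟ s e) q)
    touches-sound w v () | no _

    touches-complete : ∀ w {e} → e ∈ edges w → touches w (s e) ≡ true
    touches-complete w {e} e∈ with 0 <? ∑ (λ f → eqV (s e) (s f)) (edges w)
    ... | yes _ = refl
    ... | no ¬p = ⊥-elim (¬p (≤-trans (≤-reflexive (sym (eqV-refl (s e)))) (∑-∈ (λ f → eqV (s e) (s f)) e∈)))

    target-touched : ∀ {a b ds e} → Chain a ds b → e ∈ ds → t e ≡ b ⊎ (∃ λ f → f ∈ ds × s f ≡ t e)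
    target-touched (link e _ [])           (here refl) = inj₁ refl
    target-touched (link e _ (link f h _)) (here refl) = inj₂ (f , there (here refl) , h)
    target-touched (link e _ c)            (there e∈) with target-touched c e∈
    ... | inj₁ h = inj₁ h
    ... | inj₂ (f , f∈ , h) = inj₂ (f , there f∈ , h)

    closed-target : ∀ w → x w ≡ y w → ∀ {e} → e ∈ edges w → touches w (t e) ≡ true
    closed-target w@(walk x y e₁ rest (link _ h₁ c)) closed {e} e∈ with target-touched (link e₁ refl c) e∈
    ... | inj₁ h = subst (λ z → touches w z ≡ true) (trans h₁ (trans closed (sym h))) (touches-complete w (here refl))
    ... | inj₂ (f , f∈ , h) = subst (λ z → touches w z ≡ true) h (touches-complete w f∈)

    loopAt : ∀ w → x w ≡ y w → ∀ v → touches w v ≡ true → Σ (List (Fin k)) λ ds → Chain v ds v × (∀ f → ∑ f ds ≡ weight f w)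
    loopAt w closed v h with touches-sound w v h
    ... | e , e∈ , refl with ∈-∃++ e∈
    ...   | us , vs , eq with chain-split us (subst₂ (λ ds z → Chain (x w) ds z) eq (sym closed) (chain w))
    ...     | _ , p , link _ refl q = e ∷ vs ++ us , link e refl (chain-++ q p) ,
              λ f → trans (∑-++ f (e ∷ vs) us) (trans (+-comm (∑ f (e ∷ vs)) _) (trans (sym (∑-++ f us (e ∷ vs))) (cong (∑ f) (sym eq))))

    mk : ∀ {a b} (ds : List (Fin k)) → Chain a ds b → ∀ {e} → e ∈ ds → Σ Walk λ w → edges w ≡ ds × x w ≡ a × y w ≡ b
    mk (d ∷ ds) c _ = walk _ _ d ds c , refl , refl , refl

    insertLoop : ∀ w {e} → e ∈ edges w → ∀ v → (s e ≡ v ⊎ t e ≡ v) → (ds : List (Fin k)) → Chain v ds v →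
                 Σ Walk λ w' → (∀ f → weight f w' ≡ weight f w + ∑ f ds) × x w' ≡ x w × y w' ≡ y w
    insertLoop w {e} e∈ v h ds c with ∈-∃++ e∈
    ... | us , vs , eq with chain-split us (subst (λ z → Chain (x w) z (y w)) eq (chain w))
    insertLoop w {e} e∈ v (inj₁ refl) ds c | us , vs , eq | _ , p , link _ refl q
      with mk (us ++ ds ++ e ∷ vs) (chain-++ p (chain-++ c (link e refl q))) (∈-++⁺ʳ us (∈-++⁺ʳ ds (here refl)))
    ... | w' , ew , xw , yw = w' , (λ f → trans (cong (∑ f) ew) (trans (sums f) (cong (λ z → ∑ f z + ∑ f ds) (sym eq)))) , xw , yw
      where
      sums : ∀ f → ∑ f (us ++ ds ++ e ∷ vs) ≡ ∑ f (us ++ e ∷ vs) + ∑ f ds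
      sums f rewrite ∑-++ f us (ds ++ e ∷ vs) | ∑-++ f ds (e ∷ vs) | ∑-++ f us (e ∷ vs) = l (∑ f us) (∑ f ds) (∑ f (e ∷ vs))
        where
        l : ∀ a b c → a + (b + c) ≡ a + c + b
        l = solve-∀
    insertLoop w {e} e∈ v (inj₂ refl) ds c | us , vs , eq | _ , p , link _ refl q
      with mk (us ++ e ∷ (ds ++ vs)) (chain-++ p (link e refl (chain-++ c q))) (∈-++⁺ʳ us (here refl))
    ... | w' , ew , xw , yw = w' , (λ f → trans (cong (∑ f) ew) (trans (sums f) (cong (λ z → ∑ f z + ∑ f ds) (sym eq)))) , xw , yw
      where
      sums : ∀ f → ∑ f (us ++ e ∷ (ds ++ vs)) ≡ ∑ f (us ++ e ∷ vs) + ∑ f ds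
      sums f rewrite ∑-++ f us (e ∷ (ds ++ vs)) | ∑-++ f ds vs | ∑-++ f us (e ∷ vs) = l (∑ f us) (f e) (∑ f ds) (∑ f vs)
        where
        l : ∀ a b c d → a + (b + (c + d)) ≡ a + (b + d) + c
        l = solve-∀

    glue : ∀ w w' → y w ≡ x w' → Σ Walk λ u → (∀ f → weight f u ≡ weight f w + weight f w') × x u ≡ x w × y u ≡ y w'
    glue w w' h with mk (edges w ++ edges w') (chain-++ (chain w) (subst (λ z → Chain z (edges w') (y w')) (sym h) (chain w'))) (here refl)
    ... | u , eu , xu , yu = u , (λ f → trans (cong (∑ f) eu) (∑-++ f (edges w) (edges w'))) , xu , yu

    replace : ∀ {w w' u ts ts'} → ts ↭ w' ∷ ts' → (∀ f → weight f u ≡ weight f w + weight f w') →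
              Complete (w ∷ ts) → Complete (u ∷ ts')
    replace {w} {w'} {u} {ts} {ts'} p wt cpl f = trans (cong (_+ ∑ (weight f) ts') (wt f)) (trans (+-assoc (weight f w) _ _)
      (trans (cong (weight f w +_) (sym (∑-↭ (weight f) p))) (cpl f)))

    eqV≡1 : ∀ {a b : Fin n} → eqV a b ≡ 1 → a ≡ b
    eqV≡1 {a} {b} h = ind-pos (a FinP.≟ b) (≤-reflexive (sym h))

    -- Walks are merged as in Hierholzer's algorithm. An open `w` is continued by a walk that starts
    -- at its end, which exists by balance; a closed `w` is rotated and inserted into a walk that
    -- meets it. Each merger shortens `ts`.
    tour : ∀ N w ts → length ts ≤ N → Balanced (w ∷ ts) → Complete (w ∷ ts) → Tour
    tour N w [] len bal cpl = y w , edges w , subst (λ z → Chain z (edges w) (y w)) x≡y (chain w) , λ f → trans (sym (+-identityʳ _)) (cpl f)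
      where
      x≡y : x w ≡ y w
      x≡y = eqV≡1 (trans (sym (+-identityʳ _)) (trans (sym (bal (x w))) (trans (+-identityʳ _) (eqV-refl (x w)))))
    tour (suc N) w ts@(w₀ ∷ _) len bal cpl with x w FinP.≟ y w
    ... | no x≢y with ∑-pos-find (λ u → eqV (y w) (x u)) ts found
      where
      found : 0 < ∑ (λ u → eqV (y w) (x u)) ts
      found = ≤-trans (≤-trans (≤-reflexive (sym (eqV-refl (y w)))) (m≤m+n _ _))
        (≤-reflexive (trans (sym (bal (y w))) (cong (_+ ∑ (λ u → eqV (y w) (x u)) ts) (ind-no (y w FinP.≟ x w) (λ h → x≢y (sym h))))))
    ...   | w' , w'∈ , q with extract w'∈ | glue w w' (ind-pos (y w FinP.≟ x w') q)
    ...     | ts' , p | u , wt , xu , yu = tour N u ts' (≤-pred (subst (_≤ suc N) (↭-length p) len)) bal' (replace {w = w} {w' = w'} {u = u} p wt cpl)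
      where
      bal' : Balanced (u ∷ ts')
      bal' z rewrite xu | yu = +-cancelʳ-≡ (eqV z (y w)) _ _ (trans (cong (λ a → eqV z (x w) + ∑ (λ w → eqV z (x w)) ts' + eqV z a) (ind-pos (y w FinP.≟ x w') q))
        (trans (l (eqV z (x w)) (∑ (λ w → eqV z (x w)) ts') (eqV z (x w'))) (trans (cong (eqV z (x w) +_) (sym (∑-↭ (λ w → eqV z (x w)) p)))
        (trans (bal z) (trans (cong (eqV z (y w) +_) (∑-↭ (λ w → eqV z (y w)) p)) (l' (eqV z (y w)) (eqV z (y w')) (∑ (λ w → eqV z (y w)) ts')))))))
        where
        l : ∀ a b c → a + b + c ≡ a + (c + b)
        l = solve-∀
        l' : ∀ a b c → a + (b + c) ≡ b + c + a
        l' = solve-∀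
    tour (suc N) w ts@(w₀ ∷ _) len bal cpl | yes x≡y with 0 <? ∑ (weight meets) ts
      where
      meets : Fin k → ℕ
      meets e = bit (touches w (s e)) + bit (touches w (t e))
    ... | yes pos with ∑-pos-find (weight (λ e → bit (touches w (s e)) + bit (touches w (t e)))) ts pos
    ...   | w' , w'∈ , q with ∑-pos-find (λ e → bit (touches w (s e)) + bit (touches w (t e))) (edges w') q
    ...     | e , e∈ , q' with extract w'∈ | meeting (+-pos (bit (touches w (s e))) _ q')
      where
      bit-true : ∀ {b} → 0 < bit b → b ≡ true
      bit-true {true} _ = refl
      meeting : 0 < bit (touches w (s e)) ⊎ 0 < bit (touches w (t e)) → ∃ λ v → touches w v ≡ true × (s e ≡ v ⊎ t e ≡ v)
      meeting (inj₁ h) = s e , bit-true h , inj₁ refl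
      meeting (inj₂ h) = t e , bit-true h , inj₂ refl
    ...       | ts' , p | v , tv , at with loopAt w x≡y v tv
    ...         | ds , c , wds with insertLoop w' e∈ v at ds c
    ...           | u , wt , xu , yu = tour N u ts' (≤-pred (subst (_≤ suc N) (↭-length p) len)) bal'
                      (replace {w = w} {w' = w'} {u = u} p (λ f → trans (wt f) (trans (+-comm (weight f w') _) (cong (_+ weight f w') (wds f)))) cpl)
      where
      bal' : Balanced (u ∷ ts')
      bal' z rewrite xu | yu = +-cancelˡ-≡ (eqV z (x w)) _ _ (trans (cong (eqV z (x w) +_) (sym (∑-↭ (λ w → eqV z (x w)) p)))
        (trans (bal z) (cong₂ _+_ (cong (eqV z) (sym x≡y)) (∑-↭ (λ w → eqV z (y w)) p))))
    -- If no other walk meets the closed walk `w`, its vertices form a cut that no arc crosses,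
    -- although `w₀` lies on the other side.
    tour (suc N) w ts@(w₀ ∷ _) len bal cpl | yes x≡y | no ¬pos = ⊥-elim contra
      where
      meets : Fin k → ℕ
      meets e = bit (touches w (s e)) + bit (touches w (t e))
      none : ∀ {u e} → u ∈ ts → e ∈ edges u → meets e ≡ 0
      none u∈ e∈ = All.lookup (∑-zero⁻ meets (All.lookup (∑-zero⁻ (weight meets) (¬pos⇒≡0 _ ¬pos)) u∈)) e∈
      bit-false : ∀ {b} → bit b ≡ 0 → b ≡ false
      bit-false {false} _ = refl
      home : ∀ e → e ∈ edges w ⊎ (∃ λ u → u ∈ ts × e ∈ edges u)
      home e with ∑-pos-find (weight (λ f → eqV f e)) (w ∷ ts) (≤-reflexive (sym (trans (cpl (λ f → eqV f e)) (∑-eq-Fin e))))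
      ... | u , u∈ , q with ∑-pos-find (λ f → eqV f e) (edges u) q
      ...   | f , f∈ , q' with ind-pos (f FinP.≟ e) q'
      home e | u , here refl , q | f , f∈ , q' | refl = inj₁ f∈
      home e | u , there u∈ , q  | f , f∈ , q' | refl = inj₂ (u , u∈ , f∈)
      closed : ∀ e → touches w (s e) ≡ touches w (t e)
      closed e with home e
      ... | inj₁ e∈ = trans (touches-complete w e∈) (sym (closed-target w x≡y e∈))
      ... | inj₂ (u , u∈ , e∈) = trans (bit-false (m+n≡0⇒m≡0 _ (none u∈ e∈))) (sym (bit-false (m+n≡0⇒n≡0 (bit (touches w (s e))) (none u∈ e∈))))
      contra : ⊥
      contra with trans (sym (touches-complete w (here refl))) (trans (joined (touches w) closed (s (e₁ w)) (s (e₁ w₀))) (bit-false (m+n≡0⇒m≡0 _ (none {w₀} {e₁ w₀} (here refl) (here refl)))))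
      ... | ()
    tour zero w (_ ∷ _) () bal cpl

    single : Fin k → Walk
    single e = walk (s e) (t e) e [] (link e refl [])

  abstract
    eulerTour : Fin k → Tour
    eulerTour e₀ with map single (allFin k) in eqn
    ... | [] = ⊥-elim (none (subst (single e₀ ∈_) eqn (∈-map⁺ single (∈-allFin e₀))))
      where
      none : ∀ {w : Walk} → ¬ (w ∈ [])
      none ()
    ... | w ∷ ts = tour _ w ts ≤-refl
      (λ z → subst (λ ws → ∑ (λ w → eqV z (x w)) ws ≡ ∑ (λ w → eqV z (y w)) ws) eqn
        (trans (∑-map (λ w → eqV z (x w)) single (allFin k)) (trans (balanced z) (sym (∑-map (λ w → eqV z (y w)) single (allFin k))))))
      (λ f → subst (λ ws → ∑ (weight f) ws ≡ ∑ f (allFin k)) eqn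
        (trans (∑-map (weight f) single (allFin k)) (∑-cong (λ e → +-identityʳ (f e)) (allFin k))))

-- Cyclic windows

-- A segment of at least two entries with both ends named; the two views may overlap.
record Ends₂ {E : Set} (xs : List E) : Set where
  constructor ends₂
  field
    {p q u v} : E
    {tl ini}  : List E
    first : xs ≡ p ∷ q ∷ tl
    last  : xs ≡ ini ++ u ∷ v ∷ []

module Windows {E : Set} (f : E → E → E → ℕ) where

  at₃ : E → List E → ℕ
  at₃ x (y ∷ z ∷ _) = f x y z
  at₃ x _           = 0

  WS : List E → List E → ℕ
  WS []       tail = 0
  WS (x ∷ xs) tail = at₃ x (xs ++ tail) + WS xs tail

  -- All windows of three consecutive entries in cyclic order: the list serves as its own tail, and
  -- at most two entries of the tail are ever seen.
  cyc : List E → ℕ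
  cyc ds = WS ds ds

  WS-++ : ∀ us vs tail → WS (us ++ vs) tail ≡ WS us (vs ++ tail) + WS vs tail
  WS-++ []       vs tail = refl
  WS-++ (x ∷ us) vs tail = trans (cong₂ _+_ (cong (at₃ x) (++-assoc us vs tail)) (WS-++ us vs tail)) (sym (+-assoc (at₃ x (us ++ vs ++ tail)) _ _))

  at₃-tail : ∀ x us p q t t' → at₃ x (us ++ p ∷ q ∷ t) ≡ at₃ x (us ++ p ∷ q ∷ t')
  at₃-tail x []           p q t t' = refl
  at₃-tail x (y ∷ [])     p q t t' = refl
  at₃-tail x (y ∷ z ∷ us) p q t t' = refl

  WS-tail : ∀ us p q t t' → WS us (p ∷ q ∷ t) ≡ WS us (p ∷ q ∷ t')
  WS-tail []       p q t t' = refl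
  WS-tail (x ∷ us) p q t t' = cong₂ _+_ (at₃-tail x us p q t t') (WS-tail us p q t t')

  at₃-prefix : ∀ x us p q t → at₃ x ((us ++ p ∷ q ∷ []) ++ t) ≡ at₃ x ((us ++ p ∷ q ∷ []) ++ [])
  at₃-prefix x us p q t = trans (cong (at₃ x) (++-assoc us (p ∷ q ∷ []) t)) (trans (at₃-tail x us p q t []) (cong (at₃ x) (sym (++-identityʳ (us ++ p ∷ q ∷ [])))))

  WS-end : ∀ us p q r s t → WS (us ++ p ∷ q ∷ []) (r ∷ s ∷ t) ≡ WS (us ++ p ∷ q ∷ []) [] + (f p q r + f q r s)
  WS-end []       p q r s t = l (f p q r) (f q r s)
    where
    l : ∀ a b → a + (b + 0) ≡ 0 + (a + b)
    l = solve-∀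
  WS-end (x ∷ us) p q r s t = trans (cong₂ _+_ (at₃-prefix x us p q (r ∷ s ∷ t)) (WS-end us p q r s t)) (sym (+-assoc (at₃ x ((us ++ p ∷ q ∷ []) ++ [])) _ _))

  WS-snoc : ∀ us p q r → WS (us ++ p ∷ q ∷ r ∷ []) [] ≡ WS (us ++ p ∷ q ∷ []) [] + f p q r
  WS-snoc []       p q r = +-identityʳ _
  WS-snoc (x ∷ us) p q r = trans (cong₂ _+_ (trans (cong (at₃ x) (++-identityʳ (us ++ p ∷ q ∷ r ∷ []))) (trans (at₃-tail x us p q (r ∷ []) []) (cong (at₃ x) (sym (++-identityʳ (us ++ p ∷ q ∷ [])))))) (WS-snoc us p q r))
    (sym (+-assoc (at₃ x ((us ++ p ∷ q ∷ []) ++ [])) _ _))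

  open Ends₂

  WS-ends : ∀ {us} (U : Ends₂ us) {vs} (V : Ends₂ vs) t → WS us (vs ++ t) ≡ WS us [] + (f (u U) (v U) (p V) + f (v U) (p V) (q V))
  WS-ends (ends₂ {u = u} {v} {ini = ini} _ refl) (ends₂ {p} {q} {tl = tl} refl _) t = WS-end ini u v p q (tl ++ t)

  -- A window leaves its segment only if it starts in one of the last two entries, so two windows
  -- cross each of the two seams. If reversal preserves the inner windows, reversing a segment
  -- affects these four terms alone.
  cyc-split : ∀ {us vs} (U : Ends₂ us) (V : Ends₂ vs) →
    cyc (us ++ vs) ≡ WS us [] + WS vs [] + (f (u U) (v U) (p V) + f (v U) (p V) (q V) + (f (u V) (v V) (p U) + f (v V) (p U) (q U)))
  cyc-split {us} {vs} U V = trans (WS-++ us vs (us ++ vs)) (trans (cong₂ _+_ (WS-ends U V (us ++ vs)) (WS-ends V U vs)) (l (WS us []) (f (u U) (v U) (p V)) (f (v U) (p V) (q V)) (WS vs []) (f (u V) (v V) (p U)) (f (v V) (p U) (q U))))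
    where
    l : ∀ a b c d e g → a + (b + c) + (d + (e + g)) ≡ a + d + (b + c + (e + g))
    l = solve-∀

  cyc-rotate : ∀ us vs → 2 ≤ length (us ++ vs) → cyc (us ++ vs) ≡ cyc (vs ++ us)
  cyc-rotate us vs len = begin
    WS (us ++ vs) (us ++ vs)                      ≡⟨ WS-++ us vs (us ++ vs) ⟩
    WS us (vs ++ us ++ vs) + WS vs (us ++ vs)     ≡⟨ cong₂ _+_ (trans (cong (WS us) (sym (++-assoc vs us vs))) (long us (vs ++ us) vs len')) (sym (trans (cong (WS vs) (sym (++-assoc us vs us))) (long vs (us ++ vs) us len))) ⟩
    WS us (vs ++ us) + WS vs (us ++ vs ++ us)     ≡⟨ +-comm (WS us (vs ++ us)) _ ⟩
    WS vs (us ++ vs ++ us) + WS us (vs ++ us)     ≡⟨ sym (WS-++ vs us (vs ++ us)) ⟩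
    WS (vs ++ us) (vs ++ us)                      ∎
    where
    open ≡-Reasoning
    len' : 2 ≤ length (vs ++ us)
    len' = subst (2 ≤_) (↭-length (++-comm us vs)) len
    long : ∀ xs ys zs → 2 ≤ length ys → WS xs (ys ++ zs) ≡ WS xs ys
    long xs (y ∷ []) zs (s≤s ())
    long xs (y ∷ y' ∷ ys) zs _ = WS-tail xs y y' (ys ++ zs) ys

  cyc-find : ∀ ds → 3 ≤ length ds → 0 < cyc ds → ∃ λ us → ∃ λ vs → ds ≡ us ++ vs × (∃ λ x → ∃ λ y → ∃ λ z → ∃ λ rest → vs ++ us ≡ x ∷ y ∷ z ∷ rest × 0 < f x y z)
  cyc-find ds len = go [] ds refl
    where
    go : ∀ us vs → ds ≡ us ++ vs → 0 < WS vs ds → ∃ λ us → ∃ λ vs → ds ≡ us ++ vs × (∃ λ x → ∃ λ y → ∃ λ z → ∃ λ rest → vs ++ us ≡ x ∷ y ∷ z ∷ rest × 0 < f x y z)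
    go us []       eq ()
    go us (x ∷ vs) eq pos with +-pos (at₃ x (vs ++ ds)) _ pos
    ... | inj₂ h = go (us ++ x ∷ []) vs (trans eq (sym (++-assoc us (x ∷ []) vs))) h
    ... | inj₁ h = us , x ∷ vs , eq , found (vs ++ us) refl (subst (λ z → 0 < at₃ x z) (trans (cong (vs ++_) eq) (sym (++-assoc vs us (x ∷ vs)))) h)
      where
      found : ∀ zs → vs ++ us ≡ zs → 0 < at₃ x ((vs ++ us) ++ x ∷ vs) → ∃ λ x' → ∃ λ y → ∃ λ z → ∃ λ rest → x ∷ vs ++ us ≡ x' ∷ y ∷ z ∷ rest × 0 < f x' y z
      found zs e q with zs
      ... | y ∷ z ∷ rest = x , y , z , rest , cong (x ∷_) e , subst (λ w → 0 < at₃ x (w ++ x ∷ vs)) e q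
      ... | []     = ⊥-elim (bad (trans len≡ (cong (λ w → suc (length w)) e)))
        where
        len≡ : length ds ≡ length (x ∷ vs ++ us)
        len≡ = trans (cong length eq) (↭-length (++-comm us (x ∷ vs)))
        bad : ¬ (length ds ≡ 1)
        bad h = <-irrefl (sym h) (≤-trans (s≤s (s≤s z≤n)) len)
      ... | y ∷ [] = ⊥-elim (bad (trans len≡ (cong (λ w → suc (length w)) e)))
        where
        len≡ : length ds ≡ length (x ∷ vs ++ us)
        len≡ = trans (cong length eq) (↭-length (++-comm us (x ∷ vs)))
        bad : ¬ (length ds ≡ 2)
        bad h = <-irrefl (sym h) len

-- Reversal of a segment

module Reversal {E : Set} (_* : E → E) where

  rev : List E → List E
  rev []       = []
  rev (x ∷ xs) = rev xs ++ (x *) ∷ []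

  rev-++ : ∀ xs ys → rev (xs ++ ys) ≡ rev ys ++ rev xs
  rev-++ []       ys = sym (++-identityʳ _)
  rev-++ (x ∷ xs) ys = trans (cong (_++ (x *) ∷ []) (rev-++ xs ys)) (++-assoc (rev ys) (rev xs) _)

  ∑-rev : ∀ w → (∀ e → w (e *) ≡ w e) → ∀ xs → ∑ w (rev xs) ≡ ∑ w xs
  ∑-rev w inv []       = refl
  ∑-rev w inv (x ∷ xs) = trans (∑-++ w (rev xs) _) (trans (cong₂ _+_ (∑-rev w inv xs) (trans (+-identityʳ _) (inv x))) (+-comm (∑ w xs) _))

  All-rev : ∀ {P : E → Set} → (∀ {e} → P e → P (e *)) → ∀ {xs} → All P xs → All P (rev xs)
  All-rev h []       = []
  All-rev h (p ∷ ps) = AllP.++⁺ (All-rev h ps) (h p ∷ [])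

  ends-rev : ∀ {xs} → Ends₂ xs → Ends₂ (rev xs)
  ends-rev (ends₂ {p} {q} {u} {v} {tl} {ini} first last) = ends₂ {p = v *} {u *} {q *} {p *} {rev ini} {rev tl}
    (trans (cong rev last) (rev-++ ini (u ∷ v ∷ [])))
    (trans (cong rev first) (++-assoc (rev tl) (q * ∷ []) (p * ∷ [])))

  module _ (f : E → E → E → ℕ) (f-sym : ∀ x y z → f (z *) (y *) (x *) ≡ f x y z) where
    open Windows f

    WS-rev : ∀ xs → WS (rev xs) [] ≡ WS xs []
    WS-rev []               = refl
    WS-rev (x ∷ [])         = refl
    WS-rev (x ∷ y ∷ [])     = refl
    WS-rev (x ∷ y ∷ z ∷ xs) = begin
      WS (((rev xs ++ (z *) ∷ []) ++ (y *) ∷ []) ++ (x *) ∷ []) []  ≡⟨ cong (λ w → WS w []) (trans (cong (_++ (x *) ∷ []) (++-assoc (rev xs) _ _)) (++-assoc (rev xs) _ _)) ⟩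
      WS (rev xs ++ (z *) ∷ (y *) ∷ (x *) ∷ []) []                  ≡⟨ WS-snoc (rev xs) (z *) (y *) (x *) ⟩
      WS (rev xs ++ (z *) ∷ (y *) ∷ []) [] + f (z *) (y *) (x *)    ≡⟨ cong₂ _+_ (trans (cong (λ w → WS w []) (sym (++-assoc (rev xs) _ _))) (WS-rev (y ∷ z ∷ xs))) (f-sym x y z) ⟩
      WS (y ∷ z ∷ xs) [] + f x y z                                  ≡⟨ +-comm (WS (y ∷ z ∷ xs) []) _ ⟩
      f x y z + WS (y ∷ z ∷ xs) []                                  ∎
      where open ≡-Reasoning

adjacent : List A → List (A × A)
adjacent (x ∷ y ∷ xs) = (x , y) ∷ adjacent (y ∷ xs)
adjacent _            = []

adjacent-split : ∀ {c d : A} ds → (c , d) ∈ adjacent ds → ∃ λ us → ∃ λ vs → ds ≡ us ++ c ∷ d ∷ vs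
adjacent-split (x ∷ y ∷ ds) (here refl) = [] , ds , refl
adjacent-split (x ∷ y ∷ ds) (there h) with adjacent-split (y ∷ ds) h
... | us , vs , e = x ∷ us , vs , cong (x ∷_) e

∑-adjacent-snd : (ψ : A → ℕ) (x : A) (xs : List A) → ∑ (λ p → ψ (proj₂ p)) (adjacent (x ∷ xs)) ≡ ∑ ψ xs
∑-adjacent-snd ψ x []       = refl
∑-adjacent-snd ψ x (y ∷ xs) = cong (ψ y +_) (∑-adjacent-snd ψ y xs)

∑-adjacent-fst≤ : (φ : A → ℕ) (xs : List A) → ∑ (λ p → φ (proj₁ p)) (adjacent xs) ≤ ∑ φ xs
∑-adjacent-fst≤ φ []           = z≤n
∑-adjacent-fst≤ φ (x ∷ [])     = z≤n
∑-adjacent-fst≤ φ (x ∷ y ∷ xs) = +-monoʳ-≤ (φ x) (∑-adjacent-fst≤ φ (y ∷ xs))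

-- Repairing an Eulerian tour of a path graph

-- An Eulerian tour of H is altered by reversing segments.  First all transitions become
-- compatible: two consecutive paths meet only at their common end and at least one of them is
-- long.  Then the two neighbours of every short path are made disjoint.
module Repair {n : ℕ} (Λ : Labels n) {adj : Fin n → Fin n → ℕ} {L M lo hi : ℕ} {H : List (PathGraph.Edge Λ)}
  (good : PathGraph.Good Λ adj L M lo hi H) (ℓ : ℕ)
  (few-short : ∀ y → 8 * ∑ (λ e → PathGraph.endV Λ y e * ind (length (PathGraph.int e) <? ℓ)) H ≤ ∑ (PathGraph.endV Λ y) H)
  (spacious : 8 * (3 * (2 + L) * M) ≤ lo) (lo≥8 : 8 ≤ lo)
  where
  open PathGraph Λ
  open Chains src tgt public
  open Reversal flip

  sh : Edge → ℕ
  sh e = ind (length (int e) <? ℓ)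

  rear : Edge → List (Fin n)
  rear e = int e ++ tgt e ∷ []

  -- If `tgt x ≡ src y`, then `front x` and `rear y` both omit this common end, so the second
  -- summand counts only the forbidden meetings.
  pairBad : Edge → Edge → ℕ
  pairBad x y = sh x * sh y + inter (front x) (rear y)

  -- Pairs are also written as windows of three, so that one bookkeeping of seams serves pairs and
  -- triples; every consecutive pair is thereby counted twice.
  f₁ f₂ : Edge → Edge → Edge → ℕ
  f₁ x y z = pairBad x y + pairBad y z
  f₂ x y z = sh y * inter (verts x) (verts z)

  open Windows f₁ using () renaming (cyc to cyc₁; cyc-find to cyc-find₁; cyc-rotate to cyc-rotate₁; cyc-split to cyc-split₁)
  open Windows f₂ using () renaming (cyc to cyc₂; cyc-find to cyc-find₂; cyc-rotate to cyc-rotate₂; cyc-split to cyc-split₂)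

  private
    sh-flip : ∀ e → sh (flip e) ≡ sh e
    sh-flip e = cong (λ k → ind (k <? ℓ)) (length-reverse' (int e))

    inter-↭ : ∀ {xs xs' ys ys' : List (Fin n)} → xs ↭ xs' → ys ↭ ys' → inter xs ys ≡ inter xs' ys'
    inter-↭ {xs' = xs'} p q = trans (∑-↭ _ p) (∑-cong (λ z → ∑-↭ (eqV z) q) xs')

    front-flip : ∀ e → front (flip e) ↭ rear e
    front-flip e = ↭-trans (prep (tgt e) (↭-reverse (int e))) (∷↭∷ʳ (tgt e) (int e))

    rear-flip : ∀ e → rear (flip e) ↭ front e
    rear-flip e = ↭-trans (↭-sym (∷↭∷ʳ (src e) (reverse (int e)))) (prep (src e) (↭-reverse (int e)))

    verts-flip↭ : ∀ e → verts (flip e) ↭ verts e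
    verts-flip↭ e = ↭-trans (↭-reflexive (verts-flip e)) (↭-reverse (verts e))

    pairBad-flip : ∀ x y → pairBad (flip y) (flip x) ≡ pairBad x y
    pairBad-flip x y = cong₂ _+_ (trans (cong₂ _*_ (sh-flip y) (sh-flip x)) (*-comm (sh y) (sh x)))
      (trans (inter-↭ (front-flip y) (rear-flip x)) (inter-sym (rear y) (front x)))

    f₁-sym : ∀ x y z → f₁ (flip z) (flip y) (flip x) ≡ f₁ x y z
    f₁-sym x y z = trans (cong₂ _+_ (pairBad-flip y z) (pairBad-flip x y)) (+-comm (pairBad y z) _)

    f₂-sym : ∀ x y z → f₂ (flip z) (flip y) (flip x) ≡ f₂ x y z
    f₂-sym x y z = cong₂ _*_ (sh-flip y) (trans (inter-↭ (verts-flip↭ z) (verts-flip↭ x)) (inter-sym (verts z) (verts x)))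

  record Tour : Set where
    field
      base  : Fin n
      ds    : List Edge
      chain : Chain base ds base
      sound : All (Valid L) ds
      sums  : ∀ w → (∀ e → w (flip e) ≡ w e) → ∑ w ds ≡ ∑ w H
  open Tour public

  private
    visits : Fin n → Fin n → ℕ
    visits y p = ∑ (λ e → endV y e * mult p (verts e)) H

    -- Group by group at `y`: a nonempty group has at least `lo` ends, and at most `M` of them
    -- conflict with `p`.
    visits≤ : ∀ y p → p ≢ y → lo * visits y p ≤ M * ∑ (endV y) H
    visits≤ y p p≢y = subst₂ _≤_ (cong (lo *_) (ends-sum (λ e → mult p (verts e)))) (cong (M *_) (trans (ends-sum (λ _ → 1)) (∑-cong (λ e → *-identityʳ _) H)))
      (Distinct.fibrewise-ratio _≟L_ lo M (labelled H) proj₁ (wt (λ e → mult p (verts e))) (labelled H) proj₁ (wt (λ _ → 1)) fibre)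
      where
      labelled : List Edge → List (Lab × Edge)
      labelled = concatMap (λ e → (l₀ e , e) ∷ (l₁ e , e) ∷ [])
      wt : (Edge → ℕ) → Lab × Edge → ℕ
      wt g x = eqV y (vOf (proj₁ x)) * g (proj₂ x)
      ∑-labelled : ∀ (φ : Lab × Edge → ℕ) → ∑ φ (labelled H) ≡ ∑ (λ e → φ (l₀ e , e) + φ (l₁ e , e)) H
      ∑-labelled φ = trans (∑-concatMap φ _ H) (∑-cong (λ e → cong (φ (l₀ e , e) +_) (+-identityʳ _)) H)
      ends-sum : ∀ g → ∑ (wt g) (labelled H) ≡ ∑ (λ e → endV y e * g e) H
      ends-sum g = trans (∑-labelled (wt g)) (∑-cong (λ e → sym (*-distribʳ-+ (g e) (eqV y (src e)) (eqV y (tgt e)))) H)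
      fibre-sum : ∀ a g → ∑ (λ x → eqL a (proj₁ x) * wt g x) (labelled H) ≡ eqV y (vOf a) * ∑ (λ e → endL a e * g e) H
      fibre-sum a g = trans (∑-labelled _) (trans (∑-cong (λ e → trans (cong₂ _+_ (one (l₀ e) (g e)) (one (l₁ e) (g e))) (l (eqV y (vOf a)) (eqL a (l₀ e)) (eqL a (l₁ e)) (g e))) H) (∑-*ˡ (eqV y (vOf a)) _ H))
        where
        one : ∀ b z → eqL a b * (eqV y (vOf b) * z) ≡ eqV y (vOf a) * (eqL a b * z)
        one b z with a ≟L b
        ... | yes refl = trans (+-identityʳ _) (cong (eqV y (vOf a) *_) (sym (+-identityʳ z)))
        ... | no _     = sym (*-zeroʳ (eqV y (vOf a)))
        l : ∀ v a b z → v * (a * z) + v * (b * z) ≡ v * ((a + b) * z)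
        l = solve-∀
      group : ∀ a → vOf a ≡ y → lo * ∑ (λ e → endL a e * mult p (verts e)) H ≤ M * ∑ (λ e → endL a e * 1) H
      group a refl with 0 <? ∑ (endL a) H
      ... | yes pos = ≤-trans (*-mono-≤ (groupLow good a pos) (conflict good a p p≢y)) (≤-reflexive (trans (*-comm (∑ (endL a) H) M) (cong (M *_) (∑-cong (λ e → sym (*-identityʳ _)) H))))
      ... | no ¬pos = ≤-trans (≤-reflexive (trans (cong (lo *_) (∑-zero-All {f = λ e → endL a e * mult p (verts e)} {xs = H} (All.map (λ {e} z → cong (_* mult p (verts e)) z) (∑-zero⁻ (endL a) {xs = H} (¬pos⇒≡0 _ ¬pos))))) (*-zeroʳ lo))) z≤n
      fibre : ∀ a → lo * ∑ (λ x → eqL a (proj₁ x) * wt (λ e → mult p (verts e)) x) (labelled H) ≤ M * ∑ (λ x → eqL a (proj₁ x) * wt (λ _ → 1) x) (labelled H)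
      fibre a = subst₂ _≤_ (cong (lo *_) (sym (fibre-sum a (λ e → mult p (verts e))))) (cong (M *_) (sym (fibre-sum a (λ _ → 1)))) final
        where
        final : lo * (eqV y (vOf a) * ∑ (λ e → endL a e * mult p (verts e)) H) ≤ M * (eqV y (vOf a) * ∑ (λ e → endL a e * 1) H)
        final with y FinP.≟ vOf a
        ... | no _  = ≤-trans (≤-reflexive (*-zeroʳ lo)) z≤n
        ... | yes h = subst₂ _≤_ (cong (lo *_) (sym (+-identityʳ _))) (cong (M *_) (sym (+-identityʳ _))) (group a (sym h))

    -- The weight of the paths that may not be used at y because they are short or meet X.
    blocked : Fin n → List (Fin n) → Edge → ℕ
    blocked y X e = sh e + ∑ (λ p → (1 ∸ eqV p y) * mult p (verts e)) X

    blocked-flip : ∀ y X e → blocked y X (flip e) ≡ blocked y X e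
    blocked-flip y X e = cong₂ _+_ (sh-flip e) (∑-cong (λ p → cong ((1 ∸ eqV p y) *_) (mult-flip p e)) X)

    instance
      lo-nonZero : NonZero lo
      lo-nonZero = >-nonZero (≤-trans (s≤s z≤n) lo≥8)

    -- At most one eighth of the ends at `y` is short, by `few-short`, and at most another eighth
    -- meets `X`, by `visits≤` for each vertex of `X` and `spacious`.
    blocked-few : ∀ y X → length X ≤ 3 * (2 + L) → 4 * ∑ (λ e → endV y e * blocked y X e) H ≤ ∑ (endV y) H
    blocked-few y X len = *-cancelˡ-≤ 2 (begin
      2 * (4 * ∑ (λ e → endV y e * blocked y X e) H)       ≡⟨ cong (λ z → 2 * (4 * z)) expand ⟩
      2 * (4 * (∑ (λ e → endV y e * sh e) H + meet))       ≡⟨ l (∑ (λ e → endV y e * sh e) H) meet ⟩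
      8 * ∑ (λ e → endV y e * sh e) H + 8 * meet           ≤⟨ +-mono-≤ (few-short y) visited ⟩
      ∑ (endV y) H + ∑ (endV y) H                          ≡⟨ cong (∑ (endV y) H +_) (sym (+-identityʳ _)) ⟩
      2 * ∑ (endV y) H                                     ∎)
      where
      open ≤-Reasoning
      l : ∀ a b → 2 * (4 * (a + b)) ≡ 8 * a + 8 * b
      l = solve-∀
      meet : ℕ
      meet = ∑ (λ p → (1 ∸ eqV p y) * visits y p) X
      expand : ∑ (λ e → endV y e * blocked y X e) H ≡ ∑ (λ e → endV y e * sh e) H + meet
      expand = trans (∑-cong (λ e → trans (*-distribˡ-+ (endV y e) (sh e) _) (cong (endV y e * sh e +_) (trans (sym (∑-*ˡ (endV y e) _ X)) (∑-cong (λ p → swap₁ (endV y e) (1 ∸ eqV p y) (mult p (verts e))) X)))) H)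
        (trans (∑-+ _ _ H) (cong (∑ (λ e → endV y e * sh e) H +_) (trans (∑-swap _ H X) (∑-cong (λ p → ∑-*ˡ (1 ∸ eqV p y) _ H) X))))
        where
        swap₁ : ∀ a b c → a * (b * c) ≡ b * (a * c)
        swap₁ = solve-∀
      each : ∀ p → lo * ((1 ∸ eqV p y) * visits y p) ≤ M * ∑ (endV y) H
      each p with p FinP.≟ y
      ... | yes _ = ≤-trans (≤-reflexive (*-zeroʳ lo)) z≤n
      ... | no ne = ≤-trans (≤-reflexive (cong (lo *_) (+-identityʳ _))) (visits≤ y p ne)
      visited : 8 * meet ≤ ∑ (endV y) H
      visited = *-cancelˡ-≤ lo (begin
        lo * (8 * meet)                              ≡⟨ k lo meet ⟩
        8 * (lo * meet)                              ≡⟨ cong (8 *_) (sym (∑-*ˡ lo _ X)) ⟩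
        8 * ∑ (λ p → lo * ((1 ∸ eqV p y) * visits y p)) X ≤⟨ *-monoʳ-≤ 8 (∑-≤-length {xs = X} (All.tabulate (λ {p} _ → each p))) ⟩
        8 * (length X * (M * ∑ (endV y) H))          ≤⟨ *-monoʳ-≤ 8 (*-monoˡ-≤ (M * ∑ (endV y) H) len) ⟩
        8 * (3 * (2 + L) * (M * ∑ (endV y) H))       ≡⟨ k' (3 * (2 + L)) M (∑ (endV y) H) ⟩
        8 * (3 * (2 + L) * M) * ∑ (endV y) H         ≤⟨ *-monoˡ-≤ (∑ (endV y) H) spacious ⟩
        lo * ∑ (endV y) H                            ∎)
        where
        k : ∀ a b → a * (8 * b) ≡ 8 * (a * b)
        k = solve-∀
        k' : ∀ a b c → 8 * (a * (b * c)) ≡ 8 * (a * b) * c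
        k' = solve-∀

    label≤vertex : ∀ a → ∑ (endL a) H ≤ ∑ (endV (vOf a)) H
    label≤vertex a = ∑-mono (λ e → +-mono-≤ (le (l₀ e)) (le (l₁ e))) H
      where
      le : ∀ b → eqL a b ≤ eqV (vOf a) (vOf b)
      le b with a ≟L b
      ... | yes refl = ≤-reflexive (sym (eqV-refl (vOf a)))
      ... | no _     = z≤n

    ends-large : ∀ y → 0 < ∑ (endV y) H → lo ≤ ∑ (endV y) H
    ends-large y pos with ∑-pos-find (endV y) H pos
    ... | e , e∈ , q with +-pos (eqV y (src e)) _ q
    ...   | inj₁ h = subst (λ z → lo ≤ ∑ (endV z) H) (sym (ind-pos (y FinP.≟ src e) h)) (≤-trans (groupLow good (l₀ e)
              (≤-trans (≤-trans (≤-reflexive (sym (eqL-refl (l₀ e)))) (m≤m+n _ _)) (∑-∈ (endL (l₀ e)) e∈))) (label≤vertex (l₀ e)))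
    ...   | inj₂ h = subst (λ z → lo ≤ ∑ (endV z) H) (sym (ind-pos (y FinP.≟ tgt e) h)) (≤-trans (groupLow good (l₁ e)
              (≤-trans (≤-trans (≤-reflexive (sym (eqL-refl (l₁ e)))) (m≤n+m _ _)) (∑-∈ (endL (l₁ e)) e∈))) (label≤vertex (l₁ e)))

    module _ (T : Tour) (y : Fin n) (b : Edge) (r : List Edge) (ds≡ : ds T ≡ b ∷ r) (b-src : src b ≡ y) where

      private
        S : ℕ
        S = ∑ (λ e → eqV y (src e)) (ds T)

        ends≡2S : ∑ (endV y) H ≡ 2 * S
        ends≡2S = trans (sym (sums T (endV y) (endV-flip y))) (trans (∑-+ (λ e → eqV y (src e)) (λ e → eqV y (tgt e)) (ds T))
          (cong (S +_) (trans (sym (+-cancelʳ-≡ (eqV y (base T)) _ _ (chain-balance y (chain T)))) (sym (+-identityʳ S)))))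

        S≡ : S ≡ suc (∑ (λ e → eqV y (src e)) r)
        S≡ = trans (cong (∑ (λ e → eqV y (src e))) ds≡) (cong (_+ ∑ (λ e → eqV y (src e)) r) (ind-yes (y FinP.≟ src b) (sym b-src)))

      tour-long : 3 ≤ length (ds T)
      tour-long = ≤-trans (*-cancelˡ-≤ 2 (≤-trans (s≤s (s≤s (s≤s (s≤s (s≤s (s≤s z≤n)))))) (≤-trans (≤-trans lo≥8 (ends-large y present)) (≤-reflexive ends≡2S))))
        (≤-trans (∑-≤-length {xs = ds T} (All.tabulate (λ {e} _ → ind≤1 (y FinP.≟ src e)))) (≤-reflexive (*-identityʳ _)))
        where
        present : 0 < ∑ (endV y) H
        present = ≤-trans (s≤s z≤n) (≤-reflexive (sym (trans ends≡2S (cong (2 *_) S≡))))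

      -- The tour passes `y` half as often as `y` has path ends, say `S` times, and one passage is
      -- the seam of the list. Blocked ends number at most `S / 2`, which is below `S - 1` because
      -- `S ≥ 4`; so another transition at `y` is unblocked on both sides.
      find-crossing : ∀ X → length X ≤ 3 * (2 + L) → ∃ λ us → ∃ λ c → ∃ λ d → ∃ λ vs →
        ds T ≡ us ++ c ∷ d ∷ vs × tgt c ≡ y × src d ≡ y × blocked y X c ≡ 0 × blocked y X d ≡ 0
      find-crossing X len = finish (∑-<-find bad (λ p → eqV y (src (proj₂ p))) (adjacent (ds T)) few)
        where
        bad : Edge × Edge → ℕ
        bad p = eqV y (tgt (proj₁ p)) * blocked y X (proj₁ p) + eqV y (src (proj₂ p)) * blocked y X (proj₂ p)
        Bd : ℕ
        Bd = ∑ (λ e → endV y e * blocked y X e) H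
        open ≤-Reasoning
        bad≤ : ∑ bad (adjacent (ds T)) ≤ Bd
        bad≤ = begin
          ∑ bad (adjacent (ds T)) ≡⟨ ∑-+ (λ p → eqV y (tgt (proj₁ p)) * blocked y X (proj₁ p)) (λ p → eqV y (src (proj₂ p)) * blocked y X (proj₂ p)) (adjacent (ds T)) ⟩
          ∑ (λ p → eqV y (tgt (proj₁ p)) * blocked y X (proj₁ p)) (adjacent (ds T)) + ∑ (λ p → eqV y (src (proj₂ p)) * blocked y X (proj₂ p)) (adjacent (ds T))
            ≤⟨ +-mono-≤ (∑-adjacent-fst≤ (λ e → eqV y (tgt e) * blocked y X e) (ds T)) second ⟩
          ∑ (λ e → eqV y (tgt e) * blocked y X e) (ds T) + ∑ (λ e → eqV y (src e) * blocked y X e) (ds T) ≡⟨ sym (∑-+ _ _ (ds T)) ⟩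
          ∑ (λ e → eqV y (tgt e) * blocked y X e + eqV y (src e) * blocked y X e) (ds T) ≡⟨ ∑-cong (λ e → trans (+-comm (eqV y (tgt e) * blocked y X e) _) (sym (*-distribʳ-+ (blocked y X e) (eqV y (src e)) (eqV y (tgt e))))) (ds T) ⟩
          ∑ (λ e → endV y e * blocked y X e) (ds T) ≡⟨ sums T _ (λ e → cong₂ _*_ (endV-flip y e) (blocked-flip y X e)) ⟩
          Bd ∎
          where
          second : ∑ (λ p → eqV y (src (proj₂ p)) * blocked y X (proj₂ p)) (adjacent (ds T)) ≤ ∑ (λ e → eqV y (src e) * blocked y X e) (ds T)
          second rewrite ds≡ = ≤-trans (≤-reflexive (∑-adjacent-snd (λ e → eqV y (src e) * blocked y X e) b r)) (m≤n+m _ _)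
        total : ∑ (λ p → eqV y (src (proj₂ p))) (adjacent (ds T)) ≡ ∑ (λ e → eqV y (src e)) r
        total = trans (cong (λ z → ∑ (λ p → eqV y (src (proj₂ p))) (adjacent z)) ds≡) (∑-adjacent-snd (λ e → eqV y (src e)) b r)
        arith : ∀ {Bd E S S'} → 4 * Bd ≤ E → E ≡ 2 * S → S ≡ suc S' → 8 ≤ E → suc Bd ≤ S'
        arith {Bd} {_} {_} {S'} h refl refl h8 = *-cancelˡ-≤ 4 (≤-of-slack 0 (+-mono-≤ h h8) (l Bd S'))
          where
          l : ∀ b s → 4 * suc b + (2 * suc s + 2 * suc s) + 0 ≡ 4 * s + (4 * b + 8)
          l = solve-∀
        few : ∑ bad (adjacent (ds T)) < ∑ (λ p → eqV y (src (proj₂ p))) (adjacent (ds T))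
        few = ≤-trans (s≤s bad≤) (≤-trans (arith (blocked-few y X len) ends≡2S S≡ (≤-trans lo≥8 (ends-large y (≤-trans (s≤s z≤n) (≤-reflexive (sym (trans ends≡2S (cong (2 *_) S≡)))))))) (≤-reflexive (sym total)))
        finish : (∃ λ p → p ∈ adjacent (ds T) × bad p < eqV y (src (proj₂ p))) → ∃ λ us → ∃ λ c → ∃ λ d → ∃ λ vs →
          ds T ≡ us ++ c ∷ d ∷ vs × tgt c ≡ y × src d ≡ y × blocked y X c ≡ 0 × blocked y X d ≡ 0
        finish ((c , d) , cd∈ , lt) = proj₁ sp , c , d , proj₁ (proj₂ sp) , proj₂ (proj₂ sp) , c-tgt , d-src , blocked-c , blocked-d
          where
          sp = adjacent-split (ds T) cd∈
          d-src : src d ≡ y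
          d-src = sym (ind-pos (y FinP.≟ src d) (≤-trans (s≤s z≤n) lt))
          c-tgt : tgt c ≡ y
          c-tgt with chain-split (proj₁ sp) (subst (λ z → Chain (base T) z (base T)) (proj₂ (proj₂ sp)) (chain T))
          ... | _ , _ , link _ _ (link _ h _) = trans (sym h) d-src
          none : eqV y (tgt c) * blocked y X c + eqV y (src d) * blocked y X d ≡ 0
          none = ≤0⇒≡0 (≤-pred (≤-trans lt (ind≤1 (y FinP.≟ src d))))
          blocked-c : blocked y X c ≡ 0
          blocked-c = trans (sym (+-identityʳ _)) (trans (cong (_* blocked y X c) (sym (ind-yes (y FinP.≟ tgt c) (sym c-tgt)))) (m+n≡0⇒m≡0 _ none))
          blocked-d : blocked y X d ≡ 0
          blocked-d = trans (sym (+-identityʳ _)) (trans (cong (_* blocked y X d) (sym (ind-yes (y FinP.≟ src d) (sym d-src)))) (m+n≡0⇒n≡0 (eqV y (tgt c) * blocked y X c) none))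

      abstract
        crossing : ∀ X → length X ≤ 3 * (2 + L) → ∃ λ us → ∃ λ c → ∃ λ d → ∃ λ vs →
          ds T ≡ us ++ c ∷ d ∷ vs × tgt c ≡ y × src d ≡ y × blocked y X c ≡ 0 × blocked y X d ≡ 0
        crossing = find-crossing

    -- Changing two transitions

    snoc-view : ∀ (x : Edge) xs → ∃ λ ini → ∃ λ z → x ∷ xs ≡ ini ++ z ∷ []
    snoc-view x []       = [] , x , refl
    snoc-view x (y ∷ xs) with snoc-view y xs
    ... | ini , z , e = x ∷ ini , z , cong (x ∷_) e

    ends-snoc : ∀ x xs z → Σ (Ends₂ (x ∷ xs ++ z ∷ [])) λ W → Ends₂.p W ≡ x × Ends₂.v W ≡ z
    ends-snoc x xs z with snoc-view x xs
    ends-snoc x [] z       | ini , w , e = ends₂ refl (trans (cong (_++ z ∷ []) e) (++-assoc ini _ _)) , refl , refl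
    ends-snoc x (y ∷ xs) z | ini , w , e = ends₂ refl (trans (cong (_++ z ∷ []) e) (++-assoc ini _ _)) , refl , refl

    ends-cons : ∀ x y xs → Σ (Ends₂ (x ∷ y ∷ xs)) λ W → Ends₂.p W ≡ x
    ends-cons x y xs with snoc-view y xs
    ... | ini , z , e with ends-snoc x ini z
    ...   | W , px , _ = subst (λ w → Σ (Ends₂ (x ∷ w)) λ W → Ends₂.p W ≡ x) (sym e) (W , px)

    chain-nil : ∀ {x y} → Chain x [] y → x ≡ y
    chain-nil [] = refl

    rev-chain : ∀ {x y es} → Chain x es y → Chain y (rev es) x
    rev-chain []           = []
    rev-chain (link e h c) = chain-++ (rev-chain c) (link (flip e) refl (subst (λ z → Chain (src e) [] z) h []))

    rotate : (T : Tour) → ∀ us vs → ds T ≡ us ++ vs → Σ Tour λ T' → ds T' ≡ vs ++ us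
    rotate T us vs eq with chain-rotate us (subst (λ z → Chain (base T) z (base T)) eq (chain T))
    ... | y , c = record { base = y ; ds = vs ++ us ; chain = c ; sound = All-resp-↭ (++-comm us vs) (subst (All (Valid L)) eq (sound T))
                         ; sums = λ w inv → trans (∑-↭ w (++-comm vs us)) (trans (cong (∑ w) (sym eq)) (sums T w inv)) } , refl

    -- The tour is cut at the seam, where `p` follows `v`, and at another visit of the base, where
    -- `d` follows `c`. Reversing the part from `d` to `v` makes `flip v` follow `c` and `p` follow
    -- `flip d`. The accounting keeps the windows at these places; `k` is the sum of all others.
    record Swap (T : Tour) (W : Ends₂ (ds T)) (X : List (Fin n)) : Set where
      field
        T'         : Tour
        c⁻ c d d⁺  : Edge
        c-valid    : Valid L c
        d-valid    : Valid L d
        c-tgt      : tgt c ≡ base T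
        d-src      : src d ≡ base T
        c-free     : blocked (base T) X c ≡ 0
        d-free     : blocked (base T) X d ≡ 0
      open Ends₂ W
      field
        accounting : ∀ f → (∀ x y z → f (flip z) (flip y) (flip x) ≡ f x y z) → ∃ λ k →
          Windows.cyc f (ds T)  ≡ k + (f c⁻ c d + f c d d⁺ + (f u v p + f v p q)) ×
          Windows.cyc f (ds T') ≡ k + (f c⁻ c (flip v) + f c (flip v) (flip u) + (f (flip d⁺) (flip d) p + f (flip d) p q))

    first-src : ∀ T {b r} → ds T ≡ b ∷ r → src b ≡ base T
    first-src T eq with subst (λ z → Chain (base T) z (base T)) eq (chain T)
    ... | link _ h _ = h

    last-tgt : ∀ T {ini a⁻ a} → ds T ≡ ini ++ a⁻ ∷ a ∷ [] → tgt a ≡ base T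
    last-tgt T {ini} eq with chain-split ini (subst (λ z → Chain (base T) z (base T)) eq (chain T))
    ... | _ , _ , link _ _ (link _ _ c) = chain-nil c

    findSwap : ∀ T (W : Ends₂ (ds T)) X → length X ≤ 3 * (2 + L) → Swap T W X
    findSwap T (ends₂ {b} {b⁺} {a⁻} {a} {tl} {ini} first last) X len
      with crossing T (base T) b (b⁺ ∷ tl) first (first-src T first) X len
    -- Here `c` would be the first path of the tour and lead from the base to the base. In the next
    -- case the same would hold for `d` as the last path.
    ... | [] , c , d , vs , eq , ct , dS , fc , fd = ⊥-elim (src≢tgt c-valid (trans (first-src T eq) (sym ct)))
      where
      c-valid : Valid L c
      c-valid = All.head (subst (All (Valid L)) eq (sound T))
    ... | us@(_ ∷ _) , c , d , [] , eq , ct , dS , fc , fd = ⊥-elim (src≢tgt d-valid (trans dS (sym (last-tgt T {us} {c} {d} eq))))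
      where
      d-valid : Valid L d
      d-valid = All.head (All.tail (AllP.++⁻ʳ us (subst (All (Valid L)) eq (sound T))))
    ... | u₀ ∷ us , c , d , v₀ ∷ vs , eq , ct , dS , fc , fd with ends-snoc u₀ us c | ends-cons d v₀ vs
    ...   | WP@(ends₂ {b'} {b⁺'} {c⁻} {.c} {tlP} {iniP} firstP lastP) , _ , refl | WQ@(ends₂ {.d} {d⁺} {a⁻'} {a'} {tlQ} {iniQ} firstQ lastQ) , refl
      with ∷-injective (trans (sym first) (trans eq (trans (cong (λ z → u₀ ∷ z) (sym (++-assoc us (c ∷ []) (d ∷ v₀ ∷ vs)))) (cong (_++ d ∷ v₀ ∷ vs) firstP))))
         | ∷ʳ-injective (ini ++ a⁻ ∷ []) ((u₀ ∷ us ++ c ∷ []) ++ (iniQ ++ a⁻' ∷ []))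
             (trans (++-assoc ini _ _) (trans (sym last) (trans eq (trans (cong (λ z → u₀ ∷ z) (sym (++-assoc us (c ∷ []) (d ∷ v₀ ∷ vs))))
               (trans (cong ((u₀ ∷ us ++ c ∷ []) ++_) (trans lastQ (sym (++-assoc iniQ _ _)))) (sym (++-assoc (u₀ ∷ us ++ c ∷ []) _ _)))))))
    ...     | refl , tailEq | iniEq , refl
      with ∷-injective tailEq | ∷ʳ-injective ini ((u₀ ∷ us ++ c ∷ []) ++ iniQ) (trans iniEq (sym (++-assoc (u₀ ∷ us ++ c ∷ []) _ _)))
    ...       | refl , _ | _ , refl = record
      { T' = record { base = base T ; ds = P ++ rev Q ; chain = chain-++ chP (rev-chain chQ)
                    ; sound = AllP.++⁺ (AllP.++⁻ˡ P soundPQ) (All-rev valid-flip (AllP.++⁻ʳ P soundPQ))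
                    ; sums = λ w inv → trans (∑-++ w P (rev Q)) (trans (cong (∑ w P +_) (∑-rev w inv Q)) (trans (sym (∑-++ w P Q)) (trans (cong (∑ w) (sym eqPQ)) (sums T w inv)))) }
      ; c⁻ = c⁻ ; c = c ; d = d ; d⁺ = d⁺
      ; c-valid = All.head (AllP.++⁻ʳ (u₀ ∷ us) (AllP.++⁻ˡ P soundPQ)) ; d-valid = All.head (AllP.++⁻ʳ P soundPQ)
      ; c-tgt = ct ; d-src = dS ; c-free = fc ; d-free = fd
      ; accounting = λ f f-sym → Windows.WS f P [] + Windows.WS f Q [] ,
          trans (cong (Windows.cyc f) eqPQ) (Windows.cyc-split f WP WQ) ,
          trans (Windows.cyc-split f WP (ends-rev WQ)) (cong (λ z → Windows.WS f P [] + z + (f c⁻ c (flip a) + f c (flip a) (flip a⁻) + (f (flip d⁺) (flip d) b + f (flip d) b b⁺))) (WS-rev f f-sym Q)) }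
      where
      P = u₀ ∷ us ++ c ∷ []
      Q = d ∷ v₀ ∷ vs
      eqPQ : ds T ≡ P ++ Q
      eqPQ = trans eq (cong (u₀ ∷_) (sym (++-assoc us (c ∷ []) Q)))
      soundPQ : All (Valid L) (P ++ Q)
      soundPQ = subst (All (Valid L)) eqPQ (sound T)
      chains : ∃ λ y → Chain (base T) P y × Chain y Q (base T)
      chains = chain-split P (subst (λ z → Chain (base T) z (base T)) eqPQ (chain T))
      mid : proj₁ chains ≡ base T
      mid with proj₂ (proj₂ chains)
      ... | link _ h _ = trans (sym h) dS
      chP : Chain (base T) P (base T)
      chP = subst (Chain (base T) P) mid (proj₁ (proj₂ chains))
      chQ : Chain (base T) Q (base T)
      chQ = subst (λ z → Chain z Q (base T)) mid (proj₂ (proj₂ chains))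

    abstract
      swapTour : ∀ T (W : Ends₂ (ds T)) X → length X ≤ 3 * (2 + L) → Swap T W X
      swapTour = findSwap

    free-short : ∀ {y X e} → blocked y X e ≡ 0 → sh e ≡ 0
    free-short h = m+n≡0⇒m≡0 _ h

    free-avoid : ∀ {y X e} → blocked y X e ≡ 0 → ∀ {p} → p ∈ X → p ≢ y → mult p (verts e) ≡ 0
    free-avoid {y} {X} {e} h {p} p∈ p≢y = trans (sym (+-identityʳ _)) (trans (cong (λ z → (1 ∸ z) * mult p (verts e)) (sym (ind-no (p FinP.≟ y) p≢y)))
      (All.lookup (∑-zero⁻ (λ p → (1 ∸ eqV p y) * mult p (verts e)) (m+n≡0⇒n≡0 (sh e) h)) p∈))

    front-≢tgt : ∀ {e p} → Valid L e → p ∈ front e → p ≢ tgt e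
    front-≢tgt {e} v p∈ refl = <-irrefl (sym (tgt∉front v)) (mult-∈ {xs = front e} p∈)

    rear-≢src : ∀ {e p} → Valid L e → p ∈ rear e → p ≢ src e
    rear-≢src {e} v p∈ refl = <-irrefl refl (≤-trans (+-mono-≤ (≤-reflexive (sym (eqV-refl (src e)))) (mult-∈ {xs = rear e} p∈)) (simple v (src e)))

    mult-rear≤ : ∀ p e → mult p (rear e) ≤ mult p (verts e)
    mult-rear≤ p e = m≤n+m _ _

    length-verts : ∀ {e} → Valid L e → length (verts e) ≤ 2 + L
    length-verts {e} v = ≤-trans (≤-reflexive (cong suc (trans (length-++ (int e)) (+-comm (length (int e)) 1)))) (s≤s (s≤s (short v)))

    module _ {T : Tour} {W : Ends₂ (ds T)} {X : List (Fin n)} (sw : Swap T W X) where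
      open Swap sw
      open Ends₂ W

      v-valid : Valid L v
      v-valid = All.head (All.tail (AllP.++⁻ʳ ini (subst (All (Valid L)) last (sound T))))

      p-valid : Valid L p
      p-valid = All.head (subst (All (Valid L)) first (sound T))

      v-tgt : tgt v ≡ base T
      v-tgt = last-tgt T last

      module _ (v⊆ : ∀ {z} → z ∈ verts v → z ∈ X) (p⊆ : ∀ {z} → z ∈ verts p → z ∈ X) where

        pair-c : pairBad c (flip v) ≡ 0
        pair-c = cong₂ _+_ (cong (_* sh (flip v)) (free-short {base T} {X} {c} c-free)) (trans (inter-↭ {front c} ↭-refl (rear-flip v)) (trans (inter-sym (front c) (front v))
          (∑-zero-All (All.tabulate (λ {z} z∈ → ≤0⇒≡0 (≤-trans (mult-front≤ z c)
            (≤-reflexive (free-avoid {base T} {X} {c} c-free (v⊆ (∈-++⁺ˡ z∈)) (λ h → front-≢tgt v-valid z∈ (trans h (sym v-tgt)))))))))))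

        pair-d : pairBad (flip d) p ≡ 0
        pair-d = cong₂ _+_ (cong (_* sh p) (trans (sh-flip d) (free-short {base T} {X} {d} d-free))) (trans (inter-↭ {ys = rear p} (front-flip d) ↭-refl) (trans (inter-sym (rear d) (rear p))
          (∑-zero-All (All.tabulate (λ {z} z∈ → ≤0⇒≡0 (≤-trans (mult-rear≤ z d)
            (≤-reflexive (free-avoid {base T} {X} {d} d-free (p⊆ (there z∈)) (λ h → rear-≢src p-valid z∈ (trans h (sym (first-src T first))))))))))))

        -- Both `c` and `d` are long and avoid `v` and `p` off the base, so the new transitions are
        -- clean, and the one between `v` and `p` is gone.
        cyc₁-drop : cyc₁ (ds T') + pairBad v p ≤ cyc₁ (ds T)
        cyc₁-drop with accounting f₁ f₁-sym
        ... | k , old , new rewrite old | new | pair-c | pair-d | pairBad-flip u v | pairBad-flip d d⁺ =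
          ≤-of-slack (pairBad v p + pairBad c d + pairBad c d) (≤-refl {0}) (l k (pairBad c⁻ c) (pairBad c d) (pairBad d d⁺) (pairBad u v) (pairBad v p) (pairBad p q))
          where
          l : ∀ k a b c d e g → k + (a + 0 + (0 + d) + (c + 0 + (0 + g))) + e + 0 + (e + b + b) ≡ k + (a + b + (b + c) + (d + e + (e + g))) + 0
          l = solve-∀

    improvePair : ∀ T (W : Ends₂ (ds T)) → 0 < pairBad (Ends₂.v W) (Ends₂.p W) → Σ Tour λ T' → cyc₁ (ds T') < cyc₁ (ds T)
    improvePair T W bad = Swap.T' sw , ≤-trans (≤-reflexive (+-comm 1 _)) (≤-trans (+-monoʳ-≤ (cyc₁ (ds (Swap.T' sw))) bad) (cyc₁-drop {T} {W} sw ∈-++⁺ˡ (∈-++⁺ʳ (verts v))))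
      where
      open Ends₂ W
      X = verts v ++ verts p
      valid-v : Valid L v
      valid-v = All.head (All.tail (AllP.++⁻ʳ ini (subst (All (Valid L)) last (sound T))))
      valid-p : Valid L p
      valid-p = All.head (subst (All (Valid L)) first (sound T))
      sw : Swap T W X
      sw = swapTour T W X (≤-trans (≤-reflexive (length-++ (verts v))) (≤-trans (+-mono-≤ (length-verts valid-v) (length-verts valid-p)) (≤-trans (m≤m+n _ (2 + L)) (≤-reflexive (l L)))))
        where
        l : ∀ L → 2 + L + (2 + L) + (2 + L) ≡ 3 * (2 + L)
        l = solve-∀

    abstract
      fixPair : ∀ T (W : Ends₂ (ds T)) → 0 < pairBad (Ends₂.v W) (Ends₂.p W) → Σ Tour λ T' → cyc₁ (ds T') < cyc₁ (ds T)
      fixPair = improvePair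

    -- Here `v` is short, hence `p` is long as the pairs are clean, and `c` and `d` are long by
    -- choice. Among the four new windows only `c`, `flip v`, `flip u` has a short middle, and `c`
    -- avoids `u` since `X` contains the vertices of `u`. The three paths in `X` are the origin of
    -- the `3` in `spacious`.
    improveTriple : ∀ T (W : Ends₂ (ds T)) → cyc₁ (ds T) ≡ 0 → pairBad (Ends₂.u W) (Ends₂.v W) ≡ 0 → pairBad (Ends₂.v W) (Ends₂.p W) ≡ 0 →
                0 < f₂ (Ends₂.u W) (Ends₂.v W) (Ends₂.p W) → Σ Tour λ T' → cyc₁ (ds T') ≡ 0 × cyc₂ (ds T') < cyc₂ (ds T)
    improveTriple T W clean uv vp bad = T' , ≤0⇒≡0 (≤-trans (m≤m+n _ _) (≤-trans (cyc₁-drop {T} {W} sw ∈-++⁺ˡ (λ h → ∈-++⁺ʳ (verts v) (∈-++⁺ʳ (verts u) h))) (≤-reflexive clean))) , drop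
      where
      open Ends₂ W
      X = verts v ++ (verts u ++ verts p)
      valid-v : Valid L v
      valid-v = All.head (All.tail (AllP.++⁻ʳ ini (subst (All (Valid L)) last (sound T))))
      valid-u : Valid L u
      valid-u = All.head (AllP.++⁻ʳ ini (subst (All (Valid L)) last (sound T)))
      valid-p : Valid L p
      valid-p = All.head (subst (All (Valid L)) first (sound T))
      sw : Swap T W X
      sw = swapTour T W X (≤-trans (≤-reflexive (trans (length-++ (verts v)) (cong (length (verts v) +_) (length-++ (verts u))))) (≤-trans (+-mono-≤ (length-verts valid-v) (+-mono-≤ (length-verts valid-u) (length-verts valid-p))) (≤-reflexive (l L))))
        where
        l : ∀ L → 2 + L + (2 + L + (2 + L)) ≡ 3 * (2 + L)
        l = solve-∀
      open Swap sw
      short-v : 0 < sh v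
      short-v = proj₁ (*-pos (sh v) _ bad)
      long-p : sh p ≡ 0
      long-p = m*n≡0⇒m≡0 (sh p) (sh v) {{>-nonZero short-v}} (trans (*-comm (sh p) (sh v)) (m+n≡0⇒m≡0 (sh v * sh p) vp))
      u-joint : tgt u ≡ src v
      u-joint with chain-split ini (subst (λ z → Chain (base T) z (base T)) last (chain T))
      ... | _ , _ , link _ _ (link _ h _) = sym h
      -- Avoidance of `X` does not extend to the base, so `u` must miss it. The base is `tgt v`: the
      -- front of `u` misses it because the pair `u`, `v` is clean, and `tgt u` is `src v`, the
      -- other end of `v`.
      base∉u : ∀ {z} → z ∈ verts u → z ≢ base T
      base∉u {z} z∈ h with ∈-++⁻ (front u) z∈
      ... | inj₁ z∈f = <-irrefl (sym (All.lookup (∑-zero⁻ (λ p → mult p (rear v)) (m+n≡0⇒n≡0 (sh u * sh v) uv)) z∈f))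
              (subst (λ w → 1 ≤ mult w (rear v)) (trans (last-tgt T last) (sym h)) (mult-∈ {xs = rear v} (∈-++⁺ʳ (int v) (here refl))))
      ... | inj₂ (here e) = src≢tgt valid-v (trans (sym u-joint) (trans (sym e) (trans h (sym (last-tgt T last)))))
      ... | inj₂ (there ())
      apart : inter (verts c) (verts (flip u)) ≡ 0
      apart = trans (inter-↭ {verts c} ↭-refl (verts-flip↭ u)) (trans (inter-sym (verts c) (verts u))
        (∑-zero-All (All.tabulate (λ {z} z∈ → free-avoid {base T} {X} {c} c-free (∈-++⁺ʳ (verts v) (∈-++⁺ˡ z∈)) (base∉u z∈)))))
      none : f₂ c⁻ c (flip v) + f₂ c (flip v) (flip u) + (f₂ (flip d⁺) (flip d) p + f₂ (flip d) p q) ≡ 0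
      none = cong₂ _+_ (cong₂ _+_ (cong (_* inter (verts c⁻) (verts (flip v))) (free-short {base T} {X} {c} c-free)) (trans (cong (sh (flip v) *_) apart) (*-zeroʳ (sh (flip v)))))
        (cong₂ _+_ (cong (_* inter (verts (flip d⁺)) (verts p)) (trans (sh-flip d) (free-short {base T} {X} {d} d-free))) (cong (_* inter (verts (flip d)) (verts q)) long-p))
      compare : ∀ {k o o' z C C'} → C ≡ k + (o + z) → C' ≡ k + o' → o' ≡ 0 → 0 < z → C' < C
      compare {k} {o} {z = z} refl refl refl z>0 = ≤-trans (≤-reflexive (trans (cong suc (+-identityʳ k)) (+-comm 1 k))) (+-monoʳ-≤ k (≤-trans z>0 (m≤n+m z o)))
      drop : cyc₂ (ds T') < cyc₂ (ds T)
      drop = compare {k = proj₁ (accounting f₂ f₂-sym)} {o = f₂ c⁻ c d + f₂ c d d⁺} {z = f₂ u v p + f₂ v p q} (proj₁ (proj₂ (accounting f₂ f₂-sym))) (proj₂ (proj₂ (accounting f₂ f₂-sym))) none (≤-trans bad (m≤m+n (f₂ u v p) (f₂ v p q)))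

    abstract
      fixTriple : ∀ T (W : Ends₂ (ds T)) → cyc₁ (ds T) ≡ 0 → pairBad (Ends₂.u W) (Ends₂.v W) ≡ 0 → pairBad (Ends₂.v W) (Ends₂.p W) ≡ 0 →
                  0 < f₂ (Ends₂.u W) (Ends₂.v W) (Ends₂.p W) → Σ Tour λ T' → cyc₁ (ds T') ≡ 0 × cyc₂ (ds T') < cyc₂ (ds T)
      fixTriple = improveTriple

    ends-wrap : ∀ (z : Edge) rest x y → Σ (Ends₂ (z ∷ rest ++ x ∷ y ∷ [])) λ W → Ends₂.u W ≡ x × Ends₂.v W ≡ y × Ends₂.p W ≡ z
    ends-wrap z []       x y = ends₂ {ini = z ∷ []} refl refl , refl , refl , refl
    ends-wrap z (w ∷ ws) x y = ends₂ {ini = z ∷ w ∷ ws} refl refl , refl , refl , refl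

    -- A bad window for `f₁` may be bad through either of its pairs, hence two rotations: one puts
    -- `y`, `z` at the seam with `x` just before, the other puts `x`, `y` there.
    wrap-rotations : ∀ T {x y z rest} us vs → ds T ≡ us ++ vs → vs ++ us ≡ x ∷ y ∷ z ∷ rest →
      (Σ Tour λ T' → Σ (Ends₂ (ds T')) λ W → (Ends₂.u W ≡ x × Ends₂.v W ≡ y × Ends₂.p W ≡ z) × cyc₁ (ds T') ≡ cyc₁ (ds T) × cyc₂ (ds T') ≡ cyc₂ (ds T))
      × (Σ Tour λ T' → Σ (Ends₂ (ds T')) λ W → (Ends₂.v W ≡ x × Ends₂.p W ≡ y) × cyc₁ (ds T') ≡ cyc₁ (ds T))
    wrap-rotations T {x} {y} {z} {rest} us vs eq vu≡ with rotate T us vs eq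
    ... | T₁ , e₁ with rotate T₁ (x ∷ y ∷ []) (z ∷ rest) (trans e₁ vu≡) | rotate T₁ (x ∷ []) (y ∷ z ∷ rest) (trans e₁ vu≡)
    ...   | T₂ , e₂ | T₃ , e₃ with ends-wrap z rest x y | ends-snoc y (z ∷ rest) x
    ...     | W₂ , u₂ , v₂ , p₂ | W₃ , p₃ , v₃ =
      (T₂ , subst Ends₂ (sym e₂) W₂ , proj (sym e₂) W₂ (u₂ , v₂ , p₂) ,
        trans (cong cyc₁ e₂) (trans (sym (cyc-rotate₁ (x ∷ y ∷ []) (z ∷ rest) (s≤s (s≤s z≤n)))) (trans (cong cyc₁ (sym vu≡)) (trans (cyc-rotate₁ vs us len) (cong cyc₁ (sym eq))))) ,
        trans (cong cyc₂ e₂) (trans (sym (cyc-rotate₂ (x ∷ y ∷ []) (z ∷ rest) (s≤s (s≤s z≤n)))) (trans (cong cyc₂ (sym vu≡)) (trans (cyc-rotate₂ vs us len) (cong cyc₂ (sym eq)))))) ,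
      (T₃ , subst Ends₂ (sym e₃) W₃ , proj' (sym e₃) W₃ (v₃ , p₃) ,
        trans (cong cyc₁ e₃) (trans (sym (cyc-rotate₁ (x ∷ []) (y ∷ z ∷ rest) (s≤s (s≤s z≤n)))) (trans (cong cyc₁ (sym vu≡)) (trans (cyc-rotate₁ vs us len) (cong cyc₁ (sym eq))))))
      where
      len : 2 ≤ length (vs ++ us)
      len = subst (2 ≤_) (sym (cong length vu≡)) (s≤s (s≤s z≤n))
      proj : ∀ {xs ys} (e : xs ≡ ys) (W : Ends₂ xs) → (Ends₂.u W ≡ x × Ends₂.v W ≡ y × Ends₂.p W ≡ z) →
             Ends₂.u (subst Ends₂ e W) ≡ x × Ends₂.v (subst Ends₂ e W) ≡ y × Ends₂.p (subst Ends₂ e W) ≡ z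
      proj refl W h = h
      proj' : ∀ {xs ys} (e : xs ≡ ys) (W : Ends₂ xs) → (Ends₂.v W ≡ x × Ends₂.p W ≡ y) → Ends₂.v (subst Ends₂ e W) ≡ x × Ends₂.p (subst Ends₂ e W) ≡ y
      proj' refl W h = h

    abstract
      rotated-wrap : ∀ T {x y z rest} us vs → ds T ≡ us ++ vs → vs ++ us ≡ x ∷ y ∷ z ∷ rest →
        (Σ Tour λ T' → Σ (Ends₂ (ds T')) λ W → (Ends₂.u W ≡ x × Ends₂.v W ≡ y × Ends₂.p W ≡ z) × cyc₁ (ds T') ≡ cyc₁ (ds T) × cyc₂ (ds T') ≡ cyc₂ (ds T))
        × (Σ Tour λ T' → Σ (Ends₂ (ds T')) λ W → (Ends₂.v W ≡ x × Ends₂.p W ≡ y) × cyc₁ (ds T') ≡ cyc₁ (ds T))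
      rotated-wrap = wrap-rotations

    long-tour : ∀ T → 0 < length (ds T) → 3 ≤ length (ds T)
    long-tour T ne with ds T in e
    long-tour T () | []
    ... | b ∷ r = subst (λ z → 3 ≤ length z) e (tour-long T (base T) b r e (first-src T e))

    abstract
      long₁ : ∀ T → 0 < length (ds T) → 3 ≤ length (ds T)
      long₁ = long-tour

    zero-window : ∀ {x y z} → f₁ x y z ≡ 0 → pairBad x y ≡ 0 × pairBad y z ≡ 0
    zero-window {x} {y} h = m+n≡0⇒m≡0 _ h , m+n≡0⇒n≡0 (pairBad x y) h

    wrap-clean : ∀ T (W : Ends₂ (ds T)) → cyc₁ (ds T) ≡ 0 → f₁ (Ends₂.u W) (Ends₂.v W) (Ends₂.p W) ≡ 0
    wrap-clean T (ends₂ {p} {q} {u} {v} {tl} {ini} first last) z = m+n≡0⇒m≡0 (f₁ u v p) {f₁ v p q} (m+n≡0⇒n≡0 (WS (ini ++ u ∷ v ∷ []) []) (trans (sym (WS-end ini u v p q tl)) (trans (cong₂ WS (sym last) (sym first)) z)))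
      where open Windows f₁

  private
    repairPairs : ∀ N (T : Tour) → 0 < length (ds T) → cyc₁ (ds T) ≤ N → Σ Tour λ T' → cyc₁ (ds T') ≡ 0 × 0 < length (ds T')
    repairPairs N T ne le with 0 <? cyc₁ (ds T)
    ... | no ¬pos = T , ¬pos⇒≡0 _ ¬pos , ne
    repairPairs zero T ne le | yes pos = ⊥-elim (<-irrefl refl (≤-trans pos le))
    repairPairs (suc N) T ne le | yes pos with cyc-find₁ (ds T) (long₁ T ne) pos
    ... | us , vs , eq , x , y , z , rest , vu≡ , bad with rotated-wrap T us vs eq vu≡ | +-pos (pairBad x y) _ bad
    ...   | _ , (T₃ , W₃ , (v₃ , p₃) , c₃) | inj₁ h with fixPair T₃ W₃ (subst₂ (λ a b → 0 < pairBad a b) (sym v₃) (sym p₃) h)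
    ...     | T' , lt = repairPairs N T' (nonempty T') (≤-pred (≤-trans lt (≤-trans (≤-reflexive c₃) le)))
      where
      nonempty : ∀ T' → 0 < length (ds T')
      nonempty T' = subst (0 <_) (trans (sym (∑-ones (ds T))) (trans (sums T (λ _ → 1) (λ _ → refl)) (trans (sym (sums T' (λ _ → 1) (λ _ → refl))) (∑-ones (ds T'))))) ne
    repairPairs (suc N) T ne le | yes pos | us , vs , eq , x , y , z , rest , vu≡ , bad | (T₂ , W₂ , (u₂ , v₂ , p₂) , c₂ , _) , _ | inj₂ h
      with fixPair T₂ W₂ (subst₂ (λ a b → 0 < pairBad a b) (sym v₂) (sym p₂) h)
    ...     | T' , lt = repairPairs N T' (nonempty T') (≤-pred (≤-trans lt (≤-trans (≤-reflexive c₂) le)))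
      where
      nonempty : ∀ T' → 0 < length (ds T')
      nonempty T' = subst (0 <_) (trans (sym (∑-ones (ds T))) (trans (sums T (λ _ → 1) (λ _ → refl)) (trans (sym (sums T' (λ _ → 1) (λ _ → refl))) (∑-ones (ds T'))))) ne

    repairTriples : ∀ N (T : Tour) → 0 < length (ds T) → cyc₁ (ds T) ≡ 0 → cyc₂ (ds T) ≤ N → Σ Tour λ T' → cyc₁ (ds T') ≡ 0 × cyc₂ (ds T') ≡ 0 × 3 ≤ length (ds T')
    repairTriples N T ne clean le with 0 <? cyc₂ (ds T)
    ... | no ¬pos = T , clean , ¬pos⇒≡0 _ ¬pos , long₁ T ne
    repairTriples zero T ne clean le | yes pos = ⊥-elim (<-irrefl refl (≤-trans pos le))
    repairTriples (suc N) T ne clean le | yes pos with cyc-find₂ (ds T) (long₁ T ne) pos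
    ... | us , vs , eq , x , y , z , rest , vu≡ , bad with rotated-wrap T us vs eq vu≡
    ...   | (T₂ , W₂ , (refl , refl , refl) , c₁ , c₂) , _ with zero-window {Ends₂.u W₂} {Ends₂.v W₂} {Ends₂.p W₂} (wrap-clean T₂ W₂ (trans c₁ clean))
    ...     | uv , vp with fixTriple T₂ W₂ (trans c₁ clean) uv vp bad
    ...       | T' , clean' , lt = repairTriples N T' nonempty clean' (≤-pred (≤-trans lt (≤-trans (≤-reflexive c₂) le)))
      where
      nonempty : 0 < length (ds T')
      nonempty = subst (0 <_) (trans (sym (∑-ones (ds T))) (trans (sums T (λ _ → 1) (λ _ → refl)) (trans (sym (sums T' (λ _ → 1) (λ _ → refl))) (∑-ones (ds T'))))) ne

  abstract
    cleanPairs : ∀ N (T : Tour) → 0 < length (ds T) → cyc₁ (ds T) ≤ N → Σ Tour λ T' → cyc₁ (ds T') ≡ 0 × 0 < length (ds T')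
    cleanPairs = repairPairs

    cleanTriples : ∀ N (T : Tour) → 0 < length (ds T) → cyc₁ (ds T) ≡ 0 → cyc₂ (ds T) ≤ N → Σ Tour λ T' → cyc₁ (ds T') ≡ 0 × cyc₂ (ds T') ≡ 0 × 3 ≤ length (ds T')
    cleanTriples = repairTriples

  private
    map-chain : ∀ {k} (g : Fin k → Edge) {x y is} → Chains.Chain (src ∘ g) (tgt ∘ g) x is y → Chain x (map g is) y
    map-chain g Chains.[]             = []
    map-chain g (Chains.link i h c) = link (g i) h (map-chain g c)

  eulerian : ∀ {e} → e ∈ H → Σ Tour λ T → 0 < length (ds T)
  eulerian {e} e∈ = T , subst (0 <_) (trans (sym (sums T (λ _ → 1) (λ _ → refl))) (∑-ones (ds T))) (≤-trans (≤-refl {1}) (∑-∈ (λ _ → 1) e∈))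
    where
    O = orient H
    module O = Oriented O
    k = length O.arcs
    g : Fin k → Edge
    g = lookup O.arcs
    first : Fin k
    first with O.arcs | trans (O.flipSum (λ _ → 1) (λ _ → refl)) refl
    ... | []    | z = ⊥-elim (<-irrefl z (∑-∈ (λ _ → 1) e∈))
    ... | _ ∷ _ | _ = zero
    euler = EulerTour.eulerTour (src ∘ g) (tgt ∘ g)
      (λ z → trans (∑-lookup (λ e → eqV z (src e)) O.arcs) (trans (oriented-eulerian O (even good) z) (sym (∑-lookup (λ e → eqV z (tgt e)) O.arcs))))
      (λ R h → oriented-joined O (joined good) R (All.tabulate (λ {f} f∈ → subst (λ z → R (src z) ≡ R (tgt z)) (sym (lookup-index f∈)) (h (Any.index f∈)))))
      first
    T : Tour
    T = record
      { base = proj₁ euler ; ds = map g (proj₁ (proj₂ euler)) ; chain = map-chain g (proj₁ (proj₂ (proj₂ euler)))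
      ; sound = AllP.map⁺ (All.tabulate (λ {i} _ → All.lookup (oriented-valid O (valid good)) (∈-lookup {xs = O.arcs} i)))
      ; sums = λ w inv → trans (∑-map w g (proj₁ (proj₂ euler))) (trans (proj₂ (proj₂ (proj₂ euler)) (w ∘ g)) (trans (∑-lookup w O.arcs) (O.flipSum w inv))) }

  abstract
    initialTour : ∀ {e} → e ∈ H → Σ Tour λ T → 0 < length (ds T)
    initialTour = eulerian

  cleanTour : ∀ {e} → e ∈ H → Σ Tour λ T → cyc₁ (ds T) ≡ 0 × cyc₂ (ds T) ≡ 0 × 3 ≤ length (ds T)
  cleanTour e∈ with initialTour e∈
  ... | T₀ , ne₀ with cleanPairs _ T₀ ne₀ ≤-refl
  ...   | T₁ , clean , ne₁ = cleanTriples _ T₁ ne₁ clean ≤-refl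

  -- A path contributes its front only, because its last vertex opens the next path; the return to
  -- the base is left to cyclicity.
  walkOf : Tour → List (Fin n)
  walkOf T = concatMap front (ds T)

  private
    chain-head : ∀ {a b es} → Chain a es b → ∃ λ ys → concatMap front es ++ b ∷ [] ≡ a ∷ ys
    chain-head []              = [] , refl
    chain-head (link e refl c) = _ , refl

    occ-chain : ∀ x y {a b es} → Chain a es b → occ x y (concatMap front es ++ b ∷ []) ≡ ∑ (λ e → occ x y (verts e)) es
    occ-chain x y [] = refl
    occ-chain x y {b = b} (link {es = es} e refl c) with chain-head c
    ... | ys , h = trans (cong (occ x y) (trans (++-assoc (front e) (concatMap front es) (b ∷ [])) (cong (front e ++_) h)))
      (trans (occ-split x y (front e) (tgt e) ys) (cong (occ x y (verts e) +_) (trans (cong (occ x y) (sym h)) (occ-chain x y c))))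

  walk-occ : ∀ T x y → occ x y (walkOf T ++ base T ∷ []) ≡ adj x y
  walk-occ T x y = trans (occ-chain x y (chain T)) (trans (sums T (λ e → occ x y (verts e)) (occ-flip x y)) (covers good x y))

  private
    split-++ : ∀ (xs ys us : List (Fin n)) {x vs} → xs ++ ys ≡ us ++ x ∷ vs →
               (∃ λ zs → xs ≡ us ++ x ∷ zs × vs ≡ zs ++ ys) ⊎ (∃ λ us' → us ≡ xs ++ us' × ys ≡ us' ++ x ∷ vs)
    split-++ []       ys us       e = inj₂ (us , refl , e)
    split-++ (z ∷ xs) ys []       e with ∷-injective e
    ... | refl , e' = inj₁ (xs , refl , sym e')
    split-++ (z ∷ xs) ys (u ∷ us) e with ∷-injective e
    ... | refl , e' with split-++ xs ys us e'
    ...   | inj₁ (zs , p , q)  = inj₁ (zs , cong (z ∷_) p , q)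
    ...   | inj₂ (us' , p , q) = inj₂ (us' , cong (z ∷_) p , q)

    locate : ∀ es us {x vs} → concatMap front es ≡ us ++ x ∷ vs → ∃ λ D₁ → ∃ λ A → ∃ λ D₂ → ∃ λ g₁ → ∃ λ g₂ →
             es ≡ D₁ ++ A ∷ D₂ × front A ≡ g₁ ++ x ∷ g₂ × us ≡ concatMap front D₁ ++ g₁ × vs ≡ g₂ ++ concatMap front D₂
    locate []       []      ()
    locate []       (_ ∷ _) ()
    locate (e ∷ es) us h with split-++ (front e) (concatMap front es) us h
    ... | inj₁ (zs , p , q) = [] , e , es , us , zs , refl , p , refl , q
    ... | inj₂ (us' , p , q) with locate es us' q
    ...   | D₁ , A , D₂ , g₁ , g₂ , e₁ , e₂ , e₃ , e₄ = e ∷ D₁ , A , D₂ , g₁ , g₂ , cong (e ∷_) e₁ , e₂ ,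
            trans p (trans (cong (front e ++_) e₃) (sym (++-assoc (front e) (concatMap front D₁) g₁))) , e₄

    concatMap-++' : ∀ (xs ys : List Edge) → concatMap front (xs ++ ys) ≡ concatMap front xs ++ concatMap front ys
    concatMap-++' []       ys = refl
    concatMap-++' (x ∷ xs) ys = trans (cong (front x ++_) (concatMap-++' xs ys)) (sym (++-assoc (front x) _ _))

    mult-take≤ : ∀ p k (xs ys : List (Fin n)) → k ≤ length xs → mult p (take k (xs ++ ys)) ≤ mult p xs
    mult-take≤ p zero    xs       ys _       = z≤n
    mult-take≤ p (suc k) (x ∷ xs) ys (s≤s h) = +-monoʳ-≤ (eqV p x) (mult-take≤ p k xs ys h)

    sh-long : ∀ e → sh e ≡ 0 → ℓ ≤ length (front e)
    sh-long e h with length (int e) <? ℓ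
    sh-long e () | yes _
    ... | no ¬p = ≤-trans (≮⇒≥ ¬p) (n≤1+n _)

  private
    -- Let `x` lie on `A`, followed by `B` and `C`. The next `ℓ` vertices lie on the rest `g₂` of
    -- `A`, on `B` and, if `B` is short, on `C`, which is then long. Simplicity keeps `x` out of
    -- `g₂`, the clean pair keeps it out of `B`, and the clean triple keeps it out of `C`.
    avoid-at : ∀ T → cyc₁ (ds T) ≡ 0 → cyc₂ (ds T) ≡ 0 → 3 ≤ length (ds T) → ∀ D₁ A D₂ g₁ g₂ x → ds T ≡ D₁ ++ A ∷ D₂ → front A ≡ g₁ ++ x ∷ g₂ → ∀ R → D₂ ++ D₁ ≡ R →
      mult x (take ℓ ((g₂ ++ concatMap front D₂) ++ (concatMap front D₁ ++ g₁))) ≡ 0 × ℓ ≤ length ((g₂ ++ concatMap front D₂) ++ (concatMap front D₁ ++ g₁))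
    avoid-at T clean₁ clean₂ len D₁ A D₂ g₁ g₂ x e₁ e₂ [] e₅ = ⊥-elim (<-irrefl (sym (trans (trans (cong length e₁) (↭-length (++-comm D₁ (A ∷ D₂)))) (cong (λ z → suc (length z)) e₅))) (≤-trans (s≤s (s≤s z≤n)) len))
    avoid-at T clean₁ clean₂ len D₁ A D₂ g₁ g₂ x e₁ e₂ (B ∷ []) e₅ = ⊥-elim (<-irrefl (sym (trans (trans (cong length e₁) (↭-length (++-comm D₁ (A ∷ D₂)))) (cong (λ z → suc (length z)) e₅))) len)
    avoid-at T clean₁ clean₂ len D₁ A D₂ g₁ g₂ x e₁ e₂ (B ∷ C ∷ rest) e₅ = short-case (sh B) refl
      where
      T₁ : Tour
      T₁ = proj₁ (rotate T D₁ (A ∷ D₂) e₁)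
      d₁ : ds T₁ ≡ (A ∷ D₂) ++ D₁
      d₁ = proj₂ (rotate T D₁ (A ∷ D₂) e₁)
      ds₁ : ds T₁ ≡ A ∷ B ∷ C ∷ rest
      ds₁ = trans d₁ (cong (A ∷_) e₅)
      len₂ : 2 ≤ length (D₁ ++ A ∷ D₂)
      len₂ = ≤-trans (≤-trans (s≤s (s≤s z≤n)) len) (≤-reflexive (cong length e₁))
      c₁ : cyc₁ (A ∷ B ∷ C ∷ rest) ≡ 0
      c₁ = trans (cong cyc₁ (sym (cong (A ∷_) e₅))) (trans (sym (cyc-rotate₁ D₁ (A ∷ D₂) len₂)) (trans (cong cyc₁ (sym e₁)) clean₁))
      c₂ : cyc₂ (A ∷ B ∷ C ∷ rest) ≡ 0
      c₂ = trans (cong cyc₂ (sym (cong (A ∷_) e₅))) (trans (sym (cyc-rotate₂ D₁ (A ∷ D₂) len₂)) (trans (cong cyc₂ (sym e₁)) clean₂))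
      AB : pairBad A B ≡ 0
      AB = m+n≡0⇒m≡0 _ (m+n≡0⇒m≡0 (f₁ A B C) c₁)
      BC : pairBad B C ≡ 0
      BC = m+n≡0⇒n≡0 (pairBad A B) (m+n≡0⇒m≡0 (f₁ A B C) c₁)
      ABC : f₂ A B C ≡ 0
      ABC = m+n≡0⇒m≡0 (f₂ A B C) c₂
      A-valid : Valid L A
      A-valid = All.head (subst (All (Valid L)) ds₁ (sound T₁))
      joint : tgt A ≡ src B
      joint with subst (λ z → Chain (base T₁) z (base T₁)) ds₁ (chain T₁)
      ... | link _ _ (link _ h _) = sym h
      x∈A : x ∈ front A
      x∈A = subst (x ∈_) (sym e₂) (∈-++⁺ʳ g₁ (here refl))
      x∉g₂ : mult x g₂ ≡ 0
      x∉g₂ = ≤0⇒≡0 (≤-pred (≤-trans (≤-trans (≤-reflexive (cong (_+ mult x g₂) (sym (eqV-refl x)))) (≤-trans (m≤n+m _ (mult x g₁)) (≤-reflexive (trans (sym (∑-++ (eqV x) g₁ (x ∷ g₂))) (cong (mult x) (sym e₂))))))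
        (≤-trans (mult-front≤ x A) (simple A-valid x))))
      x∉B : mult x (front B) ≡ 0
      x∉B = cong₂ _+_ (ind-no (x FinP.≟ src B) (λ q → front-≢tgt A-valid x∈A (trans q (sym joint))))
        (≤0⇒≡0 (≤-trans (≤-trans (m≤m+n _ _) (≤-reflexive (sym (∑-++ (eqV x) (int B) (tgt B ∷ []))))) (≤-reflexive (All.lookup (∑-zero⁻ (λ p → mult p (rear B)) (m+n≡0⇒n≡0 (sh A * sh B) AB)) x∈A))))
      shape : (g₂ ++ concatMap front D₂) ++ (concatMap front D₁ ++ g₁) ≡ g₂ ++ (front B ++ (front C ++ (concatMap front rest ++ g₁)))
      shape = trans (++-assoc g₂ (concatMap front D₂) (concatMap front D₁ ++ g₁)) (cong (g₂ ++_) (trans (sym (++-assoc (concatMap front D₂) (concatMap front D₁) g₁))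
        (trans (cong (_++ g₁) (trans (sym (concatMap-++' D₂ D₁)) (cong (concatMap front) e₅))) (trans (++-assoc (front B) (front C ++ concatMap front rest) g₁) (cong (front B ++_) (++-assoc (front C) (concatMap front rest) g₁))))))
      short-case : ∀ s → sh B ≡ s → mult x (take ℓ ((g₂ ++ concatMap front D₂) ++ (concatMap front D₁ ++ g₁))) ≡ 0 × ℓ ≤ length ((g₂ ++ concatMap front D₂) ++ (concatMap front D₁ ++ g₁))
      short-case zero sB = ≤0⇒≡0 (≤-trans (≤-reflexive (cong (λ z → mult x (take ℓ z)) shape'))
          (≤-trans (mult-take≤ x ℓ (g₂ ++ front B) (front C ++ (concatMap front rest ++ g₁)) long) (≤-reflexive (trans (∑-++ (eqV x) g₂ (front B)) (cong₂ _+_ x∉g₂ x∉B))))) ,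
        ≤-trans long (≤-trans (≤-trans (m≤m+n _ _) (≤-reflexive (sym (length-++ (g₂ ++ front B))))) (≤-reflexive (cong length (sym shape'))))
        where
        shape' = trans shape (sym (++-assoc g₂ (front B) (front C ++ (concatMap front rest ++ g₁))))
        long : ℓ ≤ length (g₂ ++ front B)
        long = ≤-trans (≤-trans (sh-long B sB) (m≤n+m _ (length g₂))) (≤-reflexive (sym (length-++ g₂)))
      short-case (suc s) sB = ≤0⇒≡0 (≤-trans (≤-reflexive (cong (λ z → mult x (take ℓ z)) shape'))
          (≤-trans (mult-take≤ x ℓ (g₂ ++ (front B ++ front C)) (concatMap front rest ++ g₁) long) (≤-reflexive (trans (∑-++ (eqV x) g₂ (front B ++ front C)) (cong₂ _+_ x∉g₂ (trans (∑-++ (eqV x) (front B) (front C)) (cong₂ _+_ x∉B x∉C))))))) ,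
        ≤-trans long (≤-trans (≤-trans (m≤m+n _ _) (≤-reflexive (sym (length-++ (g₂ ++ (front B ++ front C)))))) (≤-reflexive (cong length (sym shape'))))
        where
        shape' = trans shape (trans (cong (g₂ ++_) (sym (++-assoc (front B) (front C) (concatMap front rest ++ g₁)))) (sym (++-assoc g₂ (front B ++ front C) (concatMap front rest ++ g₁))))
        short-B : NonZero (sh B)
        short-B = >-nonZero (≤-trans (s≤s z≤n) (≤-reflexive (sym sB)))
        sC : sh C ≡ 0
        sC = m*n≡0⇒m≡0 (sh C) (sh B) {{short-B}} (trans (*-comm (sh C) (sh B)) (m+n≡0⇒m≡0 (sh B * sh C) BC))
        disjoint : inter (verts A) (verts C) ≡ 0
        disjoint = m*n≡0⇒m≡0 (inter (verts A) (verts C)) (sh B) {{short-B}} (trans (*-comm (inter (verts A) (verts C)) (sh B)) ABC)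
        x∉C : mult x (front C) ≡ 0
        x∉C = ≤0⇒≡0 (≤-trans (mult-front≤ x C) (≤-reflexive (All.lookup (∑-zero⁻ (λ p → mult p (verts C)) disjoint) (∈-++⁺ˡ x∈A))))
        long : ℓ ≤ length (g₂ ++ (front B ++ front C))
        long = ≤-trans (≤-trans (sh-long C sC) (≤-trans (≤-trans (m≤n+m _ (length (front B))) (≤-reflexive (sym (length-++ (front B))))) (m≤n+m _ (length g₂)))) (≤-reflexive (sym (length-++ g₂)))

  walk-avoids : ∀ T → cyc₁ (ds T) ≡ 0 → cyc₂ (ds T) ≡ 0 → 3 ≤ length (ds T) →
    ∀ us {x vs} → walkOf T ≡ us ++ x ∷ vs → mult x (take ℓ (vs ++ us)) ≡ 0 × ℓ ≤ length (vs ++ us)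
  walk-avoids T clean₁ clean₂ len us {x} {vs} h with locate (ds T) us h
  ... | D₁ , A , D₂ , g₁ , g₂ , e₁ , e₂ , refl , refl = avoid-at T clean₁ clean₂ len D₁ A D₂ g₁ g₂ x e₁ e₂ (D₂ ++ D₁) refl

  walk-head : ∀ T → 3 ≤ length (ds T) → ∃ λ ws → walkOf T ≡ base T ∷ ws
  walk-head T len with ds T | chain T
  walk-head T ()  | []     | _
  walk-head T len | e ∷ es | link _ h _ = _ , cong (_∷ (int e ++ concatMap front es)) h

-- Closed walks as tours

module ClosedWalk {n : ℕ} (G : Graph n) (ℓ : ℕ) (w₀ : Fin n) (ws : List (Fin n)) where

  private
    W : List (Fin n)
    W = w₀ ∷ ws

    k : ℕ
    k = length ws

    v : Fin (suc k) → Fin n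
    v = lookup W

    at : List (Fin n) → ℕ → Fin n
    at []       _       = w₀
    at (x ∷ xs) zero    = x
    at (x ∷ xs) (suc j) = at xs j

    lookup-at : ∀ xs (i : Fin (length xs)) → lookup xs i ≡ at xs (toℕ i)
    lookup-at (x ∷ xs) zero    = refl
    lookup-at (x ∷ xs) (suc i) = lookup-at xs i

    vtx-at : ∀ j → vtx G v j ≡ at W (j % suc k)
    vtx-at j = trans (lookup-at W (pos k j)) (cong (at W) (FinP.toℕ-fromℕ< (m%n<n j (suc k))))

    vtx-small : ∀ j → j < suc k → vtx G v j ≡ at W j
    vtx-small j lt = trans (vtx-at j) (cong (at W) (m<n⇒m%n≡m lt))

    seq : (ℕ → Fin n) → ℕ → List (Fin n)
    seq u zero    = []
    seq u (suc N) = u 0 ∷ seq (u ∘ suc) N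

    seq-snoc : ∀ u N → seq u (suc N) ≡ seq u N ++ u N ∷ []
    seq-snoc u zero    = refl
    seq-snoc u (suc N) = cong (u 0 ∷_) (seq-snoc (u ∘ suc) N)

    seq-at : ∀ xs u → (∀ j → j < length xs → u j ≡ at xs j) → seq u (length xs) ≡ xs
    seq-at []       u h = refl
    seq-at (x ∷ xs) u h = cong₂ _∷_ (h 0 (s≤s z≤n)) (seq-at xs (u ∘ suc) (λ j lt → h (suc j) (s≤s lt)))

    occ-seq : ∀ a b u N → occ a b (seq u (suc N)) ≡ ∑ (λ i → stepWeight a b (u (toℕ i)) (u (suc (toℕ i)))) (allFin N)
    occ-seq a b u zero    = refl
    occ-seq a b u (suc N) = trans (cong (stepWeight a b (u 0) (u 1) +_) (occ-seq a b (u ∘ suc) N))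
      (sym (∑-allFin-suc {N} (λ i → stepWeight a b (u (toℕ i)) (u (suc (toℕ i))))))

    steps : Fin n → Fin n → Fin (suc k) → ℕ
    steps a b i = stepWeight a b (vtx G v (toℕ i)) (vtx G v (suc (toℕ i)))

    ∑-steps : ∀ a b → ∑ (steps a b) (allFin (suc k)) ≡ occ a b (W ++ w₀ ∷ [])
    ∑-steps a b = trans (sym (occ-seq a b (vtx G v) (suc k))) (cong (occ a b) (trans (seq-snoc (vtx G v) (suc k))
      (cong₂ (λ xs y → xs ++ y ∷ []) (seq-at W (vtx G v) vtx-small) (trans (vtx-at (suc k)) (cong (at W) (n%n≡0 (suc k)))))))

    two-points : ∀ {m} (f : Fin m → ℕ) i j → i ≢ j → 1 ≤ f i → 1 ≤ f j → 2 ≤ ∑ f (allFin m)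
    two-points {m} f i j i≢j fi fj = begin
      2                                                          ≡⟨ cong₂ _+_ (sym (∑-eq-Fin i)) (sym (∑-eq-Fin j)) ⟩
      ∑ (λ p → eqV p i) (allFin m) + ∑ (λ p → eqV p j) (allFin m) ≡⟨ sym (∑-+ (λ p → eqV p i) (λ p → eqV p j) (allFin m)) ⟩
      ∑ (λ p → eqV p i + eqV p j) (allFin m)                     ≤⟨ ∑-mono le (allFin m) ⟩
      ∑ f (allFin m)                                             ∎
      where
      open ≤-Reasoning
      le : ∀ p → eqV p i + eqV p j ≤ f p
      le p with p FinP.≟ i | p FinP.≟ j
      ... | yes refl | yes e    = ⊥-elim (i≢j e)
      ... | yes refl | no _     = fi
      ... | no _     | yes refl = fj
      ... | no _     | no _     = z≤n

    edge⇒step : ∀ a b i → EdgeIs G v i a b → 1 ≤ steps a b i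
    edge⇒step a b i (inj₁ (p , q)) rewrite p | q | eqV-refl a | eqV-refl b = s≤s z≤n
    edge⇒step a b i (inj₂ (p , q)) rewrite p | q | eqV-refl a | eqV-refl b = m≤n+m 1 _

    step⇒edge : ∀ a b i → 0 < steps a b i → EdgeIs G v i a b
    step⇒edge a b i pos with +-pos (eqV a (vtx G v (toℕ i)) * eqV b (vtx G v (suc (toℕ i)))) _ pos
    ... | inj₁ h with *-pos (eqV a (vtx G v (toℕ i))) _ h
    ...   | p , q = inj₁ (sym (ind-pos (a FinP.≟ _) p) , sym (ind-pos (b FinP.≟ _) q))
    step⇒edge a b i pos | inj₂ h with *-pos (eqV a (vtx G v (suc (toℕ i)))) _ h
    ...   | p , q = inj₂ (sym (ind-pos (b FinP.≟ _) q) , sym (ind-pos (a FinP.≟ _) p))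

    splitAt' : ∀ (xs : List (Fin n)) j → j < length xs → ∃ λ us → ∃ λ x → ∃ λ vs → xs ≡ us ++ x ∷ vs × length us ≡ j
    splitAt' (x ∷ xs) zero    _       = [] , x , xs , refl , refl
    splitAt' (x ∷ xs) (suc j) (s≤s h) with splitAt' xs j h
    ... | us , y , vs , e , l = x ∷ us , y , vs , cong (x ∷_) e , cong suc l

    at-++ʳ : ∀ us vs j → at (us ++ vs) (length us + j) ≡ at vs j
    at-++ʳ []       vs j = refl
    at-++ʳ (u ∷ us) vs j = at-++ʳ us vs j

    at-++ˡ : ∀ us vs j → j < length us → at (us ++ vs) j ≡ at us j
    at-++ˡ (u ∷ us) vs zero    _       = refl
    at-++ˡ (u ∷ us) vs (suc j) (s≤s h) = at-++ˡ us vs j h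

    at-take : ∀ xs j m → j < m → j < length xs → at xs j ∈ take m xs
    at-take (x ∷ xs) zero    (suc m) _       _       = here refl
    at-take (x ∷ xs) (suc j) (suc m) (s≤s h) (s≤s l) = there (at-take xs j m h l)

  -- The hypothesis `avoids` concerns the cyclic successors of every position. Its length bound
  -- ensures that the next `ℓ` positions do not run once around the tour.
  module _ (steps≡ : ∀ x y → occ x y (W ++ w₀ ∷ []) ≡ bit (Graph.adj G x y))
           (avoids : ∀ us {x vs} → W ≡ us ++ x ∷ vs → mult x (take ℓ (vs ++ us)) ≡ 0 × ℓ ≤ length (vs ++ us)) where

    private
      bit-true : ∀ {b} → 1 ≤ bit b → b ≡ true
      bit-true {true} _ = refl

      isTour : IsEulerianTour G v
      isTour = consecutive , covered , once
        where
        consecutive : ∀ i → Adj G (vtx G v (toℕ i)) (vtx G v (suc (toℕ i)))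
        consecutive i = bit-true (≤-trans (edge⇒step x y i (inj₁ (refl , refl))) (≤-trans (∑-∈ (steps x y) (∈-allFin i)) (≤-reflexive (trans (∑-steps x y) (steps≡ x y)))))
          where
          x = vtx G v (toℕ i)
          y = vtx G v (suc (toℕ i))
        covered : ∀ a b → Adj G a b → ∃ λ i → EdgeIs G v i a b
        covered a b h with ∑-pos-find (steps a b) (allFin (suc k)) (≤-reflexive (sym (trans (∑-steps a b) (trans (steps≡ a b) (cong bit h)))))
        ... | i , _ , q = i , step⇒edge a b i q
        -- Two steps along the same edge would make its count in `occ` at least 2, but the count is
        -- a bit.
        once : ∀ a b i j → EdgeIs G v i a b → EdgeIs G v j a b → i ≡ j
        once a b i j p q with i FinP.≟ j
        ... | yes e = e
        ... | no ne = ⊥-elim (<-irrefl refl (≤-trans (two-points (steps a b) i j ne (edge⇒step a b i p) (edge⇒step a b j q)) (≤-trans (≤-reflexive (trans (∑-steps a b) (steps≡ a b))) (bit≤1 _))))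

      -- The `τ`-th successor of `x` lies in `vs` or, once `vs` is exhausted, in `us`, after a
      -- single reduction modulo the length.
      next : ∀ us x vs τ → W ≡ us ++ x ∷ vs → τ < length (vs ++ us) → at W ((length us + suc τ) % suc k) ≡ at (vs ++ us) τ
      next us x vs τ eq lt with τ <? length vs
      ... | yes τ<vs = trans (cong (at W) (m<n⇒m%n≡m small)) (trans (cong (λ z → at z (length us + suc τ)) eq) (trans (at-++ʳ us (x ∷ vs) (suc τ)) (sym (at-++ˡ vs us τ τ<vs))))
        where
        small : length us + suc τ < suc k
        small = ≤-trans (≤-reflexive (sym (+-suc (length us) (suc τ)))) (≤-trans (+-monoʳ-≤ (length us) (s≤s τ<vs)) (≤-reflexive (trans (sym (length-++ us)) (cong length (sym eq)))))
      ... | no τ≥vs = trans (cong (λ z → at W (z % suc k)) wrap) (trans (cong (at W) (trans ([m+n]%n≡m%n e (suc k)) (m<n⇒m%n≡m (≤-trans e<us us≤)))) (trans (cong (λ z → at z e) eq) (trans (at-++ˡ us (x ∷ vs) e e<us)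
                    (trans (sym (at-++ʳ vs us e)) (cong (at (vs ++ us)) vs+e)))))
        where
        e = τ ∸ length vs
        vs+e : length vs + e ≡ τ
        vs+e = m+[n∸m]≡n (≮⇒≥ τ≥vs)
        e<us : e < length us
        e<us = +-cancelˡ-< (length vs) e (length us) (≤-trans (≤-reflexive (cong suc vs+e)) (≤-trans lt (≤-reflexive (length-++ vs))))
        lenW : suc k ≡ length us + suc (length vs)
        lenW = trans (cong length eq) (length-++ us)
        us≤ : length us ≤ suc k
        us≤ = ≤-trans (m≤m+n _ _) (≤-reflexive (sym lenW))
        wrap : length us + suc τ ≡ e + suc k
        wrap = trans (cong (λ z → length us + suc z) (sym vs+e)) (trans (l (length us) (length vs) e) (cong (e +_) (sym lenW)))
          where
          l : ∀ a b c → a + suc (b + c) ≡ c + (a + suc b)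
          l = solve-∀

      no-return : ∀ i τ → τ < ℓ → vtx G v i ≢ vtx G v (i + suc τ)
      no-return i τ τ<ℓ h with splitAt' W (i % suc k) (m%n<n i (suc k))
      ... | us , x , vs , eq , len = <-irrefl (sym (proj₁ (avoids us eq))) (mult-∈ {xs = take ℓ (vs ++ us)} (subst (_∈ take ℓ (vs ++ us)) (sym x≡) (at-take (vs ++ us) τ ℓ τ<ℓ τ<)))
        where
        τ< : τ < length (vs ++ us)
        τ< = ≤-trans τ<ℓ (proj₂ (avoids us eq))
        total : suc (length (vs ++ us)) ≡ suc k
        total = trans (cong suc (length-++ vs)) (trans (+-comm (suc (length vs)) (length us)) (trans (sym (length-++ us)) (cong length (sym eq))))
        here≡ : vtx G v i ≡ x
        here≡ = trans (vtx-at i) (trans (cong (at W) (trans (sym len) (sym (+-identityʳ (length us))))) (trans (cong (λ z → at z (length us + 0)) eq) (at-++ʳ us (x ∷ vs) 0)))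
        there≡ : vtx G v (i + suc τ) ≡ at (vs ++ us) τ
        there≡ = trans (vtx-at (i + suc τ)) (trans (cong (at W) (trans (%-distribˡ-+ i (suc τ) (suc k)) (cong₂ (λ a b → (a + b) % suc k) (sym len) (m<n⇒m%n≡m (≤-trans (s≤s τ<) (≤-reflexive total)))))) (next us x vs τ eq τ<))
        x≡ : x ≡ at (vs ++ us) τ
        x≡ = trans (sym here≡) (trans h there≡)

      forward : ∀ i s t → s < t → t ≤ ℓ → vtx G v (i + s) ≢ vtx G v (i + t)
      forward i s t s<t t≤ℓ h = no-return (i + s) (t ∸ suc s) (≤-trans (≤-trans (s≤s (m≤n+m (t ∸ suc s) s)) (≤-reflexive (m+[n∸m]≡n s<t))) t≤ℓ) (trans h (cong (vtx G v) (sym assoc)))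
        where
        assoc : i + s + suc (t ∸ suc s) ≡ i + t
        assoc = trans (+-assoc i s _) (cong (i +_) (trans (+-suc s (t ∸ suc s)) (m+[n∸m]≡n s<t)))

      avoiding : SelfAvoiding G v ℓ
      avoiding i len len≤ s t s≤ t≤ h with <-cmp s t
      ... | tri< lt _ _ = ⊥-elim (forward i s t lt (≤-trans t≤ len≤) h)
      ... | tri≈ _ e _  = e
      ... | tri> _ _ gt = ⊥-elim (forward i t s gt (≤-trans s≤ len≤) (sym h))

    hasTour : HasSelfAvoidingEulerianTour G ℓ
    hasTour = inj₂ (k , v , isTour , avoiding)

-- The initial path graph

sumTo : (ℕ → ℕ) → ℕ → ℕ
sumTo f zero    = 0
sumTo f (suc d) = f 0 + sumTo (f ∘ suc) d

private
  sumTo-+ : ∀ f a b → sumTo f (a + b) ≡ sumTo f a + sumTo (λ k → f (a + k)) b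
  sumTo-+ f zero    b = refl
  sumTo-+ f (suc a) b = trans (cong (f 0 +_) (sumTo-+ (f ∘ suc) a b)) (sym (+-assoc (f 0) _ _))

  sumTo-cong : ∀ {f g} d → (∀ k → k < d → f k ≡ g k) → sumTo f d ≡ sumTo g d
  sumTo-cong zero    h = refl
  sumTo-cong (suc d) h = cong₂ _+_ (h 0 (s≤s z≤n)) (sumTo-cong d (λ k lt → h (suc k) (s≤s lt)))

  sumTo-const : ∀ c d → sumTo (λ _ → c) d ≡ d * c
  sumTo-const c zero    = refl
  sumTo-const c (suc d) = cong (c +_) (sumTo-const c d)

-- Blocks of `s` are cut off while more than `2 * s` indices remain, so what is left at the end is
-- still at least `s`.
grouping : ∀ s d → 1 ≤ s → s ≤ d → Σ (ℕ → ℕ) λ φ → ∀ i →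
  sumTo (λ k → ind (i ≟ φ k)) d ≤ 2 * s × (0 < sumTo (λ k → ind (i ≟ φ k)) d → s ≤ sumTo (λ k → ind (i ≟ φ k)) d)
grouping s d s≥1 = go d d ≤-refl
  where
  go : ∀ N d → d ≤ N → s ≤ d → Σ (ℕ → ℕ) λ φ → ∀ i →
    sumTo (λ k → ind (i ≟ φ k)) d ≤ 2 * s × (0 < sumTo (λ k → ind (i ≟ φ k)) d → s ≤ sumTo (λ k → ind (i ≟ φ k)) d)
  go zero d d≤ s≤d = ⊥-elim (<-irrefl refl (≤-trans s≥1 (≤-trans s≤d d≤)))
  go (suc N) d d≤N s≤d with d ≤? 2 * s
  ... | yes d≤ = (λ _ → 0) , λ i → subst (λ z → z ≤ 2 * s × (0 < z → s ≤ z)) (sym (sumTo-const (ind (i ≟ 0)) d)) (whole (i ≟ 0))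
    where
    whole : ∀ {P : Set} (p : Dec P) → d * ind p ≤ 2 * s × (0 < d * ind p → s ≤ d * ind p)
    whole (yes _) = subst (λ z → z ≤ 2 * s × (0 < z → s ≤ z)) (sym (*-identityʳ d)) (d≤ , λ _ → s≤d)
    whole (no _)  = subst (λ z → z ≤ 2 * s × (0 < z → s ≤ z)) (sym (*-zeroʳ d)) (z≤n , λ ())
  ... | no d≰ = φ , λ i → subst (λ z → z ≤ 2 * s × (0 < z → s ≤ z)) (sym (total i)) (result i)
    where
    d' = d ∸ s
    d≡ : s + d' ≡ d
    d≡ = m+[n∸m]≡n s≤d
    s≤d' : s ≤ d'
    s≤d' = +-cancelˡ-≤ s s d' (≤-trans (≤-reflexive (cong (s +_) (sym (+-identityʳ s)))) (≤-trans (<⇒≤ (≰⇒> d≰)) (≤-reflexive (sym d≡))))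
    rec = go N d' (≤-pred (≤-trans (+-monoˡ-≤ d' s≥1) (≤-trans (≤-reflexive d≡) d≤N))) s≤d'
    φ' = proj₁ rec
    φ : ℕ → ℕ
    φ k with k <? s
    ... | yes _ = 0
    ... | no _  = suc (φ' (k ∸ s))
    φ-low : ∀ k → k < s → φ k ≡ 0
    φ-low k lt with k <? s
    ... | yes _ = refl
    ... | no ¬p = ⊥-elim (¬p lt)
    φ-high : ∀ k → φ (s + k) ≡ suc (φ' k)
    φ-high k with s + k <? s
    ... | yes p = ⊥-elim (<-irrefl refl (≤-trans p (m≤m+n s k)))
    ... | no _  = cong (λ z → suc (φ' z)) (m+n∸m≡n s k)
    total : ∀ i → sumTo (λ k → ind (i ≟ φ k)) d ≡ s * ind (i ≟ 0) + sumTo (λ k → ind (i ≟ suc (φ' k))) d'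
    total i = trans (cong (sumTo (λ k → ind (i ≟ φ k))) (sym d≡)) (trans (sumTo-+ (λ k → ind (i ≟ φ k)) s d')
      (cong₂ _+_ (trans (sumTo-cong s (λ k lt → cong (λ z → ind (i ≟ z)) (φ-low k lt))) (sumTo-const (ind (i ≟ 0)) s)) (sumTo-cong d' (λ k _ → cong (λ z → ind (i ≟ z)) (φ-high k)))))
    result : ∀ i → s * ind (i ≟ 0) + sumTo (λ k → ind (i ≟ suc (φ' k))) d' ≤ 2 * s × (0 < s * ind (i ≟ 0) + sumTo (λ k → ind (i ≟ suc (φ' k))) d' → s ≤ s * ind (i ≟ 0) + sumTo (λ k → ind (i ≟ suc (φ' k))) d')
    result zero = subst (λ z → z ≤ 2 * s × (0 < z → s ≤ z)) (sym (trans (cong₂ _+_ (*-identityʳ s) (trans (sumTo-const 0 d') (*-zeroʳ d'))) (+-identityʳ s))) (m≤m+n s _ , λ _ → ≤-refl)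
    result (suc i) = subst (λ z → z ≤ 2 * s × (0 < z → s ≤ z))
      (sym (trans (cong (_+ sumTo (λ k → ind (suc i ≟ suc (φ' k))) d') (*-zeroʳ s)) (sumTo-cong d' (λ k _ → ind-cong (suc i ≟ suc (φ' k)) (i ≟ φ' k) suc-injective (cong suc))))) (proj₂ rec i)

private
  rank : ∀ {n} → (Fin n → Bool) → Fin n → ℕ
  rank P zero    = 0
  rank P (suc v) = bit (P zero) + rank (P ∘ suc) v

  -- Ranks number the neighbours of a vertex without gaps, so a grouping of an initial segment of
  -- the numbers becomes a grouping of the edges at the vertex.
  ∑-rank : ∀ {n} (P : Fin n → Bool) (f : ℕ → ℕ) → ∑ (λ v → bit (P v) * f (rank P v)) (allFin n) ≡ sumTo f (∑ (bit ∘ P) (allFin n))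
  ∑-rank {zero}  P f = refl
  ∑-rank {suc n} P f = trans (∑-allFin-suc {n} (λ v → bit (P v) * f (rank P v))) (trans (split (P zero)) (cong (sumTo f) (sym (∑-allFin-suc {n} (bit ∘ P)))))
    where
    split : ∀ b → bit b * f 0 + ∑ (λ v → bit (P (suc v)) * f (bit b + rank (P ∘ suc) v)) (allFin n) ≡ sumTo f (bit b + ∑ (bit ∘ P ∘ suc) (allFin n))
    split true  = cong₂ _+_ (+-identityʳ (f 0)) (∑-rank (P ∘ suc) (f ∘ suc))
    split false = ∑-rank (P ∘ suc) f

module Initial {n : ℕ} (G : Graph n) (connected : Connected G) (evenDeg : ∀ v → 2 ∣ degree G v)
  (s : ℕ) (s≥1 : 1 ≤ s) (minDeg : ∀ v → s ≤ degree G v) where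
  open Graph G using (adj; irrefl) renaming (sym to adj-sym)

  private
    V : List (Fin n)
    V = allFin n

    a : Fin n → Fin n → ℕ
    a x y = bit (adj x y)

    deg≡ : ∀ v → degree G v ≡ ∑ (a v) V
    deg≡ v = go V
      where
      go : ∀ xs → length (filterᵇ (adj v) xs) ≡ ∑ (a v) xs
      go [] = refl
      go (x ∷ xs) with adj v x
      ... | true  = cong suc (go xs)
      ... | false = go xs

    φ : Fin n → ℕ → ℕ
    φ u = proj₁ (grouping s (degree G u) s≥1 (minDeg u))

    g : Fin n → Fin n → ℕ
    g u v = φ u (rank (adj u) v)

  Λ₀ : Labels n
  Λ₀ = record { Lab = Fin n × ℕ ; _≟L_ = ProdP.≡-dec FinP._≟_ _≟_ ; vOf = proj₁ ; lev = λ _ → 0 }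

  open PathGraph Λ₀

  private
    edge : Fin n → Fin n → Edge
    edge x y = mkEdge (x , g x y) [] (y , g y x)

    cell : Fin n → Fin n → List Edge
    cell x y with toℕ x <? toℕ y | adj x y
    ... | yes _ | true  = edge x y ∷ []
    ... | yes _ | false = []
    ... | no _  | _     = []

    lt : Fin n → Fin n → ℕ
    lt x y = ind (toℕ x <? toℕ y)

    ∑-cell : ∀ w x y → ∑ w (cell x y) ≡ lt x y * (a x y * w (edge x y))
    ∑-cell w x y with toℕ x <? toℕ y | adj x y
    ... | yes _ | true  = l (w (edge x y))
      where
      l : ∀ z → z + 0 ≡ 1 * (1 * z)
      l = solve-∀
    ... | yes _ | false = refl
    ... | no _  | _     = refl

  H₀ : List Edge
  H₀ = concatMap (λ x → concatMap (cell x) V) V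

  private
    ∑-H₀ : ∀ w → ∑ w H₀ ≡ ∑ (λ x → ∑ (λ y → lt x y * (a x y * w (edge x y))) V) V
    ∑-H₀ w = trans (∑-concatMap w (λ x → concatMap (cell x) V) V) (∑-cong (λ x → trans (∑-concatMap w (cell x) V) (∑-cong (∑-cell w x) V)) V)

    trichotomy : ∀ x y z → lt x y * (a x y * z) + lt y x * (a y x * z) ≡ a x y * z
    trichotomy x y z with <-cmp (toℕ x) (toℕ y)
    ... | tri< p _ q rewrite ind-yes (toℕ x <? toℕ y) p | ind-no (toℕ y <? toℕ x) q = l (a x y * z)
      where
      l : ∀ z → 1 * z + 0 ≡ z
      l = solve-∀
    ... | tri> p _ q rewrite ind-no (toℕ x <? toℕ y) p | ind-yes (toℕ y <? toℕ x) q | adj-sym y x = +-identityʳ _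
    ... | tri≈ p e q with FinP.toℕ-injective e
    ...   | refl rewrite irrefl x = trans (cong₂ _+_ (*-zeroʳ (lt x x)) (*-zeroʳ (lt x x))) refl

    -- An edge sits only in the cell with `x` below `y`, so that it is listed once. A weight of the
    -- form `F x y + F y x` gives one share to each ordered pair, which turns sums over edges into
    -- sums over edge ends.
    symmetrise : ∀ w (F : Fin n → Fin n → ℕ) → (∀ x y → w (edge x y) ≡ F x y + F y x) → ∑ w H₀ ≡ ∑ (λ x → ∑ (λ y → a x y * F x y) V) V
    symmetrise w F h = begin
      ∑ w H₀                                                                   ≡⟨ ∑-H₀ w ⟩
      ∑ (λ x → ∑ (λ y → lt x y * (a x y * w (edge x y))) V) V                  ≡⟨ ∑-cong (λ x → trans (∑-cong (λ y → trans (cong (λ z → lt x y * (a x y * z)) (h x y)) (l (lt x y) (a x y) (F x y) (F y x))) V) (∑-+ _ _ V)) V ⟩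
      ∑ (λ x → ∑ (λ y → P x y) V + ∑ (λ y → lt x y * (a x y * F y x)) V) V     ≡⟨ ∑-+ _ _ V ⟩
      ∑ (λ x → ∑ (λ y → P x y) V) V + ∑ (λ x → ∑ (λ y → lt x y * (a x y * F y x)) V) V ≡⟨ cong (∑ (λ x → ∑ (P x) V) V +_) (∑-swap _ V V) ⟩
      ∑ (λ x → ∑ (P x) V) V + ∑ (λ x → ∑ (λ y → lt y x * (a y x * F x y)) V) V ≡⟨ sym (∑-+ _ _ V) ⟩
      ∑ (λ x → ∑ (P x) V + ∑ (λ y → lt y x * (a y x * F x y)) V) V             ≡⟨ ∑-cong (λ x → trans (sym (∑-+ _ _ V)) (∑-cong (λ y → trichotomy x y (F x y)) V)) V ⟩
      ∑ (λ x → ∑ (λ y → a x y * F x y) V) V                                    ∎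
      where
      open ≡-Reasoning
      P : Fin n → Fin n → ℕ
      P x y = lt x y * (a x y * F x y)
      l : ∀ t b c d → t * (b * (c + d)) ≡ t * (b * c) + t * (b * d)
      l = solve-∀

    eqL-pair : ∀ u i x k → eqL (u , i) (x , k) ≡ eqV x u * ind (i ≟ k)
    eqL-pair u i x k with x FinP.≟ u | i ≟ k
    ... | yes refl | yes refl = eqL-refl (x , i)
    ... | yes refl | no ne    = ind-no (ProdP.≡-dec FinP._≟_ _≟_ (u , i) (x , k)) (λ { refl → ne refl })
    ... | no ne    | _        = ind-no (ProdP.≡-dec FinP._≟_ _≟_ (u , i) (x , k)) (λ { refl → ne refl })

    at-vertex : ∀ u (K : Fin n → Fin n → ℕ) → ∑ (λ x → ∑ (λ y → a x y * (eqV x u * K x y)) V) V ≡ ∑ (λ y → a u y * K u y) V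
    at-vertex u K = trans (∑-cong (λ x → trans (∑-cong (λ y → l (a x y) (eqV x u) (K x y)) V) (∑-*ˡ (eqV x u) _ V)) V) (∑-point (λ x → ∑ (λ y → a x y * K x y) V) u)
      where
      l : ∀ b c d → b * (c * d) ≡ c * (b * d)
      l = solve-∀

    group-size : ∀ u i → ∑ (endL (u , i)) H₀ ≡ sumTo (λ k → ind (i ≟ φ u k)) (degree G u)
    group-size u i = begin
      ∑ (endL (u , i)) H₀                                             ≡⟨ symmetrise (endL (u , i)) (λ x y → eqL (u , i) (x , g x y)) (λ x y → refl) ⟩
      ∑ (λ x → ∑ (λ y → a x y * eqL (u , i) (x , g x y)) V) V         ≡⟨ ∑-cong (λ x → ∑-cong (λ y → cong (a x y *_) (eqL-pair u i x (g x y))) V) V ⟩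
      ∑ (λ x → ∑ (λ y → a x y * (eqV x u * ind (i ≟ g x y))) V) V     ≡⟨ at-vertex u (λ x y → ind (i ≟ g x y)) ⟩
      ∑ (λ y → a u y * ind (i ≟ φ u (rank (adj u) y))) V              ≡⟨ ∑-rank (adj u) (λ k → ind (i ≟ φ u k)) ⟩
      sumTo (λ k → ind (i ≟ φ u k)) (∑ (a u) V)                       ≡⟨ cong (sumTo (λ k → ind (i ≟ φ u k))) (sym (deg≡ u)) ⟩
      sumTo (λ k → ind (i ≟ φ u k)) (degree G u)                      ∎
      where open ≡-Reasoning

    valid₀ : All (Valid 0) H₀
    valid₀ = AllP.concat⁺ (AllP.map⁺ (All.tabulate {xs = V} (λ {x} _ → AllP.concat⁺ (AllP.map⁺ (All.tabulate {xs = V} (λ {y} _ → cell-valid x y))))))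
      where
      edge-valid : ∀ x y → toℕ x < toℕ y → Valid 0 (edge x y)
      edge-valid x y x<y = record { simple = sim ; sameLevel = refl ; levelLow = z≤n ; short = z≤n }
        where
        sim : ∀ p → eqV p x + (eqV p y + 0) ≤ 1
        sim p with p FinP.≟ x | p FinP.≟ y
        ... | yes refl | yes refl = ⊥-elim (<-irrefl refl x<y)
        ... | yes _    | no _     = ≤-refl
        ... | no _     | yes _    = ≤-refl
        ... | no _     | no _     = z≤n
      cell-valid : ∀ x y → All (Valid 0) (cell x y)
      cell-valid x y with toℕ x <? toℕ y | adj x y
      ... | yes p | true  = edge-valid x y p ∷ []
      ... | yes _ | false = []
      ... | no _  | _     = []

    joined₀ : Joined src tgt H₀
    joined₀ R closed = λ x y → along (connected x y)
      where
      differ : Edge → ℕ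
      differ e = (bit (R (src e)) ∸ bit (R (tgt e))) + (bit (R (tgt e)) ∸ bit (R (src e)))
      zero₀ : ∑ (λ x → ∑ (λ y → a x y * (bit (R x) ∸ bit (R y))) V) V ≡ 0
      zero₀ = trans (sym (symmetrise differ (λ x y → bit (R x) ∸ bit (R y)) (λ x y → refl)))
        (∑-zero-All (All.map (λ {e} h → trans (cong (λ z → (bit z ∸ bit (R (tgt e))) + (bit (R (tgt e)) ∸ bit z)) h) (cong₂ _+_ (n∸n≡0 (bit (R (tgt e)))) (n∸n≡0 (bit (R (tgt e)))))) closed))
      le : ∀ x y → adj x y ≡ true → bit (R x) ≤ bit (R y)
      le x y h = m∸n≡0⇒m≤n (trans (sym (+-identityʳ _)) (trans (cong (λ z → bit z * (bit (R x) ∸ bit (R y))) (sym h))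
        (All.lookup (∑-zero⁻ (λ y → a x y * (bit (R x) ∸ bit (R y))) (All.lookup (∑-zero⁻ (λ x → ∑ (λ y → a x y * (bit (R x) ∸ bit (R y))) V) zero₀) (∈-allFin x))) (∈-allFin y))))
      along : ∀ {x y} → Reach G x y → R x ≡ R y
      along here = refl
      along (step {x} {z} h r) = trans (bit-injective (≤-antisym (le x z h) (le z x (trans (adj-sym z x) h)))) (along r)

    covers₀ : ∀ x y → ∑ (λ e → occ x y (verts e)) H₀ ≡ a x y
    covers₀ p q = trans (symmetrise (λ e → occ p q (verts e)) (λ x y → eqV p x * eqV q y) (λ x y → +-identityʳ _))
      (trans (∑-cong (λ x → ∑-cong (λ y → trans (cong (λ z → a x y * (z * eqV q y)) (eqV-sym p x)) refl) V) V)
        (trans (at-vertex p (λ x y → eqV q y)) (trans (∑-cong (λ y → trans (*-comm (a p y) (eqV q y)) (cong (_* a p y) (eqV-sym q y))) V) (∑-point (a p) q))))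

    ends₀ : ∀ y → ∑ (endV y) H₀ ≡ degree G y
    ends₀ u = trans (symmetrise (endV u) (λ x y → eqV u x) (λ x y → refl))
      (trans (∑-cong (λ x → ∑-cong (λ y → cong (a x y *_) (trans (eqV-sym u x) (sym (*-identityʳ (eqV x u))))) V) V)
        (trans (at-vertex u (λ _ _ → 1)) (trans (∑-cong (λ y → *-identityʳ _) V) (sym (deg≡ u)))))

    -- Among the edges at `u` only the one leading to `p` meets `p`.
    conflict₀ : ∀ l p → p ≢ vOf l → ∑ (λ e → endL l e * mult p (verts e)) H₀ ≤ 1
    conflict₀ (u , i) p p≢u = begin
      ∑ (λ e → endL (u , i) e * mult p (verts e)) H₀ ≡⟨ symmetrise _ F (λ x y → k (eqL (u , i) (x , g x y)) (eqL (u , i) (y , g y x)) (eqV p x) (eqV p y)) ⟩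
      ∑ (λ x → ∑ (λ y → a x y * F x y) V) V ≡⟨ ∑-cong (λ x → ∑-cong (λ y → cong (a x y *_) (trans (cong (_* (eqV p x + eqV p y)) (eqL-pair u i x (g x y))) (*-assoc (eqV x u) _ _))) V) V ⟩
      ∑ (λ x → ∑ (λ y → a x y * (eqV x u * (ind (i ≟ g x y) * (eqV p x + eqV p y)))) V) V ≡⟨ at-vertex u (λ x y → ind (i ≟ g x y) * (eqV p x + eqV p y)) ⟩
      ∑ (λ y → a u y * (ind (i ≟ g u y) * (eqV p u + eqV p y))) V ≤⟨ ∑-mono le V ⟩
      ∑ (λ y → eqV y p) V ≡⟨ ∑-eq-Fin p ⟩
      1 ∎
      where
      open ≤-Reasoning
      F : Fin n → Fin n → ℕ
      F x y = eqL (u , i) (x , g x y) * (eqV p x + eqV p y)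
      k : ∀ c d e f → (c + d) * (e + (f + 0)) ≡ c * (e + f) + d * (f + e)
      k = solve-∀
      le : ∀ y → a u y * (ind (i ≟ g u y) * (eqV p u + eqV p y)) ≤ eqV y p
      le y = ≤-trans (*-mono-≤ (bit≤1 (adj u y)) (*-monoˡ-≤ (eqV p u + eqV p y) (ind≤1 (i ≟ g u y)))) (≤-reflexive (trans (cong (λ z → 1 * (1 * (z + eqV p y))) (ind-no (p FinP.≟ u) p≢u)) (trans (k' (eqV p y)) (eqV-sym p y))))
        where
        k' : ∀ z → 1 * (1 * (0 + z)) ≡ z
        k' = solve-∀

  initial-good : Good (λ x y → bit (adj x y)) 0 1 s (2 * s) H₀
  initial-good = record
    { valid = valid₀ ; joined = joined₀
    ; even = λ y → subst (2 ∣_) (sym (ends₀ y)) (evenDeg y)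
    ; covers = covers₀ ; conflict = conflict₀
    ; groupHigh = λ { (u , i) → subst (_≤ 2 * s) (sym (group-size u i)) (proj₁ (proj₂ (grouping s (degree G u) s≥1 (minDeg u)) i)) }
    ; groupLow = λ { (u , i) → subst (λ z → 0 < z → s ≤ z) (sym (group-size u i)) (proj₂ (proj₂ (grouping s (degree G u) s≥1 (minDeg u)) i)) } }

-- Parameters

private
  fact-pos : ∀ n → 1 ≤ fact n
  fact-pos zero    = ≤-refl
  fact-pos (suc n) = ≤-trans (fact-pos n) (m≤m+n (fact n) _)

  fact-lower : ∀ A t → A ^ t ≤ fact (A + t)
  fact-lower A zero    = fact-pos (A + 0)
  fact-lower A (suc t) = subst (λ z → A ^ suc t ≤ fact z) (sym (+-suc A t)) (*-mono-≤ (≤-trans (m≤m+n A t) (n≤1+n _)) (fact-lower A t))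

  n<2^n : ∀ n → n < 2 ^ n
  n<2^n zero    = s≤s z≤n
  n<2^n (suc n) = ≤-trans (+-mono-≤ (≤-trans (s≤s z≤n) (n<2^n n)) (n<2^n n)) (≤-reflexive (cong (2 ^ n +_) (sym (+-identityʳ _))))

  n≤2^n : ∀ n → n ≤ 2 ^ n
  n≤2^n n = <⇒≤ (n<2^n n)

  ^-*-distrib : ∀ t x y → (x * y) ^ t ≡ x ^ t * y ^ t
  ^-*-distrib zero    x y = refl
  ^-*-distrib (suc t) x y = trans (cong (x * y *_) (^-*-distrib t x y)) (l x y (x ^ t) (y ^ t))
    where
    l : ∀ x y p q → x * y * (p * q) ≡ x * p * (y * q)
    l = solve-∀

  -- With X = κ · 2M², r is chosen such that (2X)^(w+a+2X²) ≤ r! beats 2^w · a · X^r.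
  threshold : ℕ → ℕ → ℕ → ℕ → ℕ
  threshold κ a w M = 2 * (κ * (2 * (M * M))) + (w + (a + 2 * (κ * (2 * (M * M))) * (κ * (2 * (M * M)))))

  -- The surplus `2 ^ t` in `(2 * X) ^ t` pays for `2 ^ w`, for `a` and for the first `2 * X`
  -- factors of `X ^ r`, each of them being bounded by a power of 2.
  threshold-works : ∀ κ a w M → 2 ^ w * (a * (κ * (2 * (M * M))) ^ threshold κ a w M) ≤ fact (threshold κ a w M)
  threshold-works κ a w M = begin
    2 ^ w * (a * X ^ (2 * X + t))                              ≡⟨ cong (λ z → 2 ^ w * (a * z)) (^-distribˡ-+-* X (2 * X) t) ⟩
    2 ^ w * (a * (X ^ (2 * X) * X ^ t))                        ≤⟨ *-monoʳ-≤ (2 ^ w) (*-mono-≤ (n≤2^n a) (*-monoˡ-≤ (X ^ t) power)) ⟩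
    2 ^ w * (2 ^ a * (2 ^ (2 * X * X) * X ^ t))                ≡⟨ regroup (2 ^ w) (2 ^ a) (2 ^ (2 * X * X)) (X ^ t) ⟩
    2 ^ w * (2 ^ a * 2 ^ (2 * X * X)) * X ^ t                  ≡⟨ cong (_* X ^ t) (trans (cong (2 ^ w *_) (sym (^-distribˡ-+-* 2 a (2 * X * X)))) (sym (^-distribˡ-+-* 2 w (a + 2 * X * X)))) ⟩
    2 ^ t * X ^ t                                              ≡⟨ sym (^-*-distrib t 2 X) ⟩
    (2 * X) ^ t                                                ≤⟨ fact-lower (2 * X) t ⟩
    fact (2 * X + t)                                           ∎
    where
    open ≤-Reasoning
    X = κ * (2 * (M * M))
    t = w + (a + 2 * X * X)
    power : X ^ (2 * X) ≤ 2 ^ (2 * X * X)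
    power = ≤-trans (^-monoˡ-≤ (2 * X) (n≤2^n X)) (≤-reflexive (trans (^-*-assoc 2 X (2 * X)) (cong (2 ^_) (*-comm X (2 * X)))))
    regroup : ∀ b c d e → b * (c * (d * e)) ≡ b * (c * d) * e
    regroup = solve-∀

  -- Multiplication by `fact r` turns the binomial coefficient into `hi ^ r`, whose part
  -- `(2 ^ w) ^ r` cancels against the right-hand side. Only one factor `2 ^ w` survives, from
  -- `suc hi`, and this is why `r` need grow only linearly in `w` for fixed `M`.
  numeric-holds : ∀ κ L Lmax w M → 1 ≤ κ → L ≤ Lmax → let r = threshold κ (4 * (κ * suc Lmax)) w M; hi = κ * 2 ^ w in
    2 * ((suc hi * suc L) * (binom hi r * (2 * (M * M)) ^ r)) ≤ (2 ^ w) ^ r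
  numeric-holds κ L Lmax w M κ≥1 L≤ = *-cancelˡ-≤ (fact r) {{>-nonZero (fact-pos r)}} (begin
    fact r * (2 * ((suc hi * suc L) * (binom hi r * Y ^ r)))       ≡⟨ l₁ (fact r) (suc hi) (suc L) (binom hi r) (Y ^ r) ⟩
    2 * (suc hi * suc L) * Y ^ r * (fact r * binom hi r)           ≤⟨ *-mono-≤ (*-monoˡ-≤ (Y ^ r) (*-monoʳ-≤ 2 (*-mono-≤ hi≤ (s≤s L≤)))) (fact*binom≤ hi r) ⟩
    2 * (2 * hi * suc Lmax) * Y ^ r * hi ^ r                       ≡⟨ cong (2 * (2 * hi * suc Lmax) * Y ^ r *_) (^-*-distrib r κ (2 ^ w)) ⟩
    2 * (2 * (κ * 2 ^ w) * suc Lmax) * Y ^ r * (κ ^ r * (2 ^ w) ^ r) ≡⟨ l₂ κ (2 ^ w) (suc Lmax) (Y ^ r) (κ ^ r) ((2 ^ w) ^ r) ⟩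
    2 ^ w * (4 * (κ * suc Lmax) * (κ ^ r * Y ^ r)) * (2 ^ w) ^ r   ≡⟨ cong (λ z → 2 ^ w * (4 * (κ * suc Lmax) * z) * (2 ^ w) ^ r) (sym (^-*-distrib r κ Y)) ⟩
    2 ^ w * (4 * (κ * suc Lmax) * (κ * Y) ^ r) * (2 ^ w) ^ r       ≤⟨ *-monoˡ-≤ ((2 ^ w) ^ r) (threshold-works κ (4 * (κ * suc Lmax)) w M) ⟩
    fact r * (2 ^ w) ^ r                                           ∎)
    where
    open ≤-Reasoning
    Y = 2 * (M * M)
    r = threshold κ (4 * (κ * suc Lmax)) w M
    hi = κ * 2 ^ w
    hi≤ : suc hi ≤ 2 * hi
    hi≤ = ≤-trans (+-monoˡ-≤ hi (*-mono-≤ κ≥1 (≤-trans (s≤s z≤n) (n<2^n w)))) (≤-reflexive (cong (hi +_) (sym (+-identityʳ hi))))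
    l₁ : ∀ f h L b y → f * (2 * (h * L * (b * y))) ≡ 2 * (h * L) * y * (f * b)
    l₁ = solve-∀
    l₂ : ∀ k p L y kr pr → 2 * (2 * (k * p) * L) * y * (kr * pr) ≡ p * (4 * (k * L) * (kr * y)) * pr
    l₂ = solve-∀

  PolyBounded : (ℕ → ℕ) → Set
  PolyBounded f = ∃ λ c → ∃ λ e → ∀ w → f w ≤ c * suc w ^ e

  poly-const : ∀ c → PolyBounded (λ _ → c)
  poly-const c = c , 0 , λ w → ≤-reflexive (sym (*-identityʳ c))

  poly-id : PolyBounded (λ w → w)
  poly-id = 1 , 1 , λ w → ≤-trans (n≤1+n w) (≤-reflexive (l w))
    where
    l : ∀ w → suc w ≡ 1 * (suc w * 1)
    l = solve-∀

  poly-+ : ∀ {f g} → PolyBounded f → PolyBounded g → PolyBounded (λ w → f w + g w)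
  poly-+ {f} {g} (c , e , h) (c' , e' , h') = c + c' , e + e' , λ w → ≤-trans (+-mono-≤ (h w) (h' w)) (≤-trans
    (+-mono-≤ (*-monoʳ-≤ c (^-monoʳ-≤ (suc w) (m≤m+n e e'))) (*-monoʳ-≤ c' (^-monoʳ-≤ (suc w) (m≤n+m e' e)))) (≤-reflexive (sym (*-distribʳ-+ (suc w ^ (e + e')) c c'))))

  poly-* : ∀ {f g} → PolyBounded f → PolyBounded g → PolyBounded (λ w → f w * g w)
  poly-* {f} {g} (c , e , h) (c' , e' , h') = c * c' , e + e' , λ w → ≤-trans (*-mono-≤ (h w) (h' w))
    (≤-reflexive (trans (l c (suc w ^ e) c' (suc w ^ e')) (cong (c * c' *_) (sym (^-distribˡ-+-* (suc w) e e')))))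
    where
    l : ∀ a b c d → a * b * (c * d) ≡ a * c * (b * d)
    l = solve-∀

  -- With `w = 2 ^ v` the comparison moves to the exponents, where `c + suc v * e` must not exceed
  -- `2 ^ v`. For `v = u + u` the latter is at least `suc u * suc u`, which suffices when
  -- `u = c + 2 * e`.
  exp-beats-poly : ∀ {f} → PolyBounded f → ∃ λ w → f w ≤ 2 ^ w
  exp-beats-poly {f} (c , e , h) = 2 ^ v , (begin
    f (2 ^ v)                       ≤⟨ h (2 ^ v) ⟩
    c * suc (2 ^ v) ^ e             ≤⟨ *-mono-≤ (n≤2^n c) (^-monoˡ-≤ e (≤-trans (+-monoˡ-≤ (2 ^ v) (≤-trans (s≤s z≤n) (n<2^n v))) (≤-reflexive (cong (2 ^ v +_) (sym (+-identityʳ _)))))) ⟩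
    2 ^ c * (2 ^ suc v) ^ e         ≡⟨ cong (2 ^ c *_) (^-*-assoc 2 (suc v) e) ⟩
    2 ^ c * 2 ^ (suc v * e)         ≡⟨ sym (^-distribˡ-+-* 2 c (suc v * e)) ⟩
    2 ^ (c + suc v * e)             ≤⟨ ^-monoʳ-≤ 2 linear ⟩
    2 ^ (2 ^ v)                     ∎)
    where
    open ≤-Reasoning
    u = c + 2 * e
    v = u + u
    square : suc u * suc u ≤ 2 ^ v
    square = ≤-trans (*-mono-≤ (n<2^n u) (n<2^n u)) (≤-reflexive (sym (^-distribˡ-+-* 2 u u)))
    linear : c + suc v * e ≤ 2 ^ v
    linear = ≤-trans (≤-of-slack (c * c + 2 * c * e + 3 * e + c + 1) (≤-refl {0}) (l c e)) square
      where
      l : ∀ c e → c + suc (c + 2 * e + (c + 2 * e)) * e + 0 + (c * c + 2 * c * e + 3 * e + c + 1) ≡ suc (c + 2 * e) * suc (c + 2 * e) + 0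
      l = solve-∀

  bernoulli₇ : ∀ t → (7 + t) * 7 ^ t ≤ 7 * 8 ^ t
  bernoulli₇ zero    = ≤-refl
  bernoulli₇ (suc t) = ≤-of-slack (t * 7 ^ t) (*-monoʳ-≤ 8 (bernoulli₇ t)) (l t (7 ^ t) (8 ^ t))
    where
    l : ∀ t x y → (7 + suc t) * (7 * x) + 8 * (7 * y) + t * x ≡ 7 * (8 * y) + 8 * ((7 + t) * x)
    l = solve-∀

  -- By Bernoulli's inequality the power `τ` of 8/7 is at least `1 + τ / 7`, so `τ = 7 * Z` is
  -- enough.
  decay : ∀ Z → ∃ λ τ → Z * 7 ^ τ ≤ 8 ^ τ
  decay Z = 7 * Z , *-cancelˡ-≤ 7 (≤-trans (≤-of-slack (7 * 7 ^ (7 * Z)) (≤-refl {0}) (l Z (7 ^ (7 * Z)))) (bernoulli₇ (7 * Z)))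
    where
    l : ∀ Z x → 7 * (Z * x) + 0 + 7 * x ≡ (7 + 7 * Z) * x + 0
    l = solve-∀

-- Iterating the stages

private
  Lseq : ℕ → ℕ
  Lseq zero    = 0
  Lseq (suc i) = suc (2 * Lseq i)

  Lseq-mono : ∀ i k → Lseq i ≤ Lseq (k + i)
  Lseq-mono i zero    = ≤-refl
  Lseq-mono i (suc k) = ≤-trans (Lseq-mono i k) (≤-trans (m≤m+n _ _) (n≤1+n _))

  Mseq : ℕ → ℕ → ℕ → ℕ → ℕ
  Mseq κ a w zero    = 1
  Mseq κ a w (suc i) = Mseq κ a w i + threshold κ a w (Mseq κ a w i) * Mseq κ a w i

  Mseq-mono : ∀ κ a w i k → Mseq κ a w i ≤ Mseq κ a w (k + i)
  Mseq-mono κ a w i zero    = ≤-refl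
  Mseq-mono κ a w i (suc k) = ≤-trans (Mseq-mono κ a w i k) (m≤m+n _ _)

  -- For fixed `κ` and `a` the threshold is a polynomial in `w` and `M`, so a fixed number of stages
  -- keeps the conflict bound polynomial in `w`.
  Mseq-poly : ∀ κ a i → PolyBounded (λ w → Mseq κ a w i)
  Mseq-poly κ a zero    = poly-const 1
  Mseq-poly κ a (suc i) = poly-+ M (poly-* (poly-+ (poly-* (poly-const 2) X) (poly-+ poly-id (poly-+ (poly-const a) (poly-* (poly-* (poly-const 2) X) X)))) M)
    where
    M = Mseq-poly κ a i
    X = poly-* (poly-const κ) (poly-* (poly-const 2) (poly-* M M))

-- The `N` stages form `ℓ` phases of `suc τ`. Groups start with `s` to `2 * s` ends and shrink at
-- most by the factor 16 per stage, so `16 ^ t * lam` bounds them from below when `t` stages are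
-- left. The number of candidate matchings is `μ`.
record Parameters (ℓ : ℕ) : Set where
  field
    τ N κ a w μ lam s : ℕ
    N≡       : ℓ * suc τ ≡ N
    s≡       : s ≡ 16 ^ N * lam
    fading   : 16 * (8 * ℓ * 16 ^ ℓ) * 7 ^ τ ≤ 8 ^ τ
    μ≥1      : 1 ≤ μ
    s≥1      : 1 ≤ s
    room     : ∀ i t → i + suc t ≡ N →
      100 * (suc (Lseq i) * Mseq κ a w i + μ + threshold κ a w (Mseq κ a w i) * Mseq κ a w i + 1) ≤ 16 ^ suc t * lam
    numeric  : ∀ i t → i + t ≡ N → let r = threshold κ a w (Mseq κ a w i) in
      2 * ((suc (2 * s) * suc (Lseq i)) * (binom (2 * s) r * (2 * (Mseq κ a w i * Mseq κ a w i)) ^ r)) ≤ μ ^ r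
    spacious : ∀ i → i + 0 ≡ N → 8 * (3 * (2 + Lseq i) * Mseq κ a w i) ≤ 16 ^ 0 * lam
    lo≥8     : 8 ≤ 16 ^ 0 * lam

M≥1 : ∀ κ a w i → 1 ≤ Mseq κ a w i
M≥1 κ a w i = subst (λ z → 1 ≤ Mseq κ a w z) (+-identityʳ i) (Mseq-mono κ a w 0 i)

private
  module Build (N κ a w μ lam s : ℕ) (μ≡ : 2 ^ w ≡ μ) (a≡ : 4 * (κ * suc (Lseq N)) ≡ a) (hi≡ : κ * μ ≡ 2 * s) (lam≡ : 400 * μ ≡ lam)
    (κ≥1 : 1 ≤ κ) (capacity : suc (Lseq N) * Mseq κ a w N ≤ μ) where

    μ≥1 : 1 ≤ μ
    μ≥1 = ≤-trans (≤-trans (s≤s z≤n) (n<2^n w)) (≤-reflexive μ≡)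

    16^≥1 : ∀ t → 1 ≤ 16 ^ t
    16^≥1 t = ≤-trans (≤-reflexive (sym (^-zeroˡ t))) (^-monoˡ-≤ t (s≤s z≤n))

    lam≤ : ∀ t → lam ≤ 16 ^ t * lam
    lam≤ t = ≤-trans (≤-reflexive (sym (*-identityˡ lam))) (*-monoˡ-≤ lam (16^≥1 t))

    lam≥ : 400 ≤ lam
    lam≥ = ≤-trans (≤-reflexive (sym (*-identityʳ 400))) (≤-trans (*-monoʳ-≤ 400 μ≥1) (≤-reflexive lam≡))

    fits : ∀ i t → i + t ≡ N → suc (Lseq i) * Mseq κ a w i ≤ μ
    fits i t e = ≤-trans (*-mono-≤ (s≤s (subst (λ z → Lseq i ≤ Lseq z) (trans (+-comm t i) e) (Lseq-mono i t))) (subst (λ z → Mseq κ a w i ≤ Mseq κ a w z) (trans (+-comm t i) e) (Mseq-mono κ a w i t))) capacity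

    -- The product is a summand of the conflict bound of the next stage, which `capacity` controls
    -- already.
    next-fits : ∀ i t → i + suc t ≡ N → threshold κ a w (Mseq κ a w i) * Mseq κ a w i ≤ μ
    next-fits i t e = ≤-trans (m≤n+m _ (Mseq κ a w i)) (≤-trans (≤-trans (≤-reflexive (sym (*-identityˡ _))) (*-monoˡ-≤ (Mseq κ a w (suc i)) (s≤s (z≤n {Lseq (suc i)})))) (fits (suc i) t (trans (sym (+-suc i t)) e)))

    -- Each of the four summands is at most `μ`, whence the value `400 * μ` of `lam`.
    room : ∀ i t → i + suc t ≡ N → 100 * (suc (Lseq i) * Mseq κ a w i + μ + threshold κ a w (Mseq κ a w i) * Mseq κ a w i + 1) ≤ 16 ^ suc t * lam
    room i t e = ≤-trans (*-monoʳ-≤ 100 (+-mono-≤ (+-mono-≤ (+-monoˡ-≤ μ (fits i (suc t) e)) (next-fits i t e)) μ≥1)) (≤-trans (≤-reflexive (trans (l μ) lam≡)) (lam≤ (suc t)))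
      where
      l : ∀ m → 100 * (m + m + m + m) ≡ 400 * m
      l = solve-∀

    numeric : ∀ i t → i + t ≡ N → let r = threshold κ a w (Mseq κ a w i) in
      2 * ((suc (2 * s) * suc (Lseq i)) * (binom (2 * s) r * (2 * (Mseq κ a w i * Mseq κ a w i)) ^ r)) ≤ μ ^ r
    numeric i t e = general μ≡ a≡ hi≡ (Mseq κ a w i)
      where
      general : ∀ {μ a hi} → 2 ^ w ≡ μ → 4 * (κ * suc (Lseq N)) ≡ a → κ * μ ≡ hi → ∀ M → let r = threshold κ a w M in
        2 * ((suc hi * suc (Lseq i)) * (binom hi r * (2 * (M * M)) ^ r)) ≤ μ ^ r
      general refl refl refl M = numeric-holds κ (Lseq i) (Lseq N) w M κ≥1 (subst (λ z → Lseq i ≤ Lseq z) (trans (+-comm t i) e) (Lseq-mono i t))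

    spacious : ∀ i → i + 0 ≡ N → 8 * (3 * (2 + Lseq i) * Mseq κ a w i) ≤ 16 ^ 0 * lam
    spacious i e = ≤-trans (≤-of-slack (24 * (Lseq i * Mseq κ a w i) + 352 * μ) (*-monoʳ-≤ 48 (fits i 0 e)) (l (Lseq i) (Mseq κ a w i) μ)) (≤-trans (≤-reflexive lam≡) (lam≤ 0))
      where
      l : ∀ L M m → 8 * (3 * (2 + L) * M) + 48 * m + (24 * (L * M) + 352 * m) ≡ 400 * m + 48 * (suc L * M)
      l = solve-∀

    lo≥8 : 8 ≤ 16 ^ 0 * lam
    lo≥8 = ≤-trans (≤-trans (m≤m+n 8 392) lam≥) (lam≤ 0)

  -- With these values `κOf N * 2 ^ w` equals `2 * s`: the ratio of the largest group size to the
  -- number of matchings does not depend on `w`.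
  κOf aOf : ℕ → ℕ
  κOf N = 2 * (16 ^ N * 400)
  aOf N = 4 * (κOf N * suc (Lseq N))

  assemble : ∀ ℓ τ N w → ℓ * suc τ ≡ N → 16 * (8 * ℓ * 16 ^ ℓ) * 7 ^ τ ≤ 8 ^ τ → suc (Lseq N) * Mseq (κOf N) (aOf N) w N ≤ 2 ^ w → Parameters ℓ
  assemble ℓ τ N w N≡ fading capacity = record
    { τ = τ ; N = N ; κ = κOf N ; a = aOf N ; w = w ; μ = 2 ^ w ; lam = 400 * 2 ^ w ; s = 16 ^ N * (400 * 2 ^ w)
    ; N≡ = N≡ ; s≡ = refl ; fading = fading ; μ≥1 = B.μ≥1 ; s≥1 = ≤-trans (≤-trans (s≤s z≤n) B.lam≥) (B.lam≤ N)
    ; room = B.room ; numeric = B.numeric ; spacious = B.spacious ; lo≥8 = B.lo≥8 }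
    where
    1≤* : ∀ x y → 1 ≤ x → 1 ≤ y → 1 ≤ x * y
    1≤* x y h h' = *-mono-≤ h h'
    κ≥1 : 1 ≤ κOf N
    κ≥1 = 1≤* 2 (16 ^ N * 400) (s≤s z≤n) (1≤* (16 ^ N) 400 (m^n>0 16 N) (s≤s z≤n))
    l : ∀ p c m → 2 * (p * c) * m ≡ 2 * (p * (c * m))
    l = solve-∀
    module B = Build N (κOf N) (aOf N) w (2 ^ w) (400 * 2 ^ w) (16 ^ N * (400 * 2 ^ w)) refl refl (l (16 ^ N) 400 (2 ^ w)) refl κ≥1 capacity

abstract
  -- The order of choice resolves the dependencies: `τ` from `ℓ`, then `N`, then `κ` and `a` from
  -- `N`, and `w` last, when a polynomial in `w` has to stay below `2 ^ w`.
  parameters : ∀ ℓ → Parameters ℓ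
  parameters ℓ = build (decay (16 * (8 * ℓ * 16 ^ ℓ)))
    where
    build : (∃ λ τ → 16 * (8 * ℓ * 16 ^ ℓ) * 7 ^ τ ≤ 8 ^ τ) → Parameters ℓ
    build (τ , fading) = choose (ℓ * suc τ) refl
      where
      choose : ∀ N → ℓ * suc τ ≡ N → Parameters ℓ
      choose N N≡ = finish (exp-beats-poly (poly-* (poly-const (suc (Lseq N))) (Mseq-poly (κOf N) (aOf N) N)))
        where
        finish : (∃ λ w → suc (Lseq N) * Mseq (κOf N) (aOf N) w N ≤ 2 ^ w) → Parameters ℓ
        finish (w , capacity) = assemble ℓ τ N w N≡ fading capacity

module Iteration {ℓ : ℕ} (P : Parameters ℓ) {n : ℕ} (adj : Fin n → Fin n → ℕ) (root : Fin n) where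
  open Parameters P

  private
    q : ℕ
    q = 8 * ℓ

  record State (t : ℕ) : Set₁ where
    field
      i     : ℕ
      count : i + t ≡ N
      Λ     : Labels n
      H     : List (PathGraph.Edge Λ)
      good  : PathGraph.Good Λ adj (Lseq i) (Mseq κ a w i) (16 ^ t * lam) (2 * s) H

  D : ∀ {t} → State t → ℕ → Fin n → ℕ
  D S k y = PathGraph.levelEnds (State.Λ S) k y (State.H S)

  private
    performStage : ∀ {t} j (S : State (suc t)) → Σ (State t) λ S' → ∀ y →
      8 * D S' j y ≤ 7 * D S j y × D S j y ≤ 16 * D S' (suc j) y × D S (suc j) y ≤ D S' (suc j) y × (∀ k → k ≢ suc j → D S' k y ≤ D S k y)
    performStage {t} j S = record { i = suc i ; count = trans (sym (+-suc i t)) count ; Λ = raise Λ ; H = St.H' ; good = St.stage-good (≤-reflexive (sym (*-assoc 16 (16 ^ t) lam))) } ,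
      λ y → St.level-shrink y , St.level-grow y , St.level-mono y , St.level-down y
      where
      open State S
      module St = Stage Λ {m = μ} {r = threshold κ a w (Mseq κ a w i)} {j = j} good (select Λ root j good) (M≥1 κ a w i) μ≥1 (room i t count) (numeric i (suc t) count)

  abstract
    oneStage : ∀ {t} j (S : State (suc t)) → Σ (State t) λ S' → ∀ y →
      8 * D S' j y ≤ 7 * D S j y × D S j y ≤ 16 * D S' (suc j) y × D S (suc j) y ≤ D S' (suc j) y × (∀ k → k ≢ suc j → D S' k y ≤ D S k y)
    oneStage = performStage

  run : ∀ k {t} j (S : State (k + t)) → Σ (State t) λ S' → ∀ y →
    8 ^ k * D S' j y ≤ 7 ^ k * D S j y × D S (suc j) y ≤ D S' (suc j) y × (∀ i → i ≢ suc j → D S' i y ≤ D S i y)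
  run zero    j S = S , λ y → ≤-refl , ≤-refl , λ _ _ → ≤-refl
  run (suc k) j S = S₂ , λ y → shrink y , ≤-trans (proj₁ (proj₂ (proj₂ (h₁ y)))) (proj₁ (proj₂ (h₂ y))) , λ i i≢ → ≤-trans (proj₂ (proj₂ (h₂ y)) i i≢) (proj₂ (proj₂ (proj₂ (h₁ y))) i i≢)
    where
    S₁ = proj₁ (oneStage j S)
    h₁ = proj₂ (oneStage j S)
    S₂ = proj₁ (run k j S₁)
    h₂ = proj₂ (run k j S₁)
    l : ∀ a b c → a * (b * c) ≡ b * (a * c)
    l = solve-∀
    l' : ∀ a b c → b * (a * c) ≡ a * b * c
    l' = solve-∀
    open ≤-Reasoning
    shrink : ∀ y → 8 ^ suc k * D S₂ j y ≤ 7 ^ suc k * D S j y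
    shrink y = begin
      8 * 8 ^ k * D S₂ j y     ≡⟨ *-assoc 8 (8 ^ k) (D S₂ j y) ⟩
      8 * (8 ^ k * D S₂ j y)   ≤⟨ *-monoʳ-≤ 8 (proj₁ (h₂ y)) ⟩
      8 * (7 ^ k * D S₁ j y)   ≡⟨ l 8 (7 ^ k) (D S₁ j y) ⟩
      7 ^ k * (8 * D S₁ j y)   ≤⟨ *-monoʳ-≤ (7 ^ k) (proj₁ (h₁ y)) ⟩
      7 ^ k * (7 * D S j y)    ≡⟨ l' 7 (7 ^ k) (D S j y) ⟩
      7 * 7 ^ k * D S j y      ∎

  -- With `k` phases to come, level `j` dominates the lower levels with a reserve of `16 ^ k`, as
  -- each phase may cost the top level a factor 16. The first stage of a phase gives level `suc j`
  -- at least a sixteenth of level `j`; the other `τ` stages reduce level `j` by powers of 7/8 while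
  -- level `suc j` does not shrink, and `fading` restores the reserve.
  phases : ∀ k j → k ≤ ℓ → (S : State (k * suc τ)) → (∀ y i → i < j → q * 16 ^ k * D S i y ≤ D S j y) →
           Σ (State 0) λ S' → ∀ y i → i < k + j → q * D S' i y ≤ D S' (k + j) y
  phases zero    j _   S inv = S , λ y i lt → ≤-trans (≤-reflexive (cong (_* D S i y) (sym (*-identityʳ q)))) (inv y i lt)
  phases (suc k) j k<ℓ S inv = subst (λ z → Σ (State 0) λ S' → ∀ y i → i < z → q * D S' i y ≤ D S' z y) (+-suc k j) (phases k (suc j) (<⇒≤ k<ℓ) S₂ inv')
    where
    S₁ = proj₁ (oneStage j S)
    h₁ = proj₂ (oneStage j S)
    S₂ = proj₁ (run τ j S₁)
    h₂ = proj₂ (run τ j S₁)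
    grow : ∀ y → D S j y ≤ 16 * D S₂ (suc j) y
    grow y = ≤-trans (proj₁ (proj₂ (h₁ y))) (*-monoʳ-≤ 16 (proj₁ (proj₂ (h₂ y))))
    inv' : ∀ y i → i < suc j → q * 16 ^ k * D S₂ i y ≤ D S₂ (suc j) y
    inv' y i (s≤s i≤j) with i ≟ j
    ... | no i≢j = *-cancelˡ-≤ 16 (begin
      16 * (q * 16 ^ k * D S₂ i y)     ≡⟨ l q (16 ^ k) (D S₂ i y) ⟩
      q * 16 ^ suc k * D S₂ i y        ≤⟨ *-monoʳ-≤ (q * 16 ^ suc k) (≤-trans (proj₂ (proj₂ (h₂ y)) i i≢) (proj₂ (proj₂ (proj₂ (h₁ y))) i i≢)) ⟩
      q * 16 ^ suc k * D S i y         ≤⟨ inv y i (≤∧≢⇒< i≤j i≢j) ⟩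
      D S j y                          ≤⟨ grow y ⟩
      16 * D S₂ (suc j) y              ∎)
      where
      open ≤-Reasoning
      i≢ : i ≢ suc j
      i≢ refl = <-irrefl refl i≤j
      l : ∀ a b c → 16 * (a * b * c) ≡ a * (16 * b) * c
      l = solve-∀
    ... | yes refl = *-cancelˡ-≤ (8 ^ τ) {{m^n≢0 8 τ}} (begin
      8 ^ τ * (q * 16 ^ k * D S₂ j y)             ≡⟨ l (8 ^ τ) (q * 16 ^ k) (D S₂ j y) ⟩
      q * 16 ^ k * (8 ^ τ * D S₂ j y)             ≤⟨ *-monoʳ-≤ (q * 16 ^ k) (proj₁ (h₂ y)) ⟩
      q * 16 ^ k * (7 ^ τ * D S₁ j y)             ≤⟨ *-monoʳ-≤ (q * 16 ^ k) (*-monoʳ-≤ (7 ^ τ) (≤-trans (proj₂ (proj₂ (proj₂ (h₁ y))) j (λ h → 1+n≢n (sym h))) (grow y))) ⟩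
      q * 16 ^ k * (7 ^ τ * (16 * D S₂ (suc j) y)) ≡⟨ l' q (16 ^ k) (7 ^ τ) (D S₂ (suc j) y) ⟩
      16 * (q * 16 ^ k) * 7 ^ τ * D S₂ (suc j) y  ≤⟨ *-monoˡ-≤ (D S₂ (suc j) y) (≤-trans (*-monoˡ-≤ (7 ^ τ) (*-monoʳ-≤ 16 (*-monoʳ-≤ q (^-monoʳ-≤ 16 (<⇒≤ k<ℓ))))) fading) ⟩
      8 ^ τ * D S₂ (suc j) y                      ∎)
      where
      open ≤-Reasoning
      l : ∀ a b c → a * (b * c) ≡ b * (a * c)
      l = solve-∀
      l' : ∀ a b c d → a * b * (c * (16 * d)) ≡ 16 * (a * b) * c * d
      l' = solve-∀

  -- A path with fewer than `ℓ` interior vertices has level below `ℓ`, and at each vertex every one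
  -- of these `ℓ` levels has at most the fraction `1 / (8 * ℓ)` of the ends of level `ℓ`.
  few-short : 1 ≤ ℓ → (S : State 0) → (∀ y i → i < ℓ → q * D S i y ≤ D S ℓ y) → ∀ y →
              8 * ∑ (λ e → PathGraph.endV (State.Λ S) y e * ind (length (PathGraph.int e) <? ℓ)) (State.H S) ≤ ∑ (PathGraph.endV (State.Λ S) y) (State.H S)
  few-short ℓ≥1 S inv y = *-cancelˡ-≤ ℓ {{>-nonZero ℓ≥1}} (begin
    ℓ * (8 * ∑ (λ e → endV y e * ind (length (int e) <? ℓ)) H)     ≤⟨ *-monoʳ-≤ ℓ (*-monoʳ-≤ 8 byLevel) ⟩
    ℓ * (8 * ∑ (λ i → D S (toℕ i) y) (allFin ℓ))                   ≡⟨ l ℓ (∑ (λ i → D S (toℕ i) y) (allFin ℓ)) ⟩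
    q * ∑ (λ i → D S (toℕ i) y) (allFin ℓ)                         ≡⟨ sym (∑-*ˡ q _ (allFin ℓ)) ⟩
    ∑ (λ i → q * D S (toℕ i) y) (allFin ℓ)                         ≤⟨ ∑-≤-length {xs = allFin ℓ} (All.tabulate (λ {i} _ → inv y (toℕ i) (FinP.toℕ<n i))) ⟩
    length (allFin ℓ) * D S ℓ y                                    ≡⟨ cong (_* D S ℓ y) (length-allFin {ℓ}) ⟩
    ℓ * D S ℓ y                                                    ≤⟨ *-monoʳ-≤ ℓ (∑-mono (λ e → +-mono-≤ (at≤ (l₀ e)) (at≤ (l₁ e))) H) ⟩
    ℓ * ∑ (endV y) H                                               ∎)
    where
    open State S
    open PathGraph Λ
    open ≤-Reasoning
    l : ∀ a b → a * (8 * b) ≡ 8 * a * b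
    l = solve-∀
    at≤ : ∀ b → atLevel ℓ y b ≤ eqV y (vOf b)
    at≤ b = ≤-trans (*-monoˡ-≤ (eqV y (vOf b)) (ind≤1 (lev b ≟ ℓ))) (≤-reflexive (*-identityˡ _))
    level-sum : ∀ b → lev b < ℓ → ∑ (λ i → atLevel (toℕ i) y b) (allFin ℓ) ≡ eqV y (vOf b)
    level-sum b lt = trans (∑-*ʳ (eqV y (vOf b)) (λ i → ind (lev b ≟ toℕ i)) (allFin ℓ)) (trans (cong (_* eqV y (vOf b)) (trans (∑-cong same (allFin ℓ)) (∑-eq-Fin (fromℕ< lt)))) (*-identityˡ _))
      where
      same : ∀ i → ind (lev b ≟ toℕ i) ≡ ind (i FinP.≟ fromℕ< lt)
      same i = ind-cong (lev b ≟ toℕ i) (i FinP.≟ fromℕ< lt) (λ h → FinP.toℕ-injective (trans (sym h) (sym (FinP.toℕ-fromℕ< lt)))) (λ h → sym (trans (cong toℕ h) (FinP.toℕ-fromℕ< lt)))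
    point : ∀ {e} → Valid (Lseq i) e → endV y e * ind (length (int e) <? ℓ) ≤ ∑ (λ i → atLevel (toℕ i) y (l₀ e) + atLevel (toℕ i) y (l₁ e)) (allFin ℓ)
    point {e} v with length (int e) <? ℓ
    ... | no _   = ≤-trans (≤-reflexive (*-zeroʳ (endV y e))) z≤n
    ... | yes lt = ≤-reflexive (trans (*-identityʳ (endV y e)) (sym (trans (∑-+ (λ i → atLevel (toℕ i) y (l₀ e)) (λ i → atLevel (toℕ i) y (l₁ e)) (allFin ℓ))
                     (cong₂ _+_ (level-sum (l₀ e) (≤-<-trans (levelLow v) lt)) (level-sum (l₁ e) (≤-<-trans (≤-trans (≤-reflexive (sym (sameLevel v))) (levelLow v)) lt))))))
    byLevel : ∑ (λ e → endV y e * ind (length (int e) <? ℓ)) H ≤ ∑ (λ i → D S (toℕ i) y) (allFin ℓ)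
    byLevel = ≤-trans (∑-mono-All (All.map point (valid good))) (≤-reflexive (∑-swap (λ e i → atLevel (toℕ i) y (l₀ e) + atLevel (toℕ i) y (l₁ e)) H (allFin ℓ)))

private
  neighbour : ∀ {n} (G : Graph n) v → 1 ≤ degree G v → ∃ λ y → Graph.adj G v y ≡ true
  neighbour {n} G v = go (allFin n)
    where
    go : ∀ xs → 1 ≤ length (filterᵇ (Graph.adj G v) xs) → ∃ λ y → Graph.adj G v y ≡ true
    go (x ∷ xs) h with Graph.adj G v x in e
    ... | true  = x , e
    ... | false = go xs h

  module Finish {ℓ n : ℕ} (ℓ≥1 : 1 ≤ ℓ) (P : Parameters ℓ) (G : Graph n) (root y₀ : Fin n) (adjacent₀ : Graph.adj G root y₀ ≡ true) where
    open Iteration P (λ x y → bit (Graph.adj G x y)) root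

    finish : (S : State 0) → (∀ y i → i < ℓ → 8 * ℓ * D S i y ≤ D S ℓ y) → HasSelfAvoidingEulerianTour G ℓ
    finish S inv = result (R.cleanTour (proj₂ edge))
      where
      open State S
      module R = Repair Λ good ℓ (few-short ℓ≥1 S inv) (Parameters.spacious P i count) (Parameters.lo≥8 P)
      open PathGraph Λ using (Edge; verts; covers)
      -- A tour needs a path to start with: the one that covers the edge from the root to `y₀`.
      found : ∃ λ e → e ∈ H × 0 < occ root y₀ (verts e)
      found = ∑-pos-find (λ e → occ root y₀ (verts e)) H (≤-reflexive (sym (trans (covers good root y₀) (cong bit adjacent₀))))
      edge : ∃ λ e → e ∈ H
      edge = proj₁ found , proj₁ (proj₂ found)
      result : (Σ R.Tour λ T → Windows.cyc R.f₁ (R.ds T) ≡ 0 × Windows.cyc R.f₂ (R.ds T) ≡ 0 × 3 ≤ length (R.ds T)) → HasSelfAvoidingEulerianTour G ℓ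
      result (T , clean₁ , clean₂ , len) = close (R.walk-head T len)
        where
        close : (∃ λ ws → R.walkOf T ≡ R.base T ∷ ws) → HasSelfAvoidingEulerianTour G ℓ
        close (ws , W≡) = ClosedWalk.hasTour G ℓ (R.base T) ws
          (λ x y → trans (cong (λ z → occ x y (z ++ R.base T ∷ [])) (sym W≡)) (R.walk-occ T x y))
          (λ us eq → R.walk-avoids T clean₁ clean₂ len us (trans W≡ eq))

  module Assemble {ℓ n : ℕ} (ℓ≥1 : 1 ≤ ℓ) (P : Parameters ℓ) (G : Graph n) (root : Fin n) (eulerian : Eulerian G) (minDeg : MinDegreeAtLeast G (Parameters.s P)) where
    open Parameters P
    open Iteration P (λ x y → bit (Graph.adj G x y)) root
    private
      module In = Initial G (proj₁ eulerian) (proj₂ eulerian) s s≥1 minDeg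
      nb = neighbour G root (≤-trans s≥1 (minDeg root))

    first : State (ℓ * suc τ)
    first = record { i = 0 ; count = N≡ ; Λ = In.Λ₀ ; H = In.H₀
      ; good = subst (λ lo → PathGraph.Good In.Λ₀ (λ x y → bit (Graph.adj G x y)) 0 1 lo (2 * s) In.H₀) (trans s≡ (cong (λ z → 16 ^ z * lam) (sym N≡))) In.initial-good }

    last : (Σ (State 0) λ S → ∀ y i → i < ℓ + 0 → 8 * ℓ * D S i y ≤ D S (ℓ + 0) y) → HasSelfAvoidingEulerianTour G ℓ
    last (S , inv) = Finish.finish ℓ≥1 P G root (proj₁ nb) (proj₂ nb) S (subst (λ z → ∀ y i → i < z → 8 * ℓ * D S i y ≤ D S z y) (+-identityʳ ℓ) inv)

    tour : HasSelfAvoidingEulerianTour G ℓ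
    tour = last (phases ℓ 0 ≤-refl first (λ y i ()))

theorem1p3 : (ℓ : ℕ) → 1 ≤ ℓ → Σ ℕ (λ d → ∀ (n : ℕ) (G : Graph n) → Eulerian G → MinDegreeAtLeast G d → HasSelfAvoidingEulerianTour G ℓ)
theorem1p3 ℓ ℓ≥1 = Parameters.s (parameters ℓ) , λ
  -- Without vertices there is no edge; otherwise any vertex may serve as the root of the
  -- arborescences.
  { zero    G _  _ → inj₁ (λ ())
  ; (suc n) G eu minDeg → Assemble.tour ℓ≥1 (parameters ℓ) G zero eu minDeg }
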